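{- Let $q_1,\ldots,q_k$ be $k$ distinct primes and $A=\{q_1,\ldots,q_k\}$. A polynomial $u\in\mathbb{Z}[x]$ of degree $1$ belongs to $L_{1,A}^1$ if and only if it is of one of the following forms: (1) $x\pm q_1^{s_1}\cdots q_k^{s_k}$ with $s_i\in\mathbb{N}\cup\{0\}$; (2) $\alpha(x-1)$ with $\alpha\in\mathbb{Z}\setminus\{0\}$; (3) $\pm q_1^{s_1}\cdots q_k^{s_k}x+1$ with $s_i\in\mathbb{N}\cup\{0\}$ and $\sum_i s_i\ge 1$; (4) $-2x-1$ (this occurs only when $2\in A$); (5) $-2x+4$.
   Context: For $u\in\mathbb{Z}[x]$ of degree at least $1$, define iterates $u^{(1)}=u$ and $u^{(n+1)}(x)=u(u^{(n)}(x))$. For $r\in\mathbb{Z}$, a finite set $A$ of primes and $d\ge1$, $L_{r,A}^d$ is the set of $u\in\mathbb{Z}[x]$ of degree $d$ such that for every prime $p\notin A$ there exists $m\ge 1$ with $u^{(m)}(r)\equiv 0\pmod p$ ("weakly locally nilpotent at $r$ outside $A$"). $\mathbb{N}=\{1,2,\dots\}$. -}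

module Defs where

open import Data.Nat as ℕ using (ℕ; zero; suc)
open import Data.Nat.Primality using (Prime)
open import Data.Integer as ℤ using (ℤ; +_; -_)
open import Data.Integer.Divisibility using (_∣_)
open import Data.Fin using (Fin; zero; suc)
open import Data.Product using (∃-syntax; _×_)
open import Relation.Nullary using (¬_)

iter : (ℤ → ℤ) → ℕ → ℤ → ℤ
iter f zero    x = x
iter f (suc n) x = f (iter f n x)

lin : ℤ → ℤ → ℤ → ℤ
lin a b x = a ℤ.* x ℤ.+ b

-- A finite set of primes A = {q_1,…,q_k}, given as an injective family.
_∈A_ : ℕ → {k : ℕ} → (Fin k → ℕ) → Set
p ∈A q = ∃[ i ] (q i ≡ p)
  where open import Relation.Binary.PropositionalEquality using (_≡_)

WLN : (ℤ → ℤ) → ℤ → {k : ℕ} → (Fin k → ℕ) → Set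
WLN u r q = ∀ (p : ℕ) → Prime p → ¬ (p ∈A q) →
            ∃[ m ] (1 ℕ.≤ m × (+ p) ∣ iter u m r)

prodPow : {k : ℕ} → (Fin k → ℕ) → (Fin k → ℕ) → ℕ
prodPow {zero}  q s = 1
prodPow {suc k} q s = (q zero ℕ.^ s zero) ℕ.* prodPow (λ i → q (suc i)) (λ i → s (suc i))

sumFin : {k : ℕ} → (Fin k → ℕ) → ℕ
sumFin {zero}  s = 0
sumFin {suc k} s = s zero ℕ.+ sumFin (λ i → s (suc i))

{-# OPTIONS --safe #-}
-- Put t = a + b − 1, so that (a − 1) uᵐ(1) = t aᵐ − b: the hypothesis says that for all primes p
-- outside a finite set, b ≡ t aᵐ mod p for some m.  When |a| ≥ 2 and t, b ≠ 0, this makes b / t a power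
-- of a up to inversion, and b = t aᵏ, t = b aᵏ are elementary equations.
--
-- (1) If e is not a square in a ring R of algebraic integers built by iterated quadratic extensions of ℤ,
-- then e is a non-square at infinitely many places of degree one.  Suppose not.  By pigeonhole over R[√e],
-- two elements v₁, v₂ of R of square-free norm yield a small v′ in R[√e] that vanishes
-- at one root of e over every place of v₁ and at the other root over every place of v₂, so N v′ is
-- a bounded multiple of N v₁ · N v₂, and v′ determines v₁ and v₂ up to bounded choices.  Splitting the
-- total size of v₁ and v₂ dyadically in all possible ways produces more pairs than there are such v′.
--
-- (2) Kummer theory over ℤ[ζ], ζ of 2-power order: after adjoining a 2ᴺ-th root of a by successive square
-- roots, b / t is locally a 2ᴺ-th power, hence a 2ᴺ-th power by (1).  Descending to ℤ,
-- |t| |a|^X′ m^(2ᴺ) = |b| |a|^X n^(2ᴺ), and for N large valuations give |b|ⁱ |a|^j₁ = |t|ⁱ |a|^j₂, i ≥ 1.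
--
-- (3) A prime ℓ dividing i divides j₁ − j₂, as seen modulo a large prime at which ℓ² divides the order
-- of a; hence i = 1 may be assumed.  A large prime at which a has odd order excludes the sign −1.
module Submission where

open import Defs
open import Level using (0ℓ)
open import Data.Nat as ℕ using (ℕ; zero; suc; s≤s; z≤n)
import Data.Nat as Nat
import Data.Nat.Properties as ℕP
import Data.Nat.Divisibility as ℕD
open import Data.Nat.Primality using (Prime; euclidsLemma; prime?; prime⇒nonZero; prime⇒nonTrivial; prime⇒irreducible; ¬prime[1]; prime[2])
open import Data.Nat.Primality.Factorisation using (factorise)
open import Data.Nat.ListAction using (product)
open import Data.Nat.Coprimality as Coprimality using (Coprime; coprime-Bézout; coprime-divisor)
open import Data.Nat.GCD using (module Bézout; gcd; gcd[m,n]∣m; gcd[m,n]∣n)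
open import Data.Integer as ℤ using (ℤ; +_; -_; ∣_∣)
import Data.Integer as I
import Data.Integer.Properties as ℤP
import Data.Integer.DivMod as ℤDM
open import Data.Integer.Divisibility.Signed as ℤD using (divides; ∣ᵤ⇒∣; ∣⇒∣ᵤ) renaming (_∣_ to infix 4 _∣ℤ_)
open import Data.Integer.Tactic.RingSolver using (solve-∀)
import Data.Nat.Tactic.RingSolver as ℕRing
open import Data.Fin as Fin using (Fin; zero; suc; toℕ; fromℕ<; combine; remQuot)
import Data.Fin.Properties as FinP
open import Data.List using (List; []; _∷_; _++_; length; lookup; map)
open import Data.List.Relation.Unary.All as All using (All; []; _∷_)
open import Data.List.Relation.Unary.Any using (Any; here; there)
open import Data.Product using (Σ; ∃; ∃-syntax; _×_; _,_; proj₁; proj₂)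
open import Data.Sum using (_⊎_; inj₁; inj₂; [_,_]′)
open import Data.Maybe using (nothing)
open import Data.Unit using (⊤; tt)
open import Data.Empty using (⊥; ⊥-elim)
open import Relation.Nullary using (¬_; Dec; yes; no; contradiction)
open import Relation.Nullary.Decidable using (decidable-stable; ¬?; _×-dec_; _⊎-dec_)
open import Relation.Binary.PropositionalEquality
open import Function.Base using (_∘_; id; case_of_)
open import Function.Bundles using (_⇔_; mk⇔)
open import Algebra.Structures using (IsCommutativeRing)
open import Data.Bool using (Bool; true; false) renaming (T to IsTrue)
import Data.Vec as Vec
import Relation.Binary.Reflection as Reflection
import Tactic.RingSolver.Core.AlmostCommutativeRing as CoreACR
open import Tactic.RingSolver.Core.Polynomial.Parameters using (Homomorphism)
import Tactic.RingSolver.Core.Polynomial.Base as Poly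
import Tactic.RingSolver.Core.Polynomial.Semantics as PolySem
import Tactic.RingSolver.Core.Polynomial.Homomorphism as PolyHom
open import Data.List.Properties using (length-++)
open import Data.List.Relation.Unary.Any.Properties using (++⁺ˡ; ++⁺ʳ)
open import Relation.Binary.Definitions using (tri<; tri≈; tri>)

-- Step (1) is a weak form of Chebotarev's theorem for quadratic extensions, reached by counting
-- alone. If e is a square at almost all places of degree one, each of them has two places above it
-- in R[√e], so v₁ can be put on one root and v₂ on the other. A single split of the sizes yields
-- only a constant fraction of the possible v′ and contradicts nothing; but this fraction does not
-- depend on the total size, so a fixed number of splits with disjoint ranges of norms is already
-- too many. The cofactor N v′ / (N v₁ · N v₂) is at most T, while every prime dividing the norms
-- exceeds T; T can be fixed first because the congruence modulo T! that enforces this scales both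
-- sides alike. Only 2-power roots occur because (1) handles one square root at a time; the sign
-- left open by each root is absorbed by ζ, which makes -1 itself a 2-power of high exponent.
-- Squareness is not decided, so existence is asserted up to double negation until the decidable
-- alternatives at the end.

module Arith where
  open I using (_+_; _*_; _-_; _^_)

  ∣-by : ∀ {d a b} c → d ∣ℤ a → b ≡ c * a → d ∣ℤ b
  ∣-by c d∣a refl = ℤD.∣n⇒∣m*n c d∣a

  ∣-comb : ∀ {d a b c} u v → d ∣ℤ a → d ∣ℤ b → c ≡ u * a + v * b → d ∣ℤ c
  ∣-comb u v d∣a d∣b refl = ℤD.∣m∣n⇒∣m+n (ℤD.∣n⇒∣m*n u d∣a) (ℤD.∣n⇒∣m*n v d∣b)

  ∣0 : ∀ {d} → d ∣ℤ + 0
  ∣0 = divides (+ 0) refl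

  *-∣-* : ∀ {a b c d} → a ∣ℤ b → c ∣ℤ d → a * c ∣ℤ b * d
  *-∣-* {a} {_} {c} (divides q refl) (divides r refl) = divides (q * r) (lemma q a r c)
    where
    lemma : ∀ q a r c → (q * a) * (r * c) ≡ (q * r) * (a * c)
    lemma = solve-∀

  ∣*ʳ : ∀ {d a} b → d ∣ℤ a → d ∣ℤ a * b
  ∣*ʳ b d = ℤD.∣m⇒∣m*n b d

  ∣*ˡ : ∀ {d b} a → d ∣ℤ b → d ∣ℤ a * b
  ∣*ˡ a d = ℤD.∣n⇒∣m*n a d

  ∣-ℕ : ∀ {p x} → + p ∣ℤ x → p ℕD.∣ ∣ x ∣
  ∣-ℕ = ∣⇒∣ᵤ

  ℕ-∣ : ∀ {p x} → p ℕD.∣ ∣ x ∣ → + p ∣ℤ x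
  ℕ-∣ = ∣ᵤ⇒∣

  euclid : ∀ {p} → Prime p → ∀ x y → + p ∣ℤ x * y → + p ∣ℤ x ⊎ + p ∣ℤ y
  euclid pp x y d with euclidsLemma ∣ x ∣ ∣ y ∣ pp (subst (_ ℕD.∣_) (ℤP.abs-* x y) (∣-ℕ d))
  ... | inj₁ e = inj₁ (ℕ-∣ e)
  ... | inj₂ e = inj₂ (ℕ-∣ e)

  ∤-prod : ∀ {p} → Prime p → ∀ {x y} → ¬ + p ∣ℤ x → ¬ + p ∣ℤ y → ¬ + p ∣ℤ x * y
  ∤-prod pp nx ny d = [ nx , ny ]′ (euclid pp _ _ d)

  ∤-pow : ∀ {p} → Prime p → ∀ {x} n → ¬ + p ∣ℤ x → ¬ + p ∣ℤ x ^ n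

  prime>1 : ∀ {p} → Prime p → 1 ℕ.< p
  prime>1 {p} pp = ℕ.nonTrivial⇒n>1 p where instance _ = prime⇒nonTrivial pp

  p∤1 : ∀ {p} → Prime p → ¬ + p ∣ℤ + 1
  p∤1 pp d = ℕP.<-irrefl (sym (ℕD.∣1⇒≡1 (∣-ℕ d))) (prime>1 pp)

  ∤-pow pp zero nx = p∤1 pp
  ∤-pow pp (suc n) nx = ∤-prod pp nx (∤-pow pp n nx)

  ∣-pow⁻ : ∀ {p} → Prime p → ∀ {x} n → + p ∣ℤ x ^ n → + p ∣ℤ x
  ∣-pow⁻ pp {x} n d = decidable-stable (_ ℤD.∣? x) λ nx → ∤-pow pp n nx d

  prime∣prime : ∀ {p q} → Prime p → Prime q → p ℕD.∣ q → p ≡ q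
  prime∣prime pp pq d with prime⇒irreducible pq d
  ... | inj₁ refl = contradiction pp ¬prime[1]
  ... | inj₂ e = e

  ∤-< : ∀ {p x} → ¬ x ≡ + 0 → ∣ x ∣ ℕ.< p → ¬ + p ∣ℤ x
  ∤-< {p} {x} x≢0 lt d = ℕP.<⇒≱ lt (ℕD.∣⇒≤ {{ℕ.≢-nonZero λ e → x≢0 (ℤP.∣i∣≡0⇒i≡0 e)}} (∣-ℕ d))

  coprime-prime : ∀ {p} → Prime p → ∀ {n} → ¬ p ℕD.∣ n → Coprime p n
  coprime-prime pp nd {d} (d∣p , d∣n) with prime⇒irreducible pp d∣p
  ... | inj₁ e = e
  ... | inj₂ refl = contradiction d∣n nd

  ±-abs : ∀ x → x ≡ + ∣ x ∣ ⊎ x ≡ - + ∣ x ∣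
  ±-abs (+ n) = inj₁ refl
  ±-abs ℤ.-[1+ n ] = inj₂ refl

  abstract
    bezout : ∀ m x → Coprime m ∣ x ∣ → ∃[ y ] (+ m ∣ℤ + 1 - x * y)
    bezout m x cop with coprime-Bézout cop | ±-abs x
    ... | Bézout.+- a b eq | inj₁ e = - (+ b) , divides (+ a) (begin
        + 1 - x * - (+ b)      ≡⟨ l x (+ b) ⟩
        + 1 + + b * x          ≡⟨ cong (λ z → + 1 + + b * z) e ⟩
        + 1 + + b * + ∣ x ∣    ≡⟨ cong (λ z → + 1 + z) (sym (ℤP.pos-* b ∣ x ∣)) ⟩
        + 1 + + (b ℕ.* ∣ x ∣)  ≡⟨ cong +_ eq ⟩
        + (a ℕ.* m)            ≡⟨ ℤP.pos-* a m ⟩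
        + a * + m ∎)
      where
      open ≡-Reasoning
      l : ∀ x b → + 1 - x * - b ≡ + 1 + b * x
      l = solve-∀
    ... | Bézout.+- a b eq | inj₂ e = + b , divides (+ a) (begin
        + 1 - x * + b          ≡⟨ cong (λ z → + 1 - z * + b) e ⟩
        + 1 - (- + ∣ x ∣) * + b      ≡⟨ l (+ ∣ x ∣) (+ b) ⟩
        + 1 + + b * + ∣ x ∣    ≡⟨ cong (λ z → + 1 + z) (sym (ℤP.pos-* b ∣ x ∣)) ⟩
        + 1 + + (b ℕ.* ∣ x ∣)  ≡⟨ cong +_ eq ⟩
        + (a ℕ.* m)            ≡⟨ ℤP.pos-* a m ⟩
        + a * + m ∎)
      where
      open ≡-Reasoning
      l : ∀ x b → + 1 - (- x) * b ≡ + 1 + b * x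
      l = solve-∀
    ... | Bézout.-+ a b eq | inj₁ e = + b , divides (- + a) (begin
        + 1 - x * + b          ≡⟨ cong (λ z → + 1 - z * + b) e ⟩
        + 1 - + ∣ x ∣ * + b    ≡⟨ cong (λ z → + 1 - z) (trans (ℤP.*-comm (+ ∣ x ∣) (+ b)) (sym (ℤP.pos-* b ∣ x ∣))) ⟩
        + 1 - + (b ℕ.* ∣ x ∣)  ≡⟨ cong (λ z → + 1 - + z) (sym eq) ⟩
        + 1 - (+ 1 + + (a ℕ.* m)) ≡⟨ cong (λ z → + 1 - (+ 1 + z)) (ℤP.pos-* a m) ⟩
        + 1 - (+ 1 + + a * + m) ≡⟨ l (+ a) (+ m) ⟩
        - (+ a) * + m ∎)
      where
      open ≡-Reasoning
      l : ∀ a m → + 1 - (+ 1 + a * m) ≡ - a * m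
      l = solve-∀
    ... | Bézout.-+ a b eq | inj₂ e = - + b , divides (- + a) (begin
        + 1 - x * - + b        ≡⟨ cong (λ z → + 1 - z * - + b) e ⟩
        + 1 - (- + ∣ x ∣) * - + b ≡⟨ l' (+ ∣ x ∣) (+ b) ⟩
        + 1 - + b * + ∣ x ∣    ≡⟨ cong (λ z → + 1 - z) (sym (ℤP.pos-* b ∣ x ∣)) ⟩
        + 1 - + (b ℕ.* ∣ x ∣)  ≡⟨ cong (λ z → + 1 - + z) (sym eq) ⟩
        + 1 - (+ 1 + + (a ℕ.* m)) ≡⟨ cong (λ z → + 1 - (+ 1 + z)) (ℤP.pos-* a m) ⟩
        + 1 - (+ 1 + + a * + m) ≡⟨ l (+ a) (+ m) ⟩
        - (+ a) * + m ∎)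
      where
      open ≡-Reasoning
      l : ∀ a m → + 1 - (+ 1 + a * m) ≡ - a * m
      l = solve-∀
      l' : ∀ x b → + 1 - (- x) * - b ≡ + 1 - b * x
      l' = solve-∀

  inverse : ∀ {p} → Prime p → ∀ x → ¬ + p ∣ℤ x → ∃[ y ] (+ p ∣ℤ + 1 - x * y)
  inverse {p} pp x nd = bezout p x (coprime-prime pp (nd ∘ ℕ-∣))

  cube : ℤ → ℤ
  cube p = p * (p * p)

  p∣cube : ∀ p → p ∣ℤ cube p
  p∣cube p = divides (p * p) (ℤP.*-comm p (p * p))

  p²∣cube : ∀ p → p * p ∣ℤ cube p
  p²∣cube p = divides p refl

  -- The new error is (s² - E)(1 - 2 s w) + (s² - E)² w². As w inverts 2 s only modulo P, a step
  -- gains one factor P instead of doubling the precision, but w need not be refined.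
  newton-step : ∀ {Q P} s E w → Q ∣ℤ s * s - E → P ∣ℤ s * s - E → P ∣ℤ + 1 - + 2 * s * w →
                Q * P ∣ℤ (s - w * (s * s - E)) * (s - w * (s * s - E)) - E
  newton-step {Q} {P} s E w hQ hP hw = subst (Q * P ∣ℤ_) (sym (eq s E w))
    (ℤD.∣m∣n⇒∣m+n (*-∣-* hQ hw) (∣*ʳ (w * w) (*-∣-* hQ hP)))
    where
    eq : ∀ s E w → (s - w * (s * s - E)) * (s - w * (s * s - E)) - E ≡
         (s * s - E) * (+ 1 - + 2 * s * w) + (s * s - E) * (s * s - E) * (w * w)
    eq = solve-∀

  hensel-lift : ∀ {p} → Prime p → ¬ + p ∣ℤ + 2 → ∀ E → ¬ + p ∣ℤ E → ∀ s → + p ∣ℤ s * s - E →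
           ∃[ s′ ] (cube (+ p) ∣ℤ s′ * s′ - E)
  hensel-lift {p} pp p∤2 E p∤E s d = s₂ , subst (_∣ℤ s₂ * s₂ - E) (ℤP.*-assoc P P P) d₂
    where
    P : ℤ
    P = + p
    module Step (s : ℤ) (d : P ∣ℤ s * s - E) where
      p∤s : ¬ P ∣ℤ s
      p∤s h = p∤E (∣-comb s (- (+ 1)) h d (l s E))
        where
        l : ∀ s E → E ≡ s * s + - (+ 1) * (s * s - E)
        l = solve-∀
      inv : ∃[ y ] (P ∣ℤ + 1 - + 2 * s * y)
      inv = inverse pp (+ 2 * s) (∤-prod pp p∤2 p∤s)
      w : ℤ
      w = proj₁ inv
      s⁺ : ℤ
      s⁺ = s - w * (s * s - E)
      lift : ∀ {Q} → Q ∣ℤ s * s - E → Q * P ∣ℤ s⁺ * s⁺ - E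
      lift h = newton-step s E w h d (proj₂ inv)
    module S₁ = Step s d
    s₁ : ℤ
    s₁ = S₁.s⁺
    d₁ : P * P ∣ℤ s₁ * s₁ - E
    d₁ = S₁.lift d
    module S₂ = Step s₁ (ℤD.∣-trans (divides P refl) d₁)
    s₂ : ℤ
    s₂ = S₂.s⁺
    d₂ : P * P * P ∣ℤ s₂ * s₂ - E
    d₂ = S₂.lift d₁

  abstract
    hensel : ∀ {p} → Prime p → ¬ + p ∣ℤ + 2 → ∀ E → ¬ + p ∣ℤ E → ∀ s → + p ∣ℤ s * s - E →
             ∃[ s′ ] (cube (+ p) ∣ℤ s′ * s′ - E)
    hensel = hensel-lift

  primeDivisor : ∀ n → 1 ℕ.< n → ∃[ p ] (Prime p × p ℕD.∣ n)
  primeDivisor n 1<n with factorise n {{ℕ.>-nonZero (ℕP.<-trans ℕP.0<1+n 1<n)}}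
  ... | record { factors = [] ; isFactorisation = refl } = contradiction 1<n (ℕP.<-irrefl refl)
  ... | record { factors = p ∷ ps ; isFactorisation = e ; factorsPrime = pp ∷ _ } =
    p , pp , ℕD.divides (product ps) (trans e (ℕP.*-comm p (product ps)))

  _! : ℕ → ℕ
  zero ! = 1
  suc n ! = suc n ℕ.* n !

  ∣! : ∀ {k n} → 1 ℕ.≤ k → k ℕ.≤ n → k ℕD.∣ n !
  ∣! {k} {zero} 1≤k k≤0 = contradiction (ℕP.≤-trans 1≤k k≤0) λ ()
  ∣! {k} {suc n} 1≤k k≤ with k ℕ.≟ suc n
  ... | yes refl = ℕD.m∣m*n (n !)
  ... | no ne = ℕD.∣n⇒∣m*n (suc n) (∣! 1≤k (ℕP.≤-pred (ℕP.≤∧≢⇒< k≤ ne)))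

  1≤! : ∀ n → 1 ℕ.≤ n !
  1≤! zero = ℕP.≤-refl
  1≤! (suc n) = ℕP.*-mono-≤ {1} {suc n} {1} (s≤s z≤n) (1≤! n)

  primeAbove : ∀ T → ∃[ p ] (Prime p × T ℕ.< p)
  primeAbove T with primeDivisor (suc (T !)) (s≤s (1≤! T))
  ... | p , pp , p∣ = p , pp , ℕP.≰⇒> λ p≤T →
    ¬prime[1] (subst Prime (ℕD.∣1⇒≡1 (ℕD.∣m+n∣m⇒∣n (subst (p ℕD.∣_) (ℕP.+-comm 1 (T !)) p∣)
      (∣! (ℕP.<⇒≤ (prime>1 pp)) p≤T))) pp)

open Arith

module Powers where
  ^-distribʳ-* : ∀ k m n → (m ℕ.* n) ℕ.^ k ≡ m ℕ.^ k ℕ.* n ℕ.^ k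
  ^-distribʳ-* zero m n = refl
  ^-distribʳ-* (suc k) m n = trans (cong (m ℕ.* n ℕ.*_) (^-distribʳ-* k m n)) (l m n (m ℕ.^ k) (n ℕ.^ k))
    where
    l : ∀ a b c d → a ℕ.* b ℕ.* (c ℕ.* d) ≡ a ℕ.* c ℕ.* (b ℕ.* d)
    l = ℕRing.solve-∀

  ^-distribʳ-*ℤ : ∀ k m n → (m ℤ.* n) ℤ.^ k ≡ m ℤ.^ k ℤ.* n ℤ.^ k
  ^-distribʳ-*ℤ zero m n = refl
  ^-distribʳ-*ℤ (suc k) m n = trans (cong (m ℤ.* n ℤ.*_) (^-distribʳ-*ℤ k m n)) (l m n (m ℤ.^ k) (n ℤ.^ k))
    where
    l : ∀ a b c d → a ℤ.* b ℤ.* (c ℤ.* d) ≡ a ℤ.* c ℤ.* (b ℤ.* d)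
    l = solve-∀

  1^ : ∀ k → (+ 1) ℤ.^ k ≡ + 1
  1^ zero = refl
  1^ (suc k) = trans (ℤP.*-identityˡ _) (1^ k)

  ∣^∣ : ∀ x k → ∣ x ℤ.^ k ∣ ≡ ∣ x ∣ ℕ.^ k
  ∣^∣ x zero = refl
  ∣^∣ x (suc k) = trans (ℤP.abs-* x (x ℤ.^ k)) (cong (∣ x ∣ ℕ.*_) (∣^∣ x k))

  1≤^ : ∀ {m} k → 1 ℕ.≤ m → 1 ℕ.≤ m ℕ.^ k
  1≤^ zero _ = ℕP.≤-refl
  1≤^ {m} (suc k) h = ℕP.*-mono-≤ h (1≤^ k h)

  n<2^n : ∀ n → n ℕ.< 2 ℕ.^ n
  n<2^n zero = s≤s z≤n
  n<2^n (suc n) = begin-strict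
    suc n ≡⟨ ℕP.+-comm 1 n ⟩
    n ℕ.+ 1 <⟨ ℕP.+-mono-<-≤ (n<2^n n) (1≤^ n (s≤s z≤n)) ⟩
    2 ℕ.^ n ℕ.+ 2 ℕ.^ n ≡⟨ cong (2 ℕ.^ n ℕ.+_) (sym (ℕP.+-identityʳ _)) ⟩
    2 ℕ.^ suc n ∎
    where open ℕP.≤-Reasoning

open Powers

-- Axioms for the rings of the tower and for their places

module Rings where
  open I using (_+_; _*_; _-_; _^_)

  infixl 6 _:+_ _:-_
  infixl 7 _:*_
  infix 8 :-_
  data Expr (n : ℕ) : Set where
    con : ℤ → Expr n
    var : Fin n → Expr n
    _:+_ _:*_ : Expr n → Expr n → Expr n
    :-_ : Expr n → Expr n

  _:-_ : ∀ {n} → Expr n → Expr n → Expr n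
  x :- y = x :+ :- y

  -- Propositional equality and a map from ℤ let the polynomial solver run over C with integer
  -- constants, and both pass to pairs over C.
  record Rg : Set₁ where
    infixl 6 _⊕_ _⊖_
    infixl 7 _⊗_
    infix 8 ⊝_
    field
      C : Set
      _⊕_ _⊗_ : C → C → C
      ⊝_ : C → C
      0# 1# : C
      cr : IsCommutativeRing _≡_ _⊕_ _⊗_ ⊝_ 0# 1#
      ι : ℤ → C
      ι-+ : ∀ m n → ι (m + n) ≡ ι m ⊕ ι n
      ι-* : ∀ m n → ι (m * n) ≡ ι m ⊗ ι n
      ι-- : ∀ m → ι (- m) ≡ ⊝ ι m
      ι-0 : ι (+ 0) ≡ 0#
      ι-1 : ι (+ 1) ≡ 1#

    _⊖_ : C → C → C
    x ⊖ y = x ⊕ ⊝ y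

    private
      coreRing : CoreACR.AlmostCommutativeRing 0ℓ 0ℓ
      coreRing = CoreACR.fromCommutativeRing (record { isCommutativeRing = cr }) (λ _ → nothing)

      isZero : ℤ → Bool
      isZero (+ zero) = true
      isZero _ = false

      zero-correct : ∀ n → IsTrue (isZero n) → 0# ≡ ι n
      zero-correct (+ zero) _ = sym ι-0

      coefficients : Homomorphism 0ℓ 0ℓ 0ℓ 0ℓ
      coefficients = record
        { from = record { rawRing = ℤ.+-*-rawRing ; isZero = isZero }
        ; to = coreRing
        ; morphism = record { ⟦_⟧ = ι ; +-homo = ι-+ ; *-homo = ι-* ; -‿homo = ι-- ; 0-homo = ι-0 ; 1-homo = ι-1 }
        ; Zero-C⟶Zero-R = zero-correct }

      module Po = Poly (Homomorphism.from coefficients)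
      module PS = PolySem coefficients
      module PH = PolyHom coefficients

      ⟦_⟧ : ∀ {n} → Expr n → Vec.Vec C n → C
      ⟦ con c ⟧ ρ = ι c
      ⟦ var i ⟧ ρ = Vec.lookup ρ i
      ⟦ x :+ y ⟧ ρ = ⟦ x ⟧ ρ ⊕ ⟦ y ⟧ ρ
      ⟦ x :* y ⟧ ρ = ⟦ x ⟧ ρ ⊗ ⟦ y ⟧ ρ
      ⟦ :- x ⟧ ρ = ⊝ ⟦ x ⟧ ρ

      norm : ∀ {n} → Expr n → Po.Poly n
      norm (con c) = Po.κ c
      norm (var i) = Po.ι i
      norm (x :+ y) = norm x Po.⊞ norm y
      norm (x :* y) = norm x Po.⊠ norm y
      norm (:- x) = Po.⊟ norm x

      correct : ∀ {n} (x : Expr n) ρ → PS.⟦ norm x ⟧ ρ ≡ ⟦ x ⟧ ρ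
      correct (con c) ρ = PH.κ-hom c ρ
      correct (var i) ρ = PH.ι-hom i ρ
      correct (x :+ y) ρ = trans (PH.⊞-hom (norm x) (norm y) ρ) (cong₂ _⊕_ (correct x ρ) (correct y ρ))
      correct (x :* y) ρ = trans (PH.⊠-hom (norm x) (norm y) ρ) (cong₂ _⊗_ (correct x ρ) (correct y ρ))
      correct (:- x) ρ = trans (PH.⊟-hom (norm x) ρ) (cong ⊝_ (correct x ρ))

    open Reflection (setoid C) var ⟦_⟧ (λ x → PS.⟦ norm x ⟧) correct public using (solve) renaming (_⊜_ to _:=_)

    open IsCommutativeRing cr public using ()
      renaming (+-identityˡ to ⊕-idˡ; +-identityʳ to ⊕-idʳ; *-identityˡ to ⊗-idˡ; *-identityʳ to ⊗-idʳ;
                zeroˡ to ⊗-zeroˡ; zeroʳ to ⊗-zeroʳ; -‿inverseʳ to ⊖-self; *-comm to ⊗-comm; *-assoc to ⊗-assoc;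
                +-comm to ⊕-comm; +-assoc to ⊕-assoc)

    ⊖-≡ : ∀ {x y} → x ⊖ y ≡ 0# → x ≡ y
    ⊖-≡ {x} {y} e = trans (solve 2 (λ x y → x := (x :+ :- y) :+ y) refl x y) (trans (cong (_⊕ y) e) (⊕-idˡ y))

    ≡-⊖ : ∀ {x y} → x ≡ y → x ⊖ y ≡ 0#
    ≡-⊖ {x} refl = ⊖-self x

  -- The two witnesses sit at different positions of the list, so that they contribute two separate
  -- factors to `Π`.
  data Two {a p} {A : Set a} (P : A → Set p) : List A → Set (a Level.⊔ p) where
    both : ∀ {x xs} → P x → Any P xs → Two P (x ∷ xs)
    skip : ∀ {x xs} → Two P xs → Two P (x ∷ xs)

  -- Residue fields of characteristic p. A Hom is a place of degree one, remembered modulo p³ so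
  -- that up to three coincident zeros can be counted; a Big place has degree at least two.
  module _ (R : Rg) where
    open Rg R

    record Hom (p : ℕ) : Set where
      field
        f   : C → ℤ
        f-+ : ∀ x y → f (x ⊕ y) ≡ f x + f y
        -- The rings in use are built from ℤ by pairing, so an additive lift to ℤ can be exact; only
        -- products have to be read modulo p³.
        f-* : ∀ x y → cube (+ p) ∣ℤ f (x ⊗ y) - f x * f y
        f-ι : ∀ n → f (ι n) ≡ n

      f-0 : f 0# ≡ + 0
      f-0 = trans (cong f (sym ι-0)) (f-ι (+ 0))

      f-1 : f 1# ≡ + 1
      f-1 = trans (cong f (sym ι-1)) (f-ι (+ 1))

      f-⊝ : ∀ x → f (⊝ x) ≡ - f x
      f-⊝ x = begin
        f (⊝ x)               ≡⟨ l (f (⊝ x)) (f x) ⟩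
        (f x + f (⊝ x)) - f x ≡⟨ cong (_- f x) (sym (f-+ x (⊝ x))) ⟩
        f (x ⊖ x) - f x       ≡⟨ cong (λ z → f z - f x) (⊖-self x) ⟩
        f 0# - f x            ≡⟨ cong (_- f x) f-0 ⟩
        + 0 - f x             ≡⟨ ℤP.+-identityˡ (- f x) ⟩
        - f x                 ∎
        where
        open ≡-Reasoning
        l : ∀ a b → a ≡ (b + a) - b
        l = solve-∀

      f-⊖ : ∀ x y → f (x ⊖ y) ≡ f x - f y
      f-⊖ x y = trans (f-+ x (⊝ y)) (cong (λ z → f x + z) (f-⊝ y))

      f-*ₚ : ∀ x y → + p ∣ℤ f (x ⊗ y) - f x * f y
      f-*ₚ x y = ℤD.∣-trans (p∣cube (+ p)) (f-* x y)

    -- The kernel of a reduction to a residue field, as a decidable set. `K-inv` says that the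
    -- quotient is a field, which spares constructing the quotient.
    record Place : Set₁ where
      field
        K     : C → Set
        K?    : ∀ x → Dec (K x)
        K-+   : ∀ {x y} → K x → K y → K (x ⊕ y)
        K-*   : ∀ c {x} → K x → K (c ⊗ x)
        K-inv : ∀ y → ¬ K y → ∃[ w ] K (1# ⊖ y ⊗ w)

      K-≡ : ∀ {x y} → x ≡ y → K x → K y
      K-≡ refl k = k

      K-0 : ∀ {x} → K x → K 0#
      K-0 {x} k = K-≡ (⊗-zeroˡ x) (K-* 0# k)

      K-prime : ∀ x y → K (x ⊗ y) → K x ⊎ K y
      K-prime x y k with K? x
      ... | yes kx = inj₁ kx
      ... | no nx with K-inv x nx
      ...   | w , kw = inj₂ (K-≡ (solve 3 (λ x y w → y :* (con (+ 1) :- x :* w) :+ w :* (x :* y) := y) refl x y w)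
                               (K-+ (K-* y (K-≡ (cong (_⊖ x ⊗ w) (sym ι-1)) kw)) (K-* w k)))

    module _ {p} (pp : Prime p) (h : Hom p) where
      open Hom h
      abstract
        kernel-+ : ∀ {x y} → + p ∣ℤ f x → + p ∣ℤ f y → + p ∣ℤ f (x ⊕ y)
        kernel-+ {x} {y} a b = subst (+ p ∣ℤ_) (sym (f-+ x y)) (ℤD.∣m∣n⇒∣m+n a b)

        kernel-* : ∀ c {x} → + p ∣ℤ f x → + p ∣ℤ f (c ⊗ x)
        kernel-* c {x} a = ∣-comb (+ 1) (f c) (f-*ₚ c x) a (l (f (c ⊗ x)) (f c) (f x))
          where
          l : ∀ a b c → a ≡ + 1 * (a - b * c) + b * c
          l = solve-∀

        kernel-inv : ∀ y → ¬ + p ∣ℤ f y → ∃[ w ] (+ p ∣ℤ f (1# ⊖ y ⊗ w))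
        kernel-inv y ny with inverse pp (f y) ny
        -- The residue field at a place of degree one is the prime field, so an inverse can be taken
        -- in ℤ.
        ... | v , hv = ι v , ∣-comb (+ 1) (- (+ 1)) hv (f-*ₚ y (ι v))
            (trans (trans (f-⊖ 1# (y ⊗ ι v)) (cong₂ _-_ f-1 refl))
              (trans (l (f (y ⊗ ι v)) (f y * f (ι v))) (cong (λ z → + 1 * (+ 1 - f y * z) + - (+ 1) * (f (y ⊗ ι v) - f y * f (ι v))) (f-ι v))))
          where
          l : ∀ a b → + 1 - a ≡ + 1 * (+ 1 - b) + - (+ 1) * (a - b)
          l = solve-∀

      homPlace : Place
      homPlace = record { K = λ x → + p ∣ℤ f x ; K? = λ x → + p ℤD.∣? f x ; K-+ = kernel-+ ; K-* = kernel-* ; K-inv = kernel-inv }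

    record Big (N : C → ℤ) (p : ℕ) : Set₁ where
      field
        place : Place
      open Place place public
      field
        K-N : ∀ {z} → K z → + p * + p ∣ℤ N z

    Π : ∀ {p} → List (Hom p) → C → ℤ
    Π [] z = + 1
    Π (h ∷ hs) z = Hom.f h z * Π hs z

    Π-∣ : ∀ {p} (hs : List (Hom p)) → All (λ h → ∀ d z → d ∣ℤ Hom.f h z → d ∣ℤ Π hs z) hs
    Π-∣ [] = []
    Π-∣ (h ∷ hs) = (λ d z d∣ → ∣*ʳ (Π hs z) d∣) ∷ All.map (λ g d z d∣ → ∣*ˡ (Hom.f h z) (g d z d∣)) (Π-∣ hs)

    -- How p decomposes in R. `prod` leads from zeros at places of degree one to divisibility of the
    -- norm, E collecting whatever the other places contribute; the two covers lead back from p or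
    -- p² in the norm to places that account for it.
    record Local (N : C → ℤ) (D p : ℕ) : Set₁ where
      field
        homs : List (Hom p)
        bigs : List (Big N p)
        prod : ∀ z → ∃[ E ] (cube (+ p) ∣ℤ N z - E * Π homs z)
        cover₁ : ∀ z → + p ∣ℤ N z → Any (λ h → + p ∣ℤ Hom.f h z) homs ⊎ Any (λ B → Big.K B z) bigs
        cover₂ : ∀ z → + p * + p ∣ℤ N z →
                 Any (λ h → + p * + p ∣ℤ Hom.f h z) homs ⊎ Two (λ h → + p ∣ℤ Hom.f h z) homs ⊎ Any (λ B → Big.K B z) bigs
        size : length homs ℕ.+ length bigs ℕ.≤ D

      prod-∣ : ∀ {d} z → d ∣ℤ cube (+ p) → d ∣ℤ Π homs z → d ∣ℤ N z
      prod-∣ z dc dΠ with prod z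
      ... | E , h = ∣-comb (+ 1) E (ℤD.∣-trans dc h) dΠ (l (N z) E (Π homs z))
        where
        l : ∀ a b c → a ≡ + 1 * (a - b * c) + b * c
        l = solve-∀

  -- What the counting needs from a ring of integers, in a form that R[√e] inherits: a
  -- multiplicative norm of degree D, a size compatible with it up to constants, boxes with B^D
  -- points, and the decomposition of all primes above S.
  record TR : Set₁ where
    field
      rg : Rg
    open Rg rg public
    field
      N     : C → ℤ
      D     : ℕ
      1≤D   : 1 ℕ.≤ D
      N-*   : ∀ x y → N (x ⊗ y) ≡ N x * N y
      N-ι   : ∀ n → N (ι n) ≡ n ^ D
      adj   : C → C
      adj-* : ∀ x → x ⊗ adj x ≡ ι (N x)
      N-0   : ∀ x → N x ≡ + 0 → x ≡ 0#
      N-cong : ∀ q z → ∃[ w ] (N (1# ⊕ ι q ⊗ z) ≡ + 1 + q * w)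
      ‖_‖   : C → ℕ
      ‖ι‖   : ∀ n → ‖ ι n ‖ ≡ ∣ n ∣
      ‖⊝‖   : ∀ x → ‖ ⊝ x ‖ ≡ ‖ x ‖
      ‖⊕‖   : ∀ x y → ‖ x ⊕ y ‖ ℕ.≤ ‖ x ‖ ℕ.+ ‖ y ‖
      Cm    : ℕ
      ‖⊗‖   : ∀ x y → ‖ x ⊗ y ‖ ℕ.≤ Cm ℕ.* (‖ x ‖ ℕ.* ‖ y ‖)
      ‖ι⊗‖  : ∀ q x → ‖ ι q ⊗ x ‖ ≡ ∣ q ∣ ℕ.* ‖ x ‖
      C₀    : ℕ
      N≤    : ∀ x → ∣ N x ∣ ℕ.≤ C₀ ℕ.* ‖ x ‖ ℕ.^ D
      M     : ℕ
      1≤M   : 1 ℕ.≤ M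
      -- Near a large rational integer v every conjugate is close to v, so the norm has its full
      -- size v^D.
      dom   : ∀ v z → M ℕ.* ‖ z ‖ ℕ.≤ v → v ℕ.^ D ℕ.≤ 2 ℕ.* ∣ N (ι (+ v) ⊕ z) ∣
      -- Kept apart from B ^ D so that for an extension it is definitionally a product, and
      -- `remQuot` splits an index into coordinates.
      card  : ℕ → ℕ
      card≡ : ∀ B → card B ≡ B ℕ.^ D
      box   : ∀ B → Fin (card B) → C
      box-inj  : ∀ B i j → box B i ≡ box B j → i ≡ j
      box-<    : ∀ B i → ‖ box B i ‖ ℕ.< B
      box-diff : ∀ B i j → ‖ box B i ⊖ box B j ‖ ℕ.< B
      enc      : ∀ B z → ‖ z ‖ ℕ.< B → Fin (card (2 ℕ.* B))
      enc-inj  : ∀ B x y p q → enc B x p ≡ enc B y q → x ≡ y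
      fl       : (δ : ℕ) .{{_ : ℕ.NonZero δ}} → C → C
      fl-≡     : ∀ δ .{{_ : ℕ.NonZero δ}} x y → fl δ x ≡ fl δ y → ‖ x ⊖ y ‖ ℕ.< δ
      fl-≤     : ∀ δ .{{_ : ℕ.NonZero δ}} g z → ‖ z ‖ ℕ.< g ℕ.* δ → ‖ fl δ z ‖ ℕ.≤ g
      S        : ℕ
      -- The decomposition depends on whether elements are squares at the places below, which is not
      -- decided; hence the double negation.
      local    : ∀ p → Prime p → S ℕ.< p → ¬ ¬ Local rg N D p

open Rings

-- The rational integers as base of the tower

module Base where
  open I using (_+_; _*_; _-_; _^_)

  ℤ-rg : Rg
  ℤ-rg = record
    { C = ℤ ; _⊕_ = _+_ ; _⊗_ = _*_ ; ⊝_ = -_ ; 0# = + 0 ; 1# = + 1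
    ; cr = ℤP.+-*-isCommutativeRing
    ; ι = id ; ι-+ = λ _ _ → refl ; ι-* = λ _ _ → refl ; ι-- = λ _ → refl ; ι-0 = refl ; ι-1 = refl }

  local-ℤ : ∀ p → Local ℤ-rg id 1 p
  local-ℤ p = record
    { homs = idHom ∷ []
    ; bigs = []
    ; prod = λ z → + 1 , subst (cube (+ p) ∣ℤ_) (sym (l z)) ∣0
    ; cover₁ = λ z d → inj₁ (here d)
    ; cover₂ = λ z d → inj₁ (here d)
    ; size = ℕP.≤-refl }
    where
    l : ∀ z → z - + 1 * (z * + 1) ≡ + 0
    l = solve-∀
    idHom : Hom ℤ-rg p
    idHom = record { f = id ; f-+ = λ _ _ → refl ; f-* = λ x y → subst (cube (+ p) ∣ℤ_) (sym (ℤP.+-inverseʳ (x * y))) ∣0 ; f-ι = λ _ → refl }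

  ∣+∣-lower : ∀ v z → v ℕ.≤ ∣ + v + z ∣ ℕ.+ ∣ z ∣
  ∣+∣-lower v z = subst (ℕ._≤ ∣ + v + z ∣ ℕ.+ ∣ z ∣) (cong ∣_∣ (l (+ v) z)) (ℤP.∣i-j∣≤∣i∣+∣j∣ (+ v + z) z)
    where
    l : ∀ v z → v + z - z ≡ v
    l = solve-∀

  dom-ℤ : ∀ v z → 2 ℕ.* ∣ z ∣ ℕ.≤ v → v ℕ.^ 1 ℕ.≤ 2 ℕ.* ∣ + v + z ∣
  dom-ℤ v z 2z≤v = ℕP.+-cancelʳ-≤ (2 ℕ.* ∣ z ∣) _ _ (begin
    v ℕ.^ 1 ℕ.+ 2 ℕ.* ∣ z ∣ ≡⟨ cong (ℕ._+ 2 ℕ.* ∣ z ∣) (ℕP.*-identityʳ v) ⟩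
    v ℕ.+ 2 ℕ.* ∣ z ∣ ≤⟨ ℕP.+-monoʳ-≤ v 2z≤v ⟩
    v ℕ.+ v ≡⟨ l v ⟩
    2 ℕ.* v ≤⟨ ℕP.*-monoʳ-≤ 2 (∣+∣-lower v z) ⟩
    2 ℕ.* (∣ + v + z ∣ ℕ.+ ∣ z ∣) ≡⟨ ℕP.*-distribˡ-+ 2 ∣ + v + z ∣ ∣ z ∣ ⟩
    2 ℕ.* ∣ + v + z ∣ ℕ.+ 2 ℕ.* ∣ z ∣ ∎)
    where
    open ℕP.≤-Reasoning
    l : ∀ v → v ℕ.+ v ≡ 2 ℕ.* v
    l = ℕRing.solve-∀

  ∣-∣-< : ∀ {m n B} → m ℕ.< B → n ℕ.< B → ∣ + m - + n ∣ ℕ.< B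
  ∣-∣-< {m} {n} {B} m<B n<B with ℕP.≤-total m n
  ... | inj₁ m≤n = subst (ℕ._< B) (sym (trans (cong ∣_∣ (ℤP.m-n≡m⊖n m n)) (ℤP.∣⊖∣-≤ m≤n))) (ℕP.≤-<-trans (ℕP.m∸n≤m n m) n<B)
  ... | inj₂ n≤m = subst (ℕ._< B) (sym (trans (cong ∣_∣ (trans (ℤP.m-n≡m⊖n m n) (ℤP.⊖-swap m n))) (trans (ℤP.∣-i∣≡∣i∣ (n ℤ.⊖ m)) (ℤP.∣⊖∣-≤ n≤m)))) (ℕP.≤-<-trans (ℕP.m∸n≤m m n) m<B)

  private
    encℕ : ∀ B z → ∣ z ∣ ℕ.< B → ∃[ n ] (+ n ≡ z + + B × n ℕ.< 2 ℕ.* B)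
    encℕ B (+ m) m<B = m ℕ.+ B , refl , ℕP.+-mono-<-≤ m<B (ℕP.≤-reflexive (sym (ℕP.+-identityʳ B)))
    encℕ B ℤ.-[1+ m ] m<B = B ℕ.∸ suc m , sym (trans (ℤP.+-comm ℤ.-[1+ m ] (+ B)) (trans (ℤP.m-n≡m⊖n B (suc m)) (ℤP.⊖-≥ (ℕP.<⇒≤ m<B)))) ,
      ℕP.≤-<-trans (ℕP.m∸n≤m B (suc m)) (ℕP.m<m+n B {B ℕ.+ 0} (ℕP.<-≤-trans (ℕP.≤-<-trans z≤n m<B) (ℕP.m≤m+n B 0)))

  enc-ℤ : ∀ B z → ∣ z ∣ ℕ.< B → Fin (2 ℕ.* B)
  enc-ℤ B z h = fromℕ< (proj₂ (proj₂ (encℕ B z h)))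

  +-cancelʳ : ∀ b x y → x + b ≡ y + b → x ≡ y
  +-cancelʳ b x y e = trans (l x b) (trans (cong (_- b) e) (sym (l y b)))
    where
    l : ∀ x b → x ≡ (x + b) - b
    l = solve-∀

  enc-ℤ-inj : ∀ B x y p q → enc-ℤ B x p ≡ enc-ℤ B y q → x ≡ y
  enc-ℤ-inj B x y p q e = +-cancelʳ (+ B) x y (trans (sym (proj₁ (proj₂ (encℕ B x p))))
    (trans (cong +_ (trans (sym (FinP.toℕ-fromℕ< _)) (trans (cong toℕ e) (FinP.toℕ-fromℕ< _)))) (proj₁ (proj₂ (encℕ B y q)))))

  fl-ℤ-≡ : ∀ δ .{{_ : ℕ.NonZero δ}} x y → x ℤDM./ℕ δ ≡ y ℤDM./ℕ δ → ∣ x - y ∣ ℕ.< δ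
  fl-ℤ-≡ δ x y e = subst (λ z → ∣ z ∣ ℕ.< δ) eq (∣-∣-< (ℤDM.n%ℕd<d x δ) (ℤDM.n%ℕd<d y δ))
    where
    l : ∀ a b c → a - b ≡ (a + c) - (b + c)
    l = solve-∀
    eq : + (x ℤDM.%ℕ δ) - + (y ℤDM.%ℕ δ) ≡ x - y
    eq = trans (l (+ (x ℤDM.%ℕ δ)) (+ (y ℤDM.%ℕ δ)) ((x ℤDM./ℕ δ) * + δ)) (cong₂ _-_ (sym (ℤDM.a≡a%ℕn+[a/ℕn]*n x δ))
           (trans (cong (λ z → + (y ℤDM.%ℕ δ) + z * + δ) e) (sym (ℤDM.a≡a%ℕn+[a/ℕn]*n y δ))))

  fl-ℤ-≤ : ∀ δ .{{_ : ℕ.NonZero δ}} g z → ∣ z ∣ ℕ.< g ℕ.* δ → ∣ z ℤDM./ℕ δ ∣ ℕ.≤ g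
  fl-ℤ-≤ δ g z h = ℕP.≤-pred (ℕP.*-cancelʳ-< δ ∣ q ∣ (suc g) (begin-strict
    ∣ q ∣ ℕ.* δ ≡⟨ sym (ℤP.abs-* q (+ δ)) ⟩
    ∣ q * + δ ∣ ≡⟨ cong ∣_∣ (trans (l (+ r) (q * + δ)) (cong (_- + r) (sym (ℤDM.a≡a%ℕn+[a/ℕn]*n z δ)))) ⟩
    ∣ z - + r ∣ ≤⟨ ℤP.∣i-j∣≤∣i∣+∣j∣ z (+ r) ⟩
    ∣ z ∣ ℕ.+ r <⟨ ℕP.+-mono-< h (ℤDM.n%ℕd<d z δ) ⟩
    g ℕ.* δ ℕ.+ δ ≡⟨ ℕP.+-comm (g ℕ.* δ) δ ⟩
    suc g ℕ.* δ ∎))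
    where
    open ℕP.≤-Reasoning
    q = z ℤDM./ℕ δ
    r = z ℤDM.%ℕ δ
    l : ∀ r q → q ≡ (r + q) - r
    l = solve-∀

  ℤ-TR : TR
  ℤ-TR = record
    { rg = ℤ-rg ; N = id ; D = 1 ; 1≤D = ℕP.≤-refl
    ; N-* = λ _ _ → refl ; N-ι = λ n → sym (ℤP.*-identityʳ n)
    ; adj = λ _ → + 1 ; adj-* = ℤP.*-identityʳ ; N-0 = λ _ e → e ; N-cong = λ q z → z , refl
    ; ‖_‖ = ∣_∣ ; ‖ι‖ = λ _ → refl ; ‖⊝‖ = ℤP.∣-i∣≡∣i∣ ; ‖⊕‖ = ℤP.∣i+j∣≤∣i∣+∣j∣
    ; Cm = 1 ; ‖⊗‖ = λ x y → ℕP.≤-reflexive (trans (ℤP.abs-* x y) (sym (ℕP.+-identityʳ _))) ; ‖ι⊗‖ = ℤP.abs-*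
    ; C₀ = 1 ; N≤ = λ x → ℕP.≤-reflexive (sym (trans (ℕP.*-identityˡ _) (ℕP.*-identityʳ _)))
    ; M = 2 ; 1≤M = s≤s z≤n ; dom = dom-ℤ
    ; card = id ; card≡ = λ B → sym (ℕP.*-identityʳ B)
    ; box = λ B i → + toℕ i ; box-inj = λ B i j e → FinP.toℕ-injective (ℤP.+-injective e)
    ; box-< = λ B i → FinP.toℕ<n i ; box-diff = λ B i j → ∣-∣-< (FinP.toℕ<n i) (FinP.toℕ<n j)
    ; enc = enc-ℤ ; enc-inj = enc-ℤ-inj
    ; fl = λ δ z → z ℤDM./ℕ δ ; fl-≡ = fl-ℤ-≡ ; fl-≤ = fl-ℤ-≤
    ; S = 0 ; local = λ p _ _ k → k (local-ℤ p) }

open Base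

-- Classical case distinctions under double negation

module ¬¬ where
  ¬¬-lem : ∀ {a} (P : Set a) → ¬ ¬ Dec P
  ¬¬-lem P k = k (no λ p → k (yes p))

  ¬¬-All : ∀ {a p} {A : Set a} (P : A → Set p) xs → ¬ ¬ All (λ x → Dec (P x)) xs
  ¬¬-All P [] k = k []
  ¬¬-All P (x ∷ xs) k = ¬¬-lem (P x) λ d → ¬¬-All P xs λ ds → k (d ∷ ds)

  -- Double-negation shift for a bounded range. It is the reason why the primes to be examined are
  -- later bounded by `L`.
  ¬¬-below : ∀ {p} {P : ℕ → Set p} n → (∀ k → k ℕ.< n → ¬ ¬ P k) → ¬ ¬ (∀ k → k ℕ.< n → P k)
  ¬¬-below zero h k = k λ _ ()
  ¬¬-below {P = P} (suc n) h k = ¬¬-below {P = P} n (λ i i<n → h i (ℕP.m≤n⇒m≤1+n i<n)) λ g → h n ℕP.≤-refl λ pn →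
    k λ i i<sn → go g pn i (ℕP.m≤n⇒m<n∨m≡n (ℕP.≤-pred i<sn))
    where
    go : (∀ k → k ℕ.< n → P k) → P n → ∀ i → i ℕ.< n ⊎ i ≡ n → P i
    go g pn i (inj₁ lt) = g i lt
    go g pn i (inj₂ refl) = pn

open ¬¬

-- R[√e] as pairs x + y√e, with relative norm nm x y.
module ExtRing (R : Rg) (e : Rg.C R) where
  open Rg R
  open I using (_+_; _*_; _-_; _^_)

  nm : C → C → C
  nm x y = x ⊗ x ⊖ e ⊗ (y ⊗ y)

  C′ : Set
  C′ = C × C

  _⊕′_ _⊗′_ : C′ → C′ → C′
  (x , y) ⊕′ (z , w) = x ⊕ z , y ⊕ w
  (x , y) ⊗′ (z , w) = x ⊗ z ⊕ e ⊗ (y ⊗ w) , x ⊗ w ⊕ y ⊗ z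

  ⊝′ : C′ → C′
  ⊝′ (x , y) = ⊝ x , ⊝ y

  abstract
    cr′ : IsCommutativeRing _≡_ _⊕′_ _⊗′_ ⊝′ (0# , 0#) (1# , 0#)
    cr′ = record
      { isRing = record
        { +-isAbelianGroup = record
          { isGroup = record
            { isMonoid = record
              { isSemigroup = record
                { isMagma = record { isEquivalence = isEquivalence ; ∙-cong = cong₂ _⊕′_ }
                ; assoc = λ x y z → cong₂ _,_ (⊕-assoc _ _ _) (⊕-assoc _ _ _) }
              ; identity = (λ x → cong₂ _,_ (⊕-idˡ _) (⊕-idˡ _)) , (λ x → cong₂ _,_ (⊕-idʳ _) (⊕-idʳ _)) }
            ; inverse = (λ x → cong₂ _,_ (⊖-selfˡ _) (⊖-selfˡ _)) , (λ x → cong₂ _,_ (⊖-self _) (⊖-self _))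
            ; ⁻¹-cong = cong ⊝′ }
          ; comm = λ x y → cong₂ _,_ (⊕-comm _ _) (⊕-comm _ _) }
        ; *-cong = cong₂ _⊗′_
        ; *-assoc = λ (x , y) (z , w) (u , v) → cong₂ _,_
            (solve 7 (λ e x y z w u v → (x :* z :+ e :* (y :* w)) :* u :+ e :* ((x :* w :+ y :* z) :* v)
               := x :* (z :* u :+ e :* (w :* v)) :+ e :* (y :* (z :* v :+ w :* u))) refl e x y z w u v)
            (solve 7 (λ e x y z w u v → (x :* z :+ e :* (y :* w)) :* v :+ (x :* w :+ y :* z) :* u
               := x :* (z :* v :+ w :* u) :+ y :* (z :* u :+ e :* (w :* v))) refl e x y z w u v)
        ; *-identity = idl , (λ x → trans (comm′ x (1# , 0#)) (idl x))
        ; distrib = distl , (λ x y z → trans (comm′ (y ⊕′ z) x) (trans (distl x y z) (cong₂ _⊕′_ (comm′ x y) (comm′ x z)))) }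
      ; *-comm = comm′ }
      where
      ⊖-selfˡ : ∀ x → ⊝ x ⊕ x ≡ 0#
      ⊖-selfˡ x = trans (⊕-comm _ _) (⊖-self x)
      comm′ : ∀ x y → x ⊗′ y ≡ y ⊗′ x
      comm′ (x , y) (z , w) = cong₂ _,_
        (solve 5 (λ e x y z w → x :* z :+ e :* (y :* w) := z :* x :+ e :* (w :* y)) refl e x y z w)
        (solve 4 (λ x y z w → x :* w :+ y :* z := z :* y :+ w :* x) refl x y z w)
      idl : ∀ x → (1# , 0#) ⊗′ x ≡ x
      idl (x , y) = cong₂ _,_
        (trans (cong₂ (λ a b → a ⊕ e ⊗ b) (⊗-idˡ x) (⊗-zeroˡ y)) (trans (cong (x ⊕_) (⊗-zeroʳ e)) (⊕-idʳ x)))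
        (trans (cong₂ _⊕_ (⊗-idˡ y) (⊗-zeroˡ x)) (⊕-idʳ y))
      distl : ∀ x y z → x ⊗′ (y ⊕′ z) ≡ (x ⊗′ y) ⊕′ (x ⊗′ z)
      distl (x , y) (z , w) (u , v) = cong₂ _,_
        (solve 7 (λ e x y z w u v → x :* (z :+ u) :+ e :* (y :* (w :+ v)) := (x :* z :+ e :* (y :* w)) :+ (x :* u :+ e :* (y :* v))) refl e x y z w u v)
        (solve 6 (λ x y z w u v → x :* (w :+ v) :+ y :* (z :+ u) := (x :* w :+ y :* z) :+ (x :* v :+ y :* u)) refl x y z w u v)

  rg′ : Rg
  rg′ = record
    { C = C′ ; _⊕_ = _⊕′_ ; _⊗_ = _⊗′_ ; ⊝_ = ⊝′ ; 0# = 0# , 0# ; 1# = 1# , 0# ; cr = cr′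
    ; ι = λ n → ι n , 0#
    ; ι-+ = λ m n → cong₂ _,_ (ι-+ m n) (sym (⊕-idʳ 0#))
    ; ι-* = λ m n → cong₂ _,_
        (trans (ι-* m n) (sym (trans (cong (λ z → ι m ⊗ ι n ⊕ e ⊗ z) (⊗-zeroˡ 0#)) (trans (cong (ι m ⊗ ι n ⊕_) (⊗-zeroʳ e)) (⊕-idʳ _)))))
        (sym (trans (cong₂ _⊕_ (⊗-zeroʳ (ι m)) (⊗-zeroˡ (ι n))) (⊕-idʳ 0#)))
    ; ι-- = λ m → cong₂ _,_ (ι-- m) (sym (trans (sym (⊕-idˡ (⊝ 0#))) (⊖-self 0#)))
    ; ι-0 = cong (_, 0#) ι-0
    ; ι-1 = cong (_, 0#) ι-1 }

  -- Brahmagupta's identity.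
  nm-* : ∀ x y z w → nm (x ⊗ z ⊕ e ⊗ (y ⊗ w)) (x ⊗ w ⊕ y ⊗ z) ≡ nm x y ⊗ nm z w
  nm-* x y z w = solve 5 (λ e x y z w →
    (x :* z :+ e :* (y :* w)) :* (x :* z :+ e :* (y :* w)) :- e :* ((x :* w :+ y :* z) :* (x :* w :+ y :* z)) :=
    ((x :* x) :- e :* (y :* y)) :* ((z :* z) :- e :* (w :* w))) refl e x y z w

  nm-ι : ∀ x → nm x 0# ≡ x ⊗ x
  nm-ι x = trans (cong (λ z → x ⊗ x ⊖ e ⊗ z) (⊗-zeroˡ 0#)) (trans (cong (λ z → x ⊗ x ⊖ z) (⊗-zeroʳ e))
    (trans (cong (λ z → x ⊗ x ⊖ z) (sym ι-0)) (trans (solve 1 (λ x → x :* x :- con (+ 0) := x :* x) refl x) refl)))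

  module _ (N : C → ℤ) where
    N′ : C′ → ℤ
    N′ (x , y) = N (nm x y)

  scal : ∀ c x y → (c , 0#) ⊗′ (x , y) ≡ (c ⊗ x , c ⊗ y)
  scal c x y = cong₂ _,_
    (trans (cong (λ z → c ⊗ x ⊕ e ⊗ z) (⊗-zeroˡ y)) (trans (cong (c ⊗ x ⊕_) (⊗-zeroʳ e)) (⊕-idʳ _)))
    (trans (cong (c ⊗ y ⊕_) (⊗-zeroˡ x)) (⊕-idʳ _))

  module _ {p : ℕ} (h : Hom R p) where
    open Hom h
    private
      P³ = cube (+ p)

    f-nm : ∀ x y → P³ ∣ℤ f (nm x y) - (f x * f x - f e * (f y * f y))
    f-nm x y = subst (P³ ∣ℤ_) (sym eq)
      (ℤD.∣m∣n⇒∣m-n (f-* x x) (ℤD.∣m∣n⇒∣m+n (f-* e (y ⊗ y)) (∣*ˡ (f e) (f-* y y))))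
      where
      l : ∀ a b c d e g → (a - b) - (d - e * g) ≡ (a - d) - ((b - e * c) + e * (c - g))
      l = solve-∀
      eq = trans (cong (_- (f x * f x - f e * (f y * f y))) (f-⊖ (x ⊗ x) (e ⊗ (y ⊗ y))))
             (l (f (x ⊗ x)) (f (e ⊗ (y ⊗ y))) (f (y ⊗ y)) (f x * f x) (f e) (f y * f y))

    -- A root s of e modulo p³ factors the relative norm x² - e y² into its two conjugate values,
    -- the future values of v at the two homs above h.
    nm-g : ∀ s → P³ ∣ℤ s * s - f e → ∀ x y → P³ ∣ℤ f (nm x y) - (f x + s * f y) * (f x + - s * f y)
    nm-g s hs x y = ∣-comb (+ 1) (f y * f y) (f-nm x y) hs (l (f x) (f y) s (f (nm x y)) (f e))
      where
      l : ∀ x y s n e → n - (x + s * y) * (x + - s * y) ≡ + 1 * (n - (x * x - e * (y * y))) + (y * y) * (s * s - e)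
      l = solve-∀

  -- Splitting of places in a quadratic extension

  module LocalExt (N : C → ℤ) {D p : ℕ} (pp : Prime p) (p∤2 : ¬ + p ∣ℤ + 2) (p∤e : ∀ (h : Hom R p) → ¬ + p ∣ℤ Hom.f h e)
                  (loc : Local R N D p) where
    open Local loc
    P P² P³ : ℤ
    P = + p
    P² = P * P
    P³ = cube P

    module _ (h : Hom R p) where
      open Hom h
      module _ (s : ℤ) (hs : P³ ∣ℤ s * s - f e) where
        g : C′ → ℤ
        g (x , y) = f x + s * f y

        abstract
          g-+ : ∀ v w → g (v ⊕′ w) ≡ g v + g w
          g-+ (x , y) (z , w) = trans (cong₂ (λ a b → a + s * b) (f-+ x z) (f-+ y w)) (l₁ (f x) (f z) s (f y) (f w))
            where
            l₁ : ∀ a b s c d → (a + b) + s * (c + d) ≡ (a + s * c) + (b + s * d)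
            l₁ = solve-∀

          g-* : ∀ v w → P³ ∣ℤ g (v ⊗′ w) - g v * g w
          g-* (x , y) (z , w) = subst (P³ ∣ℤ_)
              (sym (trans (cong₂ (λ a b → a + s * b - (f x + s * f y) * (f z + s * f w)) (f-+ (x ⊗ z) (e ⊗ (y ⊗ w))) (f-+ (x ⊗ w) (y ⊗ z)))
                (l₂ (f (x ⊗ z)) (f (e ⊗ (y ⊗ w))) (f (y ⊗ w)) s (f (x ⊗ w)) (f (y ⊗ z)) (f x) (f y) (f z) (f w) (f e))))
              (ℤD.∣m∣n⇒∣m+n (ℤD.∣m∣n⇒∣m+n (f-* x z) (ℤD.∣m∣n⇒∣m+n (f-* e (y ⊗ w)) (∣*ˡ (f e) (f-* y w))))
                (ℤD.∣m∣n⇒∣m-n (∣*ˡ s (ℤD.∣m∣n⇒∣m+n (f-* x w) (f-* y z))) (∣*ʳ (f y * f w) hs)))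
            where
            l₂ : ∀ xz eyw yw s xw yz x y z w e → (xz + eyw) + s * (xw + yz) - (x + s * y) * (z + s * w) ≡
                 ((xz - x * z) + ((eyw - e * yw) + e * (yw - y * w))) + (s * ((xw - x * w) + (yz - y * z)) - (s * s - e) * (y * w))
            l₂ = solve-∀

          g-ι : ∀ n → g (ι n , 0#) ≡ n
          g-ι n = trans (cong₂ (λ a b → a + s * b) (f-ι n) f-0) (trans (cong (λ z → n + z) (ℤP.*-zeroʳ s)) (ℤP.+-identityʳ n))

        splitHom : Hom rg′ p
        splitHom = record { f = g ; f-+ = g-+ ; f-* = g-* ; f-ι = g-ι }

      nm-split : ∀ {d} s → d ∣ℤ P³ → P³ ∣ℤ s * s - f e → ∀ x y → d ∣ℤ f (nm x y) → d ∣ℤ (f x + s * f y) * (f x + - s * f y)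
      nm-split s dP³ hs x y dn = ∣-comb (+ 1) (- (+ 1)) dn (ℤD.∣-trans dP³ (nm-g h s hs x y)) (l (f (nm x y)) _)
        where
        l : ∀ a b → b ≡ + 1 * a + - (+ 1) * (a - b)
        l = solve-∀

    module _ (B : Place R) where
      open Place B
      module _ (s : C) (ks : K (s ⊗ s ⊖ e)) where
        K± : C′ → Set
        K± (x , y) = K (x ⊕ s ⊗ y)

        abstract
          split-+ : ∀ {v w} → K± v → K± w → K± (v ⊕′ w)
          split-+ {x , y} {z , w} a b = K-≡ (solve 5 (λ s x y z w → (x :+ s :* y) :+ (z :+ s :* w) := (x :+ z) :+ s :* (y :+ w)) refl s x y z w) (K-+ a b)

          split-* : ∀ c {v} → K± v → K± (c ⊗′ v)
          split-* (z , w) {x , y} a = K-≡ (solve 6 (λ s e x y z w → (z :+ s :* w) :* (x :+ s :* y) :+ (:- (w :* y)) :* (s :* s :- e)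
                      := (z :* x :+ e :* (w :* y)) :+ s :* (z :* y :+ w :* x)) refl s e x y z w)
                    (K-+ (K-* (z ⊕ s ⊗ w) a) (K-* (⊝ (w ⊗ y)) ks))

          -- Sending √e to s does not enlarge the residue field, so the inverse is found in R.
          split-inv : ∀ v → ¬ K± v → ∃[ w ] K± (Rg._⊖_ rg′ (1# , 0#) (v ⊗′ w))
          split-inv (x , y) n = let w , kw = K-inv (x ⊕ s ⊗ y) n in (w , 0#) ,
                K-≡ (trans (solve 5 (λ o s x y w → o :- (x :+ s :* y) :* w := (o :- w :* x) :+ s :* (:- (w :* y))) refl 1# s x y w)
                      (cong₂ (λ a b → (1# ⊖ a) ⊕ s ⊗ b) (sym (trans (cong proj₁ (comm (x , y) (w , 0#))) (cong proj₁ (scal w x y))))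
                         (sym (trans (⊕-idˡ _) (cong ⊝_ (trans (cong proj₂ (comm (x , y) (w , 0#))) (cong proj₂ (scal w x y)))))))) kw
            where
            comm : ∀ v w → v ⊗′ w ≡ w ⊗′ v
            comm = Rg.⊗-comm rg′

        splitPlace : Place rg′
        splitPlace = record { K = K± ; K? = λ (x , y) → K? (x ⊕ s ⊗ y) ; K-+ = λ {v} {w} → split-+ {v} {w} ; K-* = λ c {v} → split-* c {v} ; K-inv = split-inv }

        split-nm : ∀ x y → K (x ⊕ s ⊗ y) → K (nm x y)
        split-nm x y k = K-≡ (solve 4 (λ s e x y → (x :- s :* y) :* (x :+ s :* y) :+ (y :* y) :* (s :* s :- e) := x :* x :- e :* (y :* y)) refl s e x y)
          (K-+ (K-* (x ⊖ s ⊗ y) k) (K-* (y ⊗ y) ks))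
        nm-split′ : ∀ x y → K (nm x y) → K (x ⊕ s ⊗ y) ⊎ K (x ⊕ ⊝ s ⊗ y)
        nm-split′ x y k = K-prime _ _ (K-≡ (solve 4 (λ s e x y → (x :* x :- e :* (y :* y)) :+ (:- (y :* y)) :* (s :* s :- e) := (x :+ s :* y) :* (x :+ (:- s) :* y)) refl s e x y)
          (K-+ k (K-* (⊝ (y ⊗ y)) ks)))

      module _ (ns : ¬ (∃[ s ] K (s ⊗ s ⊖ e))) where
        -- If y were a unit at the place, x / y would be a square root of e there. So y vanishes,
        -- then x² does.
        inert-nm : ∀ x y → K (nm x y) → K x × K y
        inert-nm x y k with K? y
        ... | no ny = let w , kw = K-inv y ny in contradiction (x ⊗ w ,
               K-≡ (trans (solve 5 (λ o e x y w → (w :* w) :* (x :* x :- e :* (y :* y)) :+ (:- (e :* (o :+ y :* w))) :* (o :- y :* w) := (x :* w) :* (x :* w) :- e :* (o :* o)) refl 1# e x y w)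
                      (cong (λ z → (x ⊗ w) ⊗ (x ⊗ w) ⊖ z) (trans (cong (e ⊗_) (⊗-idˡ 1#)) (trans (⊗-comm e 1#) (⊗-idˡ e)))))
                 (K-+ (K-* (w ⊗ w) k) (K-* (⊝ (e ⊗ (1# ⊕ y ⊗ w))) kw))) ns
        ... | yes ky = [ id , id ]′ (K-prime x x (K-≡ (solve 3 (λ e x y → (x :* x :- e :* (y :* y)) :+ (e :* y) :* y := x :* x) refl e x y)
                         (K-+ k (K-* (e ⊗ y) ky)))) , ky

        K² : C′ → Set
        K² (x , y) = K x × K y

        abstract
          inert-+ : ∀ {v w} → K² v → K² w → K² (v ⊕′ w)
          inert-+ (a , b) (c , d) = K-+ a c , K-+ b d

          inert-* : ∀ c {v} → K² v → K² (c ⊗′ v)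
          inert-* (z , w) (a , b) = K-+ (K-* z a) (K-* e (K-* w b)) , K-+ (K-* z b) (K-* w a)

          -- Conjugate over norm; the norm is a unit by `inert-nm`.
          inert-inv : ∀ v → ¬ K² v → ∃[ w ] K² (Rg._⊖_ rg′ (1# , 0#) (v ⊗′ w))
          inert-inv (x , y) n = let w , kw = K-inv (nm x y) (n ∘ inert-nm x y) in (x ⊗ w , ⊝ (y ⊗ w)) ,
              (K-≡ (solve 5 (λ o e x y w → o :- (x :* x :- e :* (y :* y)) :* w := o :- (x :* (x :* w) :+ e :* (y :* (:- (y :* w))))) refl 1# e x y w) kw ,
               K-≡ (sym (trans (⊕-idˡ _) (trans (trans (cong ⊝_ (solve 3 (λ x y w → x :* (:- (y :* w)) :+ y :* (x :* w) := con (+ 0)) refl x y w))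
                     (solve 0 ((:- con (+ 0)) := con (+ 0)) refl)) ι-0))) (K-0 kw))

        inertPlace : Place rg′
        inertPlace = record { K = K² ; K? = λ (x , y) → K? x ×-dec K? y ; K-+ = λ {v} {w} → inert-+ {v} {w} ; K-* = λ c {v} → inert-* c {v} ; K-inv = inert-inv }

        inert-K : ∀ {x y} → K x → K y → K (nm x y)
        inert-K {x} {y} a b = K-≡ (solve 3 (λ e x y → x :* x :+ (:- (e :* y)) :* y := x :* x :- e :* (y :* y)) refl e x y) (K-+ (K-* x a) (K-* (⊝ (e ⊗ y)) b))

    neg² : ∀ s E → P³ ∣ℤ s * s - E → P³ ∣ℤ - s * - s - E
    neg² s E = subst (P³ ∣ℤ_) (l s E)
      where
      l : ∀ s E → s * s - E ≡ - s * - s - E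
      l = solve-∀

    DecH : Hom R p → Set
    DecH h = Dec (∃[ s ] (P³ ∣ℤ s * s - Hom.f h e))

    DecB : Big R N p → Set
    DecB B = Dec (∃[ s ] Big.K B (s ⊗ s ⊖ e))

    -- Used to turn an inert hom into a `Big` place: there both coordinates vanish modulo p, so the
    -- relative norm vanishes modulo p², and this has to be visible in N.
    SqOK : Hom R p → Set
    SqOK h = ∀ d z → d ∣ℤ P³ → d ∣ℤ Hom.f h z → d ∣ℤ N z

    homs-ok : All SqOK homs
    homs-ok = All.map (λ g d z dP³ dz → prod-∣ z dP³ (g d z dz)) (Π-∣ R homs)

    -- By Hensel a root modulo p would lift to a root modulo p³.
    nonsplit : ∀ h → ¬ (∃[ s ] (P³ ∣ℤ s * s - Hom.f h e)) → ¬ (∃[ s ] Place.K (homPlace R pp h) (s ⊗ s ⊖ e))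
    nonsplit h n (s , k) = n (hensel pp p∤2 (f e) (p∤e h) (f s)
        (∣-comb (+ 1) (- (+ 1)) (subst (P ∣ℤ_) (f-⊖ (s ⊗ s) e) k) (f-*ₚ s s) (l (f s * f s) (f (s ⊗ s)) (f e))))
      where
      open Hom h
      l : ∀ a b c → a - c ≡ + 1 * (b - c) + - (+ 1) * (b - a)
      l = solve-∀

    inertBigH : ∀ h → ¬ (∃[ s ] (P³ ∣ℤ s * s - Hom.f h e)) → SqOK h → Big rg′ (N′ N) p
    inertBigH h n ok = record { place = inertPlace (homPlace R pp h) (nonsplit h n) ; K-N = λ {v} → k-N {v} }
      where
      open Hom h
      l : ∀ a b → a ≡ + 1 * (a - b) + + 1 * b
      l = solve-∀
      abstract
        k-N : ∀ {v} → P ∣ℤ f (proj₁ v) × P ∣ℤ f (proj₂ v) → P² ∣ℤ N′ N v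
        k-N {x , y} (a , b) = ok P² (nm x y) (p²∣cube P)
          (∣-comb (+ 1) (+ 1) (ℤD.∣-trans (p²∣cube P) (f-nm h x y)) (ℤD.∣m∣n⇒∣m-n (*-∣-* a a) (∣*ˡ (f e) (*-∣-* b b)))
             (l (f (nm x y)) (f x * f x - f e * (f y * f y))))

    splitBig : (B : Big R N p) (s : C) → Big.K B (s ⊗ s ⊖ e) → Big rg′ (N′ N) p
    splitBig B s k = record { place = splitPlace (Big.place B) s k ; K-N = λ {v} → k-N {v} }
      where
      abstract
        k-N : ∀ {v} → Big.K B (proj₁ v ⊕ s ⊗ proj₂ v) → P² ∣ℤ N′ N v
        k-N {x , y} a = Big.K-N B (split-nm (Big.place B) s k x y a)

    inertBig : (B : Big R N p) → ¬ (∃[ s ] Big.K B (s ⊗ s ⊖ e)) → Big rg′ (N′ N) p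
    inertBig B n = record { place = inertPlace (Big.place B) n ; K-N = λ {v} → k-N {v} }
      where
      abstract
        k-N : ∀ {v} → Big.K B (proj₁ v) × Big.K B (proj₂ v) → P² ∣ℤ N′ N v
        k-N {x , y} (a , b) = Big.K-N B (inert-K (Big.place B) n a b)

    abstract
      K-neg : ∀ (B : Big R N p) s → Big.K B (s ⊗ s ⊖ e) → Big.K B (⊝ s ⊗ ⊝ s ⊖ e)
      K-neg B s k = Big.K-≡ B (solve 2 (λ s e → s :* s :- e := (:- s) :* (:- s) :- e) refl s e) k

    homs⁺ : (hs : List (Hom R p)) → All DecH hs → List (Hom rg′ p)
    homs⁺ [] [] = []
    homs⁺ (h ∷ hs) (yes (s , q) ∷ ds) = splitHom h s q ∷ splitHom h (- s) (neg² s _ q) ∷ homs⁺ hs ds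
    homs⁺ (h ∷ hs) (no _ ∷ ds) = homs⁺ hs ds

    bigsH : (hs : List (Hom R p)) → All DecH hs → All SqOK hs → List (Big rg′ (N′ N) p)
    bigsH [] [] [] = []
    bigsH (h ∷ hs) (yes _ ∷ ds) (_ ∷ oks) = bigsH hs ds oks
    bigsH (h ∷ hs) (no n ∷ ds) (ok ∷ oks) = inertBigH h n ok ∷ bigsH hs ds oks

    bigsB : (bs : List (Big R N p)) → All DecB bs → List (Big rg′ (N′ N) p)
    bigsB [] [] = []
    bigsB (B ∷ bs) (yes (s , k) ∷ ds) = splitBig B s k ∷ splitBig B (⊝ s) (K-neg B s k) ∷ bigsB bs ds
    bigsB (B ∷ bs) (no n ∷ ds) = inertBig B n ∷ bigsB bs ds

    -- A split hom is replaced by its two conjugate factors; an inert one has no successor among the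
    -- homs, and its value moves into E.
    prod⁺ : ∀ hs ds x y → ∃[ E ] (P³ ∣ℤ Π R hs (nm x y) - E * Π rg′ (homs⁺ hs ds) (x , y))
    prod⁺ [] [] x y = + 1 , ∣0
    prod⁺ (h ∷ hs) (yes (s , q) ∷ ds) x y with prod⁺ hs ds x y
    ... | E , ih = E , ∣-comb (Π R hs (nm x y)) ((f x + s * f y) * (f x + - s * f y)) (nm-g h s q x y) ih
                         (l (f (nm x y)) (Π R hs (nm x y)) E (f x + s * f y) (f x + - s * f y) _)
      where
      open Hom h
      l : ∀ n π E a b π′ → n * π - E * (a * (b * π′)) ≡ π * (n - a * b) + (a * b) * (π - E * π′)
      l = solve-∀
    prod⁺ (h ∷ hs) (no _ ∷ ds) x y with prod⁺ hs ds x y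
    ... | E , ih = Hom.f h (nm x y) * E , ∣-by (Hom.f h (nm x y)) ih (l (Hom.f h (nm x y)) _ E _)
      where
      l : ∀ n π E π′ → n * π - n * E * π′ ≡ n * (π - E * π′)
      l = solve-∀

    Kills : C′ → Hom rg′ p → Set
    Kills v h = P ∣ℤ Hom.f h v

    splits : ∀ h s → P³ ∣ℤ s * s - Hom.f h e → ∀ x y → P ∣ℤ Hom.f h (nm x y) →
             P ∣ℤ Hom.f h x + s * Hom.f h y ⊎ P ∣ℤ Hom.f h x + - s * Hom.f h y
    splits h s q x y k = euclid pp (Hom.f h x + s * Hom.f h y) (Hom.f h x + - s * Hom.f h y) (nm-split h s (p∣cube P) q x y k)

    cover₁H : ∀ hs ds oks x y → Any (λ h → P ∣ℤ Hom.f h (nm x y)) hs →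
              Any (Kills (x , y)) (homs⁺ hs ds) ⊎ Any (λ B → Big.K B (x , y)) (bigsH hs ds oks)
    cover₁H (h ∷ hs) (yes (s , q) ∷ ds) (_ ∷ oks) x y (here k) =
      [ (λ a → inj₁ (here a)) , (λ b → inj₁ (there (here b))) ]′ (splits h s q x y k)
    cover₁H (h ∷ hs) (yes _ ∷ ds) (_ ∷ oks) x y (there a) = [ (λ b → inj₁ (there (there b))) , inj₂ ]′ (cover₁H hs ds oks x y a)
    cover₁H (h ∷ hs) (no n ∷ ds) (_ ∷ oks) x y (here k) = inj₂ (here (inert-nm (homPlace R pp h) (nonsplit h n) x y k))
    cover₁H (h ∷ hs) (no n ∷ ds) (_ ∷ oks) x y (there a) = [ inj₁ , (λ b → inj₂ (there b)) ]′ (cover₁H hs ds oks x y a)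

    coverB : ∀ bs ds x y → Any (λ B → Big.K B (nm x y)) bs → Any (λ B → Big.K B (x , y)) (bigsB bs ds)
    coverB (B ∷ bs) (yes (s , k) ∷ ds) x y (here a) = [ here , (λ b → there (here b)) ]′ (nm-split′ (Big.place B) s k x y a)
    coverB (B ∷ bs) (yes _ ∷ ds) x y (there a) = there (there (coverB bs ds x y a))
    coverB (B ∷ bs) (no n ∷ ds) x y (here a) = here (inert-nm (Big.place B) n x y a)
    coverB (B ∷ bs) (no n ∷ ds) x y (there a) = there (coverB bs ds x y a)

    -- If v inverts b modulo p, then v (2 - b v) inverts it modulo p², because 1 - b v (2 - b v) =
    -- (1 - b v)².
    cancel-coprime : ∀ a b → ¬ P ∣ℤ b → P² ∣ℤ a * b → P² ∣ℤ a
    cancel-coprime a b y d = let v , hv = inverse pp b y in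
      ∣-comb {a = (a * b) * (v * (+ 2 - b * v))} (+ 1) a (∣*ʳ (v * (+ 2 - b * v)) d) (*-∣-* hv hv) (l a b v)
      where
      l : ∀ a b v → a ≡ + 1 * ((a * b) * (v * (+ 2 - b * v))) + a * ((+ 1 - b * v) * (+ 1 - b * v))
      l = solve-∀

    p²∣* : ∀ a b → P² ∣ℤ a * b → P² ∣ℤ a ⊎ P² ∣ℤ b ⊎ (P ∣ℤ a × P ∣ℤ b)
    p²∣* a b d with P ℤD.∣? a | P ℤD.∣? b
    ... | yes x | yes y = inj₂ (inj₂ (x , y))
    ... | yes x | no y = inj₁ (cancel-coprime a b y d)
    ... | no x | _ = inj₂ (inj₁ (cancel-coprime b a x (subst (P² ∣ℤ_) (ℤP.*-comm a b) d)))

    Sq : C′ → Hom rg′ p → Set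
    Sq v h = P² ∣ℤ Hom.f h v

    Cover₂ : (hs : List (Hom rg′ p)) (bs : List (Big rg′ (N′ N) p)) → C′ → Set₁
    Cover₂ hs bs v = Any (Sq v) hs ⊎ Two (Kills v) hs ⊎ Any (λ B → Big.K B v) bs

    cons₂ : ∀ {h hs bs v} → Cover₂ hs bs v → Cover₂ (h ∷ hs) bs v
    cons₂ (inj₁ a) = inj₁ (there a)
    cons₂ (inj₂ (inj₁ t)) = inj₂ (inj₁ (skip t))
    cons₂ (inj₂ (inj₂ b)) = inj₂ (inj₂ b)

    consB : ∀ {B hs bs v} → Cover₂ hs bs v → Cover₂ hs (B ∷ bs) v
    consB (inj₁ a) = inj₁ a
    consB (inj₂ (inj₁ t)) = inj₂ (inj₁ t)
    consB (inj₂ (inj₂ b)) = inj₂ (inj₂ (there b))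

    cover₂H : ∀ hs ds oks x y → Any (λ h → P² ∣ℤ Hom.f h (nm x y)) hs → Cover₂ (homs⁺ hs ds) (bigsH hs ds oks) (x , y)
    cover₂H (h ∷ hs) (yes (s , q) ∷ ds) (_ ∷ oks) x y (here k) =
      [ (λ a → inj₁ (here a)) , [ (λ b → inj₁ (there (here b))) , (λ (a , b) → inj₂ (inj₁ (both a (here b)))) ]′ ]′
        (p²∣* (Hom.f h x + s * Hom.f h y) (Hom.f h x + - s * Hom.f h y) (nm-split h s (p²∣cube P) q x y k))
    cover₂H (h ∷ hs) (yes _ ∷ ds) (_ ∷ oks) x y (there a) = cons₂ (cons₂ (cover₂H hs ds oks x y a))
    cover₂H (h ∷ hs) (no n ∷ ds) (_ ∷ oks) x y (here k) =
      inj₂ (inj₂ (here (inert-nm (homPlace R pp h) (nonsplit h n) x y (ℤD.∣-trans (divides P refl) k))))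
    cover₂H (h ∷ hs) (no n ∷ ds) (_ ∷ oks) x y (there a) = consB (cover₂H hs ds oks x y a)

    coverTwo : ∀ hs ds oks x y → Two (λ h → P ∣ℤ Hom.f h (nm x y)) hs → Cover₂ (homs⁺ hs ds) (bigsH hs ds oks) (x , y)
    coverTwo (h ∷ hs) (yes (s , q) ∷ ds) (_ ∷ oks) x y (both k t) =
      [ (λ t′ → [ (λ a → inj₂ (inj₁ (both a (there t′)))) , (λ b → inj₂ (inj₁ (skip (both b t′)))) ]′ (splits h s q x y k)) , (λ b → inj₂ (inj₂ b)) ]′ (cover₁H hs ds oks x y t)
    coverTwo (h ∷ hs) (yes _ ∷ ds) (_ ∷ oks) x y (skip t) = cons₂ (cons₂ (coverTwo hs ds oks x y t))
    coverTwo (h ∷ hs) (no n ∷ ds) (_ ∷ oks) x y (both k t) = inj₂ (inj₂ (here (inert-nm (homPlace R pp h) (nonsplit h n) x y k)))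
    coverTwo (h ∷ hs) (no n ∷ ds) (_ ∷ oks) x y (skip t) = consB (coverTwo hs ds oks x y t)

    suc-double : ∀ {m} n → m ℕ.≤ n ℕ.+ n → suc (suc m) ℕ.≤ suc n ℕ.+ suc n
    suc-double {m} n h = s≤s (subst (suc m ℕ.≤_) (sym (ℕP.+-suc n n)) (s≤s h))

    sizeH : ∀ hs ds oks → length (homs⁺ hs ds) ℕ.+ length (bigsH hs ds oks) ℕ.≤ length hs ℕ.+ length hs
    sizeH [] [] [] = z≤n
    sizeH (h ∷ hs) (yes _ ∷ ds) (_ ∷ oks) = suc-double (length hs) (sizeH hs ds oks)
    sizeH (h ∷ hs) (no _ ∷ ds) (_ ∷ oks) = ℕP.≤-trans (ℕP.≤-reflexive (ℕP.+-suc (length (homs⁺ hs ds)) _))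
      (ℕP.≤-trans (ℕP.n≤1+n _) (suc-double (length hs) (sizeH hs ds oks)))

    sizeB : ∀ bs ds → length (bigsB bs ds) ℕ.≤ length bs ℕ.+ length bs
    sizeB [] [] = z≤n
    sizeB (B ∷ bs) (yes _ ∷ ds) = suc-double (length bs) (sizeB bs ds)
    sizeB (B ∷ bs) (no _ ∷ ds) = ℕP.≤-trans (ℕP.n≤1+n _) (suc-double (length bs) (sizeB bs ds))

    module _ (ds : All DecH homs) (es : All DecB bigs) where
      hs′ : List (Hom rg′ p)
      hs′ = homs⁺ homs ds

      bs₁ bs₂ : List (Big rg′ (N′ N) p)
      bs₁ = bigsH homs ds homs-ok
      bs₂ = bigsB bigs es

      abstract
        prod′ : ∀ v → ∃[ E ] (P³ ∣ℤ N′ N v - E * Π rg′ hs′ v)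
        prod′ (x , y) with prod (nm x y) | prod⁺ homs ds x y
        ... | E , q | E′ , q′ = E * E′ , ∣-comb (+ 1) E q q′ (l (N (nm x y)) E (Π R homs (nm x y)) E′ (Π rg′ hs′ (x , y)))
          where
          l : ∀ n E π E′ π′ → n - E * E′ * π′ ≡ + 1 * (n - E * π) + E * (π - E′ * π′)
          l = solve-∀

        inj₁-bs₁ : ∀ {v} → Any (Kills v) hs′ ⊎ Any (λ B → Big.K B v) bs₁ → Any (Kills v) hs′ ⊎ Any (λ B → Big.K B v) (bs₁ ++ bs₂)
        inj₁-bs₁ (inj₁ a) = inj₁ a
        inj₁-bs₁ (inj₂ b) = inj₂ (++⁺ˡ {xs = bs₁} b)

        cover₁′ : ∀ v → P ∣ℤ N′ N v → Any (Kills v) hs′ ⊎ Any (λ B → Big.K B v) (bs₁ ++ bs₂)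
        cover₁′ (x , y) d = [ fromHoms , fromBigs ]′ (cover₁ (nm x y) d)
          where
          fromHoms : Any (λ h → P ∣ℤ Hom.f h (nm x y)) homs → Any (Kills (x , y)) hs′ ⊎ Any (λ B → Big.K B (x , y)) (bs₁ ++ bs₂)
          fromHoms a = inj₁-bs₁ (cover₁H homs ds homs-ok x y a)
          fromBigs : Any (λ B → Big.K B (nm x y)) bigs → Any (Kills (x , y)) hs′ ⊎ Any (λ B → Big.K B (x , y)) (bs₁ ++ bs₂)
          fromBigs b = inj₂ (++⁺ʳ bs₁ (coverB bigs es x y b))

        inj-bs₁ : ∀ {v} → Cover₂ hs′ bs₁ v → Cover₂ hs′ (bs₁ ++ bs₂) v
        inj-bs₁ (inj₁ a) = inj₁ a
        inj-bs₁ (inj₂ (inj₁ t)) = inj₂ (inj₁ t)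
        inj-bs₁ (inj₂ (inj₂ b)) = inj₂ (inj₂ (++⁺ˡ {xs = bs₁} b))

        cover₂′ : ∀ v → P² ∣ℤ N′ N v → Cover₂ hs′ (bs₁ ++ bs₂) v
        cover₂′ (x , y) d = [ (λ a → inj-bs₁ (cover₂H homs ds homs-ok x y a)) ,
          [ (λ t → inj-bs₁ (coverTwo homs ds homs-ok x y t)) , (λ b → inj₂ (inj₂ (++⁺ʳ bs₁ (coverB bigs es x y b)))) ]′ ]′ (cover₂ (nm x y) d)

        -- Every place has at most two places above it.
        size′ : length hs′ ℕ.+ length (bs₁ ++ bs₂) ℕ.≤ D ℕ.+ D
        size′ = begin
          length hs′ ℕ.+ length (bs₁ ++ bs₂) ≡⟨ cong (length hs′ ℕ.+_) (length-++ bs₁) ⟩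
          length hs′ ℕ.+ (length bs₁ ℕ.+ length bs₂) ≡⟨ sym (ℕP.+-assoc (length hs′) _ _) ⟩
          length hs′ ℕ.+ length bs₁ ℕ.+ length bs₂ ≤⟨ ℕP.+-mono-≤ (sizeH homs ds homs-ok) (sizeB bigs es) ⟩
          (length homs ℕ.+ length homs) ℕ.+ (length bigs ℕ.+ length bigs) ≡⟨ lℕ (length homs) (length bigs) ⟩
          (length homs ℕ.+ length bigs) ℕ.+ (length homs ℕ.+ length bigs) ≤⟨ ℕP.+-mono-≤ size size ⟩
          D ℕ.+ D ∎
          where
          open ℕP.≤-Reasoning
          lℕ : ∀ a b → (a ℕ.+ a) ℕ.+ (b ℕ.+ b) ≡ (a ℕ.+ b) ℕ.+ (a ℕ.+ b)
          lℕ = ℕRing.solve-∀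

      local′ : Local rg′ (N′ N) (D ℕ.+ D) p
      local′ = record { homs = hs′ ; bigs = bs₁ ++ bs₂ ; prod = prod′ ; cover₁ = cover₁′ ; cover₂ = cover₂′ ; size = size′ }

-- The tower axioms for R[√e]

module Extension where
  module _ (R : TR) (e : TR.C R) (aniso : ∀ x y → TR._⊗_ R x x ≡ TR._⊗_ R e (TR._⊗_ R y y) → y ≡ TR.0# R) where
    open TR R
    open ExtRing rg e
    open I using (_+_; _*_; _-_; _^_)

    private
      module R′ = Rg rg′

      N-0# : N 0# ≡ + 0
      N-0# = trans (cong N (sym ι-0)) (trans (N-ι (+ 0)) (zero-^ D 1≤D))
        where
        zero-^ : ∀ D → 1 ℕ.≤ D → (+ 0) ^ D ≡ + 0
        zero-^ (suc D) _ = refl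

      domain : ∀ x → x ⊗ x ≡ 0# → x ≡ 0#
      domain x h = N-0 x ([ id , id ]′ (ℤP.i*j≡0⇒i≡0∨j≡0 (N x) (trans (sym (N-* x x)) (trans (cong N h) N-0#))))

    nm-0 : ∀ x y → nm x y ≡ 0# → (x , y) ≡ (0# , 0#)
    nm-0 x y h with aniso x y (⊖-≡ h)
    ... | refl = cong (_, 0#) (domain x (trans (sym (nm-ι x)) h))

    private
      ‖_‖′ : C′ → ℕ
      ‖ x , y ‖′ = ‖ x ‖ ℕ.⊔ ‖ y ‖

      ‖0‖ : ‖ 0# ‖ ≡ 0
      ‖0‖ = trans (cong ‖_‖ (sym ι-0)) (‖ι‖ (+ 0))

      c₁ : ℕ
      c₁ = Cm ℕ.* ‖ e ‖ ℕ.* Cm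

      ‖e⊗‖ : ∀ y w → ‖ e ⊗ (y ⊗ w) ‖ ℕ.≤ c₁ ℕ.* (‖ y ‖ ℕ.* ‖ w ‖)
      ‖e⊗‖ y w = begin
        ‖ e ⊗ (y ⊗ w) ‖ ≤⟨ ‖⊗‖ e (y ⊗ w) ⟩
        Cm ℕ.* (‖ e ‖ ℕ.* ‖ y ⊗ w ‖) ≤⟨ ℕP.*-monoʳ-≤ Cm (ℕP.*-monoʳ-≤ ‖ e ‖ (‖⊗‖ y w)) ⟩
        Cm ℕ.* (‖ e ‖ ℕ.* (Cm ℕ.* (‖ y ‖ ℕ.* ‖ w ‖))) ≡⟨ l Cm ‖ e ‖ Cm (‖ y ‖ ℕ.* ‖ w ‖) ⟩
        c₁ ℕ.* (‖ y ‖ ℕ.* ‖ w ‖) ∎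
        where
        open ℕP.≤-Reasoning
        l : ∀ a b c d → a ℕ.* (b ℕ.* (c ℕ.* d)) ≡ a ℕ.* b ℕ.* c ℕ.* d
        l = ℕRing.solve-∀

      Cn Cm′ : ℕ
      Cn = Cm ℕ.+ c₁
      Cm′ = Cm ℕ.+ c₁ ℕ.+ (Cm ℕ.+ Cm)

      ‖nm‖ : ∀ x y → ‖ nm x y ‖ ℕ.≤ Cn ℕ.* (‖ x , y ‖′ ℕ.* ‖ x , y ‖′)
      ‖nm‖ x y = begin
        ‖ x ⊗ x ⊖ e ⊗ (y ⊗ y) ‖ ≤⟨ ‖⊕‖ (x ⊗ x) (⊝ (e ⊗ (y ⊗ y))) ⟩
        ‖ x ⊗ x ‖ ℕ.+ ‖ ⊝ (e ⊗ (y ⊗ y)) ‖ ≡⟨ cong (‖ x ⊗ x ‖ ℕ.+_) (‖⊝‖ _) ⟩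
        ‖ x ⊗ x ‖ ℕ.+ ‖ e ⊗ (y ⊗ y) ‖ ≤⟨ ℕP.+-mono-≤ (‖⊗‖ x x) (‖e⊗‖ y y) ⟩
        Cm ℕ.* (‖ x ‖ ℕ.* ‖ x ‖) ℕ.+ c₁ ℕ.* (‖ y ‖ ℕ.* ‖ y ‖)
          ≤⟨ ℕP.+-mono-≤ (ℕP.*-monoʳ-≤ Cm (ℕP.*-mono-≤ x≤ x≤)) (ℕP.*-monoʳ-≤ c₁ (ℕP.*-mono-≤ y≤ y≤)) ⟩
        Cm ℕ.* (b ℕ.* b) ℕ.+ c₁ ℕ.* (b ℕ.* b) ≡⟨ sym (ℕP.*-distribʳ-+ (b ℕ.* b) Cm c₁) ⟩
        Cn ℕ.* (b ℕ.* b) ∎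
        where
        open ℕP.≤-Reasoning
        b = ‖ x , y ‖′
        x≤ = ℕP.m≤m⊔n ‖ x ‖ ‖ y ‖
        y≤ = ℕP.m≤n⊔m ‖ x ‖ ‖ y ‖

      dbl : ∀ m k → (m ℕ.* m) ℕ.^ k ≡ m ℕ.^ (k ℕ.+ k)
      dbl m k = trans (^-distribʳ-* k m m) (sym (ℕP.^-distribˡ-+-* m k k))

    abstract
      N-*′ : ∀ v w → N′ N (v ⊗′ w) ≡ N′ N v * N′ N w
      N-*′ (x , y) (z , w) = trans (cong N (nm-* x y z w)) (N-* _ _)

      N-ι′ : ∀ n → N (nm (ι n) 0#) ≡ n ^ (D ℕ.+ D)
      N-ι′ n = trans (cong N (nm-ι (ι n))) (trans (N-* _ _) (trans (cong₂ _*_ (N-ι n) (N-ι n)) (sym (ℤP.^-distribˡ-+-* n D D))))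

      adj-*′ : ∀ x y → (x , y) ⊗′ (x ⊗ adj (nm x y) , ⊝ (y ⊗ adj (nm x y))) ≡ (ι (N (nm x y)) , 0#)
      adj-*′ x y = cong₂ _,_
        (trans (solve 4 (λ e x y a → x :* (x :* a) :+ e :* (y :* (:- (y :* a))) := (x :* x :- e :* (y :* y)) :* a) refl e x y (adj (nm x y))) (adj-* (nm x y)))
        (trans (solve 3 (λ x y a → x :* (:- (y :* a)) :+ y :* (x :* a) := con (+ 0)) refl x y (adj (nm x y))) ι-0)

      N-0′ : ∀ v → N′ N v ≡ + 0 → v ≡ (0# , 0#)
      N-0′ (x , y) h = nm-0 x y (N-0 _ h)

      -- The relative norm of 1 + q v is again 1 plus a multiple of q in R, so the congruence for R
      -- applies.
      N-cong′ : ∀ q v → ∃[ w ] (N′ N ((1# , 0#) ⊕′ ((ι q , 0#) ⊗′ v)) ≡ + 1 + q * w)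
      N-cong′ q (x , y) with N-cong q (ι (+ 2) ⊗ x ⊕ ι q ⊗ (x ⊗ x ⊖ e ⊗ (y ⊗ y)))
      ... | w , h = w , trans (cong (N′ N) (cong ((1# , 0#) ⊕′_) (scal (ι q) x y))) (trans (cong N eq) h)
        where
        eq : nm (1# ⊕ ι q ⊗ x) (0# ⊕ ι q ⊗ y) ≡ 1# ⊕ ι q ⊗ (ι (+ 2) ⊗ x ⊕ ι q ⊗ (x ⊗ x ⊖ e ⊗ (y ⊗ y)))
        eq = trans (cong₂ (λ o z → nm (o ⊕ ι q ⊗ x) (z ⊕ ι q ⊗ y)) (sym ι-1) (sym ι-0))
          (trans (solve 4 (λ e q x y → (con (+ 1) :+ q :* x) :* (con (+ 1) :+ q :* x) :- e :* ((con (+ 0) :+ q :* y) :* (con (+ 0) :+ q :* y))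
             := con (+ 1) :+ q :* (con (+ 2) :* x :+ q :* (x :* x :- e :* (y :* y)))) refl e (ι q) x y)
             (cong (_⊕ ι q ⊗ (ι (+ 2) ⊗ x ⊕ ι q ⊗ (x ⊗ x ⊖ e ⊗ (y ⊗ y)))) ι-1))

      ‖⊕‖′ : ∀ v w → ‖ v ⊕′ w ‖′ ℕ.≤ ‖ v ‖′ ℕ.+ ‖ w ‖′
      ‖⊕‖′ (x , y) (z , w) = ℕP.⊔-lub
        (ℕP.≤-trans (‖⊕‖ x z) (ℕP.+-mono-≤ (ℕP.m≤m⊔n ‖ x ‖ ‖ y ‖) (ℕP.m≤m⊔n ‖ z ‖ ‖ w ‖)))
        (ℕP.≤-trans (‖⊕‖ y w) (ℕP.+-mono-≤ (ℕP.m≤n⊔m ‖ x ‖ ‖ y ‖) (ℕP.m≤n⊔m ‖ z ‖ ‖ w ‖)))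

      ‖⊗‖′ : ∀ v w → ‖ v ⊗′ w ‖′ ℕ.≤ Cm′ ℕ.* (‖ v ‖′ ℕ.* ‖ w ‖′)
      ‖⊗‖′ (x , y) (z , w) = ℕP.⊔-lub
        (begin
          ‖ x ⊗ z ⊕ e ⊗ (y ⊗ w) ‖ ≤⟨ ‖⊕‖ _ _ ⟩
          ‖ x ⊗ z ‖ ℕ.+ ‖ e ⊗ (y ⊗ w) ‖ ≤⟨ ℕP.+-mono-≤ (‖⊗‖ x z) (‖e⊗‖ y w) ⟩
          Cm ℕ.* (‖ x ‖ ℕ.* ‖ z ‖) ℕ.+ c₁ ℕ.* (‖ y ‖ ℕ.* ‖ w ‖) ≤⟨ ℕP.+-mono-≤ (ℕP.*-monoʳ-≤ Cm (ℕP.*-mono-≤ x≤ z≤)) (ℕP.*-monoʳ-≤ c₁ (ℕP.*-mono-≤ y≤ w≤)) ⟩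
          Cm ℕ.* p ℕ.+ c₁ ℕ.* p ≡⟨ sym (ℕP.*-distribʳ-+ p Cm c₁) ⟩
          (Cm ℕ.+ c₁) ℕ.* p ≤⟨ ℕP.*-monoˡ-≤ p (ℕP.m≤m+n (Cm ℕ.+ c₁) (Cm ℕ.+ Cm)) ⟩
          Cm′ ℕ.* p ∎)
        (begin
          ‖ x ⊗ w ⊕ y ⊗ z ‖ ≤⟨ ‖⊕‖ _ _ ⟩
          ‖ x ⊗ w ‖ ℕ.+ ‖ y ⊗ z ‖ ≤⟨ ℕP.+-mono-≤ (‖⊗‖ x w) (‖⊗‖ y z) ⟩
          Cm ℕ.* (‖ x ‖ ℕ.* ‖ w ‖) ℕ.+ Cm ℕ.* (‖ y ‖ ℕ.* ‖ z ‖) ≤⟨ ℕP.+-mono-≤ (ℕP.*-monoʳ-≤ Cm (ℕP.*-mono-≤ x≤ w≤)) (ℕP.*-monoʳ-≤ Cm (ℕP.*-mono-≤ y≤ z≤)) ⟩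
          Cm ℕ.* p ℕ.+ Cm ℕ.* p ≡⟨ sym (ℕP.*-distribʳ-+ p Cm Cm) ⟩
          (Cm ℕ.+ Cm) ℕ.* p ≤⟨ ℕP.*-monoˡ-≤ p (ℕP.m≤n+m (Cm ℕ.+ Cm) (Cm ℕ.+ c₁)) ⟩
          Cm′ ℕ.* p ∎)
        where
        open ℕP.≤-Reasoning
        p : ℕ
        p = (‖ x ‖ ℕ.⊔ ‖ y ‖) ℕ.* (‖ z ‖ ℕ.⊔ ‖ w ‖)
        x≤ : ‖ x ‖ ℕ.≤ ‖ x , y ‖′
        x≤ = ℕP.m≤m⊔n ‖ x ‖ ‖ y ‖
        y≤ : ‖ y ‖ ℕ.≤ ‖ x , y ‖′
        y≤ = ℕP.m≤n⊔m ‖ x ‖ ‖ y ‖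
        z≤ : ‖ z ‖ ℕ.≤ ‖ z , w ‖′
        z≤ = ℕP.m≤m⊔n ‖ z ‖ ‖ w ‖
        w≤ : ‖ w ‖ ℕ.≤ ‖ z , w ‖′
        w≤ = ℕP.m≤n⊔m ‖ z ‖ ‖ w ‖

      ‖ι⊗‖′ : ∀ q v → ‖ (ι q , 0#) ⊗′ v ‖′ ≡ ∣ q ∣ ℕ.* ‖ v ‖′
      ‖ι⊗‖′ q (x , y) = trans (cong ‖_‖′ (scal (ι q) x y)) (trans (cong₂ ℕ._⊔_ (‖ι⊗‖ q x) (‖ι⊗‖ q y)) (sym (ℕP.*-distribˡ-⊔ ∣ q ∣ ‖ x ‖ ‖ y ‖)))

      N≤′ : ∀ v → ∣ N′ N v ∣ ℕ.≤ C₀ ℕ.* Cn ℕ.^ D ℕ.* ‖ v ‖′ ℕ.^ (D ℕ.+ D)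
      N≤′ (x , y) = begin
        ∣ N (nm x y) ∣ ≤⟨ N≤ (nm x y) ⟩
        C₀ ℕ.* ‖ nm x y ‖ ℕ.^ D ≤⟨ ℕP.*-monoʳ-≤ C₀ (ℕP.^-monoˡ-≤ D (‖nm‖ x y)) ⟩
        C₀ ℕ.* (Cn ℕ.* (b ℕ.* b)) ℕ.^ D ≡⟨ cong (C₀ ℕ.*_) (^-distribʳ-* D Cn (b ℕ.* b)) ⟩
        C₀ ℕ.* (Cn ℕ.^ D ℕ.* (b ℕ.* b) ℕ.^ D) ≡⟨ sym (ℕP.*-assoc C₀ (Cn ℕ.^ D) _) ⟩
        C₀ ℕ.* Cn ℕ.^ D ℕ.* (b ℕ.* b) ℕ.^ D ≡⟨ cong (C₀ ℕ.* Cn ℕ.^ D ℕ.*_) (dbl b D) ⟩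
        C₀ ℕ.* Cn ℕ.^ D ℕ.* b ℕ.^ (D ℕ.+ D) ∎
        where
        open ℕP.≤-Reasoning
        b : ℕ
        b = ‖ x , y ‖′

    private
      M′ : ℕ
      M′ = suc (M ℕ.* (2 ℕ.+ Cn))

    abstract
      -- The relative norm is v² + z′ with ‖z′‖ ≤ (2 + Cn) v ‖z‖, so it is dominated by the rational
      -- integer v². The additional 1 in `M′` yields ‖z‖ ≤ v, which makes the bound for the
      -- quadratic term linear in ‖z‖.
      dom′ : ∀ v z → M′ ℕ.* ‖ z ‖′ ℕ.≤ v → v ℕ.^ (D ℕ.+ D) ℕ.≤ 2 ℕ.* ∣ N′ N ((ι (+ v) , 0#) ⊕′ z) ∣
      dom′ v (x , y) h = subst₂ (λ a b → a ℕ.≤ 2 ℕ.* ∣ N b ∣) (dbl v D) (sym eq) (dom (v ℕ.* v) z′ (begin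
          M ℕ.* ‖ z′ ‖ ≤⟨ ℕP.*-monoʳ-≤ M z′≤ ⟩
          M ℕ.* ((2 ℕ.+ Cn) ℕ.* (v ℕ.* b)) ≡⟨ l M (2 ℕ.+ Cn) v b ⟩
          v ℕ.* (M ℕ.* (2 ℕ.+ Cn) ℕ.* b) ≤⟨ ℕP.*-monoʳ-≤ v (ℕP.≤-trans (ℕP.m≤n+m _ b) h) ⟩
          v ℕ.* v ∎))
        where
        open ℕP.≤-Reasoning
        b : ℕ
        b = ‖ x , y ‖′
        z′ : C
        z′ = ι (+ 2) ⊗ (ι (+ v) ⊗ x) ⊕ nm x y
        b≤v : b ℕ.≤ v
        b≤v = ℕP.≤-trans (ℕP.m≤m+n b _) h
        z′≤ : ‖ z′ ‖ ℕ.≤ (2 ℕ.+ Cn) ℕ.* (v ℕ.* b)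
        z′≤ = begin
          ‖ z′ ‖ ≤⟨ ‖⊕‖ _ _ ⟩
          ‖ ι (+ 2) ⊗ (ι (+ v) ⊗ x) ‖ ℕ.+ ‖ nm x y ‖ ≡⟨ cong (ℕ._+ ‖ nm x y ‖) (trans (‖ι⊗‖ (+ 2) _) (cong (2 ℕ.*_) (‖ι⊗‖ (+ v) x))) ⟩
          2 ℕ.* (v ℕ.* ‖ x ‖) ℕ.+ ‖ nm x y ‖ ≤⟨ ℕP.+-mono-≤ (ℕP.*-monoʳ-≤ 2 (ℕP.*-monoʳ-≤ v (ℕP.m≤m⊔n ‖ x ‖ ‖ y ‖)))
                                               (ℕP.≤-trans (‖nm‖ x y) (ℕP.*-monoʳ-≤ Cn (ℕP.*-monoˡ-≤ b b≤v))) ⟩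
          2 ℕ.* (v ℕ.* b) ℕ.+ Cn ℕ.* (v ℕ.* b) ≡⟨ sym (ℕP.*-distribʳ-+ (v ℕ.* b) 2 Cn) ⟩
          (2 ℕ.+ Cn) ℕ.* (v ℕ.* b) ∎
        l : ∀ m c v b → m ℕ.* (c ℕ.* (v ℕ.* b)) ≡ v ℕ.* (m ℕ.* c ℕ.* b)
        l = ℕRing.solve-∀
        eq : nm (ι (+ v) ⊕ x) (0# ⊕ y) ≡ ι (+ (v ℕ.* v)) ⊕ z′
        eq = trans (cong (nm (ι (+ v) ⊕ x)) (⊕-idˡ y)) (trans
          (solve 4 (λ e v x y → (v :+ x) :* (v :+ x) :- e :* (y :* y) := v :* v :+ (con (+ 2) :* (v :* x) :+ (x :* x :- e :* (y :* y)))) refl e (ι (+ v)) x y)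
          (cong (_⊕ z′) (trans (sym (ι-* (+ v) (+ v))) (cong ι (sym (ℤP.pos-* v v))))))

    private
      card′ : ℕ → ℕ
      card′ B = card B ℕ.* card B

      box′ : ∀ B → Fin (card′ B) → C′
      box′ B i = box B (proj₁ (remQuot (card B) i)) , box B (proj₂ (remQuot {card B} (card B) i))

    abstract
      box-inj′ : ∀ B i j → box′ B i ≡ box′ B j → i ≡ j
      box-inj′ B i j h = trans (sym (FinP.combine-remQuot {card B} (card B) i)) (trans
        (cong₂ combine (box-inj B _ _ (cong proj₁ h)) (box-inj B _ _ (cong proj₂ h))) (FinP.combine-remQuot {card B} (card B) j))

      enc′ : ∀ B z → ‖ z ‖′ ℕ.< B → Fin (card′ (2 ℕ.* B))
      enc′ B (x , y) h = combine (enc B x (ℕP.≤-<-trans (ℕP.m≤m⊔n ‖ x ‖ ‖ y ‖) h)) (enc B y (ℕP.≤-<-trans (ℕP.m≤n⊔m ‖ x ‖ ‖ y ‖) h))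

      enc-inj′ : ∀ B x y p q → enc′ B x p ≡ enc′ B y q → x ≡ y
      enc-inj′ B (x , y) (z , w) p q h with FinP.combine-injective (enc B x _) (enc B y _) (enc B z _) (enc B w _) h
      ... | h₁ , h₂ = cong₂ _,_ (enc-inj B _ _ _ _ h₁) (enc-inj B _ _ _ _ h₂)

      N-e≢0 : ¬ N e ≡ + 0
      N-e≢0 h = 1≢0 (aniso 0# 1# (trans (⊗-zeroˡ 0#) (sym (trans (cong (_⊗ (1# ⊗ 1#)) (N-0 e h)) (⊗-zeroˡ _)))))
        where
        1≢0 : ¬ 1# ≡ 0#
        1≢0 h with trans (sym (1^ D)) (trans (sym (N-ι (+ 1))) (trans (cong N (trans ι-1 h)) N-0#))
        ... | ()

      e-unit : ∀ {p} → Prime p → ∣ N e ∣ ℕ.< p → ∀ (h : Hom rg p) → ¬ + p ∣ℤ Hom.f h e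
      e-unit {p} pp lt h d = ∤-< N-e≢0 lt
          (subst (+ p ∣ℤ_) (trans (cong f (adj-* e)) (f-ι (N e)))
            (∣-comb (+ 1) (f (adj e)) (f-*ₚ e (adj e)) d (l (f (e ⊗ adj e)) (f e) (f (adj e)))))
          where
          open Hom h
          l : ∀ a b c → a ≡ + 1 * (a - b * c) + c * b
          l = solve-∀

      local-ext : ∀ p → Prime p → S ℕ.+ (2 ℕ.+ ∣ N e ∣) ℕ.< p → ¬ ¬ Local rg′ (N′ N) (D ℕ.+ D) p
      local-ext p pp S<p k = local p pp (ℕP.≤-<-trans (ℕP.m≤m+n S _) S<p) λ loc →
        let module L = LocalExt N pp (∤-< (λ ()) (ℕP.≤-<-trans (ℕP.≤-trans (ℕP.m≤m+n 2 ∣ N e ∣) (ℕP.m≤n+m _ S)) S<p))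
                         (e-unit pp (ℕP.≤-<-trans (ℕP.≤-trans (ℕP.m≤n+m ∣ N e ∣ 2) (ℕP.m≤n+m _ S)) S<p)) loc in
        ¬¬-All (λ h → ∃[ s ] (L.P³ ∣ℤ s * s - Hom.f h e)) (Local.homs loc) λ ds →
        ¬¬-All (λ B → ∃[ s ] Big.K B (s ⊗ s ⊖ e)) (Local.bigs loc) λ es → k (L.local′ ds es)

    Ext : TR
    Ext = record
      { rg = rg′ ; N = N′ N ; D = D ℕ.+ D ; 1≤D = ℕP.≤-trans 1≤D (ℕP.m≤m+n D D)
      ; N-* = N-*′ ; N-ι = N-ι′
      ; adj = λ (x , y) → x ⊗ adj (nm x y) , ⊝ (y ⊗ adj (nm x y)) ; adj-* = λ (x , y) → adj-*′ x y
      ; N-0 = N-0′ ; N-cong = N-cong′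
      ; ‖_‖ = ‖_‖′
      ; ‖ι‖ = λ n → trans (cong (‖ ι n ‖ ℕ.⊔_) ‖0‖) (trans (ℕP.⊔-identityʳ _) (‖ι‖ n))
      ; ‖⊝‖ = λ (x , y) → cong₂ ℕ._⊔_ (‖⊝‖ x) (‖⊝‖ y)
      ; ‖⊕‖ = ‖⊕‖′ ; Cm = Cm′ ; ‖⊗‖ = ‖⊗‖′ ; ‖ι⊗‖ = ‖ι⊗‖′
      ; C₀ = C₀ ℕ.* Cn ℕ.^ D ; N≤ = N≤′ ; M = M′ ; 1≤M = s≤s z≤n ; dom = dom′
      ; card = card′ ; card≡ = λ B → trans (cong₂ ℕ._*_ (card≡ B) (card≡ B)) (sym (ℕP.^-distribˡ-+-* B D D))
      ; box = box′ ; box-inj = box-inj′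
      ; box-< = λ B i → ℕP.⊔-lub (box-< B _) (box-< B _)
      ; box-diff = λ B i j → ℕP.⊔-lub (box-diff B _ _) (box-diff B _ _)
      ; enc = enc′ ; enc-inj = enc-inj′
      ; fl = λ δ (x , y) → fl δ x , fl δ y
      ; fl-≡ = λ δ x y h → ℕP.⊔-lub (fl-≡ δ _ _ (cong proj₁ h)) (fl-≡ δ _ _ (cong proj₂ h))
      ; fl-≤ = λ δ g (x , y) h → ℕP.⊔-lub (fl-≤ δ g x (ℕP.≤-<-trans (ℕP.m≤m⊔n _ _) h)) (fl-≤ δ g y (ℕP.≤-<-trans (ℕP.m≤n⊔m ‖ x ‖ _) h))
      -- This leaves out 2 and the primes dividing N e, where Hensel's lemma may fail.
      ; S = S ℕ.+ (2 ℕ.+ ∣ N e ∣) ; local = local-ext }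

open Extension

-- Counting lattice points of square-free norm

module Counting where
  cnt : ∀ {n} {P : Fin n → Set} → (∀ i → Dec (P i)) → ℕ
  cnt {zero} P? = 0
  cnt {suc n} P? with P? zero
  ... | yes _ = suc (cnt (λ i → P? (suc i)))
  ... | no _ = cnt (λ i → P? (suc i))

  enum : ∀ {n} {P : Fin n → Set} (P? : ∀ i → Dec (P i)) → Fin (cnt P?) → ∃ P
  enum {suc n} P? k with P? zero
  enum {suc n} P? zero | yes p = zero , p
  enum {suc n} P? (suc k) | yes p = let i , q = enum (λ i → P? (suc i)) k in suc i , q
  enum {suc n} P? k | no _ = let i , q = enum (λ i → P? (suc i)) k in suc i , q

  enum-inj : ∀ {n} {P : Fin n → Set} (P? : ∀ i → Dec (P i)) k l → proj₁ (enum P? k) ≡ proj₁ (enum P? l) → k ≡ l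
  enum-inj {suc n} P? k l e with P? zero
  enum-inj {suc n} P? zero zero e | yes p = refl
  enum-inj {suc n} P? (suc k) (suc l) e | yes p = cong suc (enum-inj (λ i → P? (suc i)) k l (FinP.suc-injective e))
  enum-inj {suc n} P? k l e | no _ = enum-inj (λ i → P? (suc i)) k l (FinP.suc-injective e)

  cnt-inj : ∀ {n m} {P : Fin n → Set} (P? : ∀ i → Dec (P i)) (f : ∀ i → P i → Fin m) →
            (∀ i j p q → f i p ≡ f j q → i ≡ j) → cnt P? ℕ.≤ m
  cnt-inj P? f f-inj = FinP.injective⇒≤ {f = λ k → f (proj₁ (enum P? k)) (proj₂ (enum P? k))}
    λ {k} {l} e → enum-inj P? k l (f-inj _ _ _ _ e)

  cnt-compl : ∀ {n} {P : Fin n → Set} (P? : ∀ i → Dec (P i)) → cnt P? ℕ.+ cnt (λ i → ¬? (P? i)) ≡ n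
  cnt-compl {zero} P? = refl
  cnt-compl {suc n} P? with P? zero
  ... | yes _ = cong suc (cnt-compl (λ i → P? (suc i)))
  ... | no _ = trans (ℕP.+-suc _ _) (cong suc (cnt-compl (λ i → P? (suc i))))

  cnt-⊎ : ∀ {n} {P Q : Fin n → Set} (P? : ∀ i → Dec (P i)) (Q? : ∀ i → Dec (Q i)) →
          cnt (λ i → P? i ⊎-dec Q? i) ℕ.≤ cnt P? ℕ.+ cnt Q?
  cnt-⊎ {zero} P? Q? = z≤n
  cnt-⊎ {suc n} P? Q? with P? zero | Q? zero | cnt-⊎ (λ i → P? (suc i)) (λ i → Q? (suc i))
  ... | yes _ | yes _ | ih = s≤s (ℕP.≤-trans ih (ℕP.+-monoʳ-≤ _ (ℕP.n≤1+n _)))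
  ... | yes _ | no _ | ih = s≤s ih
  ... | no _ | yes _ | ih = ℕP.≤-trans (s≤s ih) (ℕP.≤-reflexive (sym (ℕP.+-suc _ _)))
  ... | no _ | no _ | ih = ih

  sumTo : ℕ → (ℕ → ℕ) → ℕ
  sumTo zero f = 0
  sumTo (suc n) f = sumTo n f ℕ.+ f n

  module _ {m : ℕ} {Q : ℕ → Fin m → Set} (Q? : ∀ k i → Dec (Q k i)) where
    Union : ℕ → Fin m → Set
    Union zero i = ⊥
    Union (suc n) i = Union n i ⊎ Q n i

    union? : ∀ n i → Dec (Union n i)
    union? zero i = no λ ()
    union? (suc n) i = union? n i ⊎-dec Q? n i

    cnt-union : ∀ n → cnt (union? n) ℕ.≤ sumTo n (λ k → cnt (Q? k))
    cnt-union zero = ℕP.≤-reflexive (cnt-0 (union? zero) λ _ ())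
      where
      cnt-0 : ∀ {n} {P : Fin n → Set} (P? : ∀ i → Dec (P i)) → (∀ i → ¬ P i) → cnt P? ≡ 0
      cnt-0 {zero} P? np = refl
      cnt-0 {suc n} P? np with P? zero
      ... | yes p = contradiction p (np zero)
      ... | no _ = cnt-0 (λ i → P? (suc i)) (λ i → np (suc i))
    cnt-union (suc n) = ℕP.≤-trans (cnt-⊎ (union? n) (Q? n)) (ℕP.+-monoˡ-≤ _ (cnt-union n))

    union-intro : ∀ n k i → k ℕ.< n → Q k i → Union n i
    union-intro (suc n) k i k<n q with ℕP.m≤n⇒m<n∨m≡n (ℕP.≤-pred k<n)
    ... | inj₁ lt = inj₁ (union-intro n k i lt q)
    ... | inj₂ refl = inj₂ q

  -- The tail of Σ 1/p², in the integral form S(S+k) Σ ≤ Y k obtained from 1/n² ≤ 1/(n-1) - 1/n.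
  module _ (S Y c : ℕ) (x : ℕ → ℕ)
           (hx : ∀ j → x j ℕ.≤ c ⊎ x j ℕ.* (suc (S ℕ.+ j) ℕ.* suc (S ℕ.+ j)) ℕ.≤ Y) (1≤S : 1 ℕ.≤ S) where
    open Nat using (_+_; _*_; _≤_)
    private
      tail : ∀ k → S * (S + k) * sumTo k x ≤ Y * k + S * (S + k) * (k * c)
      tail zero = ℕP.≤-trans (ℕP.≤-reflexive (ℕP.*-zeroʳ (S * (S + 0)))) z≤n
      tail (suc k) = ℕP.*-cancelˡ-≤ P {{ℕ.>-nonZero (ℕP.≤-trans 1≤S (ℕP.m≤m+n S k))}} (begin
          P * (S * (S + suc k) * (σ + x k)) ≡⟨ cong (λ z → P * (S * z * (σ + x k))) (ℕP.+-suc S k) ⟩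
          P * (S * suc P * (σ + x k)) ≡⟨ l₁ P S σ (x k) ⟩
          suc P * (S * P * σ) + S * (P * suc P * x k) ≤⟨ ℕP.+-monoˡ-≤ _ (ℕP.*-monoʳ-≤ (suc P) (tail k)) ⟩
          suc P * (Y * k + S * P * (k * c)) + S * (P * suc P * x k) ≤⟨ ℕP.+-monoʳ-≤ (suc P * (Y * k + S * P * (k * c))) last ⟩
          suc P * (Y * k + S * P * (k * c)) + (S * Y + S * (P * suc P * c)) ≡⟨ l₂ S k Y c ⟩
          P * (Y * suc k + S * suc P * (suc k * c)) ≡⟨ cong (λ z → P * (Y * suc k + S * z * (suc k * c))) (sym (ℕP.+-suc S k)) ⟩
          P * (Y * suc k + S * (S + suc k) * (suc k * c)) ∎)
        where
        open ℕP.≤-Reasoning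
        P = S + k
        σ = sumTo k x
        l₁ : ∀ P S σ x → P * (S * suc P * (σ + x)) ≡ suc P * (S * P * σ) + S * (P * suc P * x)
        l₁ = ℕRing.solve-∀
        l₂ : ∀ S k Y c → suc (S + k) * (Y * k + S * (S + k) * (k * c)) + (S * Y + S * ((S + k) * suc (S + k) * c)) ≡
             (S + k) * (Y * suc k + S * suc (S + k) * (suc k * c))
        l₂ = ℕRing.solve-∀
        last : S * (P * suc P * x k) ≤ S * Y + S * (P * suc P * c)
        last with hx k
        ... | inj₁ h = ℕP.≤-trans (ℕP.*-monoʳ-≤ S (ℕP.*-monoʳ-≤ (P * suc P) h)) (ℕP.m≤n+m _ (S * Y))
        ... | inj₂ h = ℕP.≤-trans (ℕP.*-monoʳ-≤ S (ℕP.≤-trans (ℕP.≤-trans (ℕP.*-monoˡ-≤ (x k) (ℕP.*-monoˡ-≤ (suc P) (ℕP.n≤1+n P)))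
                         (ℕP.≤-reflexive (ℕP.*-comm _ (x k)))) h)) (ℕP.m≤m+n _ _)

    tail-sum : ∀ k → S * sumTo k x ≤ Y + S * (k * c)
    tail-sum k = ℕP.*-cancelˡ-≤ (S + k) {{ℕ.>-nonZero (ℕP.≤-trans 1≤S (ℕP.m≤m+n S k))}} (begin
        (S + k) * (S * σ) ≡⟨ l₁ S k σ ⟩
        S * (S + k) * σ ≤⟨ tail k ⟩
        Y * k + S * (S + k) * (k * c) ≤⟨ ℕP.+-monoˡ-≤ _ (ℕP.*-monoʳ-≤ Y (ℕP.m≤n+m k S)) ⟩
        Y * (S + k) + S * (S + k) * (k * c) ≡⟨ l₂ S k Y c ⟩
        (S + k) * (Y + S * (k * c)) ∎)
      where
      open ℕP.≤-Reasoning
      σ = sumTo k x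
      l₁ : ∀ S k σ → (S + k) * (S * σ) ≡ S * (S + k) * σ
      l₁ = ℕRing.solve-∀
      l₂ : ∀ S k Y c → Y * (S + k) + S * (S + k) * (k * c) ≡ (S + k) * (Y + S * (k * c))
      l₂ = ℕRing.solve-∀

  prodFin : ∀ {r} → (Fin r → ℤ) → ℤ
  prodFin {zero} f = + 1
  prodFin {suc r} f = f zero ℤ.* prodFin (λ i → f (suc i))

  prodFin-∣ : ∀ {r d} (f : Fin r → ℤ) i → d ∣ℤ f i → d ∣ℤ prodFin f
  prodFin-∣ f zero h = ∣*ʳ _ h
  prodFin-∣ f (suc i) h = ∣*ˡ (f zero) (prodFin-∣ (λ i → f (suc i)) i h)

  prodFin-∣₂ : ∀ {r d e} (f : Fin r → ℤ) i j → ¬ i ≡ j → d ∣ℤ f i → e ∣ℤ f j → d ℤ.* e ∣ℤ prodFin f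
  prodFin-∣₂ f zero zero ne _ _ = contradiction refl ne
  prodFin-∣₂ f zero (suc j) ne h k = *-∣-* h (prodFin-∣ _ j k)
  prodFin-∣₂ {d = d} {e} f (suc i) zero ne h k = subst (_∣ℤ prodFin f) (ℤP.*-comm e d) (*-∣-* k (prodFin-∣ _ i h))
  prodFin-∣₂ f (suc i) (suc j) ne h k = ∣*ˡ (f zero) (prodFin-∣₂ _ i j (ne ∘ cong suc) h k)

  prodFin-* : ∀ {r} (f g : Fin r → ℤ) → prodFin (λ i → f i ℤ.* g i) ≡ prodFin f ℤ.* prodFin g
  prodFin-* {zero} f g = refl
  prodFin-* {suc r} f g = trans (cong (f zero ℤ.* g zero ℤ.*_) (prodFin-* (λ i → f (suc i)) (λ i → g (suc i)))) (l (f zero) (g zero) (prodFin (λ i → f (suc i))) (prodFin (λ i → g (suc i))))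
    where
    l : ∀ a b c d → a ℤ.* b ℤ.* (c ℤ.* d) ≡ a ℤ.* c ℤ.* (b ℤ.* d)
    l = solve-∀

  p∤! : ∀ {p} → Prime p → ∀ T → T ℕ.< p → ¬ + p ∣ℤ + (T !)
  p∤! pp zero _ d = p∤1 pp d
  p∤! {p} pp (suc T) T<p d with euclid pp (+ suc T) (+ (T !)) (subst (+ p ∣ℤ_) (ℤP.pos-* (suc T) (T !)) d)
  ... | inj₁ d′ = ∤-< (λ ()) T<p d′
  ... | inj₂ d′ = p∤! pp T (ℕP.<-trans ℕP.≤-refl T<p) d′

  abstract
    ²-cancel : ∀ {p} → Prime p → ∀ a b → ¬ + p ∣ℤ a → + p ℤ.* + p ∣ℤ a ℤ.* b → + p ℤ.* + p ∣ℤ b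
    ²-cancel pp a b na d with inverse pp a na
    ... | v , hv = ∣-comb {a = (a ℤ.* b) ℤ.* (v ℤ.* (+ 2 ℤ.- a ℤ.* v))} (+ 1) b (∣*ʳ _ d) (*-∣-* hv hv) (l a b v)
      where
      l : ∀ a b v → b ≡ + 1 ℤ.* ((a ℤ.* b) ℤ.* (v ℤ.* (+ 2 ℤ.- a ℤ.* v))) ℤ.+ b ℤ.* ((+ 1 ℤ.- a ℤ.* v) ℤ.* (+ 1 ℤ.- a ℤ.* v))
      l = solve-∀

    cancel-p : ∀ {p} → Prime p → ∀ {a b} → + p ℤ.* a ∣ℤ + p ℤ.* b → a ∣ℤ b
    cancel-p {p} pp {a} {b} d = ℤD.*-cancelˡ-∣ (+ p) {{prime⇒nonZero pp}} d

  SqFree : ℤ → Set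
  SqFree n = ∀ p → Prime p → ¬ + p ℤ.* + p ∣ℤ n

  abstract
    -- Remove the prime factors of n one at a time; square-freeness keeps a removed prime from
    -- recurring among the rest.
    sqfree-∣ : ∀ n m → ¬ n ≡ + 0 → SqFree n → (∀ p → Prime p → + p ∣ℤ n → + p ∣ℤ m) → n ∣ℤ m
    sqfree-∣ n m n≢0 sf h with factorise ∣ n ∣ {{ℕ.≢-nonZero λ e → n≢0 (ℤP.∣i∣≡0⇒i≡0 e)}}
    ... | record { factors = ps ; isFactorisation = e ; factorsPrime = pps } =
      ℤD.∣-trans ℤD.m∣∣m∣ (subst (λ z → + z ∣ℤ m) (sym e) (go ps pps (λ p pp d → sf p pp (ℤD.∣-trans (subst (λ z → + p ℤ.* + p ∣ℤ + z) (sym e) d) ℤD.∣m∣∣m)) m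
        λ p pp d → h p pp (ℤD.∣-trans (subst (λ z → + p ∣ℤ + z) (sym e) d) ℤD.∣m∣∣m)))
      where
      go : ∀ ps → All Prime ps → SqFree (+ product ps) → ∀ m → (∀ p → Prime p → + p ∣ℤ + product ps → + p ∣ℤ m) → + product ps ∣ℤ m
      go [] [] sf m h = divides m (sym (ℤP.*-identityʳ m))
      go (p ∷ ps) (pp ∷ pps) sf m h with h p pp (subst (+ p ∣ℤ_) (sym (ℤP.pos-* p (product ps))) (∣*ʳ _ ℤD.∣-refl))
      ... | divides m′ refl = subst (_∣ℤ m′ ℤ.* + p) (sym (ℤP.pos-* p (product ps)))
        (subst (+ p ℤ.* + product ps ∣ℤ_) (ℤP.*-comm (+ p) m′) (*-∣-* (ℤD.∣-refl {+ p}) (go ps pps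
          (λ q pq d → sf q pq (subst (_ ∣ℤ_) (sym (ℤP.pos-* p (product ps))) (∣*ˡ (+ p) d))) m′ λ q pq d →
            [ id , (λ q∣p → ⊥-elim (sf p pp (subst (+ p ℤ.* + p ∣ℤ_) (sym (ℤP.pos-* p (product ps)))
                (*-∣-* (ℤD.∣-refl {+ p}) (subst (λ z → + z ∣ℤ + product ps) (prime∣prime pq pp (∣-ℕ q∣p)) d))))) ]′
            (euclid pq m′ (+ p) (h q pq (subst (+ q ∣ℤ_) (sym (ℤP.pos-* p (product ps))) (∣*ˡ (+ p) d)))))))

open Counting

module Positions where
  any→ : ∀ {a p} {A : Set a} {P : A → Set p} {xs : List A} → Any P xs → ∃[ i ] P (lookup xs i)
  any→ (here p) = zero , p
  any→ (there a) = let i , p = any→ a in suc i , p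

  two→ : ∀ {a p} {A : Set a} {P : A → Set p} {xs : List A} → Two P xs →
         ∃[ i ] ∃[ j ] (¬ i ≡ j × P (lookup xs i) × P (lookup xs j))
  two→ (both p a) = let j , q = any→ a in zero , suc j , (λ ()) , p , q
  two→ (skip t) = let i , j , ne , p , q = two→ t in suc i , suc j , ne ∘ FinP.suc-injective , p , q

  Π-prodFin : ∀ R {p} (hs : List (Hom R p)) z → Π R hs z ≡ prodFin (λ i → Hom.f (lookup hs i) z)
  Π-prodFin R [] z = refl
  Π-prodFin R (h ∷ hs) z = cong (Hom.f h z ℤ.*_) (Π-prodFin R hs z)

open Positions

-- The points pt B u = 1 + Q (M B + u), u in a box of side B, have norms ≍ (Q M B)^D free of small
-- primes. Those whose norm is divisible by some p² lie in few lattices of large index, so at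
-- most half of the points are lost.
module Points (R : TR) (T : ℕ) (1≤T : 1 ℕ.≤ T) where
  open TR R
  open Nat using (_+_; _*_; _≤_; _<_; _^_)

  Q : ℕ
  Q = T !

  pt : ∀ B → Fin (card B) → C
  pt B u = ι (+ suc (Q * M * B)) ⊕ ι (+ Q) ⊗ box B u

  abstract
    pt-form : ∀ B u → pt B u ≡ 1# ⊕ ι (+ Q) ⊗ (ι (+ (M * B)) ⊕ box B u)
    pt-form B u = trans (cong (_⊕ ι (+ Q) ⊗ box B u) (trans (ι-+ (+ 1) (+ (Q * M * B))) (cong (ι (+ 1) ⊕_)
        (trans (cong ι (trans (cong +_ (ℕP.*-assoc Q M B)) (ℤP.pos-* Q (M * B)))) (ι-* (+ Q) (+ (M * B)))))))
      (trans (solve 4 (λ o q m b → (o :+ q :* m) :+ q :* b := o :+ q :* (m :+ b)) refl (ι (+ 1)) (ι (+ Q)) (ι (+ (M * B))) (box B u))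
        (cong (_⊕ ι (+ Q) ⊗ (ι (+ (M * B)) ⊕ box B u)) ι-1))

    pt-⊖ : ∀ B u w → pt B u ⊖ pt B w ≡ ι (+ Q) ⊗ (box B u ⊖ box B w)
    pt-⊖ B u w = solve 4 (λ c q a b → (c :+ q :* a) :- (c :+ q :* b) := q :* (a :- b)) refl (ι (+ suc (Q * M * B))) (ι (+ Q)) (box B u) (box B w)

    -- The norm is 1 modulo Q = T!, and every prime up to T divides Q.
    pt-large : ∀ B u p → Prime p → + p ∣ℤ N (pt B u) → T < p
    pt-large B u p pp d = ℕP.≰⇒> λ p≤T → let w , e = N-cong (+ Q) (ι (+ (M * B)) ⊕ box B u) in
      p∤1 pp (∣-comb (+ 1) (ℤ.- w) (subst (+ p ∣ℤ_) (trans (cong N (pt-form B u)) e) d) (ℕ-∣ {p} {+ Q} (∣! (ℕP.<⇒≤ (prime>1 pp)) p≤T)) (l (+ Q) w))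
      where
      l : ∀ q w → + 1 ≡ + 1 ℤ.* (+ 1 ℤ.+ q ℤ.* w) ℤ.+ (ℤ.- w) ℤ.* q
      l = solve-∀

    pt-lower : ∀ B u → (Q * M * B) ^ D ≤ 2 * ∣ N (pt B u) ∣
    pt-lower B u = ℕP.≤-trans (ℕP.^-monoˡ-≤ D (ℕP.n≤1+n _)) (dom (suc (Q * M * B)) (ι (+ Q) ⊗ box B u) (begin
      M * ‖ ι (+ Q) ⊗ box B u ‖ ≡⟨ cong (M *_) (‖ι⊗‖ (+ Q) (box B u)) ⟩
      M * (Q * ‖ box B u ‖) ≤⟨ ℕP.*-monoʳ-≤ M (ℕP.*-monoʳ-≤ Q (ℕP.<⇒≤ (box-< B u))) ⟩
      M * (Q * B) ≡⟨ l M Q B ⟩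
      Q * M * B ≤⟨ ℕP.n≤1+n _ ⟩
      suc (Q * M * B) ∎))
      where
      open ℕP.≤-Reasoning
      l : ∀ m q b → m * (q * b) ≡ q * m * b
      l = ℕRing.solve-∀

    1≤QMB : ∀ B → Fin (card B) → 1 ≤ Q * M * B
    1≤QMB B u = ℕP.*-mono-≤ (ℕP.*-mono-≤ (1≤! T) 1≤M) (ℕP.≤-trans (s≤s z≤n) (box-< B u))

    pt-upper : ∀ B u → ∣ N (pt B u) ∣ ≤ C₀ * (3 * (Q * M * B)) ^ D
    pt-upper B u = ℕP.≤-trans (N≤ (pt B u)) (ℕP.*-monoʳ-≤ C₀ (ℕP.^-monoˡ-≤ D (begin
      ‖ pt B u ‖ ≤⟨ ‖⊕‖ _ _ ⟩
      ‖ ι (+ suc (Q * M * B)) ‖ + ‖ ι (+ Q) ⊗ box B u ‖ ≡⟨ cong₂ _+_ (‖ι‖ _) (‖ι⊗‖ (+ Q) (box B u)) ⟩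
      suc (Q * M * B) + Q * ‖ box B u ‖ ≤⟨ ℕP.+-mono-≤ (ℕP.+-monoˡ-≤ (Q * M * B) (1≤QMB B u)) (ℕP.*-mono-≤ {Q} {Q * M} (ℕP.m≤m*n Q M {{ℕ.>-nonZero 1≤M}}) (ℕP.<⇒≤ (box-< B u))) ⟩
      (Q * M * B + Q * M * B) + Q * M * B ≡⟨ l (Q * M * B) ⟩
      3 * (Q * M * B) ∎)))
      where
      open ℕP.≤-Reasoning
      l : ∀ a → a + a + a ≡ 3 * a
      l = ℕRing.solve-∀

    pt-≢0 : ∀ B u → ¬ N (pt B u) ≡ + 0
    pt-≢0 B u e = ℕP.<⇒≱ (ℕP.≤-trans (1≤^ D (1≤QMB B u)) (pt-lower B u)) (ℕP.≤-reflexive (cong (λ z → 2 * ∣ z ∣) e))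

    N-Q⊗ : ∀ z → N (ι (+ Q) ⊗ z) ≡ (+ Q) ℤ.^ D ℤ.* N z
    N-Q⊗ z = trans (N-* _ _) (cong (ℤ._* N z) (N-ι (+ Q)))

    p∤Q^D : ∀ {p} → Prime p → T < p → ¬ + p ∣ℤ (+ Q) ℤ.^ D
    p∤Q^D pp T<p = ∤-pow pp D (p∤! pp T T<p)

    -- The size bound gives |N z| < d, so the norm is zero. All separation of lattice points rests
    -- on this.
    N-small : ∀ d z δ → + d ∣ℤ N z → ‖ z ‖ < δ → C₀ * δ ^ D < d → z ≡ 0#
    N-small d z δ dz ‖z‖<δ lt = N-0 z (decidable-stable (N z ℤ.≟ + 0) λ ne → ∤-<  {d} ne
      (ℕP.≤-<-trans (ℕP.≤-trans (N≤ z) (ℕP.*-monoʳ-≤ C₀ (ℕP.^-monoˡ-≤ D (ℕP.<⇒≤ ‖z‖<δ)))) lt) dz)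

  -- Rounding to multiples of δ leaves sizes at most g, that is below `suc g`; the factor 2 makes
  -- room for signs.
  cells : ℕ → ℕ
  cells g = card (2 * suc g)

  cell : ∀ B g δ .{{_ : ℕ.NonZero δ}} → g * δ ≡ B → Fin (card B) → Fin (cells g)
  cell B g δ e u = enc (suc g) (fl δ (box B u)) (s≤s (fl-≤ δ g (box B u) (subst (‖ box B u ‖ <_) (sym e) (box-< B u))))

  cell-≡ : ∀ B g δ .{{_ : ℕ.NonZero δ}} (e : g * δ ≡ B) u w → cell B g δ e u ≡ cell B g δ e w → ‖ box B u ⊖ box B w ‖ < δ
  cell-≡ B g δ e u w h = fl-≡ δ _ _ (enc-inj (suc g) _ _ _ _ h)

  box-≡ : ∀ B u w → box B u ⊖ box B w ≡ 0# → u ≡ w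
  box-≡ B u w h = box-inj B u w (⊖-≡ h)

  Bad : ∀ B p → Fin (card B) → Set
  Bad B p u = + p ℤ.* + p ∣ℤ N (pt B u)

  abstract
    Bad? : ∀ B p u → Dec (Bad B p u)
    Bad? B p u = + p ℤ.* + p ℤD.∣? N (pt B u)

  -- One summand for each kind in `Fam`: a double zero at one hom, zeros at a pair of homs, a Big
  -- place.
  NF : ℕ
  NF = D + (D * D + D)

  module Families {p} (pp : Prime p) (loc : Local rg N D p) where
    open Local loc
    P² = + p ℤ.* + p
    lh = length homs
    lb = length bigs

    hom : Fin lh → C → ℤ
    hom i = Hom.f (lookup homs i)

    Fam : Set
    Fam = Fin lh ⊎ (Fin lh × Fin lh ⊎ Fin lb)

    -- That p² divides the norm is not an additive condition. It is covered by boundedly many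
    -- conditions that are closed under subtraction and still imply it.
    Lies : Fam → C → Set
    Lies (inj₁ i) z = P² ∣ℤ hom i z
    Lies (inj₂ (inj₁ (i , j))) z = ¬ i ≡ j × + p ∣ℤ hom i z × + p ∣ℤ hom j z
    Lies (inj₂ (inj₂ b)) z = Big.K (lookup bigs b) z

    J-cover : ∀ z → P² ∣ℤ N z → ∃[ φ ] Lies φ z
    J-cover z d with cover₂ z d
    ... | inj₁ a = let i , k = any→ a in inj₁ i , k
    ... | inj₂ (inj₁ t) = let i , j , k = two→ t in inj₂ (inj₁ (i , j)) , k
    ... | inj₂ (inj₂ b) = let i , k = any→ b in inj₂ (inj₂ i) , k

    hom-⊖ : ∀ {d} i x y → d ∣ℤ hom i x → d ∣ℤ hom i y → d ∣ℤ hom i (x ⊖ y)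
    hom-⊖ i x y a b = subst (_ ∣ℤ_) (sym (Hom.f-⊖ (lookup homs i) x y)) (ℤD.∣m∣n⇒∣m-n a b)

    J-⊖ : ∀ φ x y → Lies φ x → Lies φ y → Lies φ (x ⊖ y)
    J-⊖ (inj₁ i) x y a b = hom-⊖ i x y a b
    J-⊖ (inj₂ (inj₁ (i , j))) x y (ne , a , a′) (_ , b , b′) = ne , hom-⊖ i x y a b , hom-⊖ j x y a′ b′
    J-⊖ (inj₂ (inj₂ i)) x y a b = Big.K-+ B a (Big.K-≡ B (trans (cong (λ o → ⊝ o ⊗ y) ι-1) (trans (solve 2 (λ o y → (:- o) :* y := :- (o :* y)) refl 1# y) (cong ⊝_ (⊗-idˡ y)))) (Big.K-* B (⊝ (ι (+ 1))) b))
      where B = lookup bigs i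

    J-N : ∀ φ z → Lies φ z → P² ∣ℤ N z
    J-N (inj₁ i) z k = prod-∣ z (p²∣cube (+ p)) (subst (P² ∣ℤ_) (sym (Π-prodFin rg homs z)) (prodFin-∣ (λ i → hom i z) i k))
    J-N (inj₂ (inj₁ (i , j))) z (ne , a , b) =
      prod-∣ z (p²∣cube (+ p)) (subst (P² ∣ℤ_) (sym (Π-prodFin rg homs z)) (prodFin-∣₂ (λ i → hom i z) i j ne a b))
    J-N (inj₂ (inj₂ i)) z k = Big.K-N (lookup bigs i) k

    ℓ : ℕ
    ℓ = lh + (lh * lh + lb)

    encF : Fam → Fin ℓ
    encF (inj₁ i) = Fin.join lh _ (inj₁ i)
    encF (inj₂ (inj₁ (i , j))) = Fin.join lh _ (inj₂ (Fin.join (lh * lh) lb (inj₁ (combine i j))))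
    encF (inj₂ (inj₂ b)) = Fin.join lh _ (inj₂ (Fin.join (lh * lh) lb (inj₂ b)))

    decF : Fin ℓ → Fam
    decF k = Data.Sum.map₂ (Data.Sum.map₁ (remQuot lh) ∘ Fin.splitAt (lh * lh)) (Fin.splitAt lh k)

    decF-encF : ∀ φ → decF (encF φ) ≡ φ
    decF-encF (inj₁ i) = cong (Data.Sum.map₂ _) (FinP.splitAt-join lh _ (inj₁ i))
    decF-encF (inj₂ (inj₁ (i , j))) = trans (cong (Data.Sum.map₂ _) (FinP.splitAt-join lh _ (inj₂ (Fin.join (lh * lh) lb (inj₁ (combine i j))))))
      (cong inj₂ (trans (cong (Data.Sum.map₁ (remQuot lh)) (FinP.splitAt-join (lh * lh) lb (inj₁ (combine i j)))) (cong inj₁ (FinP.remQuot-combine i j))))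
    decF-encF (inj₂ (inj₂ b)) = trans (cong (Data.Sum.map₂ _) (FinP.splitAt-join lh _ (inj₂ (Fin.join (lh * lh) lb (inj₂ b)))))
      (cong inj₂ (cong (Data.Sum.map₁ (remQuot lh)) (FinP.splitAt-join (lh * lh) lb (inj₂ b))))

    encF-inj : ∀ φ ψ → encF φ ≡ encF ψ → φ ≡ ψ
    encF-inj φ ψ e = trans (sym (decF-encF φ)) (trans (cong decF e) (decF-encF ψ))

    ℓ≤NF : ℓ ≤ NF
    ℓ≤NF = ℕP.+-mono-≤ lh≤ (ℕP.+-mono-≤ (ℕP.*-mono-≤ lh≤ lh≤) lb≤)
      where
      lh≤ = ℕP.≤-trans (ℕP.m≤m+n lh lb) size
      lb≤ = ℕP.≤-trans (ℕP.m≤n+m lb lh) size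

    module _ (T<p : T < p) B g δ .{{_ : ℕ.NonZero δ}} (e : g * δ ≡ B) (small : C₀ * δ ^ D < p * p) where
      code : ∀ u → Bad B p u → Fin (ℓ * cells g)
      code u d = combine (encF (proj₁ (J-cover (pt B u) d))) (cell B g δ e u)

      -- Two bad points of one family in one cell differ by Q times a vector shorter than δ. Its
      -- norm is divisible by p², Q being prime to p, and C₀ δ^D < p² leaves only zero.
      code-inj : ∀ u w du dw → code u du ≡ code w dw → u ≡ w
      code-inj u w du dw h with FinP.combine-injective (encF (proj₁ (J-cover (pt B u) du))) (cell B g δ e u) (encF (proj₁ (J-cover (pt B w) dw))) (cell B g δ e w) h
      ... | h₁ , h₂ = box-≡ B u w (N-small (p * p) _ δ (subst (_∣ℤ N z) (sym (ℤP.pos-* p p))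
                (²-cancel pp ((+ Q) ℤ.^ D) (N z) (p∤Q^D pp T<p) (subst (P² ∣ℤ_) (trans (cong N (pt-⊖ B u w)) (N-Q⊗ z))
                  (J-N φ (pt B u ⊖ pt B w) (J-⊖ φ _ _ (proj₂ cu) (subst (λ ψ → Lies ψ (pt B w)) (sym (encF-inj φ (proj₁ cw) h₁)) (proj₂ cw)))))))
              (cell-≡ B g δ e u w h₂) small)
        where
        cu = J-cover (pt B u) du
        cw = J-cover (pt B w) dw
        φ = proj₁ cu
        z = box B u ⊖ box B w

      cnt-bad : cnt (Bad? B p) ≤ NF * cells g
      cnt-bad = ℕP.≤-trans (cnt-inj (Bad? B p) code code-inj) (ℕP.*-monoˡ-≤ (cells g) ℓ≤NF)

module Density where
  cnt-mono : ∀ {n} {P Q : Fin n → Set} (P? : ∀ i → Dec (P i)) (Q? : ∀ i → Dec (Q i)) →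
             (∀ i → P i → Q i) → cnt P? ℕ.≤ cnt Q?
  cnt-mono {zero} P? Q? h = z≤n
  cnt-mono {suc n} P? Q? h with P? zero | Q? zero | cnt-mono (λ i → P? (suc i)) (λ i → Q? (suc i)) (λ i → h (suc i))
  ... | yes _ | yes _ | ih = s≤s ih
  ... | yes p | no nq | _ = contradiction (h zero p) nq
  ... | no _ | yes _ | ih = ℕP.m≤n⇒m≤1+n ih
  ... | no _ | no _ | ih = ih

  open Nat using (_+_; _*_; _≤_; _<_; _^_)

  -- The largest dyadic side 2^j ≤ 2^m for which boxes of that side separate a lattice of index q.
  level : ∀ C D q m → C < q → ∃[ j ] ∃[ j′ ] (j + j′ ≡ m × C * (2 ^ j) ^ D < q × (j′ ≡ 0 ⊎ q ≤ C * (2 ^ suc j) ^ D))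
  level C D q zero C<q = 0 , 0 , refl , subst (_< q) (sym (trans (cong (C *_) (ℕP.^-zeroˡ D)) (ℕP.*-identityʳ C))) C<q , inj₁ refl
  level C D q (suc m) C<q with C * (2 ^ suc m) ^ D ℕ.<? q
  ... | yes lt = suc m , 0 , ℕP.+-identityʳ _ , lt , inj₁ refl
  ... | no ge with level C D q m C<q
  ...   | j , j′ , e , lt , inj₂ h = j , suc j′ , trans (ℕP.+-suc j j′) (cong suc e) , lt , inj₂ h
  ...   | j , zero , e , lt , inj₁ refl = j , 1 , trans (ℕP.+-suc j 0) (cong suc e) , lt ,
              inj₂ (subst (λ z → q ≤ C * (2 ^ suc z) ^ D) (trans (sym e) (ℕP.+-identityʳ j)) (ℕP.≮⇒≥ ge))

  module FewCollisions (R : TR) (T : ℕ) (1≤T : 1 ≤ T) (S≤T : TR.S R ≤ T) (C₀≤T : TR.C₀ R ≤ T) where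
    open TR R
    open Points R T 1≤T public

    -- `c` is the bound when δ is the whole side, i.e. g = 1. `W` belongs to the other case and
    -- combines cells g ≤ (4 g)^D with p² ≤ C₀ (2 δ)^D and g δ = B. The norms of the points are at
    -- most β B^D.
    c W β : ℕ
    c = NF * cells 1
    W = NF * (4 ^ D * (C₀ * 2 ^ D))
    β = C₀ * (3 * (Q * M)) ^ D

    cells≤ : ∀ g → 1 ≤ g → cells g ≤ 4 ^ D * g ^ D
    cells≤ g 1≤g = begin
      card (2 * suc g) ≡⟨ card≡ _ ⟩
      (2 * suc g) ^ D ≤⟨ ℕP.^-monoˡ-≤ D (ℕP.≤-trans (ℕP.*-monoʳ-≤ 2 (ℕP.+-monoˡ-≤ g 1≤g)) (ℕP.≤-reflexive (l g))) ⟩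
      (4 * g) ^ D ≡⟨ ^-distribʳ-* D 4 g ⟩
      4 ^ D * g ^ D ∎
      where
      open ℕP.≤-Reasoning
      l : ∀ g → 2 * (g + g) ≡ 4 * g
      l = ℕRing.solve-∀

    module Scale (m : ℕ) where
      B : ℕ
      B = 2 ^ m

      estimate : ∀ p → Prime p → T < p → cnt (Bad? B p) ≤ c ⊎ cnt (Bad? B p) * (p * p) ≤ W * B ^ D
      estimate p pp T<p = decidable-stable (_ ℕ.≤? _ ⊎-dec _ ℕ.≤? _) λ k → local p pp (ℕP.≤-<-trans S≤T T<p) (k ∘ go)
        where
        open ℕP.≤-Reasoning
        p≤p² : p ≤ p * p
        p≤p² = ℕP.m≤m*n p p {{prime⇒nonZero pp}}
        go : Local rg N D p → cnt (Bad? B p) ≤ c ⊎ cnt (Bad? B p) * (p * p) ≤ W * B ^ D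
        go loc with level C₀ D (p * p) m (ℕP.≤-<-trans C₀≤T (ℕP.<-≤-trans T<p p≤p²))
        ... | j , j′ , e , lt , alt = [ (λ { refl → inj₁ bound }) , (λ h → inj₂ (begin
              cnt (Bad? B p) * (p * p) ≤⟨ ℕP.*-mono-≤ bound h ⟩
              NF * cells g * (C₀ * (2 ^ suc j) ^ D) ≤⟨ ℕP.*-monoˡ-≤ _ (ℕP.*-monoʳ-≤ NF (cells≤ g (1≤^ j′ (s≤s z≤n)))) ⟩
              NF * (4 ^ D * g ^ D) * (C₀ * (2 * δ) ^ D) ≡⟨ cong (λ z → NF * (4 ^ D * g ^ D) * (C₀ * z)) (^-distribʳ-* D 2 δ) ⟩
              NF * (4 ^ D * g ^ D) * (C₀ * (2 ^ D * δ ^ D)) ≡⟨ l NF (4 ^ D) (g ^ D) C₀ (2 ^ D) (δ ^ D) ⟩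
              W * (g ^ D * δ ^ D) ≡⟨ cong (W *_) (trans (sym (^-distribʳ-* D g δ)) (cong (_^ D) gδ)) ⟩
              W * B ^ D ∎)) ]′ alt
          where
          g = 2 ^ j′
          δ = 2 ^ j
          instance _ = ℕP.m^n≢0 2 j
          gδ : g * δ ≡ B
          gδ = trans (ℕP.*-comm g δ) (trans (sym (ℕP.^-distribˡ-+-* 2 j j′)) (cong (2 ^_) e))
          bound : cnt (Bad? B p) ≤ NF * cells g
          bound = Families.cnt-bad pp loc T<p B g δ gδ lt
          l : ∀ n f g c t d → n * (f * g) * (c * (t * d)) ≡ n * (f * (c * t)) * (g * d)
          l = ℕRing.solve-∀

      BadP : ℕ → Fin (card B) → Set
      BadP k u = Prime (suc (T + k)) × Bad B (suc (T + k)) u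

      abstract
        badP? : ∀ k u → Dec (BadP k u)
        badP? k u = prime? (suc (T + k)) ×-dec Bad? B (suc (T + k)) u

      -- The index k stands for the integer T + k + 1; one that is not prime has no bad points.
      estimate′ : ∀ k → cnt (badP? k) ≤ c ⊎ cnt (badP? k) * (suc (T + k) * suc (T + k)) ≤ W * B ^ D
      estimate′ k = aux (prime? (suc (T + k)))
        where
        aux : Dec (Prime (suc (T + k))) → _
        aux (no np) = inj₁ (ℕP.≤-trans (cnt-inj (badP? k) (λ _ x → ⊥-elim (np (proj₁ x))) (λ _ _ p _ _ → ⊥-elim (np (proj₁ p)))) (z≤n {c}))
        aux (yes pp) = Data.Sum.map (ℕP.≤-trans mono) (ℕP.≤-trans (ℕP.*-monoˡ-≤ (suc (T + k) * suc (T + k)) mono))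
          (estimate (suc (T + k)) pp (s≤s (ℕP.m≤m+n T k)))
          where mono = cnt-mono (badP? k) (Bad? B (suc (T + k))) (λ _ → proj₂)

    -- Square side, so that the primes with p² ≤ β B^D number at most β b^D.
    module Square (W≤T : 4 * W ≤ T) (m : ℕ) (large : 4 * (β * c) ≤ (2 ^ m) ^ D) where
      open Scale (m + m) public
      b = 2 ^ m
      K = β * b ^ D

      B≡ : B ≡ b * b
      B≡ = ℕP.^-distribˡ-+-* 2 m m

      B^D : B ^ D ≡ b ^ D * b ^ D
      B^D = trans (cong (_^ D) B≡) (^-distribʳ-* D b b)

      IsGood : Fin (card B) → Set
      IsGood u = ¬ Union badP? K u

      good? : ∀ u → Dec (IsGood u)
      good? u = ¬? (union? badP? K u)

      -- Indices in the first alternative of `estimate′` cost at most K c ≤ B^D / 4 together, by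
      -- `large`; the others at most W B^D / T ≤ B^D / 4, by the tail of the sum of inverse squares.
      sum-bad : 4 * sumTo K (λ k → cnt (badP? k)) ≤ 2 * B ^ D
      sum-bad = ℕP.*-cancelˡ-≤ T {{ℕ.>-nonZero 1≤T}} (begin
        T * (4 * σ) ≡⟨ l₁ T σ ⟩
        4 * (T * σ) ≤⟨ ℕP.*-monoʳ-≤ 4 (tail-sum T (W * B ^ D) c (λ k → cnt (badP? k)) estimate′ 1≤T K) ⟩
        4 * (W * B ^ D + T * (K * c)) ≡⟨ l₂ W (B ^ D) T β (b ^ D) c ⟩
        4 * W * B ^ D + T * (4 * (β * c) * b ^ D) ≤⟨ ℕP.+-mono-≤ (ℕP.*-monoˡ-≤ (B ^ D) W≤T) (ℕP.*-monoʳ-≤ T (ℕP.*-monoˡ-≤ (b ^ D) large)) ⟩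
        T * B ^ D + T * (b ^ D * b ^ D) ≡⟨ cong (λ z → T * B ^ D + T * z) (sym B^D) ⟩
        T * B ^ D + T * B ^ D ≡⟨ l₃ T (B ^ D) ⟩
        T * (2 * B ^ D) ∎)
        where
        open ℕP.≤-Reasoning
        σ = sumTo K (λ k → cnt (badP? k))
        l₁ : ∀ t s → t * (4 * s) ≡ 4 * (t * s)
        l₁ = ℕRing.solve-∀
        l₂ : ∀ w x t β b c → 4 * (w * x + t * (β * b * c)) ≡ 4 * w * x + t * (4 * (β * c) * b)
        l₂ = ℕRing.solve-∀
        l₃ : ∀ t x → t * x + t * x ≡ t * (2 * x)
        l₃ = ℕRing.solve-∀

      good-many : card B ≤ 2 * cnt good?
      good-many = ℕP.+-cancelʳ-≤ (card B) _ _ (begin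
        card B + card B ≡⟨ cong₂ _+_ (sym (cnt-compl (union? badP? K))) (sym (cnt-compl (union? badP? K))) ⟩
        (x + y) + (x + y) ≡⟨ l x y ⟩
        2 * y + 2 * x ≤⟨ ℕP.+-monoʳ-≤ (2 * y) (ℕP.*-monoʳ-≤ 2 (cnt-union badP? K)) ⟩
        2 * y + 2 * sumTo K (λ k → cnt (badP? k)) ≤⟨ ℕP.+-monoʳ-≤ (2 * y) (ℕP.*-cancelˡ-≤ 2 (ℕP.≤-trans (ℕP.≤-reflexive (sym (ℕP.*-assoc 2 2 (sumTo K (λ k → cnt (badP? k)))))) sum-bad)) ⟩
        2 * y + B ^ D ≡⟨ cong (λ z → 2 * y + z) (sym (card≡ B)) ⟩
        2 * y + card B ∎)
        where
        open ℕP.≤-Reasoning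
        x = cnt (union? badP? K)
        y = cnt good?
        l : ∀ x y → (x + y) + (x + y) ≡ 2 * y + 2 * x
        l = ℕRing.solve-∀

      -- A square p² dividing the norm is at most β B^D ≤ K², so p ≤ K. Together with p > T this
      -- puts p in the range that was sieved.
      good-sqfree : ∀ u → IsGood u → SqFree (N (pt B u))
      good-sqfree u g p pp d = g (union-intro badP? K k u k<K (subst (λ q → Prime q × Bad B q u) (sym p≡) (pp , d)))
        where
        T<p : T < p
        T<p = pt-large B u p pp (ℤD.∣-trans (divides (+ p) refl) d)
        k = p ℕ.∸ suc T
        p≡ : suc (T + k) ≡ p
        p≡ = ℕP.m+[n∸m]≡n T<p
        open ℕP.≤-Reasoning
        pp≤ : p * p ≤ ∣ N (pt B u) ∣
        pp≤ = ℕD.∣⇒≤ {{ℕ.≢-nonZero λ e → pt-≢0 B u (ℤP.∣i∣≡0⇒i≡0 e)}} (∣-ℕ (subst (_∣ℤ N (pt B u)) (sym (ℤP.pos-* p p)) d))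
        1≤β : 1 ≤ β
        1≤β = ℕP.n≢0⇒n>0 λ e → ℕP.<⇒≱ (ℕP.≤-trans (ℕP.*-mono-≤ (ℕP.<⇒≤ (prime>1 pp)) (ℕP.<⇒≤ (prime>1 pp))) (ℕP.≤-trans pp≤ (pt-upper′)))
           (ℕP.≤-reflexive (cong (_* B ^ D) e))
          where
          pt-upper′ : ∣ N (pt B u) ∣ ≤ β * B ^ D
          pt-upper′ = ℕP.≤-trans (pt-upper B u) (ℕP.≤-reflexive (trans (cong (λ z → C₀ * z ^ D) (sym (ℕP.*-assoc 3 (Q * M) B)))
            (trans (cong (C₀ *_) (^-distribʳ-* D (3 * (Q * M)) B)) (sym (ℕP.*-assoc C₀ _ _)))))
        pp≤K² : p * p ≤ K * K
        pp≤K² = begin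
          p * p ≤⟨ pp≤ ⟩
          ∣ N (pt B u) ∣ ≤⟨ pt-upper B u ⟩
          C₀ * (3 * (Q * M * B)) ^ D ≡⟨ trans (cong (λ z → C₀ * z ^ D) (sym (ℕP.*-assoc 3 (Q * M) B))) (trans (cong (C₀ *_) (^-distribʳ-* D (3 * (Q * M)) B)) (sym (ℕP.*-assoc C₀ _ _))) ⟩
          β * B ^ D ≡⟨ cong (β *_) B^D ⟩
          β * (b ^ D * b ^ D) ≤⟨ ℕP.*-monoˡ-≤ _ (ℕP.m≤m*n β β {{ℕ.>-nonZero 1≤β}}) ⟩
          β * β * (b ^ D * b ^ D) ≡⟨ l β (b ^ D) ⟩
          K * K ∎
          where
          l : ∀ a b → a * a * (b * b) ≡ a * b * (a * b)
          l = ℕRing.solve-∀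
        p≤K : p ≤ K
        p≤K = ℕP.≮⇒≥ λ K<p → ℕP.<⇒≱ (ℕP.*-mono-< K<p K<p) pp≤K²
        k<K : k < K
        k<K = ℕP.<-≤-trans (ℕP.∸-monoʳ-< {p} {suc T} {0} (s≤s z≤n) T<p) p≤K

open Density

-- Prime factors, multiplicities and residue classes

module Pigeon where
  primeFactor : ∀ {P : ℕ → Set} {p} ps → Prime p → p ℕD.∣ product ps → All Prime ps → All P ps → P p
  primeFactor [] pp d [] [] = contradiction (subst Prime (ℕD.∣1⇒≡1 d) pp) ¬prime[1]
  primeFactor {P} (q ∷ ps) pp d (pq ∷ pps) (x ∷ xs) with euclidsLemma q (product ps) pp d
  ... | inj₁ d′ = subst P (sym (prime∣prime pp pq d′)) x
  ... | inj₂ d′ = primeFactor ps pp d′ pps xs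

  abstract
    primeFactors : ∀ n → ¬ n ≡ + 0 → ∃[ ps ] (∣ n ∣ ≡ product ps × All Prime ps × All (λ p → + p ∣ℤ n) ps)
    primeFactors n n≢0 with factorise ∣ n ∣ {{ℕ.≢-nonZero λ e → n≢0 (ℤP.∣i∣≡0⇒i≡0 e)}}
    ... | record { factors = ps ; isFactorisation = e ; factorsPrime = pps } =
      ps , e , pps , All.map (λ d → ℕ-∣ (subst (_ ℕD.∣_) (sym e) d)) (divs ps)
      where
      divs : ∀ ps → All (λ p → p ℕD.∣ product ps) ps
      divs [] = []
      divs (p ∷ ps) = ℕD.m∣m*n (product ps) ∷ All.map (λ d → ℕD.∣n⇒∣m*n p d) (divs ps)

  -- The product of two square-free numbers need not be square-free, so at a common prime the
  -- divisibility by p² has to be supplied.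
  sqfree-∣₂ : ∀ n₁ n₂ m → ¬ n₁ ≡ + 0 → ¬ n₂ ≡ + 0 → SqFree n₁ → SqFree n₂ → (∀ p → Prime p → + p ∣ℤ n₁ → + p ∣ℤ m) →
    (∀ p → Prime p → + p ∣ℤ n₂ → + p ∣ℤ m) → (∀ p → Prime p → + p ∣ℤ n₁ → + p ∣ℤ n₂ → + p ℤ.* + p ∣ℤ m) → n₁ ℤ.* n₂ ∣ℤ m
  sqfree-∣₂ n₁ n₂ m n₁≢0 n₂≢0 sf₁ sf₂ h₁ h₂ h₁₂ with sqfree-∣ n₁ m n₁≢0 sf₁ h₁
  ... | divides m′ refl = subst (n₁ ℤ.* n₂ ∣ℤ_) (ℤP.*-comm n₁ m′) (*-∣-* (ℤD.∣-refl {n₁}) (sqfree-∣ n₂ m′ n₂≢0 sf₂ step))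
    where
    step : ∀ p → Prime p → + p ∣ℤ n₂ → + p ∣ℤ m′
    step p pp d with + p ℤD.∣? n₁
    ... | no nd = [ id , (λ x → contradiction x nd) ]′ (euclid pp m′ n₁ (h₂ p pp d))
    ... | yes (divides n refl) = [ (λ x → contradiction (*-∣-* x (ℤD.∣-refl {+ p})) (sf₁ p pp)) , id ]′
          (euclid pp n m′ (cancel-p pp (subst (+ p ℤ.* + p ∣ℤ_) (l n (+ p) m′) (h₁₂ p pp (divides n refl) d))))
      where
      l : ∀ n p m → m ℤ.* (n ℤ.* p) ≡ p ℤ.* (n ℤ.* m)
      l = solve-∀

  module Multiplicity {p} (pp : Prime p) where
    open I using (_*_)

    -- If p divided b but not a, the resulting p² in M could only come from b, which is square-free.
    transfer : ∀ {M} κ a b → M ≡ κ * (a * b) → ¬ + p ∣ℤ κ → SqFree b → + p ∣ℤ M → (+ p ∣ℤ b → + p * + p ∣ℤ M) → + p ∣ℤ a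
    transfer κ a b refl p∤κ sf d h = decidable-stable (+ p ℤD.∣? a) λ nd →
      sf p pp (²-cancel pp a b nd (²-cancel pp κ (a * b) p∤κ (h
        ([ (λ x → contradiction x nd) , id ]′ (euclid pp a b ([ (λ x → contradiction x p∤κ) , id ]′ (euclid pp κ (a * b) d)))))))

    excess₂ : ∀ {M} κ a b → M ≡ κ * (a * b) → ¬ + p ∣ℤ κ → SqFree a → ¬ + p ∣ℤ b → + p * + p ∣ℤ M → ⊥
    excess₂ κ a b refl p∤κ sf nd d =
      sf p pp (²-cancel pp b a nd (subst (+ p * + p ∣ℤ_) (ℤP.*-comm a b) (²-cancel pp κ (a * b) p∤κ d)))

    excess₃ : ∀ {M} κ a b → M ≡ κ * (a * b) → ¬ + p ∣ℤ κ → SqFree a → SqFree b → + p ∣ℤ a → + p ∣ℤ b → cube (+ p) ∣ℤ M → ⊥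
    excess₃ κ a b refl p∤κ sf sf′ (divides a′ refl) (divides b′ refl) d =
      [ p∤κ , [ (λ x → sf p pp (*-∣-* x (ℤD.∣-refl {+ p}))) , (λ x → sf′ p pp (*-∣-* x (ℤD.∣-refl {+ p}))) ]′ ∘ euclid pp a′ b′ ]′
        (euclid pp κ (a′ * b′) (cancel-p pp (cancel-p pp (subst (cube (+ p) ∣ℤ_) (l κ a′ b′ (+ p)) d))))
      where
      l : ∀ κ n₁ n₂ p → κ * (n₁ * p * (n₂ * p)) ≡ p * (p * (κ * (n₁ * n₂)))
      l = solve-∀

  module Residues {A : Set} where
    Fn : ℕ → Set
    Fn p = Prime p × (A → ℤ)

    -- One value modulo each prime of the list gives `product ps` classes, for the factors of N v
    -- exactly its absolute value.
    residue : ∀ {ps} → All Fn ps → A → Fin (product ps)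
    residue [] v = zero
    residue {p ∷ ps} ((pp , φ) ∷ E) v = combine (fromℕ< (ℤDM.n%ℕd<d (φ v) p)) (residue E v)
      where instance _ = prime⇒nonZero pp

    Congruent : ∀ {ps} → All Fn ps → A → A → Set
    Congruent [] v w = ⊤
    Congruent {p ∷ ps} ((_ , φ) ∷ E) v w = + p ∣ℤ φ v ℤ.- φ w × Congruent E v w

    residue-≡ : ∀ {ps} (E : All Fn ps) v w → residue E v ≡ residue E w → Congruent E v w
    residue-≡ [] v w _ = tt
    residue-≡ {p ∷ ps} ((pp , φ) ∷ E) v w h
      with FinP.combine-injective (fromℕ< (ℤDM.n%ℕd<d (φ v) p {{prime⇒nonZero pp}})) (residue E v) (fromℕ< (ℤDM.n%ℕd<d (φ w) p {{prime⇒nonZero pp}})) (residue E w) h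
    ... | h₁ , h₂ = subst (+ p ∣ℤ_) eq (∣*ˡ (q₁ ℤ.- q₂) ℤD.∣-refl) , residue-≡ E v w h₂
      where
      instance _ = prime⇒nonZero pp
      q₁ = φ v ℤDM./ℕ p
      q₂ = φ w ℤDM./ℕ p
      r≡ : φ v ℤDM.%ℕ p ≡ φ w ℤDM.%ℕ p
      r≡ = trans (sym (FinP.toℕ-fromℕ< _)) (trans (cong toℕ h₁) (FinP.toℕ-fromℕ< _))
      l : ∀ a b r p → (a ℤ.- b) ℤ.* p ≡ (r ℤ.+ a ℤ.* p) ℤ.- (r ℤ.+ b ℤ.* p)
      l = solve-∀
      eq : (q₁ ℤ.- q₂) ℤ.* + p ≡ φ v ℤ.- φ w
      eq = trans (l q₁ q₂ (+ (φ v ℤDM.%ℕ p)) (+ p)) (cong₂ ℤ._-_ (sym (ℤDM.a≡a%ℕn+[a/ℕn]*n (φ v) p))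
             (trans (cong (λ r → + r ℤ.+ q₂ ℤ.* + p) r≡) (sym (ℤDM.a≡a%ℕn+[a/ℕn]*n (φ w) p))))

  prodFin-≡ : ∀ {r d} (f g : Fin r → ℤ) → (∀ i → d ∣ℤ f i ℤ.- g i) → d ∣ℤ prodFin f ℤ.- prodFin g
  prodFin-≡ {zero} f g h = ∣0
  prodFin-≡ {suc r} f g h = ∣-comb (prodFin (λ i → f (suc i))) (g zero) (h zero) (prodFin-≡ (λ i → f (suc i)) (λ i → g (suc i)) (λ i → h (suc i)))
    (l (f zero) (prodFin (λ i → f (suc i))) (g zero) (prodFin (λ i → g (suc i))))
    where
    l : ∀ a b c d → a ℤ.* b ℤ.- c ℤ.* d ≡ b ℤ.* (a ℤ.- c) ℤ.+ c ℤ.* (b ℤ.- d)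
    l = solve-∀

open Pigeon

-- Over a prime p of R with √e available, each root φ : R → ℤ/p³ gives the two roots φ(x) ± s φ(y) of R[√e].
module Pairing (R : TR) (e : TR.C R) (aniso : ∀ x y → TR._⊗_ R x x ≡ TR._⊗_ R e (TR._⊗_ R y y) → y ≡ TR.0# R) (T L : ℕ) where
  open TR R
  open ExtRing rg e using (nm; C′; rg′)
  R′ : TR
  R′ = Ext R e aniso
  module R′ = TR R′
  open I using (_+_; _*_; _-_; _^_)

  signed : Bool → ℤ → ℤ
  signed true s = s
  signed false s = - s

  flip : Bool → Bool
  flip true = false
  flip false = true

  -- Outside the primes with T < p < L the last two fields are void and the empty list serves, so a
  -- family over all p can be formed from finitely many choices.
  record Roots (p : ℕ) : Set where
    field
      hs : List (Hom rg p)
      sg : Fin (length hs) → ℤ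
    φ : Fin (length hs) → C → ℤ
    φ i = Hom.f (lookup hs i)
    val : Bool → Fin (length hs) → C′ → ℤ
    val σ i (x , y) = φ i x + signed σ (sg i) * φ i y
    field
      -- If p divides the norm exactly once, no Big place can be responsible, since these force p².
      kill : Prime p → T ℕ.< p → p ℕ.< L → ∀ z → + p ∣ℤ N z → ¬ + p * + p ∣ℤ N z → ∃[ i ] (+ p ∣ℤ φ i z)
      prodR : Prime p → T ℕ.< p → p ℕ.< L → ∀ v → ∃[ E ] (cube (+ p) ∣ℤ R′.N v - E * (prodFin (λ i → val true i v) * prodFin (λ i → val false i v)))

  module _ (S₀ : ℕ) (H : ∀ p → Prime p → S₀ ℕ.< p → (h : Hom rg p) → ∃[ s ] (+ p ∣ℤ s * s - Hom.f h e))
           (S₀≤T : S₀ ℕ.≤ T) (S≤T : R′.S ℕ.≤ T) where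
    module FromLocal (p : ℕ) (pp : Prime p) (T<p : T ℕ.< p) (loc : Local rg N D p) where
      open Local loc

      S′<p : S ℕ.+ (2 ℕ.+ ∣ N e ∣) ℕ.< p
      S′<p = ℕP.≤-<-trans S≤T T<p

      p∤2 : ¬ + p ∣ℤ + 2
      p∤2 = ∤-< (λ ()) (ℕP.≤-<-trans (ℕP.≤-trans (ℕP.m≤m+n 2 ∣ N e ∣) (ℕP.m≤n+m _ S)) S′<p)

      unit : ∀ (h : Hom rg p) → ¬ + p ∣ℤ Hom.f h e
      unit = e-unit R e aniso pp (ℕP.≤-<-trans (ℕP.≤-trans (ℕP.m≤n+m ∣ N e ∣ 2) (ℕP.m≤n+m _ S)) S′<p)

      -- The hypothesis that e is a square everywhere enters here: it gives a root modulo p, and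
      -- Hensel raises it to p³.
      sqrt : (h : Hom rg p) → ∃[ s ] (cube (+ p) ∣ℤ s * s - Hom.f h e)
      sqrt h with H p pp (ℕP.≤-<-trans S₀≤T T<p) h
      ... | s , q = hensel pp p∤2 (Hom.f h e) (unit h) s q

      s : Fin (length homs) → ℤ
      s i = proj₁ (sqrt (lookup homs i))

      a b : Fin (length homs) → C′ → ℤ
      a i (x , y) = Hom.f (lookup homs i) x + s i * Hom.f (lookup homs i) y
      b i (x , y) = Hom.f (lookup homs i) x + - s i * Hom.f (lookup homs i) y

      kills : ∀ z → + p ∣ℤ N z → ¬ + p * + p ∣ℤ N z → ∃[ i ] (+ p ∣ℤ Hom.f (lookup homs i) z)
      kills z d nd with cover₁ z d
      ... | inj₁ k = any→ k
      ... | inj₂ k = let i , kz = any→ k in contradiction (Big.K-N (lookup bigs i) kz) nd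

      Πab : ∀ v → cube (+ p) ∣ℤ prodFin (λ i → Hom.f (lookup homs i) (nm (proj₁ v) (proj₂ v))) - prodFin (λ i → a i v) * prodFin (λ i → b i v)
      Πab (x , y) = subst (λ z → cube (+ p) ∣ℤ prodFin f - z) (prodFin-* (λ i → a i (x , y)) (λ i → b i (x , y)))
          (prodFin-≡ f (λ i → a i (x , y) * b i (x , y)) λ i → ExtRing.nm-g rg e (lookup homs i) (s i) (proj₂ (sqrt (lookup homs i))) x y)
        where
        f : Fin (length homs) → ℤ
        f i = Hom.f (lookup homs i) (nm x y)

      prods : ∀ v → ∃[ E ] (cube (+ p) ∣ℤ N (nm (proj₁ v) (proj₂ v)) - E * (prodFin (λ i → a i v) * prodFin (λ i → b i v)))
      prods (x , y) with prod (nm x y)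
      ... | E , q = E , ∣-comb (+ 1) E (subst (λ z → cube (+ p) ∣ℤ N (nm x y) - E * z) (Π-prodFin rg homs (nm x y)) q) (Πab (x , y))
            (l (N (nm x y)) E (prodFin (λ i → Hom.f (lookup homs i) (nm x y))) (prodFin (λ i → a i (x , y)) * prodFin (λ i → b i (x , y))))
        where
        l : ∀ n E π q → n - E * q ≡ + 1 * (n - E * π) + E * (π - q)
        l = solve-∀

      fromLocal : Roots p
      fromLocal = record { hs = homs ; sg = s ; kill = λ _ _ _ → kills ; prodR = λ _ _ _ → prods }

    roots : ∀ p → ¬ ¬ Roots p
    roots p k = go (prime? p) (T ℕ.<? p)
      where
      go : Dec (Prime p) → Dec (T ℕ.< p) → ⊥
      go (no np) _ = k (record { hs = [] ; sg = λ () ; kill = λ pp → contradiction pp np ; prodR = λ pp → contradiction pp np })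
      go (yes _) (no nT) = k (record { hs = [] ; sg = λ () ; kill = λ _ T< → contradiction T< nT ; prodR = λ _ T< → contradiction T< nT })
      go (yes pp) (yes T<p) = local p pp (ℕP.≤-<-trans (ℕP.m≤m+n S _) (ℕP.≤-<-trans S≤T T<p)) λ loc → k (FromLocal.fromLocal p pp T<p loc)

  record Good (v : C) : Set where
    field
      sf   : SqFree (N v)
      ≢0   : ¬ N v ≡ + 0
      T<   : ∀ p → Prime p → + p ∣ℤ N v → T ℕ.< p
      <L   : ∣ N v ∣ ℕ.< L
    p<L : ∀ p → + p ∣ℤ N v → p ℕ.< L
    p<L p d = ℕP.≤-<-trans (ℕD.∣⇒≤ {{ℕ.≢-nonZero λ e → ≢0 (ℤP.∣i∣≡0⇒i≡0 e)}} (∣-ℕ d)) <L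

  module WithRoots (rts : ∀ p → Roots p) where
    module _ (p : ℕ) where
      open Roots (rts p) public using (φ; val)

    ix : ℕ → Set
    ix p = Fin (length (Roots.hs (rts p)))

    -- Stands for membership of v′ in an ideal of R[√e]: above a place of v over each prime of N v,
    -- one of the two roots is selected by σ.
    Over : Bool → C → C′ → Set
    Over σ v v′ = ∀ p → Prime p → + p ∣ℤ N v → ∃[ i ] (+ p ∣ℤ φ p i v × + p ∣ℤ val p σ i v′)

    val-⊖ : ∀ p σ i x y → val p σ i (R′._⊖_ x y) ≡ val p σ i x - val p σ i y
    val-⊖ p σ i (x , y) (z , w) = trans (cong₂ (λ a b → a + signed σ (Roots.sg (rts p) i) * b) (Hom.f-⊖ h x z) (Hom.f-⊖ h y w))
      (l (Hom.f h x) (Hom.f h z) (signed σ (Roots.sg (rts p) i)) (Hom.f h y) (Hom.f h w))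
      where
      h = lookup (Roots.hs (rts p)) i
      l : ∀ a b s c d → (a - b) + s * (c - d) ≡ (a + s * c) - (b + s * d)
      l = solve-∀

    module _ (v : C) (g : Good v) (σ : Bool) where
      open Good g
      open Residues {C′}

      root : ∀ p → Prime p → + p ∣ℤ N v → ∃[ i ] (+ p ∣ℤ φ p i v)
      root p pp d = Roots.kill (rts p) pp (T< p pp d) (p<L p d) v d (sf p pp)

      fns : ∀ {ps} → All Prime ps → All (λ p → + p ∣ℤ N v) ps → All Fn ps
      fns [] [] = []
      fns {p ∷ _} (pp ∷ pps) (d ∷ ds) = (pp , val p σ (proj₁ (root p pp d))) ∷ fns pps ds

      fns-sound : ∀ {ps} (pps : All Prime ps) ds x y → Congruent (fns pps ds) x y →
                  All (λ p → ∃[ i ] (+ p ∣ℤ φ p i v × + p ∣ℤ val p σ i (R′._⊖_ x y))) ps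
      fns-sound [] [] x y _ = []
      fns-sound {p ∷ _} (pp ∷ pps) (d ∷ ds) x y (c , cs) =
        (proj₁ (root p pp d) , proj₂ (root p pp d) , subst (+ p ∣ℤ_) (sym (val-⊖ p σ _ x y)) c) ∷ fns-sound pps ds x y cs

      factors = primeFactors (N v) ≢0

      functionals : All Fn (proj₁ factors)
      functionals = fns (proj₁ (proj₂ (proj₂ factors))) (proj₂ (proj₂ (proj₂ factors)))

      over : ∀ x y → Congruent functionals x y → Over σ v (R′._⊖_ x y)
      over x y c p pp d = primeFactor (proj₁ factors) pp (subst (p ℕD.∣_) (proj₁ (proj₂ factors)) (∣-ℕ d)) (proj₁ (proj₂ (proj₂ factors)))
        (fns-sound (proj₁ (proj₂ (proj₂ factors))) (proj₂ (proj₂ (proj₂ factors))) x y c)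

    -- The conditions at the primes of N v₁ and N v₂ distinguish only |N v₁| |N v₂| classes, fewer
    -- than the box has points. Two points of one class differ by the required v′, as in Thue's
    -- lemma.
    pair : ∀ v₁ v₂ → Good v₁ → Good v₂ → ∀ B → ∣ N v₁ ∣ ℕ.* ∣ N v₂ ∣ ℕ.< R′.card B →
           ∃[ v′ ] (¬ v′ ≡ R′.0# × R′.‖ v′ ‖ ℕ.< B × Over true v₁ v′ × Over false v₂ v′)
    pair v₁ v₂ g₁ g₂ B lt = R′._⊖_ x y , (λ z → ℕP.<-irrefl (cong toℕ (R′.box-inj B i j (R′.⊖-≡ z))) i<j) , R′.box-diff B i j ,
        over v₁ g₁ true x y (Res.residue-≡ E₁ x y (proj₁ split)) , over v₂ g₂ false x y (Res.residue-≡ E₂ x y (proj₂ split))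
      where
      module Res = Residues {C′}
      E₁ = functionals v₁ g₁ true
      E₂ = functionals v₂ g₂ false
      code : Fin (R′.card B) → Fin _
      code i = combine (Res.residue E₁ (R′.box B i)) (Res.residue E₂ (R′.box B i))
      ph = FinP.pigeonhole (subst₂ (λ a b → a ℕ.* b ℕ.< R′.card B) (proj₁ (proj₂ (factors v₁ g₁ true))) (proj₁ (proj₂ (factors v₂ g₂ false))) lt) code
      i = proj₁ ph
      j = proj₁ (proj₂ ph)
      i<j = proj₁ (proj₂ (proj₂ ph))
      x = R′.box B i
      y = R′.box B j
      split = FinP.combine-injective (Res.residue E₁ x) (Res.residue E₂ x) (Res.residue E₁ y) (Res.residue E₂ y) (proj₂ (proj₂ (proj₂ ph)))

    module At (p : ℕ) (pp : Prime p) (T<p : T ℕ.< p) (p<L : p ℕ.< L) (v′ : C′) where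
      P = + p

      Π± : Bool → ℤ
      Π± σ = prodFin (λ i → val p σ i v′)

      from-prod : ∀ {d} σ → d ∣ℤ cube P → d ∣ℤ Π± σ * Π± (flip σ) → d ∣ℤ R′.N v′
      from-prod true dc h with Roots.prodR (rts p) pp T<p p<L v′
      ... | E , q = ∣-comb (+ 1) E (ℤD.∣-trans dc q) h (l (R′.N v′) E (Π± true * Π± false))
        where
        l : ∀ n E π → n ≡ + 1 * (n - E * π) + E * π
        l = solve-∀
      from-prod false dc h = from-prod true dc (subst (_ ∣ℤ_) (ℤP.*-comm (Π± false) (Π± true)) h)

      one : ∀ σ i → P ∣ℤ val p σ i v′ → P ∣ℤ R′.N v′
      one σ i h = from-prod σ (p∣cube P) (∣*ʳ (Π± (flip σ)) (prodFin-∣ (λ i → val p σ i v′) i h))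

      two± : ∀ σ i j → P ∣ℤ val p σ i v′ → P ∣ℤ val p (flip σ) j v′ → P * P ∣ℤ R′.N v′
      two± σ i j h k = from-prod σ (p²∣cube P) (*-∣-* (prodFin-∣ (λ i → val p σ i v′) i h) (prodFin-∣ (λ i → val p (flip σ) i v′) j k))

      two : ∀ σ i j → ¬ i ≡ j → P ∣ℤ val p σ i v′ → P ∣ℤ val p σ j v′ → P * P ∣ℤ R′.N v′
      two σ i j ne h k = from-prod σ (p²∣cube P) (∣*ʳ (Π± (flip σ)) (prodFin-∣₂ (λ i → val p σ i v′) i j ne h k))

      three : ∀ σ i j k → ¬ i ≡ j → P ∣ℤ val p σ i v′ → P ∣ℤ val p σ j v′ → P ∣ℤ val p (flip σ) k v′ → cube P ∣ℤ R′.N v′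
      three σ i j k ne h h′ h″ = from-prod σ ℤD.∣-refl (subst (_∣ℤ Π± σ * Π± (flip σ)) (l P)
        (*-∣-* (prodFin-∣₂ (λ i → val p σ i v′) i j ne h h′) (prodFin-∣ (λ i → val p (flip σ) i v′) k h″)))
        where
        l : ∀ p → (p * p) * p ≡ p * (p * p)
        l = solve-∀

    module Divides (v₁ v₂ : C) (v′ : C′) (g₁ : Good v₁) (g₂ : Good v₂) (o₁ : Over true v₁ v′) (o₂ : Over false v₂ v′) where
      module G₁ = Good g₁
      module G₂ = Good g₂

      prime₁ : ∀ p → Prime p → + p ∣ℤ N v₁ → + p ∣ℤ R′.N v′
      prime₁ p pp d with o₁ p pp d
      ... | i , _ , h = At.one p pp (G₁.T< p pp d) (G₁.p<L p d) v′ true i h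

      prime₂ : ∀ p → Prime p → + p ∣ℤ N v₂ → + p ∣ℤ R′.N v′
      prime₂ p pp d with o₂ p pp d
      ... | i , _ , h = At.one p pp (G₂.T< p pp d) (G₂.p<L p d) v′ false i h

      prime₁₂ : ∀ p → Prime p → + p ∣ℤ N v₁ → + p ∣ℤ N v₂ → + p * + p ∣ℤ R′.N v′
      prime₁₂ p pp d d₂ with o₁ p pp d | o₂ p pp d₂
      ... | i , _ , h | j , _ , k = At.two± p pp (G₁.T< p pp d) (G₁.p<L p d) v′ true i j h k

    -- Over a prime common to both norms the two zeros of v′ carry opposite signs, hence lie in
    -- different factors of `prodR` and give p².
    divides-N : ∀ v₁ v₂ v′ → Good v₁ → Good v₂ → Over true v₁ v′ → Over false v₂ v′ → N v₁ * N v₂ ∣ℤ R′.N v′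
    divides-N v₁ v₂ v′ g₁ g₂ o₁ o₂ = sqfree-∣₂ (N v₁) (N v₂) (R′.N v′) G₁.≢0 G₂.≢0 G₁.sf G₂.sf prime₁ prime₂ prime₁₂
      where open Divides v₁ v₂ v′ g₁ g₂ o₁ o₂

    -- The pair (v₁, v₂) can be read off from v′ up to the choice of generators: counting the roots of v′
    -- over p against the exact power of p in its norm leaves no other possibility.
    module Recover (v₁ v₂ w₁ w₂ : C) (v′ : C′) (σ : Bool) (g₁ : Good v₁) (g₂ : Good v₂) (f₁ : Good w₁) (f₂ : Good w₂)
                   (o₁ : Over σ v₁ v′) (o₂ : Over (flip σ) v₂ v′) (q₁ : Over σ w₁ v′) (q₂ : Over (flip σ) w₂ v′)
                   (κ κ′ : ℤ) (Nκ : R′.N v′ ≡ κ * (N v₁ * N v₂)) (Nκ′ : R′.N v′ ≡ κ′ * (N w₁ * N w₂))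
                   (κ≢0 : ¬ κ ≡ + 0) (κ′≢0 : ¬ κ′ ≡ + 0) (κ≤T : ∣ κ ∣ ℕ.≤ T) (κ′≤T : ∣ κ′ ∣ ℕ.≤ T) where
      module G₁ = Good g₁
      module G₂ = Good g₂
      module F₁ = Good f₁
      module F₂ = Good f₂

      unit : ∀ {x} → ¬ x ≡ + 0 → ∣ x ∣ ℕ.≤ T → ∀ {p} → T ℕ.< p → ¬ + p ∣ℤ x
      unit x≢0 x≤T T<p = ∤-< x≢0 (ℕP.≤-<-trans x≤T T<p)

      -- κ′ is prime to p, so p comes from N w₁ or N w₂. If it divides N w₂, then v′ has zeros of
      -- both signs over p, and the second factor p must come from N w₁.
      prime∣ : ∀ p → Prime p → + p ∣ℤ N v₁ → + p ∣ℤ N w₁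
      prime∣ p pp d with o₁ p pp d
      ... | i , _ , h = Multiplicity.transfer pp κ′ (N w₁) (N w₂) Nκ′ (unit κ′≢0 κ′≤T (G₁.T< p pp d)) F₂.sf
            (At.one p pp (G₁.T< p pp d) (G₁.p<L p d) v′ σ i h)
            λ d₂ → case q₂ p pp d₂ of λ { (j , _ , k) → At.two± p pp (G₁.T< p pp d) (G₁.p<L p d) v′ σ i j h k }

      N∣ : N v₁ ∣ℤ N w₁
      N∣ = sqfree-∣ (N v₁) (N w₁) G₁.≢0 G₁.sf prime∣

      -- A second zero of the same sign would force p² into the norm when p does not divide N v₂,
      -- and p³ when v₂ adds a zero of the other sign; square-freeness allows neither.
      unique : ∀ p → Prime p → + p ∣ℤ N v₁ → ∀ i l → + p ∣ℤ val p σ i v′ → + p ∣ℤ val p σ l v′ → i ≡ l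
      unique p pp d i l h k = decidable-stable (i Fin.≟ l) λ ne → contra ne (+ p ℤD.∣? N v₂)
        where
        contra : ¬ i ≡ l → Dec (+ p ∣ℤ N v₂) → ⊥
        contra ne (no nd) = Multiplicity.excess₂ pp κ (N v₁) (N v₂) Nκ (unit κ≢0 κ≤T (G₁.T< p pp d)) G₁.sf nd
          (At.two p pp (G₁.T< p pp d) (G₁.p<L p d) v′ σ i l ne h k)
        contra ne (yes d₂) with o₂ p pp d₂
        ... | j , _ , m = Multiplicity.excess₃ pp κ (N v₁) (N v₂) Nκ (unit κ≢0 κ≤T (G₁.T< p pp d)) G₁.sf G₂.sf d d₂
          (At.three p pp (G₁.T< p pp d) (G₁.p<L p d) v′ σ i l j ne h k m)

      sameRoot : ∀ p → Prime p → + p ∣ℤ N v₁ → ∃[ i ] (+ p ∣ℤ φ p i v₁ × + p ∣ℤ φ p i w₁)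
      sameRoot p pp d with o₁ p pp d | q₁ p pp (prime∣ p pp d)
      ... | i , a , h | l , b , k = i , a , subst (λ j → + p ∣ℤ φ p j w₁) (sym (unique p pp d i l h k)) b

      hom⇒N : ∀ p → (h : Hom rg p) → ∀ z → + p ∣ℤ Hom.f h z → + p ∣ℤ N z
      hom⇒N p h z d = subst (+ p ∣ℤ_) (trans (cong f (adj-* z)) (f-ι (N z))) (∣-comb (+ 1) (f (adj z)) (f-*ₚ z (adj z)) d (l (f (z ⊗ adj z)) (f z) (f (adj z))))
        where
        open Hom h
        l : ∀ a b c → a ≡ + 1 * (a - b * c) + c * b
        l = solve-∀

      -- v₁ and w₁ vanish at a common place over every prime of N v₁. For points in one cell this
      -- will leave only equality.
      N∣diff : N v₁ ∣ℤ N (v₁ ⊖ w₁)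
      N∣diff = sqfree-∣ (N v₁) (N (v₁ ⊖ w₁)) G₁.≢0 G₁.sf prime-diff
        where
        prime-diff : ∀ p → Prime p → + p ∣ℤ N v₁ → + p ∣ℤ N (v₁ ⊖ w₁)
        prime-diff p pp d with sameRoot p pp d
        ... | i , a , b = hom⇒N p h (v₁ ⊖ w₁) (subst (+ p ∣ℤ_) (sym (Hom.f-⊖ h v₁ w₁)) (ℤD.∣m∣n⇒∣m-n a b))
          where h = lookup (Roots.hs (rts p)) i

module CoprimePart where
  abstract
    coprime-∣ : ∀ n a b → ¬ n ≡ + 0 → (∀ p → Prime p → + p ∣ℤ n → ¬ + p ∣ℤ a) → n ∣ℤ a ℤ.* b → n ∣ℤ b
    coprime-∣ n a b n≢0 h d = ∣ᵤ⇒∣ (coprime-divisor cop (subst (∣ n ∣ ℕD.∣_) (ℤP.abs-* a b) (∣⇒∣ᵤ d)))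
      where
      cop : Coprime ∣ n ∣ ∣ a ∣
      cop {zero} (x , _) = contradiction (ℤP.∣i∣≡0⇒i≡0 (ℕD.0∣⇒≡0 x)) n≢0
      cop {suc zero} _ = refl
      cop {suc (suc k)} (x , y) with primeDivisor (suc (suc k)) (s≤s (s≤s z≤n))
      ... | p , pp , p∣ = contradiction (ℕ-∣ (ℕD.∣-trans p∣ y)) (h p pp (ℕ-∣ (ℕD.∣-trans p∣ x)))

  product≤ : ∀ {m n k} (f : Fin m × Fin n → Fin k) → (∀ a b → f a ≡ f b → a ≡ b) → m ℕ.* n ℕ.≤ k
  product≤ {m} {n} f f-inj = FinP.injective⇒≤ {f = λ i → f (remQuot {m} n i)} λ {i} {j} h →
    trans (sym (FinP.combine-remQuot {m} n i)) (trans (cong (λ a → combine (proj₁ a) (proj₂ a)) (f-inj _ _ h)) (FinP.combine-remQuot {m} n j))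

open CoprimePart

-- The counting contradiction: constants, pairs and keys

module Engine (R : TR) (e : TR.C R) (aniso : ∀ x y → TR._⊗_ R x x ≡ TR._⊗_ R e (TR._⊗_ R y y) → y ≡ TR.0# R)
              (S₀ : ℕ) (H : ∀ p → Prime p → S₀ ℕ.< p → (h : Hom (TR.rg R) p) → ∃[ s ] (+ p ∣ℤ s ℤ.* s ℤ.- Hom.f h e)) where
  open Nat using (_+_; _*_; _≤_; _<_; _^_; _∸_)

  private
    R″ : TR
    R″ = Ext R e aniso
    module R₁ = TR R
    module R₂ = TR R″

  open R₁ using (D; C₀; M; N; 1≤D; 1≤M; card; C; _⊖_; 0#; ‖_‖; box; Cm)

  abstract
    C₂ : ℕ
    C₂ = R₂.C₀

    N≤₂ : ∀ v → ∣ R₂.N v ∣ ≤ C₂ * R₂.‖ v ‖ ^ (D + D)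
    N≤₂ = R₂.N≤

  -- With P = q 2^τ, the factor `μ` makes a box of side μ P larger than the product of the two
  -- norms. `C₁` bounds the cofactor κ, from |N v′| ≤ C₂ (μ P)^(2D) and P^(2D) ≤ 4 |N v₁ · N v₂|.
  NF₀ W₀ μ C₁ : ℕ
  NF₀ = D + (D * D + D)
  W₀ = NF₀ * (4 ^ D * (C₀ * 2 ^ D))
  μ = (C₀ + 1) * 3
  C₁ = C₂ * (4 * μ ^ (D + D))

  abstract
    -- No summand involves Q = T!, because the scale Q cancels in the bound for κ. So T can dominate
    -- κ, and the primes of the norms, all above T, never divide κ.
    T : ℕ
    T = suc (R₂.S + (S₀ + (C₁ + (4 * W₀ + C₀))))

  abstract
    1≤T : 1 ≤ T
    1≤T = s≤s z≤n
    S₂≤T : R₂.S ≤ T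
    S₂≤T = ℕP.m≤n⇒m≤1+n (ℕP.m≤m+n _ _)
    S₁≤T : R₁.S ≤ T
    S₁≤T = ℕP.≤-trans (ℕP.m≤m+n _ _) S₂≤T
    S₀≤T : S₀ ≤ T
    S₀≤T = ℕP.m≤n⇒m≤1+n (ℕP.≤-trans (ℕP.m≤m+n _ _) (ℕP.m≤n+m _ R₂.S))
    C₁≤T : C₁ ≤ T
    C₁≤T = ℕP.m≤n⇒m≤1+n (ℕP.≤-trans (ℕP.m≤m+n _ _) (ℕP.≤-trans (ℕP.m≤n+m _ S₀) (ℕP.m≤n+m _ R₂.S)))
    W≤T : 4 * W₀ ≤ T
    W≤T = ℕP.m≤n⇒m≤1+n (ℕP.≤-trans (ℕP.m≤m+n _ _) (ℕP.≤-trans (ℕP.m≤n+m _ C₁) (ℕP.≤-trans (ℕP.m≤n+m _ S₀) (ℕP.m≤n+m _ R₂.S))))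
    C₀≤T : C₀ ≤ T
    C₀≤T = ℕP.m≤n⇒m≤1+n (ℕP.≤-trans (ℕP.m≤n+m _ (4 * W₀)) (ℕP.≤-trans (ℕP.m≤n+m _ C₁) (ℕP.≤-trans (ℕP.m≤n+m _ S₀) (ℕP.m≤n+m _ R₂.S))))

  module G = Density.FewCollisions R T 1≤T S₁≤T C₀≤T
  open G using (Q; pt; cells; cell; pt-lower; pt-upper; c; β)

  q : ℕ
  q = Q * M

  1≤q : 1 ≤ q
  1≤q = ℕP.*-mono-≤ (1≤! T) 1≤M

  -- Cells of side B / 2^γ are small enough that C₀ (B / 2^γ)^D stays below every norm. `ρ` is the
  -- ratio of the upper to the lower norm bound on one level, so levels at distance ρ have disjoint
  -- ranges of norms.
  γ ρ : ℕ
  γ = 2 * C₀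
  ρ = 2 * (C₀ * 3 ^ D)

  abstract
    g m₀ : ℕ
    g = 2 ^ γ
    m₀ = suc (4 * (β * c) + γ)

  abstract
    -- There are Ω V keys in all and at least `Wd` = V / 4 pairs on each level, so 4 Ω + 1 levels
    -- are too many. Ω does not depend on τ, so τ can be chosen afterwards to accommodate that many
    -- levels.
    Ω τ Wd : ℕ
    Ω = (2 * (μ * q)) ^ (D + D) * (cells g * cells g)
    τ = m₀ + m₀ + ρ * (4 * Ω)
    Wd = 2 ^ (τ * (D + D) ∸ 2)

  -- `B′` is the side of the box that contains v′, and `L` exceeds all norms of points used, hence
  -- all primes dividing them.
  K V B′ L : ℕ
  K = suc (4 * Ω)
  V = (2 ^ τ) ^ (D + D)
  B′ = μ * (q * 2 ^ τ)
  L = suc (C₀ * (3 * (q * 2 ^ (τ + τ))) ^ D)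

  abstract
    Ω-def : (2 * (μ * q)) ^ (D + D) * (cells g * cells g) ≡ Ω
    Ω-def = refl

    γ<g : γ < g
    γ<g = n<2^n γ

    g-pow : ∀ k → γ ≤ k → g * 2 ^ (k ∸ γ) ≡ 2 ^ k
    g-pow k h = trans (sym (ℕP.^-distribˡ-+-* 2 γ _)) (cong (2 ^_) (ℕP.m+[n∸m]≡n h))

    γ≤m₀ : γ ≤ m₀
    γ≤m₀ = ℕP.≤-trans (ℕP.m≤n+m γ (4 * (β * c))) (ℕP.n≤1+n _)

  -- Their sum is always τ, so the product of the two norms, and with it the size of v′, is the same
  -- on every level up to constants.
  lev lev′ : Fin K → ℕ
  lev i = m₀ + ρ * toℕ i
  lev′ i = m₀ + ρ * (4 * Ω ∸ toℕ i)

  abstract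
    lev+lev′ : ∀ i → lev i + lev′ i ≡ τ
    lev+lev′ i = trans (l m₀ ρ (toℕ i) (4 * Ω ∸ toℕ i)) (cong (λ z → m₀ + m₀ + ρ * z) (ℕP.m+[n∸m]≡n (ℕP.≤-pred (FinP.toℕ<n i))))
      where
      l : ∀ a r x y → (a + r * x) + (a + r * y) ≡ a + a + r * (x + y)
      l = ℕRing.solve-∀

    ≤^D : ∀ x → x ≤ x ^ D
    ≤^D zero = z≤n
    ≤^D x@(suc _) = ℕP.≤-trans (ℕP.≤-reflexive (sym (ℕP.^-identityʳ x))) (ℕP.^-monoʳ-≤ x 1≤D)

    large : ∀ k → 4 * (β * c) ≤ (2 ^ (m₀ + k)) ^ D
    large k = ℕP.≤-trans (ℕP.≤-trans (ℕP.≤-trans (ℕP.m≤m+n _ γ) (ℕP.n≤1+n _)) (ℕP.≤-trans (ℕP.m≤m+n m₀ k) (ℕP.<⇒≤ (n<2^n (m₀ + k))))) (≤^D _)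

    4Wd : 4 * Wd ≡ V
    4Wd = trans (sym (ℕP.^-distribˡ-+-* 2 2 (τ * (D + D) ∸ 2))) (trans (cong (2 ^_) (ℕP.m+[n∸m]≡n 2≤)) (sym (ℕP.^-*-assoc 2 τ (D + D))))
      where
      2≤ : 2 ≤ τ * (D + D)
      2≤ = ℕP.*-mono-≤ {1} {τ} {2} (s≤s z≤n) (ℕP.+-mono-≤ 1≤D 1≤D)

    1≤Wd : 1 ≤ Wd
    1≤Wd = 1≤^ (τ * (D + D) ∸ 2) (s≤s z≤n)

  -- The two members of a pair live at the dyadic levels lev i and lev′ i.
  module At (k : ℕ) where
    open G.Square W≤T (m₀ + k) (large k) public

    δ : ℕ
    δ = 2 ^ ((m₀ + k) + (m₀ + k) ∸ γ)

    instance
      δ≢0 : ℕ.NonZero δ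
      δ≢0 = ℕP.m^n≢0 2 ((m₀ + k) + (m₀ + k) ∸ γ)

    abstract
      gδ : g * δ ≡ B
      gδ = g-pow _ (ℕP.≤-trans γ≤m₀ (ℕP.≤-trans (ℕP.m≤m+n m₀ k) (ℕP.m≤m+n (m₀ + k) (m₀ + k))))

      lower : ∀ u → (q * B) ^ D ≤ 2 * ∣ N (pt B u) ∣
      lower u = pt-lower B u

      upper : ∀ u → ∣ N (pt B u) ∣ ≤ C₀ * (3 * (q * B)) ^ D
      upper u = pt-upper B u

      -- Q is prime to the norm of a point and can be cancelled. What remains is a vector shorter
      -- than a cell whose norm is divisible by a number too large for it.
      separate : ∀ u w → cell B g δ gδ u ≡ cell B g δ gδ w → N (pt B u) ∣ℤ N (pt B u ⊖ pt B w) → u ≡ w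
      separate u w h d = G.box-≡ B u w (G.N-small ∣ N (pt B u) ∣ z δ
          (ℤD.∣-trans ℤD.∣m∣∣m (coprime-part (subst (N (pt B u) ∣ℤ_) (trans (cong N (G.pt-⊖ B u w)) (G.N-Q⊗ z)) d)))
          (G.cell-≡ B g δ gδ u w h) small)
        where
        z : C
        z = box B u ⊖ box B w
        coprime-part : N (pt B u) ∣ℤ (+ Q) ℤ.^ D ℤ.* N z → N (pt B u) ∣ℤ N z
        coprime-part = coprime-∣ (N (pt B u)) ((+ Q) ℤ.^ D) (N z) (G.pt-≢0 B u) λ p pp d → G.p∤Q^D pp (G.pt-large B u p pp d)
        small : C₀ * δ ^ D < ∣ N (pt B u) ∣
        small = ℕP.*-cancelˡ-< 2 _ _ (begin-strict
            2 * (C₀ * δ ^ D) ≡⟨ sym (ℕP.*-assoc 2 C₀ (δ ^ D)) ⟩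
            γ * δ ^ D <⟨ ℕP.*-monoˡ-< (δ ^ D) {{ℕP.m^n≢0 δ D}} (ℕP.<-≤-trans γ<g (≤^D g)) ⟩
            g ^ D * δ ^ D ≡⟨ trans (sym (^-distribʳ-* D g δ)) (cong (_^ D) gδ) ⟩
            B ^ D ≤⟨ ℕP.^-monoˡ-≤ D (ℕP.m≤n*m B q {{ℕ.>-nonZero 1≤q}}) ⟩
            (q * B) ^ D ≤⟨ lower u ⟩
            2 * ∣ N (pt B u) ∣ ∎)
          where open ℕP.≤-Reasoning

  open Pairing R e aniso T L using (Roots; roots; Good; module WithRoots)

  module _ (i : Fin K) where
    module A₁ = At (ρ * toℕ i)
    module A₂ = At (ρ * (4 * Ω ∸ toℕ i))

    abstract
      2^lev : A₁.B * A₂.B ≡ 2 ^ τ * 2 ^ τ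
      2^lev = trans (sym (ℕP.^-distribˡ-+-* 2 (lev i + lev i) (lev′ i + lev′ i)))
        (trans (cong (2 ^_) (trans (l (lev i) (lev′ i)) (cong₂ _+_ (lev+lev′ i) (lev+lev′ i)))) (ℕP.^-distribˡ-+-* 2 τ τ))
        where
        l : ∀ a b → (a + a) + (b + b) ≡ (a + b) + (a + b)
        l = ℕRing.solve-∀

      -- Half of each box is good, hence a quarter of the V pairs of box points.
      enough : Wd ≤ cnt A₁.good? * cnt A₂.good?
      enough = ℕP.*-cancelˡ-≤ 4 (begin
        4 * Wd ≡⟨ 4Wd ⟩
        (2 ^ τ) ^ (D + D) ≡⟨ ℕP.^-distribˡ-+-* (2 ^ τ) D D ⟩
        (2 ^ τ) ^ D * (2 ^ τ) ^ D ≡⟨ sym (^-distribʳ-* D (2 ^ τ) (2 ^ τ)) ⟩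
        (2 ^ τ * 2 ^ τ) ^ D ≡⟨ cong (_^ D) (sym 2^lev) ⟩
        (A₁.B * A₂.B) ^ D ≡⟨ ^-distribʳ-* D A₁.B A₂.B ⟩
        A₁.B ^ D * A₂.B ^ D ≡⟨ cong₂ _*_ (sym (R₁.card≡ A₁.B)) (sym (R₁.card≡ A₂.B)) ⟩
        card A₁.B * card A₂.B ≤⟨ ℕP.*-mono-≤ A₁.good-many A₂.good-many ⟩
        2 * cnt A₁.good? * (2 * cnt A₂.good?) ≡⟨ l (cnt A₁.good?) (cnt A₂.good?) ⟩
        4 * (cnt A₁.good? * cnt A₂.good?) ∎)
        where
        open ℕP.≤-Reasoning
        l : ∀ a b → 2 * a * (2 * b) ≡ 4 * (a * b)
        l = ℕRing.solve-∀

    split : Fin Wd → Fin (cnt A₁.good?) × Fin (cnt A₂.good?)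
    split x = remQuot (cnt A₂.good?) (Fin.inject≤ x enough)

    e₁ : Fin Wd → ∃ A₁.IsGood
    e₁ x = enum A₁.good? (proj₁ (split x))

    e₂ : Fin Wd → ∃ A₂.IsGood
    e₂ x = enum A₂.good? (proj₂ (split x))

    abstract
      split-inj : ∀ x y → proj₁ (e₁ x) ≡ proj₁ (e₁ y) → proj₁ (e₂ x) ≡ proj₁ (e₂ y) → x ≡ y
      split-inj x y h₁ h₂ = FinP.inject≤-injective enough enough x y (trans (sym (FinP.combine-remQuot {cnt A₁.good?} (cnt A₂.good?) _))
        (trans (cong₂ combine (enum-inj A₁.good? _ _ h₁) (enum-inj A₂.good? _ _ h₂)) (FinP.combine-remQuot {cnt A₁.good?} (cnt A₂.good?) _)))

    v₁ v₂ : Fin Wd → C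
    v₁ x = pt A₁.B (proj₁ (e₁ x))
    v₂ x = pt A₂.B (proj₁ (e₂ x))

    abstract
      <L : ∀ k u → m₀ + k ≤ τ → ∣ N (pt (At.B k) u) ∣ < L
      <L k u h = s≤s (ℕP.≤-trans (At.upper k u) (ℕP.*-monoʳ-≤ C₀ (ℕP.^-monoˡ-≤ D (ℕP.*-monoʳ-≤ 3 (ℕP.*-monoʳ-≤ q (ℕP.^-monoʳ-≤ 2 (ℕP.+-mono-≤ h h)))))))

      good₁ : ∀ x → Good (v₁ x)
      good₁ x = record { sf = A₁.good-sqfree _ (proj₂ (e₁ x)) ; ≢0 = G.pt-≢0 A₁.B _ ; T< = G.pt-large A₁.B _
        ; <L = <L _ (proj₁ (e₁ x)) (ℕP.≤-trans (ℕP.m≤m+n (lev i) (lev′ i)) (ℕP.≤-reflexive (lev+lev′ i))) }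

      good₂ : ∀ x → Good (v₂ x)
      good₂ x = record { sf = A₂.good-sqfree _ (proj₂ (e₂ x)) ; ≢0 = G.pt-≢0 A₂.B _ ; T< = G.pt-large A₂.B _
        ; <L = <L _ (proj₁ (e₂ x)) (ℕP.≤-trans (ℕP.m≤n+m (lev′ i) (lev i)) (ℕP.≤-reflexive (lev+lev′ i))) }

    P : ℕ
    P = q * 2 ^ τ

    abstract
      q-sides : (q * A₁.B) ^ D * (q * A₂.B) ^ D ≡ P ^ (D + D)
      q-sides = trans (sym (^-distribʳ-* D (q * A₁.B) (q * A₂.B))) (trans (cong (_^ D) (trans (l q A₁.B A₂.B) (trans (cong (q * q *_) 2^lev) (sym (l q (2 ^ τ) (2 ^ τ))))))
        (trans (^-distribʳ-* D P P) (sym (ℕP.^-distribˡ-+-* P D D))))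
        where
        l : ∀ q a b → q * a * (q * b) ≡ q * q * (a * b)
        l = ℕRing.solve-∀

      norms-lower : ∀ x → P ^ (D + D) ≤ 4 * (∣ N (v₁ x) ∣ * ∣ N (v₂ x) ∣)
      norms-lower x = begin
        P ^ (D + D) ≡⟨ sym q-sides ⟩
        (q * A₁.B) ^ D * (q * A₂.B) ^ D ≤⟨ ℕP.*-mono-≤ (A₁.lower _) (A₂.lower _) ⟩
        2 * ∣ N (v₁ x) ∣ * (2 * ∣ N (v₂ x) ∣) ≡⟨ l ∣ N (v₁ x) ∣ ∣ N (v₂ x) ∣ ⟩
        4 * (∣ N (v₁ x) ∣ * ∣ N (v₂ x) ∣) ∎
        where
        open ℕP.≤-Reasoning
        l : ∀ a b → 2 * a * (2 * b) ≡ 4 * (a * b)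
        l = ℕRing.solve-∀

      norms-upper : ∀ x → ∣ N (v₁ x) ∣ * ∣ N (v₂ x) ∣ < R₂.card B′
      norms-upper x = begin-strict
        ∣ N (v₁ x) ∣ * ∣ N (v₂ x) ∣ ≤⟨ ℕP.*-mono-≤ (A₁.upper _) (A₂.upper _) ⟩
        C₀ * (3 * (q * A₁.B)) ^ D * (C₀ * (3 * (q * A₂.B)) ^ D) ≡⟨ cong₂ (λ a b → C₀ * a * (C₀ * b)) (^-distribʳ-* D 3 (q * A₁.B)) (^-distribʳ-* D 3 (q * A₂.B)) ⟩
        C₀ * (3 ^ D * (q * A₁.B) ^ D) * (C₀ * (3 ^ D * (q * A₂.B) ^ D)) ≡⟨ l C₀ (3 ^ D) ((q * A₁.B) ^ D) ((q * A₂.B) ^ D) ⟩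
        C₀ * C₀ * (3 ^ D * 3 ^ D * ((q * A₁.B) ^ D * (q * A₂.B) ^ D)) ≡⟨ cong₂ (λ a b → C₀ * C₀ * (a * b)) (sym (ℕP.^-distribˡ-+-* 3 D D)) q-sides ⟩
        C₀ * C₀ * (3 ^ (D + D) * P ^ (D + D)) <⟨ ℕP.*-monoˡ-< _ {{ℕ.>-nonZero (ℕP.*-mono-≤ (1≤^ (D + D) (s≤s z≤n)) (1≤^ (D + D) (ℕP.*-mono-≤ 1≤q (1≤^ τ (s≤s z≤n)))))}}
            (ℕP.<-≤-trans (ℕP.*-mono-< C₀<  C₀<) (ℕP.≤-trans (ℕP.*-mono-≤ (≤^D (C₀ + 1)) (≤^D (C₀ + 1))) (ℕP.≤-reflexive (sym (ℕP.^-distribˡ-+-* (C₀ + 1) D D))))) ⟩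
        (C₀ + 1) ^ (D + D) * (3 ^ (D + D) * P ^ (D + D)) ≡⟨ trans (sym (ℕP.*-assoc ((C₀ + 1) ^ (D + D)) _ _)) (trans (cong (_* P ^ (D + D)) (sym (^-distribʳ-* (D + D) (C₀ + 1) 3))) (sym (^-distribʳ-* (D + D) μ P))) ⟩
        B′ ^ (D + D) ≡⟨ sym (R₂.card≡ B′) ⟩
        R₂.card B′ ∎
        where
        open ℕP.≤-Reasoning
        C₀< : C₀ < C₀ + 1
        C₀< = ℕP.≤-reflexive (ℕP.+-comm 1 C₀)
        l : ∀ c t a b → c * (t * a) * (c * (t * b)) ≡ c * c * (t * t * (a * b))
        l = ℕRing.solve-∀

  abstract
    count : R₂.card (2 * B′) * (cells g * cells g) < K * Wd
    count = begin-strict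
      R₂.card (2 * B′) * (cells g * cells g) ≡⟨ cong (_* (cells g * cells g)) card-B′ ⟩
      (2 * (μ * q)) ^ (D + D) * V * (cells g * cells g) ≡⟨ l₂ ((2 * (μ * q)) ^ (D + D)) V (cells g * cells g) ⟩
      (2 * (μ * q)) ^ (D + D) * (cells g * cells g) * V ≡⟨ cong (_* V) Ω-def ⟩
      Ω * V ≡⟨ cong (Ω *_) (sym 4Wd) ⟩
      Ω * (4 * Wd) ≡⟨ l₃ Ω Wd ⟩
      4 * Ω * Wd <⟨ ℕP.m<n+m (4 * Ω * Wd) 1≤Wd ⟩
      K * Wd ∎
      where
      open ℕP.≤-Reasoning
      l₁ : ∀ m q t → 2 * (m * (q * t)) ≡ 2 * (m * q) * t
      l₁ = ℕRing.solve-∀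
      l₂ : ∀ a v c → a * v * c ≡ a * c * v
      l₂ = ℕRing.solve-∀
      l₃ : ∀ o w → o * (4 * w) ≡ 4 * o * w
      l₃ = ℕRing.solve-∀
      card-B′ : R₂.card (2 * B′) ≡ (2 * (μ * q)) ^ (D + D) * V
      card-B′ = trans (R₂.card≡ (2 * B′)) (trans (cong (_^ (D + D)) (l₁ μ q (2 ^ τ))) (^-distribʳ-* (D + D) (2 * (μ * q)) (2 ^ τ)))

  module Final (rts : ∀ p → Roots p) where
    open WithRoots rts

    record Datum (i : Fin K) (x : Fin Wd) : Set where
      field
        v′ : R₂.C
        v′< : R₂.‖ v′ ‖ < B′
        o₁ : Over true (v₁ i x) v′
        o₂ : Over false (v₂ i x) v′
        κ : ℤ
        Nκ : R₂.N v′ ≡ κ ℤ.* (N (v₁ i x) ℤ.* N (v₂ i x))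
        κ≢0 : ¬ κ ≡ + 0
        κ≤T : ∣ κ ∣ ≤ T

    cofactor : ∀ n κ m A B T → n ≡ κ ℤ.* m → ∣ n ∣ ≤ A * B → B ≤ 4 * ∣ m ∣ → ¬ m ≡ + 0 → A * 4 ≤ T → ∣ κ ∣ ≤ T
    cofactor n κ m A B T e h₁ h₂ m≢0 h₃ = ℕP.*-cancelʳ-≤ (∣ κ ∣) T (∣ m ∣) {{ℕ.≢-nonZero λ z → m≢0 (ℤP.∣i∣≡0⇒i≡0 z)}} (begin
      ∣ κ ∣ * ∣ m ∣ ≡⟨ sym (trans (cong ∣_∣ e) (ℤP.abs-* κ m)) ⟩
      ∣ n ∣ ≤⟨ h₁ ⟩
      A * B ≤⟨ ℕP.*-monoʳ-≤ A h₂ ⟩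
      A * (4 * ∣ m ∣) ≡⟨ sym (ℕP.*-assoc A 4 ∣ m ∣) ⟩
      A * 4 * ∣ m ∣ ≤⟨ ℕP.*-monoˡ-≤ ∣ m ∣ h₃ ⟩
      T * ∣ m ∣ ∎)
      where open ℕP.≤-Reasoning

    module _ (i : Fin K) (x : Fin Wd) where
      private
        n₁ n₂ : ℤ
        n₁ = N (v₁ i x)
        n₂ = N (v₂ i x)

      abstract
        n₁n₂≢0 : ¬ n₁ ℤ.* n₂ ≡ + 0
        n₁n₂≢0 z = [ Good.≢0 (good₁ i x) , Good.≢0 (good₂ i x) ]′ (ℤP.i*j≡0⇒i≡0∨j≡0 n₁ z)

        N-bound : ∀ v′ → R₂.‖ v′ ‖ < B′ → ∣ R₂.N v′ ∣ ≤ C₂ * μ ^ (D + D) * P i ^ (D + D)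
        N-bound v′ v′< = ℕP.≤-trans (N≤₂ v′) (ℕP.≤-trans (ℕP.*-monoʳ-≤ C₂ (ℕP.^-monoˡ-≤ (D + D) (ℕP.<⇒≤ v′<)))
          (ℕP.≤-reflexive (trans (cong (C₂ *_) (^-distribʳ-* (D + D) μ (P i))) (sym (ℕP.*-assoc C₂ (μ ^ (D + D)) (P i ^ (D + D)))))))

        κ-bound : ∀ v′ κ → R₂.‖ v′ ‖ < B′ → R₂.N v′ ≡ κ ℤ.* (n₁ ℤ.* n₂) → ∣ κ ∣ ≤ T
        κ-bound v′ κ v′< Nκ = cofactor (R₂.N v′) κ (n₁ ℤ.* n₂) (C₂ * μ ^ (D + D)) (P i ^ (D + D)) T Nκ (N-bound v′ v′<)
            (subst (λ z → P i ^ (D + D) ≤ 4 * z) (sym (ℤP.abs-* n₁ n₂)) (norms-lower i x)) n₁n₂≢0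
            (ℕP.≤-trans (ℕP.≤-reflexive (l C₂ (μ ^ (D + D)))) C₁≤T)
          where
          l : ∀ a b → a * b * 4 ≡ a * (4 * b)
          l = ℕRing.solve-∀

        κ-≢0 : ∀ v′ κ → ¬ v′ ≡ R₂.0# → R₂.N v′ ≡ κ ℤ.* (n₁ ℤ.* n₂) → ¬ κ ≡ + 0
        κ-≢0 v′ κ v′≢0 Nκ z = v′≢0 (R₂.N-0 v′ (trans Nκ (trans (cong (ℤ._* (n₁ ℤ.* n₂)) z) (ℤP.*-zeroˡ (n₁ ℤ.* n₂)))))

      fromQuotient : ∀ v′ → ¬ v′ ≡ R₂.0# → R₂.‖ v′ ‖ < B′ → Over true (v₁ i x) v′ → Over false (v₂ i x) v′ → n₁ ℤ.* n₂ ∣ℤ R₂.N v′ → Datum i x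
      fromQuotient v′ v′≢0 v′< o₁ o₂ (divides κ Nκ) = record
        { v′ = v′ ; v′< = v′< ; o₁ = o₁ ; o₂ = o₂ ; κ = κ ; Nκ = Nκ ; κ≢0 = κ-≢0 v′ κ v′≢0 Nκ ; κ≤T = κ-bound v′ κ v′< Nκ }

      fromPair : ∃[ v′ ] (¬ v′ ≡ R₂.0# × R₂.‖ v′ ‖ < B′ × Over true (v₁ i x) v′ × Over false (v₂ i x) v′) → Datum i x
      fromPair (v′ , v′≢0 , v′< , o₁ , o₂) = fromQuotient v′ v′≢0 v′< o₁ o₂ (divides-N (v₁ i x) (v₂ i x) v′ (good₁ i x) (good₂ i x) o₁ o₂)

      abstract
        datum : Datum i x
        datum = fromPair (pair (v₁ i x) (v₂ i x) (good₁ i x) (good₂ i x) B′ (norms-upper i x))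

    module _ (i j : Fin K) (x y : Fin Wd) (same : Datum.v′ (datum i x) ≡ Datum.v′ (datum j y)) where
      private
        module X = Datum (datum i x)
        module Y = Datum (datum j y)

      module Rec₁ = Recover (v₁ i x) (v₂ i x) (v₁ j y) (v₂ j y) X.v′ true (good₁ i x) (good₂ i x) (good₁ j y) (good₂ j y) X.o₁ X.o₂
        (subst (Over true (v₁ j y)) (sym same) Y.o₁) (subst (Over false (v₂ j y)) (sym same) Y.o₂) X.κ Y.κ X.Nκ (trans (cong R₂.N same) Y.Nκ) X.κ≢0 Y.κ≢0 X.κ≤T Y.κ≤T

      module Rec₂ = Recover (v₂ i x) (v₁ i x) (v₂ j y) (v₁ j y) X.v′ false (good₂ i x) (good₁ i x) (good₂ j y) (good₁ j y) X.o₂ X.o₁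
        (subst (Over false (v₂ j y)) (sym same) Y.o₂) (subst (Over true (v₁ j y)) (sym same) Y.o₁) X.κ Y.κ (trans X.Nκ (cong (X.κ ℤ.*_) (ℤP.*-comm (N (v₁ i x)) (N (v₂ i x)))))
        (trans (cong R₂.N same) (trans Y.Nκ (cong (Y.κ ℤ.*_) (ℤP.*-comm (N (v₁ j y)) (N (v₂ j y)))))) X.κ≢0 Y.κ≢0 X.κ≤T Y.κ≤T

    norm≤ : ∀ i j x y → Datum.v′ (datum i x) ≡ Datum.v′ (datum j y) → ∣ N (v₁ i x) ∣ ≤ ∣ N (v₁ j y) ∣
    norm≤ i j x y same = ℕD.∣⇒≤ {{ℕ.≢-nonZero λ z → Good.≢0 (good₁ j y) (ℤP.∣i∣≡0⇒i≡0 z)}} (∣⇒∣ᵤ (Rec₁.N∣ i j x y same))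

    -- The first norm of one pair divides that of the other, whereas norms on a higher level exceed
    -- all norms on a lower one.
    level-≤ : ∀ i j x y → Datum.v′ (datum i x) ≡ Datum.v′ (datum j y) → toℕ i ≤ toℕ j
    level-≤ i j x y same = ℕP.≮⇒≥ λ j<i → ℕP.<⇒≱ (begin-strict
        2 * ∣ N (v₁ j y) ∣ ≤⟨ ℕP.*-monoʳ-≤ 2 (At.upper (ρ * toℕ j) (proj₁ (e₁ j y))) ⟩
        2 * (C₀ * (3 * (q * Bj)) ^ D) ≡⟨ trans (cong (λ z → 2 * (C₀ * z)) (^-distribʳ-* D 3 (q * Bj))) (l C₀ (3 ^ D) ((q * Bj) ^ D)) ⟩
        ρ * (q * Bj) ^ D <⟨ ℕP.*-monoˡ-< ((q * Bj) ^ D) {{ℕ.>-nonZero (1≤^ D (ℕP.*-mono-≤ 1≤q (1≤^ (lev j + lev j) (s≤s z≤n))))}} (ℕP.<-≤-trans (n<2^n ρ) (≤^D (2 ^ ρ))) ⟩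
        (2 ^ ρ) ^ D * (q * Bj) ^ D ≡⟨ sym (^-distribʳ-* D (2 ^ ρ) (q * Bj)) ⟩
        (2 ^ ρ * (q * Bj)) ^ D ≤⟨ ℕP.^-monoˡ-≤ D (ratio j<i) ⟩
        (q * Bi) ^ D ∎) (ℕP.≤-trans (At.lower (ρ * toℕ i) (proj₁ (e₁ i x))) (ℕP.*-monoʳ-≤ 2 (norm≤ i j x y same)))
      where
      open ℕP.≤-Reasoning
      Bi = At.B (ρ * toℕ i)
      Bj = At.B (ρ * toℕ j)
      l : ∀ c t z → 2 * (c * (t * z)) ≡ 2 * (c * t) * z
      l = ℕRing.solve-∀
      ratio : toℕ j < toℕ i → 2 ^ ρ * (q * Bj) ≤ q * Bi
      ratio j<i = begin
        2 ^ ρ * (q * Bj) ≡⟨ l′ (2 ^ ρ) q Bj ⟩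
        q * (2 ^ ρ * Bj) ≡⟨ cong (q *_) (sym (ℕP.^-distribˡ-+-* 2 ρ (lev j + lev j))) ⟩
        q * 2 ^ (ρ + (lev j + lev j)) ≤⟨ ℕP.*-monoʳ-≤ q (ℕP.^-monoʳ-≤ 2 step) ⟩
        q * Bi ∎
        where
        l′ : ∀ a b c → a * (b * c) ≡ b * (a * c)
        l′ = ℕRing.solve-∀
        lev≤ : ρ + lev j ≤ lev i
        lev≤ = ℕP.≤-trans (ℕP.≤-reflexive (l″ ρ m₀ (toℕ j))) (ℕP.+-monoʳ-≤ m₀ (ℕP.*-monoʳ-≤ ρ j<i))
          where
          l″ : ∀ r m j → r + (m + r * j) ≡ m + r * suc j
          l″ = ℕRing.solve-∀
        step : ρ + (lev j + lev j) ≤ lev i + lev i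
        step = ℕP.≤-trans (ℕP.≤-reflexive (sym (ℕP.+-assoc ρ (lev j) (lev j)))) (ℕP.+-mono-≤ lev≤ (ℕP.≤-trans (ℕP.m≤n+m (lev j) ρ) lev≤))

    cell₁ cell₂ : Fin K → Fin Wd → Fin (cells g)
    cell₁ i x = cell (A₁.B i) g (A₁.δ i) {{A₁.δ≢0 i}} (A₁.gδ i) (proj₁ (e₁ i x))
    cell₂ i x = cell (A₂.B i) g (A₂.δ i) {{A₂.δ≢0 i}} (A₂.gδ i) (proj₁ (e₂ i x))

    code′ : Fin K → Fin Wd → Fin (R₂.card (2 * B′))
    code′ i x = R₂.enc B′ (Datum.v′ (datum i x)) (Datum.v′< (datum i x))

    -- v′ alone gives the level; the two cells then single out the generators among the points
    -- vanishing at the same places.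
    key : Fin K → Fin Wd → Fin (R₂.card (2 * B′) * (cells g * cells g))
    key i x = combine (code′ i x) (combine (cell₁ i x) (cell₂ i x))

    key-v′ : ∀ i j x y → key i x ≡ key j y → Datum.v′ (datum i x) ≡ Datum.v′ (datum j y)
    key-v′ i j x y h = R₂.enc-inj B′ (Datum.v′ (datum i x)) (Datum.v′ (datum j y)) (Datum.v′< (datum i x)) (Datum.v′< (datum j y))
      (FinP.combine-injectiveˡ (code′ i x) (combine (cell₁ i x) (cell₂ i x)) (code′ j y) (combine (cell₁ j y) (cell₂ j y)) h)

    key-cells : ∀ i x y → key i x ≡ key i y → combine (cell₁ i x) (cell₂ i x) ≡ combine (cell₁ i y) (cell₂ i y)
    key-cells i x y h = FinP.combine-injectiveʳ (code′ i x) (combine (cell₁ i x) (cell₂ i x)) (code′ i y) (combine (cell₁ i y) (cell₂ i y)) h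

    key-inj : ∀ i x y → key i x ≡ key i y → x ≡ y
    key-inj i x y h = split-inj i x y
      (A₁.separate i (proj₁ (e₁ i x)) (proj₁ (e₁ i y)) (FinP.combine-injectiveˡ (cell₁ i x) (cell₂ i x) (cell₁ i y) (cell₂ i y) (key-cells i x y h)) (Rec₁.N∣diff i i x y same))
      (A₂.separate i (proj₁ (e₂ i x)) (proj₁ (e₂ i y)) (FinP.combine-injectiveʳ (cell₁ i x) (cell₂ i x) (cell₁ i y) (cell₂ i y) (key-cells i x y h)) (Rec₂.N∣diff i i x y same))
      where
      same : Datum.v′ (datum i x) ≡ Datum.v′ (datum i y)
      same = key-v′ i i x y h

    key-level : ∀ i j x y → key i x ≡ key j y → i ≡ j
    key-level i j x y h = FinP.toℕ-injective (ℕP.≤-antisym (level-≤ i j x y (key-v′ i j x y h)) (level-≤ j i y x (sym (key-v′ i j x y h))))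

    pairKey : Fin K × Fin Wd → Fin (R₂.card (2 * B′) * (cells g * cells g))
    pairKey (i , x) = key i x

    pairKey-inj : ∀ a b → pairKey a ≡ pairKey b → a ≡ b
    pairKey-inj (i , x) (j , y) h = go i j x y (key-level i j x y h) h
      where
      go : ∀ i j x y → i ≡ j → key i x ≡ key j y → (i , x) ≡ (j , y)
      go i .i x y refl h = cong (i ,_) (key-inj i x y h)

    contra : ⊥
    contra = ℕP.<⇒≱ count (product≤ pairKey pairKey-inj)

  -- Roots are needed only below L, so finitely many double negations have to be removed before the
  -- contradiction.
  absurd : ⊥
  absurd = ¬¬-below {P = Roots} L (λ p _ → roots S₀ H S₀≤T S₂≤T p) λ f → Final.contra λ p → total f p (p ℕ.<? L)
    where
    total : (∀ p → p < L → Roots p) → ∀ p → Dec (p < L) → Roots p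
    total f p (yes h) = f p h
    total f p (no n) = record { hs = [] ; sg = λ () ; kill = λ _ _ h → contradiction h n ; prodR = λ _ _ h → contradiction h n }

-- Kummer theory for powers of two

module PowersOfTwo (R : Rg) where
  open Rg R

  -- The power x^(2^k), squaring the base first, so that one square root taken lowers k by one.
  pw2 : C → ℕ → C
  pw2 x zero = x
  pw2 x (suc k) = pw2 (x ⊗ x) k

  pw2-⊗ : ∀ x y k → pw2 (x ⊗ y) k ≡ pw2 x k ⊗ pw2 y k
  pw2-⊗ x y zero = refl
  pw2-⊗ x y (suc k) = trans (cong (λ z → pw2 z k) (solve 2 (λ x y → (x :* y) :* (x :* y) := (x :* x) :* (y :* y)) refl x y)) (pw2-⊗ (x ⊗ x) (y ⊗ y) k)

  pw2-sq : ∀ x k → pw2 x (suc k) ≡ pw2 x k ⊗ pw2 x k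
  pw2-sq x k = pw2-⊗ x x k

  pw2-+ : ∀ x j k → pw2 x (j ℕ.+ k) ≡ pw2 (pw2 x j) k
  pw2-+ x zero k = refl
  pw2-+ x (suc j) k = pw2-+ (x ⊗ x) j k

  pw2-1 : ∀ k → pw2 1# k ≡ 1#
  pw2-1 zero = refl
  pw2-1 (suc k) = trans (cong (λ z → pw2 z k) (⊗-idˡ 1#)) (pw2-1 k)

  -- −1 is a 2^(k−1)-th power.
  NegPow : ℕ → Set
  NegPow zero = ⊤
  NegPow (suc k) = ∃[ ζ ] (pw2 ζ k ≡ ⊝ 1#)

  NegPow-pred : ∀ k → NegPow (suc k) → NegPow k
  NegPow-pred zero _ = tt
  NegPow-pred (suc k) (ζ , h) = ζ ⊗ ζ , h

  ⊝1⊗ : ∀ x → ⊝ 1# ⊗ x ≡ ⊝ x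
  ⊝1⊗ x = trans (cong (λ o → ⊝ o ⊗ x) (sym ι-1)) (trans (solve 1 (λ x → (:- con (+ 1)) :* x := :- x) refl x) refl)

  module OfHom {p} (pp : Prime p) (h : Hom R p) where
    open Hom h
    open I using (_*_; _-_; _+_)

    f-sq : ∀ x y → + p ∣ℤ f x - y → + p ∣ℤ f (x ⊗ x) - y * y
    f-sq x y d = ∣-comb (+ 1) (f x + y) (f-*ₚ x x) d (l (f (x ⊗ x)) (f x) y)
      where
      l : ∀ a b c → a - c * c ≡ + 1 * (a - b * b) + (b + c) * (b - c)
      l = solve-∀

module Domain (R : TR) where
  open TR R
  open PowersOfTwo rg public

  0^ : ∀ D → 1 ℕ.≤ D → (+ 0) ℤ.^ D ≡ + 0
  0^ (suc D) _ = refl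

  N-0# : N 0# ≡ + 0
  N-0# = trans (cong N (sym ι-0)) (trans (N-ι (+ 0)) (0^ D 1≤D))

  0? : ∀ x → Dec (x ≡ 0#)
  0? x with N x ℤ.≟ + 0
  ... | yes h = yes (N-0 x h)
  ... | no n = no λ h → n (trans (cong N h) N-0#)

  ⊗-0 : ∀ x y → x ⊗ y ≡ 0# → x ≡ 0# ⊎ y ≡ 0#
  ⊗-0 x y h with ℤP.i*j≡0⇒i≡0∨j≡0 (N x) (trans (sym (N-* x y)) (trans (cong N h) N-0#))
  ... | inj₁ a = inj₁ (N-0 x a)
  ... | inj₂ b = inj₂ (N-0 y b)

  ⊗-≢0 : ∀ {x y} → ¬ x ≡ 0# → ¬ y ≡ 0# → ¬ x ⊗ y ≡ 0#
  ⊗-≢0 nx ny h = [ nx , ny ]′ (⊗-0 _ _ h)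

  cancelˡ : ∀ z x y → ¬ z ≡ 0# → z ⊗ x ≡ z ⊗ y → x ≡ y
  cancelˡ z x y nz h = ⊖-≡ ([ (λ e → contradiction e nz) , id ]′ (⊗-0 z (x ⊖ y)
    (trans (solve 3 (λ z x y → z :* (x :- y) := z :* x :- z :* y) refl z x y) (≡-⊖ h))))

  sq-≡ : ∀ x y → x ⊗ x ≡ y ⊗ y → x ≡ y ⊎ x ≡ ⊝ y
  sq-≡ x y h with ⊗-0 (x ⊖ y) (x ⊕ y) (trans (solve 2 (λ x y → (x :- y) :* (x :+ y) := x :* x :- y :* y) refl x y) (≡-⊖ h))
  ... | inj₁ e = inj₁ (⊖-≡ e)
  ... | inj₂ e = inj₂ (⊖-≡ (trans (cong (x ⊕_) (solve 1 (λ y → :- (:- y) := y) refl y)) e))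

  ι-≢0 : ∀ {n} → ¬ n ≡ + 0 → ¬ ι n ≡ 0#
  ι-≢0 {n} n≢0 h = n≢0 (pow0 D (trans (sym (N-ι n)) (trans (cong N h) N-0#)))
    where
    pow0 : ∀ k → n ℤ.^ k ≡ + 0 → n ≡ + 0
    pow0 (suc k) e = [ id , pow0 k ]′ (ℤP.i*j≡0⇒i≡0∨j≡0 n e)

  1≢0 : ¬ 1# ≡ 0#
  1≢0 h = ι-≢0 {+ 1} (λ ()) (trans ι-1 h)

  ⊝-self : ∀ x → ⊝ x ≡ x → x ≡ 0#
  ⊝-self x h = [ (λ e → contradiction e (ι-≢0 {+ 2} (λ ()))) , id ]′ (⊗-0 (ι (+ 2)) x
    (trans (solve 1 (λ x → con (+ 2) :* x := x :- (:- x)) refl x) (≡-⊖ (sym h))))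

  pw2-≢0 : ∀ {x} k → ¬ x ≡ 0# → ¬ pw2 x k ≡ 0#
  pw2-≢0 zero h = h
  pw2-≢0 (suc k) h = pw2-≢0 k (⊗-≢0 h h)

  pw2-ι : ∀ n k → pw2 (ι n) k ≡ ι (n ℤ.^ (2 ℕ.^ k))
  pw2-ι n zero = cong ι (sym (ℤP.*-identityʳ n))
  pw2-ι n (suc k) = trans (cong (λ z → pw2 z k) (sym (ι-* n n))) (trans (pw2-ι (n ℤ.* n) k)
    (cong ι (trans (^-distribʳ-*ℤ (2 ℕ.^ k) n n) (trans (sym (ℤP.^-distribˡ-+-* n (2 ℕ.^ k) (2 ℕ.^ k))) (cong (λ z → n ℤ.^ (2 ℕ.^ k ℕ.+ z)) (sym (ℕP.+-identityʳ (2 ℕ.^ k))))))))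

  -- Were e not a square in the fraction field, the counting argument would apply to R[√e].
  local-square : ∀ e S₀ → (∀ p → Prime p → S₀ ℕ.< p → (h : Hom rg p) → ∃[ s ] (+ p ∣ℤ s ℤ.* s ℤ.- Hom.f h e)) →
                 ¬ ¬ (∃[ x ] ∃[ y ] (¬ y ≡ 0# × x ⊗ x ≡ e ⊗ (y ⊗ y)))
  local-square e S₀ H k = Engine.absurd R e (λ x y h → decidable-stable (0? y) λ ny → k (x , y , ny , h)) S₀ H

  pw2ℤ : ℤ → ℕ → ℤ
  pw2ℤ = PowersOfTwo.pw2 ℤ-rg

  module _ where
    open I using (_*_; _-_; _+_)

    f-pw2 : ∀ {p} (pp : Prime p) (h : Hom rg p) x y k → + p ∣ℤ Hom.f h x - y → + p ∣ℤ Hom.f h (pw2 x k) - pw2ℤ y k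
    f-pw2 pp h x y zero d = d
    f-pw2 pp h x y (suc k) d = f-pw2 pp h (x ⊗ x) (y * y) k (OfHom.f-sq pp h x y d)

    Locally : ℕ → C → C → ℕ → Set
    Locally S₀ u v k = ∀ p → Prime p → S₀ ℕ.< p → (h : Hom rg p) → ∃[ w ] (+ p ∣ℤ pw2ℤ w k * Hom.f h v - Hom.f h u)

    -- By `local-square`, x² = u v y², so u / v is the square of x / (v y). This quotient is locally
    -- a 2^k-th power up to sign, and the sign is absorbed because -1 = ζ^(2^k).
    local-power : ∀ k → NegPow k → ∀ S₀ u v → ¬ u ≡ 0# → ¬ v ≡ 0# → Locally S₀ u v k →
                  ¬ ¬ (∃[ x ] ∃[ y ] (¬ y ≡ 0# × pw2 x k ⊗ v ≡ u ⊗ pw2 y k))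
    local-power zero _ S₀ u v u≢0 v≢0 H K = K (u , v , v≢0 , refl)
    local-power (suc k) (ζ , hζ) S₀ u v u≢0 v≢0 H K = local-square (u ⊗ v) S₀ square λ { (x , y , y≢0 , e) →
        local-power k (NegPow-pred k (ζ , hζ)) S₀ x (v ⊗ y) (x≢0 x y y≢0 e) (⊗-≢0 v≢0 y≢0) (root x y e) λ { (X , Y , Y≢0 , E) →
          K (X , Y , Y≢0 , lift x y X Y y≢0 e E) } }
      where
      square : ∀ p → Prime p → S₀ ℕ.< p → (h : Hom rg p) → ∃[ s ] (+ p ∣ℤ s * s - Hom.f h (u ⊗ v))
      square p pp S<p h with H p pp S<p h
      ... | w , d = pw2ℤ w k * f v , ∣-comb (f v) (- (+ 1)) (subst (λ z → + p ∣ℤ z * f v - f u) (PowersOfTwo.pw2-sq ℤ-rg w k) d) (f-*ₚ u v)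
                      (l (pw2ℤ w k) (f v) (f u) (f (u ⊗ v)))
        where
        open Hom h
        l : ∀ w v u x → w * v * (w * v) - x ≡ v * (w * w * v - u) + - (+ 1) * (x - u * v)
        l = solve-∀
      x≢0 : ∀ x y → ¬ y ≡ 0# → x ⊗ x ≡ u ⊗ v ⊗ (y ⊗ y) → ¬ x ≡ 0#
      x≢0 x y y≢0 e h = ⊗-≢0 (⊗-≢0 u≢0 v≢0) (⊗-≢0 y≢0 y≢0) (trans (sym e) (trans (cong (_⊗ x) h) (⊗-zeroˡ x)))
      root : ∀ x y → x ⊗ x ≡ u ⊗ v ⊗ (y ⊗ y) → Locally S₀ x (v ⊗ y) k
      root x y e p pp S<p h with H p pp S<p h
      ... | w , d = [ (λ a → w , ∣-comb W (- (+ 1)) (f-*ₚ v y) a (l₁ W (f (v ⊗ y)) (f v) (f y) (f x))) ,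
                      (λ b → f ζ * w , ∣-comb W (- (+ 1)) (f-*ₚ v y) (neg b) (l₂ W (f (v ⊗ y)) (f v) (f y) (f x) (pw2ℤ (f ζ * w) k))) ]′
                    (euclid pp (f x - W * (f v * f y)) (f x + W * (f v * f y)) main)
        where
        open Hom h
        W = pw2ℤ w k
        l₁ : ∀ W vy v y x → W * vy - x ≡ W * (vy - v * y) + - (+ 1) * (x - W * (v * y))
        l₁ = solve-∀
        l₂ : ∀ W vy v y x W′ → W′ * vy - x ≡ W * (vy - v * y) + - (+ 1) * (x - W * (v * y) - (W′ - W) * vy)
        l₂ = solve-∀
        d′ : + p ∣ℤ W * W * f v - f u
        d′ = subst (λ z → + p ∣ℤ z * f v - f u) (PowersOfTwo.pw2-sq ℤ-rg w k) d
        uv : + p ∣ℤ f (u ⊗ v ⊗ (y ⊗ y)) - f u * f v * (f y * f y)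
        uv = ∣-comb (+ 1) (+ 1) (f-*ₚ (u ⊗ v) (y ⊗ y)) (ℤD.∣m∣n⇒∣m+n (∣*ˡ (f (u ⊗ v)) (f-*ₚ y y)) (∣*ʳ (f y * f y) (f-*ₚ u v)))
               (l (f (u ⊗ v ⊗ (y ⊗ y))) (f (u ⊗ v)) (f (y ⊗ y)) (f u * f v) (f y * f y))
          where
          l : ∀ a b c d e → a - d * e ≡ + 1 * (a - b * c) + + 1 * (b * (c - e) + (b - d) * e)
          l = solve-∀
        main : + p ∣ℤ (f x - W * (f v * f y)) * (f x + W * (f v * f y))
        main = ∣-comb (+ 1) (- (+ 1)) (ℤD.∣m∣n⇒∣m-n (subst (λ z → + p ∣ℤ f z - f u * f v * (f y * f y)) (sym e) uv) (f-*ₚ x x))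
                 (∣*ˡ (f v * (f y * f y)) d′) (l (f (x ⊗ x)) (f x) (f u) (f v) (f y) W)
          where
          l : ∀ xx x u v y W → (x - W * (v * y)) * (x + W * (v * y)) ≡ + 1 * ((xx - u * v * (y * y)) - (xx - x * x)) + - (+ 1) * ((v * (y * y)) * (W * W * v - u))
          l = solve-∀
        ζ-neg : + p ∣ℤ pw2ℤ (f ζ) k + + 1
        ζ-neg = ∣-comb (- (+ 1)) (+ 0) (subst (λ z → + p ∣ℤ z - pw2ℤ (f ζ) k) (trans (cong f hζ) (trans (f-⊝ 1#) (cong -_ f-1)))
                  (f-pw2 pp h ζ (f ζ) k (subst (+ p ∣ℤ_) (sym (ℤP.+-inverseʳ (f ζ))) ∣0))) ∣0 (l (pw2ℤ (f ζ) k))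
          where
          l : ∀ z → z + + 1 ≡ - (+ 1) * (- (+ 1) - z) + + 0 * + 0
          l = solve-∀
        neg : + p ∣ℤ f x + W * (f v * f y) → + p ∣ℤ f x - W * (f v * f y) - (pw2ℤ (f ζ * w) k - W) * f (v ⊗ y)
        neg b = ∣-comb (+ 1) (- (+ 1)) b (ℤD.∣m∣n⇒∣m+n (∣*ˡ (pw2ℤ (f ζ) k * W) (f-*ₚ v y)) (ℤD.∣m∣n⇒∣m-n (∣*ʳ (W * (f v * f y)) ζ-neg) (∣*ˡ W (f-*ₚ v y))))
          (trans (cong (λ z → f x - W * (f v * f y) - (z - W) * f (v ⊗ y)) (PowersOfTwo.pw2-⊗ ℤ-rg (f ζ) w k))
             (l (f x) W (f v * f y) (pw2ℤ (f ζ) k) (f (v ⊗ y))))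
          where
          l : ∀ x W c z s → x - W * c - (z * W - W) * s ≡ + 1 * (x + W * c) + - (+ 1) * ((z * W) * (s - c) + ((z + + 1) * (W * c) - W * (s - c)))
          l = solve-∀
      lift : ∀ x y X Y → ¬ y ≡ 0# → x ⊗ x ≡ u ⊗ v ⊗ (y ⊗ y) → pw2 X k ⊗ (v ⊗ y) ≡ x ⊗ pw2 Y k → pw2 X (suc k) ⊗ v ≡ u ⊗ pw2 Y (suc k)
      lift x y X Y y≢0 e E = cancelˡ (v ⊗ (y ⊗ y)) _ _ (⊗-≢0 v≢0 (⊗-≢0 y≢0 y≢0)) (begin
        (v ⊗ (y ⊗ y)) ⊗ (pw2 X (suc k) ⊗ v) ≡⟨ cong (λ z → (v ⊗ (y ⊗ y)) ⊗ (z ⊗ v)) (pw2-sq X k) ⟩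
        (v ⊗ (y ⊗ y)) ⊗ (pw2 X k ⊗ pw2 X k ⊗ v) ≡⟨ solve 3 (λ v y a → (v :* (y :* y)) :* (a :* a :* v) := (a :* (v :* y)) :* (a :* (v :* y))) refl v y (pw2 X k) ⟩
        (pw2 X k ⊗ (v ⊗ y)) ⊗ (pw2 X k ⊗ (v ⊗ y)) ≡⟨ cong₂ _⊗_ E E ⟩
        (x ⊗ pw2 Y k) ⊗ (x ⊗ pw2 Y k) ≡⟨ solve 2 (λ x b → (x :* b) :* (x :* b) := (x :* x) :* (b :* b)) refl x (pw2 Y k) ⟩
        (x ⊗ x) ⊗ (pw2 Y k ⊗ pw2 Y k) ≡⟨ cong₂ _⊗_ e (sym (pw2-sq Y k)) ⟩
        (u ⊗ v ⊗ (y ⊗ y)) ⊗ pw2 Y (suc k) ≡⟨ solve 4 (λ u v y b → (u :* v :* (y :* y)) :* b := (v :* (y :* y)) :* (u :* b)) refl u v y (pw2 Y (suc k)) ⟩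
        (v ⊗ (y ⊗ y)) ⊗ (u ⊗ pw2 Y (suc k)) ∎)
        where open ≡-Reasoning

module Conjugation (R : TR) (e : TR.C R) (aniso : ∀ x y → TR._⊗_ R x x ≡ TR._⊗_ R e (TR._⊗_ R y y) → y ≡ TR.0# R) where
  open TR R
  open ExtRing rg e using (nm; C′; scal)
  R⁺ : TR
  R⁺ = Ext R e aniso
  module R⁺ = TR R⁺
  open R⁺ using () renaming (_⊗_ to _⊗⁺_; ⊝_ to ⊝⁺_)
  module Dm = Domain R
  module Dm⁺ = Domain R⁺
  open Dm using (pw2; NegPow)
  open Dm⁺ using () renaming (pw2 to pw2⁺)

  j : C → C′
  j x = x , 0#

  ⊝0 : ⊝ 0# ≡ 0#
  ⊝0 = trans (sym (⊕-idˡ (⊝ 0#))) (⊖-self 0#)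

  j-⊗ : ∀ x y → j (x ⊗ y) ≡ j x ⊗⁺ j y
  j-⊗ x y = sym (trans (scal x y 0#) (cong (x ⊗ y ,_) (⊗-zeroʳ x)))

  j-pw2 : ∀ x k → j (pw2 x k) ≡ pw2⁺ (j x) k
  j-pw2 x zero = refl
  j-pw2 x (suc k) = trans (j-pw2 (x ⊗ x) k) (cong (λ z → pw2⁺ z k) (j-⊗ x x))

  j-≢0 : ∀ {x} → ¬ x ≡ 0# → ¬ j x ≡ R⁺.0#
  j-≢0 n h = n (cong proj₁ h)

  σ : C′ → C′
  σ (x , y) = x , ⊝ y

  σ-⊗ : ∀ v w → σ (v ⊗⁺ w) ≡ σ v ⊗⁺ σ w
  σ-⊗ (x , y) (z , w) = cong₂ _,_
    (solve 5 (λ e x y z w → x :* z :+ e :* (y :* w) := x :* z :+ e :* ((:- y) :* (:- w))) refl e x y z w)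
    (solve 4 (λ x y z w → :- (x :* w :+ y :* z) := x :* (:- w) :+ (:- y) :* z) refl x y z w)

  σ-pw2 : ∀ v k → σ (pw2⁺ v k) ≡ pw2⁺ (σ v) k
  σ-pw2 v zero = refl
  σ-pw2 v (suc k) = trans (σ-pw2 (v ⊗⁺ v) k) (cong (λ z → pw2⁺ z k) (σ-⊗ v v))

  σ-j : ∀ x → σ (j x) ≡ j x
  σ-j x = cong (x ,_) ⊝0

  σ-nm : ∀ v → v ⊗⁺ σ v ≡ j (nm (proj₁ v) (proj₂ v))
  σ-nm (x , y) = cong₂ _,_ (solve 3 (λ e x y → x :* x :+ e :* (y :* (:- y)) := x :* x :- e :* (y :* y)) refl e x y)
    (trans (solve 2 (λ x y → x :* (:- y) :+ y :* x := con (+ 0)) refl x y) ι-0)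

  nm-≢0 : ∀ v → ¬ v ≡ R⁺.0# → ¬ nm (proj₁ v) (proj₂ v) ≡ 0#
  nm-≢0 (x , y) n h = n (nm-0 R e aniso x y h)

  Pure : C′ → Set
  Pure X = proj₁ X ≡ 0# ⊎ proj₂ X ≡ 0#

  -- If x ≠ 0, the first coordinates give η = 1, and the second then give y = -y.
  eigen-pure : ∀ η X → σ X ≡ j η ⊗⁺ X → Pure X
  eigen-pure η X@(x , y) h with Dm.0? x
  ... | yes x≡0 = inj₁ x≡0
  ... | no x≢0 = inj₂ (Dm.⊝-self y (trans (cong proj₂ h) (trans (cong proj₂ (scal η x y)) (trans (cong (_⊗ y) η≡1) (⊗-idˡ y)))))
    where
    η≡1 : η ≡ 1#
    η≡1 = Dm.cancelˡ x η 1# x≢0 (trans (⊗-comm x η) (trans (sym (cong proj₁ (trans h (scal η x y)))) (trans (sym (⊗-idˡ x)) (⊗-comm 1# x))))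

  -- X = x σ(y) is x / y times the norm of y. Thus X^(2^F) V lies in R and is fixed by σ, which
  -- makes σ(X) / X a root of unity; it remains to see that X is pure.
  module Descend (k : ℕ) (V W : C) (V≢0 : ¬ V ≡ 0#) (x y : C′) (y≢0 : ¬ y ≡ R⁺.0#)
                 (eq : pw2⁺ x (suc k) ⊗⁺ j V ≡ j W ⊗⁺ pw2⁺ y (suc k)) where
    F = suc k

    X : C′
    X = x ⊗⁺ σ y

    n : C
    n = nm (proj₁ y) (proj₂ y)

    n≢0 : ¬ n ≡ 0#
    n≢0 = nm-≢0 y y≢0

    eqX : pw2⁺ X F ⊗⁺ j V ≡ j (W ⊗ pw2 n F)
    eqX = begin
      pw2⁺ X F ⊗⁺ j V ≡⟨ cong (_⊗⁺ j V) (Dm⁺.pw2-⊗ x (σ y) F) ⟩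
      pw2⁺ x F ⊗⁺ pw2⁺ (σ y) F ⊗⁺ j V ≡⟨ R⁺.solve 3 (λ a b c → a :* b :* c R⁺.:= (a :* c) :* b) refl (pw2⁺ x F) (pw2⁺ (σ y) F) (j V) ⟩
      pw2⁺ x F ⊗⁺ j V ⊗⁺ pw2⁺ (σ y) F ≡⟨ cong (_⊗⁺ pw2⁺ (σ y) F) eq ⟩
      j W ⊗⁺ pw2⁺ y F ⊗⁺ pw2⁺ (σ y) F ≡⟨ R⁺.⊗-assoc (j W) (pw2⁺ y F) (pw2⁺ (σ y) F) ⟩
      j W ⊗⁺ (pw2⁺ y F ⊗⁺ pw2⁺ (σ y) F) ≡⟨ cong (j W ⊗⁺_) (trans (sym (Dm⁺.pw2-⊗ y (σ y) F)) (trans (cong (λ z → pw2⁺ z F) (σ-nm y)) (sym (j-pw2 n F)))) ⟩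
      j W ⊗⁺ j (pw2 n F) ≡⟨ sym (j-⊗ W (pw2 n F)) ⟩
      j (W ⊗ pw2 n F) ∎
      where open ≡-Reasoning

    X≢0 : ¬ W ≡ 0# → ¬ X ≡ R⁺.0#
    X≢0 W≢0 h = Dm.⊗-≢0 W≢0 (Dm.pw2-≢0 F n≢0) (cong proj₁ (trans (sym eqX) (trans (cong (λ z → pw2⁺ z F ⊗⁺ j V) h) (trans (cong (_⊗⁺ j V) pw0) (R⁺.⊗-zeroˡ (j V))))))
      where
      pw0 : pw2⁺ R⁺.0# F ≡ R⁺.0#
      pw0 = trans (Dm⁺.pw2-⊗ R⁺.0# R⁺.0# k) (trans (cong (_⊗⁺ pw2⁺ R⁺.0# k) (pw00 k)) (R⁺.⊗-zeroˡ (pw2⁺ R⁺.0# k)))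
        where
        pw00 : ∀ k → pw2⁺ R⁺.0# k ≡ R⁺.0#
        pw00 zero = refl
        pw00 (suc k) = trans (cong (λ z → pw2⁺ z k) (R⁺.⊗-zeroˡ R⁺.0#)) (pw00 k)

    conj : pw2⁺ (σ X) F ≡ pw2⁺ X F
    conj = Dm⁺.cancelˡ (j V) (pw2⁺ (σ X) F) (pw2⁺ X F) (j-≢0 V≢0) (begin
      j V ⊗⁺ pw2⁺ (σ X) F ≡⟨ cong₂ _⊗⁺_ (sym (σ-j V)) (sym (σ-pw2 X F)) ⟩
      σ (j V) ⊗⁺ σ (pw2⁺ X F) ≡⟨ sym (σ-⊗ (j V) (pw2⁺ X F)) ⟩
      σ (j V ⊗⁺ pw2⁺ X F) ≡⟨ cong σ (trans (R⁺.⊗-comm (j V) (pw2⁺ X F)) eqX) ⟩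
      σ (j (W ⊗ pw2 n F)) ≡⟨ σ-j _ ⟩
      j (W ⊗ pw2 n F) ≡⟨ trans (sym eqX) (R⁺.⊗-comm (pw2⁺ X F) (j V)) ⟩
      j V ⊗⁺ pw2⁺ X F ∎)
      where open ≡-Reasoning

    Descent : Set
    Descent = ∃[ x ] ∃[ y ] (¬ y ≡ 0# × (pw2 x F ⊗ V ≡ W ⊗ pw2 y F ⊎ pw2 x F ⊗ pw2 e k ⊗ V ≡ W ⊗ pw2 y F))

    -- A multiple of √e contributes (√e)^(2^F) = e^(2^k), whence the second alternative.
    descend : Pure X → Descent
    descend (inj₂ X₁≡0) = proj₁ X , n , n≢0 , inj₁ (cong proj₁ (trans (j-⊗ _ V)
      (trans (cong (_⊗⁺ j V) (trans (j-pw2 (proj₁ X) F) (cong (λ z → pw2⁺ (proj₁ X , z) F) (sym X₁≡0)))) eqX)))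
    descend (inj₁ X₀≡0) = proj₂ X , n , n≢0 , inj₂ (cong proj₁ (trans (j-⊗ _ V) (trans (cong (_⊗⁺ j V) (begin
        j (pw2 (proj₂ X) F ⊗ pw2 e k) ≡⟨ cong j (trans (⊗-comm _ _) (sym (Dm.pw2-⊗ e (proj₂ X ⊗ proj₂ X) k))) ⟩
        j (pw2 (e ⊗ (proj₂ X ⊗ proj₂ X)) k) ≡⟨ j-pw2 _ k ⟩
        pw2⁺ (j (e ⊗ (proj₂ X ⊗ proj₂ X))) k ≡⟨ cong (λ z → pw2⁺ z k) (sym sq) ⟩
        pw2⁺ (0# , proj₂ X) F ≡⟨ cong (λ z → pw2⁺ (z , proj₂ X) F) (sym X₀≡0) ⟩
        pw2⁺ X F ∎)) eqX)))
      where
      open ≡-Reasoning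
      sq : (0# , proj₂ X) ⊗⁺ (0# , proj₂ X) ≡ j (e ⊗ (proj₂ X ⊗ proj₂ X))
      sq = cong₂ _,_ (trans (cong (_⊕ e ⊗ (proj₂ X ⊗ proj₂ X)) (⊗-zeroˡ 0#)) (⊕-idˡ _))
        (trans (cong₂ _⊕_ (⊗-zeroˡ (proj₂ X)) (⊗-zeroʳ (proj₂ X))) (⊕-idˡ 0#))

  -- `NegPow k` puts all 2^k-th roots of unity into R: at each square root the sign -1 is replaced
  -- by a power of ζ.
  root-ratio : ∀ k → NegPow k → ∀ X Y → pw2⁺ X k ≡ pw2⁺ Y k → ∃[ η ] (X ≡ j η ⊗⁺ Y)
  root-ratio zero _ X Y h = 1# , trans h (sym (R⁺.⊗-idˡ Y))
  root-ratio (suc k) (ζ , hζ) X Y h = [ root-ratio k np X Y , (λ e₂ → rescale (root-ratio k np X (j ζ ⊗⁺ Y) (trans e₂ (trans (sym (Dm⁺.⊝1⊗ (pw2⁺ Y k)))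
         (trans (cong (_⊗⁺ pw2⁺ Y k) (sym (trans (sym (j-pw2 ζ k)) (trans (cong j hζ) (cong (⊝ 1# ,_) (sym ⊝0)))))) (sym (Dm⁺.pw2-⊗ (j ζ) Y k))))))) ]′
      (Dm⁺.sq-≡ (pw2⁺ X k) (pw2⁺ Y k) (trans (sym (Dm⁺.pw2-sq X k)) (trans h (Dm⁺.pw2-sq Y k))))
    where
    np : NegPow k
    np = Dm.NegPow-pred k (ζ , hζ)
    rescale : ∃[ η ] (X ≡ j η ⊗⁺ (j ζ ⊗⁺ Y)) → ∃[ η ] (X ≡ j η ⊗⁺ Y)
    rescale (η , e₃) = η ⊗ ζ , trans e₃ (trans (sym (R⁺.⊗-assoc (j η) (j ζ) Y)) (cong (_⊗⁺ Y) (sym (j-⊗ η ζ))))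

  kummer : ∀ k → NegPow (suc k) → ∀ V W → ¬ V ≡ 0# → ∀ x y → ¬ y ≡ R⁺.0# → pw2⁺ x (suc k) ⊗⁺ j V ≡ j W ⊗⁺ pw2⁺ y (suc k) →
           ∃[ x ] ∃[ y ] (¬ y ≡ 0# × (pw2 x (suc k) ⊗ V ≡ W ⊗ pw2 y (suc k) ⊎ pw2 x (suc k) ⊗ pw2 e k ⊗ V ≡ W ⊗ pw2 y (suc k)))
  kummer k np V W V≢0 x y y≢0 eq = descend (eigen-pure (proj₁ rr) X (proj₂ rr))
    where
    open Descend k V W V≢0 x y y≢0 eq
    rr = root-ratio F np (σ X) X conj

-- Adjoining 2-power roots of a

module Radicals (F′ : ℕ) (a b t : ℤ) (a≢0 : ¬ a ≡ + 0) (b≢0 : ¬ b ≡ + 0) (t≢0 : ¬ t ≡ + 0) (S₀ : ℕ)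
                (H : ∀ p → Prime p → S₀ ℕ.< p → ∃[ m ] (+ p ∣ℤ t ℤ.* a ℤ.^ m ℤ.- b)) where
  F = suc F′

  -- b / t is a 2^F-th power up to powers of a. The exponents are left free because the descent from
  -- R[√(A Y)] may bring in (A Y)^(2^F′) = a^(2^d) Y^(2^F).
  Claim : TR → Set
  Claim R = ∃[ X ] ∃[ X′ ] ∃[ x ] ∃[ y ] (¬ y ≡ 0# × pw2 x F ⊗ ι (t ℤ.* a ℤ.^ X′) ≡ ι (b ℤ.* a ℤ.^ X) ⊗ pw2 y F)
    where
    open TR R
    open Domain R

  module _ (R : TR) where
    open TR R
    open Domain R
    open I using (_*_; _-_; _+_; _^_)

    module _ (A Y : C) (Y≢0 : ¬ Y ≡ 0#) (h : pw2 A F ≡ ι a ⊗ pw2 Y F) where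
      -- Since a = (A / Y)^(2^F), the congruence b ≡ t a^m exhibits b / t as the 2^F-th power of (A
      -- / Y)^m. The summand |N Y| excludes places where Y vanishes.
      locally : Locally (S₀ ℕ.+ ∣ N Y ∣) (ι b) (ι t) F
      locally p pp S<p hm = lift (inverse pp (f Y) p∤Y) (H p pp (ℕP.≤-<-trans (ℕP.m≤m+n S₀ ∣ N Y ∣) S<p))
        where
        open Hom hm
        p∤Y : ¬ + p ∣ℤ f Y
        p∤Y d = ∤-< (λ z → Y≢0 (N-0 Y z)) (ℕP.≤-<-trans (ℕP.m≤n+m ∣ N Y ∣ S₀) S<p)
          (subst (+ p ∣ℤ_) (trans (cong f (adj-* Y)) (f-ι (N Y))) (∣-comb (+ 1) (f (adj Y)) (f-*ₚ Y (adj Y)) d (l (f (Y ⊗ adj Y)) (f Y) (f (adj Y)))))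
          where
          l : ∀ a b c → a ≡ + 1 * (a - b * c) + c * b
          l = solve-∀
        lift : ∃[ v ] (+ p ∣ℤ + 1 - f Y * v) → ∃[ m ] (+ p ∣ℤ t * a ^ m - b) → ∃[ s ] (+ p ∣ℤ pw2ℤ s F * f (ι t) - f (ι b))
        lift (v , hv) (m , hm′) = (f A * v) ^ m , subst₂ (λ x y → + p ∣ℤ pw2ℤ ((f A * v) ^ m) F * x - y) (sym (f-ι t)) (sym (f-ι b))
            (∣-comb t (+ 1) (powers m) hm′ (trans (cong (λ z → z * t - b) (pw-^ (f A * v) m F)) (l t (W ^ m) (a ^ m) b)))
          where
          W : ℤ
          W = pw2ℤ (f A * v) F
          l : ∀ t w am b → w * t - b ≡ t * (w - am) + + 1 * (t * am - b)
          l = solve-∀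
          pw-^ : ∀ x m k → pw2ℤ (x ^ m) k ≡ pw2ℤ x k ^ m
          pw-^ x m zero = refl
          pw-^ x m (suc k) = trans (cong (λ z → pw2ℤ z k) (sym (^-distribʳ-*ℤ m x x))) (pw-^ (x * x) m k)
          W≡a : + p ∣ℤ W - a
          W≡a = subst (λ z → + p ∣ℤ z - a) (sym (PowersOfTwo.pw2-⊗ ℤ-rg (f A) v F)) (∣-comb (+ 1) (+ 1)
              (∣*ˡ (pw2ℤ v F) (ℤD.∣m∣n⇒∣m+n (subst (λ z → + p ∣ℤ f z - a * pw2ℤ (f Y) F) (sym h) hA) (fself A)))
              (∣*ˡ (- a) vY) (l′ (pw2ℤ (f A) F) (pw2ℤ v F) (f (pw2 A F)) a (pw2ℤ (f Y) F)))
            where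
            fself : ∀ A → + p ∣ℤ pw2ℤ (f A) F - f (pw2 A F)
            fself A = ∣-comb (- (+ 1)) (+ 0) (f-pw2 pp hm A (f A) F (subst (+ p ∣ℤ_) (sym (ℤP.+-inverseʳ (f A))) ∣0)) ∣0 (l″ (f (pw2 A F)) (pw2ℤ (f A) F))
              where
              l″ : ∀ a b → b - a ≡ - (+ 1) * (a - b) + + 0 * + 0
              l″ = solve-∀
            hA : + p ∣ℤ f (ι a ⊗ pw2 Y F) - a * pw2ℤ (f Y) F
            hA = ∣-comb (+ 1) (- a) (f-*ₚ (ι a) (pw2 Y F)) (fself Y) (trans (cong (λ z → f (ι a ⊗ pw2 Y F) - z * pw2ℤ (f Y) F) (sym (f-ι a)))
                   (trans (l″ (f (ι a ⊗ pw2 Y F)) (f (ι a)) (f (pw2 Y F)) (pw2ℤ (f Y) F)) (cong (λ z → + 1 * (f (ι a ⊗ pw2 Y F) - f (ι a) * f (pw2 Y F)) + (- z) * (pw2ℤ (f Y) F - f (pw2 Y F))) (f-ι a))))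
              where
              l″ : ∀ u a y z → u - a * z ≡ + 1 * (u - a * y) + (- a) * (z - y)
              l″ = solve-∀
            vY : + p ∣ℤ + 1 - pw2ℤ (f Y) F * pw2ℤ v F
            vY = subst (λ z → + p ∣ℤ + 1 - z) (PowersOfTwo.pw2-⊗ ℤ-rg (f Y) v F) (one (f Y * v) F hv)
              where
              one : ∀ z k → + p ∣ℤ + 1 - z → + p ∣ℤ + 1 - pw2ℤ z k
              one z zero d = d
              one z (suc k) d = one (z * z) k (∣-by (+ 1 + z) d (lz z))
                where
                lz : ∀ z → + 1 - z * z ≡ (+ 1 + z) * (+ 1 - z)
                lz = solve-∀
            l′ : ∀ A v fA a Y → A * v - a ≡ + 1 * (v * ((fA - a * Y) + (A - fA))) + + 1 * (- a * (+ 1 - Y * v))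
            l′ = solve-∀
          powers : ∀ m → + p ∣ℤ W ^ m - a ^ m
          powers zero = ∣0
          powers (suc m) = ∣-comb (W ^ m) a W≡a (powers m) (lp W (W ^ m) a (a ^ m))
            where
            lp : ∀ w wm a am → w * wm - a * am ≡ wm * (w - a) + a * (wm - am)
            lp = solve-∀

  -- Adjoin the 2^i-th roots A/Y of a one at a time, then come back down by Kummer theory.
  claim : ∀ d i → i ℕ.+ d ≡ F → ∀ R → Domain.NegPow R F → ∀ A Y → ¬ A ≡ TR.0# R → ¬ Y ≡ TR.0# R →
          Domain.pw2 R A i ≡ TR._⊗_ R (TR.ι R a) (Domain.pw2 R Y i) → ¬ ¬ Claim R
  claim zero i e R np A Y A≢0 Y≢0 h k = local-power F np _ (ι b) (ι t) (ι-≢0 b≢0) (ι-≢0 t≢0)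
      (locally R A Y Y≢0 (subst (λ n → pw2 A n ≡ ι a ⊗ pw2 Y n) (trans (sym (ℕP.+-identityʳ i)) e) h))
      λ { (x , y , y≢0 , E) → k (0 , 0 , x , y , y≢0 , subst₂ (λ u v → pw2 x F ⊗ ι u ≡ ι v ⊗ pw2 y F) (sym (ℤP.*-identityʳ t)) (sym (ℤP.*-identityʳ b)) E) }
    where
    open TR R
    open Domain R
  claim (suc d) i e R np A Y A≢0 Y≢0 h k = ¬¬-lem (∃[ B ] ∃[ W ] (¬ W ≡ 0# × B ⊗ B ≡ A ⊗ Y ⊗ (W ⊗ W))) λ
      { (yes (B , W , W≢0 , E)) → claim d (suc i) e′ R np B (Y ⊗ W) (B≢0 B W W≢0 E) (⊗-≢0 Y≢0 W≢0) (inside B W E) k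
      ; (no none) → outside none }
    where
    open TR R
    open Domain R
    e′ : suc i ℕ.+ d ≡ F
    e′ = trans (sym (ℕP.+-suc i d)) e
    B≢0 : ∀ B W → ¬ W ≡ 0# → B ⊗ B ≡ A ⊗ Y ⊗ (W ⊗ W) → ¬ B ≡ 0#
    B≢0 B W W≢0 E z = ⊗-≢0 (⊗-≢0 A≢0 Y≢0) (⊗-≢0 W≢0 W≢0) (trans (sym E) (trans (cong (_⊗ B) z) (⊗-zeroˡ B)))
    inside : ∀ B W → B ⊗ B ≡ A ⊗ Y ⊗ (W ⊗ W) → pw2 B (suc i) ≡ ι a ⊗ pw2 (Y ⊗ W) (suc i)
    inside B W E = begin
      pw2 (B ⊗ B) i ≡⟨ cong (λ z → pw2 z i) (trans E (⊗-assoc A Y (W ⊗ W))) ⟩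
      pw2 (A ⊗ (Y ⊗ (W ⊗ W))) i ≡⟨ pw2-⊗ A _ i ⟩
      pw2 A i ⊗ pw2 (Y ⊗ (W ⊗ W)) i ≡⟨ cong (_⊗ pw2 (Y ⊗ (W ⊗ W)) i) h ⟩
      ι a ⊗ pw2 Y i ⊗ pw2 (Y ⊗ (W ⊗ W)) i ≡⟨ ⊗-assoc (ι a) _ _ ⟩
      ι a ⊗ (pw2 Y i ⊗ pw2 (Y ⊗ (W ⊗ W)) i) ≡⟨ cong (ι a ⊗_) (trans (sym (pw2-⊗ Y _ i)) (cong (λ z → pw2 z i) (solve 2 (λ y w → y :* (y :* (w :* w)) := (y :* w) :* (y :* w)) refl Y W))) ⟩
      ι a ⊗ pw2 ((Y ⊗ W) ⊗ (Y ⊗ W)) i ∎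
      where open ≡-Reasoning
    outside : ¬ (∃[ B ] ∃[ W ] (¬ W ≡ 0# × B ⊗ B ≡ A ⊗ Y ⊗ (W ⊗ W))) → ⊥
    -- √(A Y) / Y is a square root of A / Y, so the new numerator is √(A Y) and the denominator
    -- stays Y.
    outside none = claim d (suc i) e′ R⁺ np⁺ (0# , 1#) (j Y) (λ z → 1≢0 (cong proj₂ z)) (j-≢0 Y≢0) root⁺
        λ { (X , X′ , x , y , y≢0 , E) → k (down X X′ (kummer F′ np (ι (t ℤ.* a ℤ.^ X′)) (ι (b ℤ.* a ℤ.^ X)) (ι-≢0 (nz t X′ t≢0)) x y y≢0 E)) }
      where
      aniso : ∀ x y → x ⊗ x ≡ A ⊗ Y ⊗ (y ⊗ y) → y ≡ 0#
      aniso x y E = decidable-stable (0? y) λ ny → none (x , y , ny , E)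
      open Conjugation R (A ⊗ Y) aniso
      nz : ∀ u X → ¬ u ≡ + 0 → ¬ u ℤ.* a ℤ.^ X ≡ + 0
      nz u X u≢0 z = [ u≢0 , pow0 X ]′ (ℤP.i*j≡0⇒i≡0∨j≡0 u z)
        where
        pow0 : ∀ k → ¬ a ℤ.^ k ≡ + 0
        pow0 zero ()
        pow0 (suc k) e = [ a≢0 , pow0 k ]′ (ℤP.i*j≡0⇒i≡0∨j≡0 a e)
      np⁺ : Dm⁺.NegPow F
      np⁺ = j (proj₁ np) , trans (sym (j-pw2 (proj₁ np) F′)) (trans (cong j (proj₂ np)) (cong (⊝ 1# ,_) (sym ⊝0)))
      root⁺ : Dm⁺.pw2 (0# , 1#) (suc i) ≡ R⁺._⊗_ (R⁺.ι a) (Dm⁺.pw2 (j Y) (suc i))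
      root⁺ = begin
        Dm⁺.pw2 (R⁺._⊗_ (0# , 1#) (0# , 1#)) i ≡⟨ cong (λ z → Dm⁺.pw2 z i) sq ⟩
        Dm⁺.pw2 (j (A ⊗ Y)) i ≡⟨ sym (j-pw2 (A ⊗ Y) i) ⟩
        j (pw2 (A ⊗ Y) i) ≡⟨ cong j (trans (pw2-⊗ A Y i) (trans (cong (_⊗ pw2 Y i) h) (trans (⊗-assoc _ _ _) (cong (ι a ⊗_) (sym (pw2-⊗ Y Y i)))))) ⟩
        j (ι a ⊗ pw2 Y (suc i)) ≡⟨ trans (j-⊗ (ι a) _) (cong (R⁺._⊗_ (R⁺.ι a)) (j-pw2 Y (suc i))) ⟩
        R⁺._⊗_ (R⁺.ι a) (Dm⁺.pw2 (j Y) (suc i)) ∎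
        where
        open ≡-Reasoning
        sq : R⁺._⊗_ (0# , 1#) (0# , 1#) ≡ j (A ⊗ Y)
        sq = cong₂ _,_ (trans (cong₂ (λ u v → u ⊕ A ⊗ Y ⊗ v) (⊗-zeroˡ 0#) (⊗-idˡ 1#)) (trans (⊕-idˡ _) (⊗-idʳ (A ⊗ Y))))
          (trans (cong₂ _⊕_ (⊗-zeroˡ 1#) (⊗-zeroʳ 1#)) (⊕-idˡ 0#))
      down : ∀ X X′ → ∃[ x ] ∃[ y ] (¬ y ≡ 0# × (pw2 x F ⊗ ι (t ℤ.* a ℤ.^ X′) ≡ ι (b ℤ.* a ℤ.^ X) ⊗ pw2 y F ⊎
             pw2 x F ⊗ pw2 (A ⊗ Y) F′ ⊗ ι (t ℤ.* a ℤ.^ X′) ≡ ι (b ℤ.* a ℤ.^ X) ⊗ pw2 y F)) → Claim R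
      down X X′ (x , y , y≢0 , inj₁ E) = X , X′ , x , y , y≢0 , E
      down X X′ (x , y , y≢0 , inj₂ E) = X , 2 ℕ.^ d ℕ.+ X′ , x ⊗ Y , y , y≢0 , trans (begin
          pw2 (x ⊗ Y) F ⊗ ι (t ℤ.* a ℤ.^ (2 ℕ.^ d ℕ.+ X′)) ≡⟨ cong₂ _⊗_ (pw2-⊗ x Y F) (trans (cong ι (trans (cong (t ℤ.*_) (ℤP.^-distribˡ-+-* a (2 ℕ.^ d) X′)) (l t (a ℤ.^ (2 ℕ.^ d)) (a ℤ.^ X′)))) (ι-* (a ℤ.^ (2 ℕ.^ d)) (t ℤ.* a ℤ.^ X′))) ⟩
          (pw2 x F ⊗ pw2 Y F) ⊗ (ι (a ℤ.^ (2 ℕ.^ d)) ⊗ ι (t ℤ.* a ℤ.^ X′)) ≡⟨ solve 4 (λ x y a t → (x :* y) :* (a :* t) := x :* (a :* y) :* t) refl (pw2 x F) (pw2 Y F) (ι (a ℤ.^ (2 ℕ.^ d))) (ι (t ℤ.* a ℤ.^ X′)) ⟩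
          pw2 x F ⊗ (ι (a ℤ.^ (2 ℕ.^ d)) ⊗ pw2 Y F) ⊗ ι (t ℤ.* a ℤ.^ X′) ≡⟨ cong (λ z → pw2 x F ⊗ z ⊗ ι (t ℤ.* a ℤ.^ X′)) (sym AY) ⟩
          pw2 x F ⊗ pw2 (A ⊗ Y) F′ ⊗ ι (t ℤ.* a ℤ.^ X′) ∎) E
        where
        open ≡-Reasoning
        l : ∀ t x y → t ℤ.* (x ℤ.* y) ≡ x ℤ.* (t ℤ.* y)
        l = solve-∀
        F′≡ : i ℕ.+ d ≡ F′
        F′≡ = ℕP.suc-injective e′
        AY : pw2 (A ⊗ Y) F′ ≡ ι (a ℤ.^ (2 ℕ.^ d)) ⊗ pw2 Y F
        AY = begin
          pw2 (A ⊗ Y) F′ ≡⟨ cong (pw2 (A ⊗ Y)) (sym F′≡) ⟩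
          pw2 (A ⊗ Y) (i ℕ.+ d) ≡⟨ pw2-+ (A ⊗ Y) i d ⟩
          pw2 (pw2 (A ⊗ Y) i) d ≡⟨ cong (λ z → pw2 z d) (trans (pw2-⊗ A Y i) (trans (cong (_⊗ pw2 Y i) h) (trans (⊗-assoc _ _ _) (cong (ι a ⊗_) (sym (pw2-⊗ Y Y i)))))) ⟩
          pw2 (ι a ⊗ pw2 Y (suc i)) d ≡⟨ pw2-⊗ (ι a) _ d ⟩
          pw2 (ι a) d ⊗ pw2 (pw2 Y (suc i)) d ≡⟨ cong₂ _⊗_ (pw2-ι a d) (trans (sym (pw2-+ Y (suc i) d)) (cong (pw2 Y) e′)) ⟩
          ι (a ℤ.^ (2 ℕ.^ d)) ⊗ pw2 Y F ∎

  radical-claim : ∀ R → Domain.NegPow R F → ¬ ¬ Claim R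
  radical-claim R np = claim F 0 refl R np (ι a) 1# (ι-≢0 a≢0) 1≢0 (trans (sym (⊗-idʳ (ι a))) refl)
    where
    open TR R
    open Domain R

-- Irrationality of √2 and the Gaussian integers

module RootTwo where
  open Nat using (_+_; _*_; _≤_; _<_)

  private
    -- Infinite descent: n and p are both even, and halving both preserves the equation.
    descent : ∀ fuel n p → n ≤ fuel → n * n ≡ 2 * (p * p) → n ≡ 0
    descent zero n p h e = ℕP.n≤0⇒n≡0 h
    descent (suc fuel) zero p h e = refl
    descent (suc fuel) n@(suc _) p h e with half n (ℕD.divides (p * p) (trans e (ℕP.*-comm 2 (p * p))))
      where
      half : ∀ n → 2 ℕD.∣ n * n → 2 ℕD.∣ n
      half n d = [ id , id ]′ (euclidsLemma n n prime[2] d)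
    ... | ℕD.divides n′ n≡ with [ id , id ]′ (euclidsLemma p p prime[2] (ℕD.divides (n′ * n′) p²))
      where
      p² : p * p ≡ n′ * n′ * 2
      p² = ℕP.*-cancelˡ-≡ (p * p) (n′ * n′ * 2) 2 (trans (sym e) (trans (cong₂ _*_ n≡ n≡) (l n′)))
        where
        l : ∀ n → n * 2 * (n * 2) ≡ 2 * (n * n * 2)
        l = ℕRing.solve-∀
    ...   | ℕD.divides p′ p≡ = trans n≡ (cong (_* 2) (descent fuel n′ p′ (ℕP.≤-pred (ℕP.<-≤-trans smaller h)) (ℕP.*-cancelˡ-≡ (n′ * n′) (2 * (p′ * p′)) 4 (begin
            4 * (n′ * n′) ≡⟨ l n′ ⟩
            n′ * 2 * (n′ * 2) ≡⟨ sym (cong₂ _*_ n≡ n≡) ⟩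
            n * n ≡⟨ e ⟩
            2 * (p * p) ≡⟨ cong (2 *_) (cong₂ _*_ p≡ p≡) ⟩
            2 * (p′ * 2 * (p′ * 2)) ≡⟨ l′ p′ ⟩
            4 * (2 * (p′ * p′)) ∎))))
      where
      open ≡-Reasoning
      l : ∀ n → 4 * (n * n) ≡ n * 2 * (n * 2)
      l = ℕRing.solve-∀
      l′ : ∀ p → 2 * (p * 2 * (p * 2)) ≡ 4 * (2 * (p * p))
      l′ = ℕRing.solve-∀
      smaller : n′ < n
      smaller = subst (n′ <_) (sym n≡) (ℕP.m<m*n n′ 2 {{ℕ.≢-nonZero λ z → contradiction (trans n≡ (cong (_* 2) z)) λ ()}} (s≤s (s≤s z≤n)))

  √2-irrational : ∀ n p → n ℤ.* n ≡ + 2 ℤ.* (p ℤ.* p) → n ≡ + 0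
  √2-irrational n p e = ℤP.∣i∣≡0⇒i≡0 (descent (∣ n ∣) (∣ n ∣) (∣ p ∣) ℕP.≤-refl (trans (sym (ℤP.abs-* n n)) (trans (cong ∣_∣ e) (trans (ℤP.abs-* (+ 2) (p ℤ.* p)) (cong (2 *_) (ℤP.abs-* p p))))))

  sq≥0 : ∀ x → ∃[ n ] (x ℤ.* x ≡ + n × (n ≡ 0 → x ≡ + 0))
  sq≥0 (+ n) = n * n , sym (ℤP.pos-* n n) , λ e → cong +_ ([ id , id ]′ (ℕP.m*n≡0⇒m≡0∨n≡0 n e))
  sq≥0 ℤ.-[1+ n ] = suc n * suc n , refl , λ ()

  sum-sq : ∀ x y → x ℤ.* x ℤ.+ y ℤ.* y ≡ + 0 → x ≡ + 0 × y ≡ + 0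
  sum-sq x y e with sq≥0 x | sq≥0 y
  ... | m , e₁ , z₁ | n , e₂ , z₂ = z₁ (ℕP.m+n≡0⇒m≡0 m mn) , z₂ (ℕP.m+n≡0⇒n≡0 m mn)
    where
    mn : m + n ≡ 0
    mn = ℤP.+-injective (trans (sym (cong₂ ℤ._+_ e₁ e₂)) e)

open RootTwo

module Gaussian where
  open I using (_+_; _*_; _-_)

  aniso-1 : ∀ x y → x * x ≡ (- (+ 1)) * (y * y) → y ≡ + 0
  aniso-1 x y e = proj₂ (sum-sq x y (trans (cong (_+ y * y) e) (l (y * y))))
    where
    l : ∀ z → (- (+ 1)) * z + z ≡ + 0
    l = solve-∀

  ℤ[i] : TR
  ℤ[i] = Ext ℤ-TR (- (+ 1)) aniso-1

  module G = TR ℤ[i]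
  open Domain ℤ[i] public using () renaming (pw2 to pw2ᵢ)

  i : G.C
  i = + 0 , + 1

  -- X² = iY² would make 2 a rational square.
  i-nonsquare : ∀ X Y → G._⊗_ X X ≡ G._⊗_ i (G._⊗_ Y Y) → Y ≡ G.0#
  i-nonsquare (a , b) (c , d) h = cong₂ _,_ c≡0 d≡0
    where
    e₁ : a * a - b * b ≡ - (+ 2 * (c * d))
    e₁ = trans (l a b) (trans (cong proj₁ h) (l′ c d))
      where
      l : ∀ a b → a * a - b * b ≡ a * a + (- (+ 1)) * (b * b)
      l = solve-∀
      l′ : ∀ c d → + 0 * (c * c + (- (+ 1)) * (d * d)) + (- (+ 1)) * (+ 1 * (c * d + d * c)) ≡ - (+ 2 * (c * d))
      l′ = solve-∀
    e₂ : + 2 * (a * b) ≡ c * c - d * d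
    e₂ = trans (l a b) (trans (cong proj₂ h) (l′ c d))
      where
      l : ∀ a b → + 2 * (a * b) ≡ a * b + b * a
      l = solve-∀
      l′ : ∀ c d → + 0 * (c * d + d * c) + + 1 * (c * c + (- (+ 1)) * (d * d)) ≡ c * c - d * d
      l′ = solve-∀
    norms : (a * a + b * b) * (a * a + b * b) ≡ (c * c + d * d) * (c * c + d * d)
    norms = trans (l a b) (trans (cong₂ (λ u v → u * u + v * v) e₁ e₂) (l′ c d))
      where
      l : ∀ a b → (a * a + b * b) * (a * a + b * b) ≡ (a * a - b * b) * (a * a - b * b) + + 2 * (a * b) * (+ 2 * (a * b))
      l = solve-∀
      l′ : ∀ c d → - (+ 2 * (c * d)) * - (+ 2 * (c * d)) + (c * c - d * d) * (c * c - d * d) ≡ (c * c + d * d) * (c * c + d * d)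
      l′ = solve-∀
    same : a * a + b * b ≡ c * c + d * d → (c - d) * (c - d) ≡ + 2 * (a * a) × (c + d) * (c + d) ≡ + 2 * (b * b)
    same e = trans (l c d) (trans (cong₂ _+_ (sym e) (sym e₁)) (l′ a b)) , trans (m c d) (trans (cong₂ _-_ (sym e) (sym e₁)) (m′ a b))
      where
      l : ∀ c d → (c - d) * (c - d) ≡ (c * c + d * d) + - (+ 2 * (c * d))
      l = solve-∀
      l′ : ∀ a b → (a * a + b * b) + (a * a - b * b) ≡ + 2 * (a * a)
      l′ = solve-∀
      m : ∀ c d → (c + d) * (c + d) ≡ (c * c + d * d) - - (+ 2 * (c * d))
      m = solve-∀
      m′ : ∀ a b → (a * a + b * b) - (a * a - b * b) ≡ + 2 * (b * b)
      m′ = solve-∀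
    opposite : a * a + b * b ≡ - (c * c + d * d) → c - d ≡ + 0 × c + d ≡ + 0
    opposite e with sq≥0 a | sq≥0 b | sq≥0 c | sq≥0 d
    ... | na , ea , _ | nb , eb , _ | nc , ec , zc | nd , ed , zd = cong₂ _-_ c0 d0 , cong₂ _+_ c0 d0
      where
      sum0 : (na ℕ.+ nb) ℕ.+ (nc ℕ.+ nd) ≡ 0
      sum0 = ℤP.+-injective (trans (cong₂ _+_ (sym (cong₂ _+_ ea eb)) (sym (cong₂ _+_ ec ed))) (trans (cong (_+ (c * c + d * d)) e) (ℤP.+-inverseˡ (c * c + d * d))))
      cd0 : nc ℕ.+ nd ≡ 0
      cd0 = ℕP.m+n≡0⇒n≡0 (na ℕ.+ nb) sum0
      c0 = zc (ℕP.m+n≡0⇒m≡0 nc cd0)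
      d0 = zd (ℕP.m+n≡0⇒n≡0 nc cd0)
    -- Equal norms make (c - d)² and (c + d)² twice a square; opposite norms make a sum of four
    -- squares vanish.
    cd : c - d ≡ + 0 × c + d ≡ + 0
    cd = [ (λ e → √2-irrational (c - d) a (proj₁ (same e)) , √2-irrational (c + d) b (proj₂ (same e))) , opposite ]′
      (Domain.sq-≡ ℤ-TR (a * a + b * b) (c * c + d * d) norms)
    2c≡0 : + 2 * c ≡ + 0
    2c≡0 = trans (l c d) (cong₂ _+_ (proj₁ cd) (proj₂ cd))
      where
      l : ∀ c d → + 2 * c ≡ (c - d) + (c + d)
      l = solve-∀
    c≡0 : c ≡ + 0
    c≡0 = [ (λ ()) , id ]′ (ℤP.i*j≡0⇒i≡0∨j≡0 (+ 2) 2c≡0)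
    d≡0 : d ≡ + 0
    d≡0 = trans (sym (ℤP.+-identityˡ d)) (trans (cong (_+ d) (sym c≡0)) (proj₂ cd))

-- ζ is a primitive 2^(j+2)-th root of unity.
record Cyclotomic (j : ℕ) : Set₁ where
  field
    ring : TR
  open TR ring
  open Domain ring
  field
    ζ    : C
    ζ-order : pw2 ζ (suc j) ≡ ⊝ 1#
    ζ-nonsquare : ∀ x y → x ⊗ x ≡ ζ ⊗ (y ⊗ y) → y ≡ 0#
    𝕚    : C
    𝕚²   : 𝕚 ⊗ 𝕚 ≡ ⊝ 1#
    -- The exponent drops from 2^(k+1) to 2^k because the norm from ℤ[i] squares U and V. The bound
    -- on k makes the factors ζ^(2^k) met on the way down equal to 1.
    to-ℤ : ∀ k → suc j ℕ.≤ k → ∀ V U → ¬ V ≡ + 0 → ¬ U ≡ + 0 → ∀ x y → ¬ y ≡ 0# → pw2 x (suc k) ⊗ ι V ≡ ι U ⊗ pw2 y (suc k) →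
           ∃[ m ] ∃[ n ] (1 ℕ.≤ m × 1 ℕ.≤ n × ∣ V ∣ ℕ.* m ℕ.^ (2 ℕ.^ k) ≡ ∣ U ∣ ℕ.* n ℕ.^ (2 ℕ.^ k))

module CyclotomicBase where
  open Gaussian
  module Di = Domain ℤ[i]
  open Nat using (_*_; _≤_; _^_)

  N-pw2 : ∀ x k → G.N (Di.pw2 x k) ≡ Di.pw2ℤ (G.N x) k
  N-pw2 x zero = refl
  N-pw2 x (suc k) = trans (N-pw2 (x G.⊗ x) k) (cong (λ z → Di.pw2ℤ z k) (G.N-* x x))

  ∣pw2∣ : ∀ z k → ∣ Di.pw2ℤ z k ∣ ≡ ∣ z ∣ ^ (2 ^ k)
  ∣pw2∣ z k = trans (cong ∣_∣ (Domain.pw2-ι ℤ-TR z k)) (∣^∣ z (2 ^ k))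

  sq-inj : ∀ a b → a * a ≡ b * b → a ≡ b
  sq-inj a b h with ℕP.<-cmp a b
  ... | tri< lt _ _ = contradiction h (ℕP.<⇒≢ (ℕP.*-mono-< lt lt))
  ... | tri≈ _ e _ = e
  ... | tri> _ _ gt = contradiction (sym h) (ℕP.<⇒≢ (ℕP.*-mono-< gt gt))

  -- Taking norms to ℤ makes both sides perfect squares; the square root is then extracted.
  gaussian-to-ℤ : ∀ k → 1 ≤ k → ∀ V U → ¬ V ≡ + 0 → ¬ U ≡ + 0 → ∀ x y → ¬ y ≡ G.0# → G._⊗_ (Di.pw2 x (suc k)) (G.ι V) ≡ G._⊗_ (G.ι U) (Di.pw2 y (suc k)) →
           ∃[ m ] ∃[ n ] (1 ≤ m × 1 ≤ n × ∣ V ∣ * m ^ (2 ^ k) ≡ ∣ U ∣ * n ^ (2 ^ k))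
  gaussian-to-ℤ k _ V U V≢0 U≢0 x y y≢0 h = (∣ G.N x ∣) , (∣ G.N y ∣) , 1≤m , 1≤n , eq
    where
    1≤n : 1 ≤ ∣ G.N y ∣
    1≤n = ℕP.n≢0⇒n>0 λ z → y≢0 (G.N-0 y (ℤP.∣i∣≡0⇒i≡0 z))
    1≤U : 1 ≤ ∣ U ∣
    1≤U = ℕP.n≢0⇒n>0 λ z → U≢0 (ℤP.∣i∣≡0⇒i≡0 z)
    q = 2 ^ k
    nrm : ∀ z W → ∣ G.N (G._⊗_ (Di.pw2 z (suc k)) (G.ι W)) ∣ ≡ (∣ W ∣ * ∣ G.N z ∣ ^ q) * (∣ W ∣ * ∣ G.N z ∣ ^ q)
    nrm z W = begin
      ∣ G.N (G._⊗_ (Di.pw2 z (suc k)) (G.ι W)) ∣ ≡⟨ trans (cong ∣_∣ (G.N-* (Di.pw2 z (suc k)) (G.ι W))) (ℤP.abs-* (G.N (Di.pw2 z (suc k))) (G.N (G.ι W))) ⟩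
      ∣ G.N (Di.pw2 z (suc k)) ∣ * ∣ G.N (G.ι W) ∣ ≡⟨ cong₂ _*_ (trans (cong ∣_∣ (N-pw2 z (suc k))) (∣pw2∣ (G.N z) (suc k))) (trans (cong ∣_∣ (G.N-ι W)) (∣^∣ W 2)) ⟩
      ∣ G.N z ∣ ^ (2 * q) * (∣ W ∣ ^ 2) ≡⟨ cong₂ _*_ (trans (cong (∣ G.N z ∣ ^_) (cong (q ℕ.+_) (ℕP.+-identityʳ q))) (ℕP.^-distribˡ-+-* (∣ G.N z ∣) q q)) (cong (∣ W ∣ *_) (ℕP.*-identityʳ ∣ W ∣)) ⟩
      (∣ G.N z ∣ ^ q * ∣ G.N z ∣ ^ q) * (∣ W ∣ * ∣ W ∣) ≡⟨ l (∣ G.N z ∣ ^ q) (∣ W ∣) ⟩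
      (∣ W ∣ * ∣ G.N z ∣ ^ q) * (∣ W ∣ * ∣ G.N z ∣ ^ q) ∎
      where
      open ≡-Reasoning
      l : ∀ a w → (a * a) * (w * w) ≡ (w * a) * (w * a)
      l = ℕRing.solve-∀
    eq : ∣ V ∣ * ∣ G.N x ∣ ^ q ≡ ∣ U ∣ * ∣ G.N y ∣ ^ q
    eq = sq-inj _ _ (trans (sym (nrm x V)) (trans (cong (λ z → ∣ G.N z ∣) (trans h (G.⊗-comm (G.ι U) (Di.pw2 y (suc k))))) (nrm y U)))
    1≤m : 1 ≤ ∣ G.N x ∣
    1≤m = ℕP.n≢0⇒n>0 λ z → ℕP.<⇒≢ (ℕP.*-mono-≤ 1≤U (1≤^ q 1≤n)) (trans (sym (trans (cong (∣ V ∣ *_) (trans (cong (_^ q) z) (zero^ q (1≤^ k (s≤s z≤n))))) (ℕP.*-zeroʳ ∣ V ∣))) eq)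
      where
      zero^ : ∀ q → 1 ≤ q → 0 ^ q ≡ 0
      zero^ (suc q) _ = refl

  base : Cyclotomic 0
  base = record { ring = ℤ[i] ; ζ = i ; ζ-order = refl ; ζ-nonsquare = i-nonsquare ; 𝕚 = i ; 𝕚² = refl ; to-ℤ = gaussian-to-ℤ }

-- Adjoining a square root of ζ

module CyclotomicStep (j : ℕ) (cyc : Cyclotomic j) where
  open Cyclotomic cyc
  open TR ring
  open ExtRing rg ζ using (nm; scal; nm-*)
  open Conjugation ring ζ ζ-nonsquare renaming (j to emb; j-⊗ to emb-⊗; j-pw2 to emb-pw2; j-≢0 to emb-≢0)
  open Domain ring
  open R⁺ using () renaming (_⊗_ to _⊗⁺_; ⊝_ to ⊝⁺_; 0# to 0⁺; 1# to 1⁺)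

  ζ⁺ : R⁺.C
  ζ⁺ = 0# , 1#

  ζ⁺² : ζ⁺ ⊗⁺ ζ⁺ ≡ emb ζ
  ζ⁺² = cong₂ _,_ (trans (cong₂ (λ u v → u ⊕ ζ ⊗ v) (⊗-zeroˡ 0#) (⊗-idˡ 1#)) (trans (⊕-idˡ _) (⊗-idʳ ζ)))
          (trans (cong₂ _⊕_ (⊗-zeroˡ 1#) (⊗-zeroʳ 1#)) (⊕-idˡ 0#))

  emb-⊝1 : emb (⊝ 1#) ≡ ⊝⁺ 1⁺
  emb-⊝1 = cong (⊝ 1# ,_) (sym ⊝0)

  order⁺ : Dm⁺.pw2 ζ⁺ (suc (suc j)) ≡ ⊝⁺ 1⁺
  order⁺ = trans (cong (λ z → Dm⁺.pw2 z (suc j)) ζ⁺²) (trans (sym (emb-pw2 ζ (suc j))) (trans (cong emb ζ-order) emb-⊝1))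

  -- The relative norm of ζ⁺ is -ζ. From X² = ζ⁺ Y² the norms n and m of X and Y satisfy n² = -ζ m²,
  -- so (𝕚 n)² = ζ m², which is impossible below unless m = 0.
  nonsquare⁺ : ∀ X Y → X ⊗⁺ X ≡ ζ⁺ ⊗⁺ (Y ⊗⁺ Y) → Y ≡ 0⁺
  nonsquare⁺ X@(x , x′) Y@(y , y′) h = nm-0 ring ζ ζ-nonsquare y y′ (ζ-nonsquare (𝕚 ⊗ nm x x′) (nm y y′) (begin
      (𝕚 ⊗ n) ⊗ (𝕚 ⊗ n) ≡⟨ solve 2 (λ i n → (i :* n) :* (i :* n) := (i :* i) :* (n :* n)) refl 𝕚 n ⟩
      (𝕚 ⊗ 𝕚) ⊗ (n ⊗ n) ≡⟨ cong₂ _⊗_ 𝕚² norms ⟩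
      ⊝ 1# ⊗ (⊝ ζ ⊗ (nm y y′ ⊗ nm y y′)) ≡⟨ ⊝1⊗ _ ⟩
      ⊝ (⊝ ζ ⊗ (nm y y′ ⊗ nm y y′)) ≡⟨ solve 2 (λ z m → :- ((:- z) :* (m :* m)) := z :* (m :* m)) refl ζ (nm y y′) ⟩
      ζ ⊗ (nm y y′ ⊗ nm y y′) ∎))
    where
    open ≡-Reasoning
    n = nm x x′
    nζ : nm 0# 1# ≡ ⊝ ζ
    nζ = trans (cong₂ (λ u v → u ⊖ ζ ⊗ v) (⊗-zeroˡ 0#) (⊗-idˡ 1#)) (trans (⊕-idˡ _) (cong ⊝_ (⊗-idʳ ζ)))
    norms : n ⊗ n ≡ ⊝ ζ ⊗ (nm y y′ ⊗ nm y y′)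
    norms = begin
      n ⊗ n ≡⟨ sym (nm-* x x′ x x′) ⟩
      nm (proj₁ (X ⊗⁺ X)) (proj₂ (X ⊗⁺ X)) ≡⟨ cong (λ z → nm (proj₁ z) (proj₂ z)) h ⟩
      nm (proj₁ (ζ⁺ ⊗⁺ (Y ⊗⁺ Y))) (proj₂ (ζ⁺ ⊗⁺ (Y ⊗⁺ Y))) ≡⟨ nm-* 0# 1# (proj₁ (Y ⊗⁺ Y)) (proj₂ (Y ⊗⁺ Y)) ⟩
      nm 0# 1# ⊗ nm (proj₁ (Y ⊗⁺ Y)) (proj₂ (Y ⊗⁺ Y)) ≡⟨ cong₂ _⊗_ nζ (nm-* y y′ y y′) ⟩
      ⊝ ζ ⊗ (nm y y′ ⊗ nm y y′) ∎

  pow⁺ : ℕ → R⁺.C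
  pow⁺ zero = 1⁺
  pow⁺ (suc n) = ζ⁺ ⊗⁺ pow⁺ n

  pow⁺-+ : ∀ m n → pow⁺ (m ℕ.+ n) ≡ pow⁺ m ⊗⁺ pow⁺ n
  pow⁺-+ zero n = sym (R⁺.⊗-idˡ _)
  pow⁺-+ (suc m) n = trans (cong (ζ⁺ ⊗⁺_) (pow⁺-+ m n)) (sym (R⁺.⊗-assoc _ _ _))

  pow⁺-pw2 : ∀ n k → Dm⁺.pw2 (pow⁺ n) k ≡ pow⁺ (n ℕ.* 2 ℕ.^ k)
  pow⁺-pw2 n zero = cong pow⁺ (sym (ℕP.*-identityʳ n))
  pow⁺-pw2 n (suc k) = trans (cong (λ z → Dm⁺.pw2 z k) (sym (pow⁺-+ n n))) (trans (pow⁺-pw2 (n ℕ.+ n) k) (cong pow⁺ (l n (2 ℕ.^ k))))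
    where
    l : ∀ n q → (n ℕ.+ n) ℕ.* q ≡ n ℕ.* (2 ℕ.* q)
    l = ℕRing.solve-∀

  minus-one : ∃[ n ] (pow⁺ n ≡ ⊝⁺ 1⁺)
  minus-one = 1 ℕ.* 2 ℕ.^ suc (suc j) , trans (sym (pow⁺-pw2 1 (suc (suc j)))) (trans (cong (λ z → Dm⁺.pw2 z (suc (suc j))) (R⁺.⊗-idʳ ζ⁺)) order⁺)

  parity : ∀ n → ∃[ m ] (n ≡ m ℕ.+ m ⊎ n ≡ suc (m ℕ.+ m))
  parity zero = 0 , inj₁ refl
  parity (suc n) with parity n
  ... | m , inj₁ e = m , inj₂ (cong suc e)
  ... | m , inj₂ e = suc m , inj₁ (trans (cong suc e) (cong suc (sym (ℕP.+-suc m m))))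

  pow⁺-even : ∀ m → ∃[ z ] (pow⁺ (m ℕ.+ m) ≡ emb z)
  pow⁺-even zero = 1# , refl
  pow⁺-even (suc m) with pow⁺-even m
  ... | z , e = ζ ⊗ z , (begin
      ζ⁺ ⊗⁺ pow⁺ (m ℕ.+ suc m) ≡⟨ cong (λ n → ζ⁺ ⊗⁺ pow⁺ n) (ℕP.+-suc m m) ⟩
      ζ⁺ ⊗⁺ (ζ⁺ ⊗⁺ pow⁺ (m ℕ.+ m)) ≡⟨ sym (R⁺.⊗-assoc _ _ _) ⟩
      (ζ⁺ ⊗⁺ ζ⁺) ⊗⁺ pow⁺ (m ℕ.+ m) ≡⟨ cong₂ _⊗⁺_ ζ⁺² e ⟩
      emb ζ ⊗⁺ emb z ≡⟨ sym (emb-⊗ ζ z) ⟩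
      emb (ζ ⊗ z) ∎)
    where open ≡-Reasoning

  -- The powers of ζ⁺ exhaust the roots of unity of 2-power order, since ζ⁺ is not a square.
  unity-ratio : ∀ k A B → ¬ B ≡ 0⁺ → Dm⁺.pw2 A k ≡ Dm⁺.pw2 B k → ∃[ n ] (A ≡ pow⁺ n ⊗⁺ B)
  unity-ratio zero A B B≢0 h = 0 , trans h (sym (R⁺.⊗-idˡ B))
  unity-ratio (suc k) A B B≢0 h = root (unity-ratio k (A ⊗⁺ A) (B ⊗⁺ B) (Dm⁺.⊗-≢0 B≢0 B≢0) h)
    where
    open ≡-Reasoning
    pow≢0 : ∀ m → ¬ pow⁺ m ≡ 0⁺
    pow≢0 zero = Dm⁺.1≢0
    pow≢0 (suc m) = Dm⁺.⊗-≢0 (λ h → 1≢0 (cong proj₂ h)) (pow≢0 m)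
    even : ∀ m → A ≡ pow⁺ m ⊗⁺ B ⊎ A ≡ ⊝⁺ (pow⁺ m ⊗⁺ B) → ∃[ n ] (A ≡ pow⁺ n ⊗⁺ B)
    even m (inj₁ e) = m , e
    even m (inj₂ e) = proj₁ minus-one ℕ.+ m , (begin
      A ≡⟨ e ⟩
      ⊝⁺ (pow⁺ m ⊗⁺ B) ≡⟨ sym (Dm⁺.⊝1⊗ _) ⟩
      ⊝⁺ 1⁺ ⊗⁺ (pow⁺ m ⊗⁺ B) ≡⟨ cong (_⊗⁺ (pow⁺ m ⊗⁺ B)) (sym (proj₂ minus-one)) ⟩
      pow⁺ (proj₁ minus-one) ⊗⁺ (pow⁺ m ⊗⁺ B) ≡⟨ sym (R⁺.⊗-assoc _ _ _) ⟩
      (pow⁺ (proj₁ minus-one) ⊗⁺ pow⁺ m) ⊗⁺ B ≡⟨ cong (_⊗⁺ B) (sym (pow⁺-+ (proj₁ minus-one) m)) ⟩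
      pow⁺ (proj₁ minus-one ℕ.+ m) ⊗⁺ B ∎)
    square : ∀ m → A ⊗⁺ A ≡ pow⁺ (m ℕ.+ m) ⊗⁺ (B ⊗⁺ B) → A ⊗⁺ A ≡ (pow⁺ m ⊗⁺ B) ⊗⁺ (pow⁺ m ⊗⁺ B)
    square m e = trans e (trans (cong (_⊗⁺ (B ⊗⁺ B)) (pow⁺-+ m m)) (R⁺.solve 2 (λ p b → (p :* p) :* (b :* b) R⁺.:= (p :* b) :* (p :* b)) refl (pow⁺ m) B))
    odd : ∀ m → A ⊗⁺ A ≡ (ζ⁺ ⊗⁺ pow⁺ (m ℕ.+ m)) ⊗⁺ (B ⊗⁺ B) → A ⊗⁺ A ≡ ζ⁺ ⊗⁺ ((pow⁺ m ⊗⁺ B) ⊗⁺ (pow⁺ m ⊗⁺ B))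
    odd m e = trans e (trans (cong (λ z → (ζ⁺ ⊗⁺ z) ⊗⁺ (B ⊗⁺ B)) (pow⁺-+ m m))
      (R⁺.solve 3 (λ z p b → (z :* (p :* p)) :* (b :* b) R⁺.:= z :* ((p :* b) :* (p :* b))) refl ζ⁺ (pow⁺ m) B))
    byParity : ∀ n m → n ≡ m ℕ.+ m ⊎ n ≡ suc (m ℕ.+ m) → A ⊗⁺ A ≡ pow⁺ n ⊗⁺ (B ⊗⁺ B) → ∃[ n ] (A ≡ pow⁺ n ⊗⁺ B)
    byParity n m (inj₁ refl) e = even m (Dm⁺.sq-≡ A (pow⁺ m ⊗⁺ B) (square m e))
    byParity n m (inj₂ refl) e = contradiction (nonsquare⁺ A (pow⁺ m ⊗⁺ B) (odd m e)) (Dm⁺.⊗-≢0 (pow≢0 m) B≢0)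
    root : ∃[ n ] (A ⊗⁺ A ≡ pow⁺ n ⊗⁺ (B ⊗⁺ B)) → ∃[ n ] (A ≡ pow⁺ n ⊗⁺ B)
    root (n , e) = byParity n (proj₁ (parity n)) (proj₂ (parity n)) e

  -- For even n the ratio lies in R and `eigen-pure` applies. For odd n it is z √ζ, and comparing
  -- coordinates gives -y = ζ z² y, so y ≠ 0 would give 𝕚² = ζ z².
  unity-pure : ∀ n X → σ X ≡ pow⁺ n ⊗⁺ X → Pure X
  unity-pure n X h with parity n
  ... | m , inj₁ refl = let z , e = pow⁺-even m in eigen-pure z X (trans h (cong (_⊗⁺ X) e))
  unity-pure n X@(x , y) h | m , inj₂ refl = inj₂ (decidable-stable (0? y) λ y≢0 → absurd y≢0)
    where
    z = proj₁ (pow⁺-even m)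
    expand : (x , ⊝ y) ≡ (ζ ⊗ (z ⊗ y) , z ⊗ x)
    expand = begin
      σ X ≡⟨ h ⟩
      (ζ⁺ ⊗⁺ pow⁺ (m ℕ.+ m)) ⊗⁺ X ≡⟨ R⁺.⊗-assoc _ _ _ ⟩
      ζ⁺ ⊗⁺ (pow⁺ (m ℕ.+ m) ⊗⁺ X) ≡⟨ cong (ζ⁺ ⊗⁺_) (trans (cong (_⊗⁺ X) (proj₂ (pow⁺-even m))) (scal z x y)) ⟩
      ζ⁺ ⊗⁺ (z ⊗ x , z ⊗ y) ≡⟨ cong₂ _,_ (trans (cong₂ (λ u v → u ⊕ ζ ⊗ v) (⊗-zeroˡ (z ⊗ x)) (⊗-idˡ (z ⊗ y))) (⊕-idˡ _))
                                        (trans (cong₂ _⊕_ (⊗-zeroˡ (z ⊗ y)) (⊗-idˡ (z ⊗ x))) (⊕-idˡ _)) ⟩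
      (ζ ⊗ (z ⊗ y) , z ⊗ x) ∎
      where open ≡-Reasoning
    absurd : ¬ y ≡ 0# → ⊥
    absurd y≢0 = ι-≢0 {+ 1} (λ ()) (trans ι-1 (trans (sym minus) (trans (cong (λ w → ⊝ (ζ ⊗ (w ⊗ w))) z≡0) (trans (solve 1 (λ ζ → :- (ζ :* (con (+ 0) :* con (+ 0))) := con (+ 0)) refl ζ) ι-0 ))))
      where
      -1≡ : ⊝ 1# ≡ ζ ⊗ (z ⊗ z)
      -1≡ = cancelˡ y _ _ y≢0 (begin
        y ⊗ ⊝ 1# ≡⟨ trans (⊗-comm y (⊝ 1#)) (⊝1⊗ y) ⟩
        ⊝ y ≡⟨ cong proj₂ expand ⟩
        z ⊗ x ≡⟨ cong (z ⊗_) (cong proj₁ expand) ⟩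
        z ⊗ (ζ ⊗ (z ⊗ y)) ≡⟨ solve 3 (λ z ζ y → z :* (ζ :* (z :* y)) := y :* (ζ :* (z :* z))) refl z ζ y ⟩
        y ⊗ (ζ ⊗ (z ⊗ z)) ∎)
        where open ≡-Reasoning
      z≡0′ : z ≡ 0#
      z≡0′ = ζ-nonsquare 𝕚 z (trans 𝕚² -1≡)
      z≡0 : z ≡ ι (+ 0)
      z≡0 = trans z≡0′ (sym ι-0)
      minus : ⊝ (ζ ⊗ (z ⊗ z)) ≡ 1#
      minus = trans (cong ⊝_ (sym -1≡)) (trans (cong (λ o → ⊝ (⊝ o)) (sym ι-1)) (trans (solve 0 (:- (:- con (+ 1)) := con (+ 1)) refl) ι-1))

  -- The ring below need not contain the 2^(k+1)-th roots of unity that `kummer` asks for;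
  -- `unity-ratio` shows that the ratio is a power of ζ⁺ all the same. As e = ζ, the stray factor
  -- e^(2^k) is 1.
  to-ℤ⁺ : ∀ k → suc (suc j) ℕ.≤ k → ∀ V U → ¬ V ≡ + 0 → ¬ U ≡ + 0 → ∀ x y → ¬ y ≡ 0⁺ → Dm⁺.pw2 x (suc k) ⊗⁺ R⁺.ι V ≡ R⁺.ι U ⊗⁺ Dm⁺.pw2 y (suc k) →
           ∃[ m ] ∃[ n ] (1 ℕ.≤ m × 1 ℕ.≤ n × ∣ V ∣ ℕ.* m ℕ.^ (2 ℕ.^ k) ≡ ∣ U ∣ ℕ.* n ℕ.^ (2 ℕ.^ k))
  to-ℤ⁺ k k≥ V U V≢0 U≢0 x y y≢0 h = finish (descend (unity-pure (proj₁ ur) X (proj₂ ur)))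
    where
    open Descend k (ι V) (ι U) (ι-≢0 V≢0) x y y≢0 h
    ur = unity-ratio F (σ X) X (X≢0 (ι-≢0 U≢0)) conj
    ζ-trivial : pw2 ζ k ≡ 1#
    ζ-trivial = subst (λ n → pw2 ζ n ≡ 1#) (trans (cong (ℕ._+ (k ℕ.∸ suc (suc j))) (ℕP.+-comm (suc j) 1)) (ℕP.m+[n∸m]≡n k≥)) (begin
      pw2 ζ ((suc j ℕ.+ 1) ℕ.+ (k ℕ.∸ suc (suc j))) ≡⟨ pw2-+ ζ (suc j ℕ.+ 1) _ ⟩
      pw2 (pw2 ζ (suc j ℕ.+ 1)) (k ℕ.∸ suc (suc j)) ≡⟨ cong (λ z → pw2 z (k ℕ.∸ suc (suc j))) (trans (pw2-+ ζ (suc j) 1) (trans (cong (λ z → z ⊗ z) ζ-order) (trans (⊝1⊗ (⊝ 1#))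
           (trans (cong (λ o → ⊝ (⊝ o)) (sym ι-1)) (trans (solve 0 (:- (:- con (+ 1)) := con (+ 1)) refl) ι-1))))) ⟩
      pw2 1# (k ℕ.∸ suc (suc j)) ≡⟨ pw2-1 (k ℕ.∸ suc (suc j)) ⟩
      1# ∎)
      where open ≡-Reasoning
    finish : Descent → _
    finish (x , y , y≢0 , inj₁ e) = to-ℤ k (ℕP.<⇒≤ k≥) V U V≢0 U≢0 x y y≢0 e
    finish (x , y , y≢0 , inj₂ e) = to-ℤ k (ℕP.<⇒≤ k≥) V U V≢0 U≢0 x y y≢0 (trans (cong (_⊗ ι V) (sym (trans (cong (pw2 x (suc k) ⊗_) ζ-trivial) (⊗-idʳ _)))) e)

  step : Cyclotomic (suc j)
  step = record { ring = R⁺ ; ζ = ζ⁺ ; ζ-order = order⁺ ; ζ-nonsquare = nonsquare⁺ ; 𝕚 = emb 𝕚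
    ; 𝕚² = trans (sym (emb-⊗ 𝕚 𝕚)) (trans (cong emb 𝕚²) emb-⊝1) ; to-ℤ = to-ℤ⁺ }

cyclotomic : ∀ j → Cyclotomic j
cyclotomic zero = CyclotomicBase.base
cyclotomic (suc j) = CyclotomicStep.step j (cyclotomic j)

-- Working over ℤ[ζ] with ζ of order 2^(j+2) and descending to ℤ.
module GlobalRelation (a b t : ℤ) (a≢0 : ¬ a ≡ + 0) (b≢0 : ¬ b ≡ + 0) (t≢0 : ¬ t ≡ + 0) (S₀ : ℕ)
                      (H : ∀ p → Prime p → S₀ ℕ.< p → ∃[ m ] (+ p ∣ℤ t ℤ.* a ℤ.^ m ℤ.- b)) where
  nz : ∀ u X → ¬ u ≡ + 0 → ¬ u ℤ.* a ℤ.^ X ≡ + 0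
  nz u X u≢0 z = [ u≢0 , pow0 X ]′ (ℤP.i*j≡0⇒i≡0∨j≡0 u z)
    where
    pow0 : ∀ k → ¬ a ℤ.^ k ≡ + 0
    pow0 zero ()
    pow0 (suc k) e = [ a≢0 , pow0 k ]′ (ℤP.i*j≡0⇒i≡0∨j≡0 a e)

  relation : ∀ j → ¬ ¬ (∃[ X ] ∃[ X′ ] ∃[ m ] ∃[ n ] (1 ℕ.≤ m × 1 ℕ.≤ n ×
             ∣ t ∣ ℕ.* ∣ a ∣ ℕ.^ X′ ℕ.* m ℕ.^ (2 ℕ.^ suc j) ≡ ∣ b ∣ ℕ.* ∣ a ∣ ℕ.^ X ℕ.* n ℕ.^ (2 ℕ.^ suc j)))
  relation j k = Radicals.radical-claim (suc j) a b t a≢0 b≢0 t≢0 S₀ H ring (ζ , ζ-order) λ { (X , X′ , x , y , y≢0 , e) →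
      k (X , X′ , extract X X′ (to-ℤ (suc j) ℕP.≤-refl (t ℤ.* a ℤ.^ X′) (b ℤ.* a ℤ.^ X) (nz t X′ t≢0) (nz b X b≢0) x y y≢0 e)) }
    where
    open Cyclotomic (cyclotomic j)
    abs : ∀ u X → ∣ u ℤ.* a ℤ.^ X ∣ ≡ ∣ u ∣ ℕ.* ∣ a ∣ ℕ.^ X
    abs u X = trans (ℤP.abs-* u (a ℤ.^ X)) (cong (∣ u ∣ ℕ.*_) (∣^∣ a X))
    extract : ∀ X X′ → ∃[ m ] ∃[ n ] (1 ℕ.≤ m × 1 ℕ.≤ n × ∣ t ℤ.* a ℤ.^ X′ ∣ ℕ.* m ℕ.^ (2 ℕ.^ suc j) ≡ ∣ b ℤ.* a ℤ.^ X ∣ ℕ.* n ℕ.^ (2 ℕ.^ suc j)) →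
              ∃[ m ] ∃[ n ] (1 ℕ.≤ m × 1 ℕ.≤ n × ∣ t ∣ ℕ.* ∣ a ∣ ℕ.^ X′ ℕ.* m ℕ.^ (2 ℕ.^ suc j) ≡ ∣ b ∣ ℕ.* ∣ a ∣ ℕ.^ X ℕ.* n ℕ.^ (2 ℕ.^ suc j))
    extract X X′ (m , n , 1≤m , 1≤n , e) = m , n , 1≤m , 1≤n , subst₂ (λ u v → u ℕ.* m ℕ.^ (2 ℕ.^ suc j) ≡ v ℕ.* n ℕ.^ (2 ℕ.^ suc j)) (abs t X′) (abs b X) e

-- Multiplicative orders and dependence

module Orders where
  open I using (_+_; _*_; _-_; _^_)

  -- The sum 1 + x + ⋯ + x^(n-1): it replaces the quotient (xⁿ - 1) / (x - 1) and keeps its meaning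
  -- when x ≡ 1.
  geo : ℤ → ℕ → ℤ
  geo x zero = + 0
  geo x (suc n) = + 1 + x * geo x n

  geo-≡ : ∀ x n → (x - + 1) * geo x n ≡ x ^ n - + 1
  geo-≡ x zero = ℤP.*-zeroʳ (x - + 1)
  geo-≡ x (suc n) = trans (l x (geo x n)) (trans (cong (λ z → x * z + (x - + 1)) (geo-≡ x n)) (l′ x (x ^ n)))
    where
    l : ∀ x g → (x - + 1) * (+ 1 + x * g) ≡ x * ((x - + 1) * g) + (x - + 1)
    l = solve-∀
    l′ : ∀ x y → x * (y - + 1) + (x - + 1) ≡ x * y - + 1
    l′ = solve-∀

  geo-cong1 : ∀ {d} x n → d ∣ℤ x - + 1 → d ∣ℤ geo x n - + n
  geo-cong1 x zero h = ∣0
  geo-cong1 x (suc n) h = ∣-comb (geo x n) (+ 1) h (geo-cong1 x n h) (l x (geo x n) (+ n))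
    where
    l : ∀ x g n → + 1 + x * g - (+ 1 + n) ≡ g * (x - + 1) + + 1 * (g - n)
    l = solve-∀

  pow-cong1 : ∀ {d} x n → d ∣ℤ x - + 1 → d ∣ℤ x ^ n - + 1
  pow-cong1 x n h = subst (_ ∣ℤ_) (geo-≡ x n) (∣*ʳ (geo x n) h)

  pow-cong1-* : ∀ {d} x m n → d ∣ℤ x ^ m - + 1 → d ∣ℤ x ^ (m ℕ.* n) - + 1
  pow-cong1-* {d} x m n h = subst (λ z → d ∣ℤ z - + 1) (ℤP.^-*-assoc x m n) (pow-cong1 (x ^ m) n h)

  -- Powers of a modulo n repeat among the first n + 1.
  order : ∀ n → 1 ℕ.≤ n → ∀ x → (∀ p → Prime p → p ℕD.∣ n → ¬ + p ∣ℤ x) → ∃[ e ] (1 ℕ.≤ e × e ℕ.≤ n × + n ∣ℤ x ^ e - + 1)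
  order n@(suc _) 1≤n x cop with FinP.pigeonhole (ℕP.n<1+n n) (λ i → fromℕ< (ℤDM.n%ℕd<d (x ^ toℕ i) n))
  ... | i , j , i<j , h = toℕ j ℕ.∸ toℕ i , ℕP.m<n⇒0<n∸m i<j , ℕP.≤-trans (ℕP.m∸n≤m (toℕ j) (toℕ i)) (ℕP.≤-pred (FinP.toℕ<n j)) ,
      coprime-∣ (+ n) (x ^ toℕ i) _ (λ ()) (λ p pp d d′ → cop p pp (∣-ℕ d) (∣-pow⁻ pp (toℕ i) d′)) (subst (+ n ∣ℤ_) eq diff)
    where
    rest = toℕ j ℕ.∸ toℕ i
    r≡ : x ^ toℕ i ℤDM.%ℕ n ≡ x ^ toℕ j ℤDM.%ℕ n
    r≡ = trans (sym (FinP.toℕ-fromℕ< _)) (trans (cong toℕ h) (FinP.toℕ-fromℕ< _))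
    diff : + n ∣ℤ x ^ toℕ j - x ^ toℕ i
    diff = subst (+ n ∣ℤ_) (trans (l (x ^ toℕ j ℤDM./ℕ n) (x ^ toℕ i ℤDM./ℕ n) (+ (x ^ toℕ j ℤDM.%ℕ n)) (+ n))
             (cong₂ _-_ (sym (ℤDM.a≡a%ℕn+[a/ℕn]*n (x ^ toℕ j) n))
               (trans (cong (λ r → + r + (x ^ toℕ i ℤDM./ℕ n) * + n) (sym r≡)) (sym (ℤDM.a≡a%ℕn+[a/ℕn]*n (x ^ toℕ i) n)))))
             (∣*ˡ (x ^ toℕ j ℤDM./ℕ n - x ^ toℕ i ℤDM./ℕ n) ℤD.∣-refl)
      where
      l : ∀ a b r n → (a - b) * n ≡ (r + a * n) - (r + b * n)
      l = solve-∀
    eq : x ^ toℕ j - x ^ toℕ i ≡ x ^ toℕ i * (x ^ rest - + 1)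
    eq = trans (cong (λ k → x ^ k - x ^ toℕ i) (sym (ℕP.m+[n∸m]≡n (ℕP.<⇒≤ i<j)))) (trans (cong (_- x ^ toℕ i) (ℤP.^-distribˡ-+-* x (toℕ i) rest)) (l (x ^ toℕ i) (x ^ rest)))
      where
      l : ∀ a b → a * b - a ≡ a * (b - + 1)
      l = solve-∀

  prime-order : ∀ {p} → Prime p → ∀ x → ¬ + p ∣ℤ x → ∃[ e ] (1 ℕ.≤ e × e ℕ.≤ p × + p ∣ℤ x ^ e - + 1)
  prime-order {p} pp x nd = order p (ℕP.<⇒≤ (prime>1 pp)) x λ r pr r∣p → subst (λ s → ¬ + s ∣ℤ x) (sym (prime∣prime pr pp r∣p)) nd

  pow-bezout : ∀ {d} x g u v m n → g ℕ.+ v ℕ.* n ≡ u ℕ.* m → d ∣ℤ x ^ m - + 1 → d ∣ℤ x ^ n - + 1 → d ∣ℤ x ^ g - + 1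
  pow-bezout {d} x g u v m n eq hm hn = ∣-comb (+ 1) (- (x ^ g)) (subst (λ k → d ∣ℤ x ^ k - + 1) (trans (ℕP.*-comm m u) (sym eq)) (pow-cong1-* x m u hm))
    (subst (λ k → d ∣ℤ x ^ k - + 1) (ℕP.*-comm n v) (pow-cong1-* x n v hn))
    (trans (l (x ^ g) (x ^ (v ℕ.* n))) (cong (λ z → + 1 * (z - + 1) + - (x ^ g) * (x ^ (v ℕ.* n) - + 1)) (sym (ℤP.^-distribˡ-+-* x g (v ℕ.* n)))))
    where
    l : ∀ g y → g - + 1 ≡ + 1 * (g * y - + 1) + - g * (y - + 1)
    l = solve-∀

  pow-gcd : ∀ {d} x m n → d ∣ℤ x ^ m - + 1 → d ∣ℤ x ^ n - + 1 → d ∣ℤ x ^ gcd m n - + 1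
  pow-gcd x m n hm hn with Bézout.identity (Data.Nat.GCD.gcd-GCD m n)
  ... | Bézout.+- u v eq = pow-bezout x (gcd m n) u v m n eq hm hn
  ... | Bézout.-+ u v eq = pow-bezout x (gcd m n) v u n m eq hn hm

  ∣-pow⁻ℕ : ∀ {p m} → Prime p → ∀ n → p ℕD.∣ m ℕ.^ n → p ℕD.∣ m
  ∣-pow⁻ℕ pp zero d = contradiction (subst Prime (ℕD.∣1⇒≡1 d) pp) ¬prime[1]
  ∣-pow⁻ℕ {m = m} pp (suc n) d = [ id , ∣-pow⁻ℕ pp n ]′ (euclidsLemma m (m ℕ.^ n) pp d)

  -- The order of A is exactly ℓ^(N+1).
  exact-order : ∀ {ℓ} → Prime ℓ → ∀ d A N → d ∣ℤ A ^ (ℓ ℕ.^ suc N) - + 1 → ¬ d ∣ℤ A ^ (ℓ ℕ.^ N) - + 1 → ∀ f → d ∣ℤ A ^ f - + 1 → ℓ ℕ.^ suc N ℕD.∣ f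
  exact-order {ℓ} pℓ d A N h nh f hf with gcd[m,n]∣n f (ℓ ℕ.^ suc N)
  ... | ℕD.divides q e with q ℕ.≟ 1
  ...   | yes q≡1 = subst (ℕD._∣ f) (sym (trans e (trans (cong (ℕ._* gcd f (ℓ ℕ.^ suc N)) q≡1) (ℕP.*-identityˡ _)))) (gcd[m,n]∣m f (ℓ ℕ.^ suc N))
  ...   | no q≢1 with primeDivisor q (ℕP.≤∧≢⇒< (ℕP.n≢0⇒n>0 λ z → contradiction (trans e (cong (ℕ._* gcd f (ℓ ℕ.^ suc N)) z)) (ℕ.≢-nonZero⁻¹ (ℓ ℕ.^ suc N) {{ℕP.m^n≢0 ℓ (suc N) {{prime⇒nonZero pℓ}}}})) (q≢1 ∘ sym))
  ...     | r , pr , r∣q with prime∣prime pr pℓ (∣-pow⁻ℕ pr (suc N) (ℕD.∣-trans r∣q (ℕD.divides (gcd f (ℓ ℕ.^ suc N)) (trans e (ℕP.*-comm q _)))))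
  ...       | refl = contradiction (subst (λ k → d ∣ℤ A ^ k - + 1) (sym smaller) (pow-cong1-* A (gcd f (ℓ ℕ.^ suc N)) (ℕD.quotient r∣q) (pow-gcd A f (ℓ ℕ.^ suc N) hf h))) nh
    where
    smaller : ℓ ℕ.^ N ≡ gcd f (ℓ ℕ.^ suc N) ℕ.* ℕD.quotient r∣q
    smaller = ℕP.*-cancelˡ-≡ _ _ ℓ {{prime⇒nonZero pℓ}} (trans e (trans (cong (ℕ._* gcd f (ℓ ℕ.^ suc N)) (ℕD._∣_.equality r∣q)) (l (ℕD.quotient r∣q) ℓ (gcd f (ℓ ℕ.^ suc N)))))
      where
      l : ∀ q l g → q ℕ.* l ℕ.* g ≡ l ℕ.* (g ℕ.* q)
      l = ℕRing.solve-∀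

  n<p^n : ∀ {p} → Prime p → ∀ n → n ℕ.< p ℕ.^ n
  n<p^n pp n = ℕP.<-≤-trans (n<2^n n) (ℕP.^-monoˡ-≤ n (prime>1 pp))

  -- A prime divisor other than ℓ of (Y^ℓ - 1)/(Y - 1), Y = A^(ℓ^N).
  large-order : ∀ {ℓ} → Prime ℓ → ∀ a A e N → A ≡ a ^ e → ∀ {p} → Prime p → ¬ p ≡ ℓ → + p ∣ℤ geo (A ^ (ℓ ℕ.^ N)) ℓ →
                N ℕ.< p × (∀ f → + p ∣ℤ a ^ f - + 1 → ℓ ℕ.^ suc N ℕD.∣ f) × + p ∣ℤ A ^ (ℓ ℕ.^ suc N) - + 1
  large-order {ℓ} pℓ a A e N refl {p} pp p≢ℓ d = N<p , orders , one
    where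
    Y = A ^ (ℓ ℕ.^ N)
    one : + p ∣ℤ A ^ (ℓ ℕ.^ suc N) - + 1
    one = subst (+ p ∣ℤ_) (trans (geo-≡ Y ℓ) (cong (_- + 1) (trans (ℤP.^-*-assoc A (ℓ ℕ.^ N) ℓ) (cong (A ^_) (ℕP.*-comm (ℓ ℕ.^ N) ℓ))))) (∣*ˡ (Y - + 1) d)
    not : ¬ + p ∣ℤ Y - + 1
    not h = p≢ℓ (prime∣prime pp pℓ (∣-ℕ (∣-comb (+ 1) (- (+ 1)) d (geo-cong1 Y ℓ h) (l (+ ℓ) (geo Y ℓ)))))
      where
      l : ∀ a b → a ≡ + 1 * b + - (+ 1) * (b - a)
      l = solve-∀
    orders : ∀ f → + p ∣ℤ a ^ f - + 1 → ℓ ℕ.^ suc N ℕD.∣ f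
    orders f h = exact-order pℓ (+ p) A N one not f (subst (λ z → + p ∣ℤ z - + 1) (trans (cong (a ^_) (ℕP.*-comm f e)) (sym (ℤP.^-*-assoc a e f))) (pow-cong1-* a f e h))
    p∤a : ¬ + p ∣ℤ a
    p∤a h = go e (ℓ ℕ.^ suc N) not one (1≤^ (suc N) (ℕP.<⇒≤ (prime>1 pℓ)))
      where
      go : ∀ e M → ¬ + p ∣ℤ (a ^ e) ^ (ℓ ℕ.^ N) - + 1 → + p ∣ℤ (a ^ e) ^ M - + 1 → 1 ℕ.≤ M → ⊥
      go (suc e) (suc M) _ x _ = p∤1 pp (∣-comb (- (+ 1)) (a ^ e * (a ^ suc e) ^ M) x h (l a (a ^ e) ((a ^ suc e) ^ M)))
        where
        l : ∀ a b c → + 1 ≡ - (+ 1) * (a * b * c - + 1) + b * c * a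
        l = solve-∀
      go zero M not x _ = not (subst (λ z → + p ∣ℤ z - + 1) (sym (1^ (ℓ ℕ.^ N))) ∣0)
    N<p : N ℕ.< p
    N<p = bound (prime-order pp a p∤a)
      where
      bound : ∃[ f ] (1 ℕ.≤ f × f ℕ.≤ p × + p ∣ℤ a ^ f - + 1) → N ℕ.< p
      bound (f , 1≤f , f≤p , hf) = ℕP.<-≤-trans (ℕP.<-trans (ℕP.n<1+n N) (n<p^n pℓ (suc N))) (ℕP.≤-trans (ℕD.∣⇒≤ {{ℕ.>-nonZero 1≤f}} (orders f hf)) f≤p)

  geo-pos : ∀ y n → 2 ℕ.≤ y → ∃[ k ] (geo (+ y) n ≡ + k × n ℕ.≤ k × (2 ℕ.≤ n → n ℕ.< k))
  geo-pos y zero 2≤y = 0 , refl , z≤n , λ ()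
  geo-pos y (suc n) 2≤y with geo-pos y n 2≤y
  ... | k , e , n≤k , _ = suc (y ℕ.* k) , trans (cong (λ z → + 1 + + y * z) e) (cong (λ z → + 1 + z) (sym (ℤP.pos-* y k))) ,
        s≤s (ℕP.≤-trans n≤k (ℕP.m≤n*m k y {{ℕ.>-nonZero (ℕP.≤-trans (s≤s z≤n) 2≤y)}})) ,
        λ h → s≤s (ℕP.<-≤-trans (ℕP.m<m+n n {n ℕ.+ 0} (ℕP.<-≤-trans (ℕP.≤-pred h) (ℕP.m≤m+n n 0))) (ℕP.*-mono-≤ 2≤y n≤k))

  -- An even exponent makes the base positive, so that `geo-pos` can bound the sum from below.
  sq-pos : ∀ a e → 2 ℕ.≤ ∣ a ∣ → 1 ℕ.≤ e → ∃[ y ] (a ^ (2 ℕ.* e) ≡ + y × 2 ℕ.≤ y)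
  sq-pos a e 2≤a 1≤e = ∣ a ∣ ℕ.^ (2 ℕ.* e) ,
    trans (sym (ℤP.^-*-assoc a 2 e)) (trans (cong (_^ e) sq) (trans (pos-^ ((∣ a ∣) ℕ.^ 2) e) (cong +_ (ℕP.^-*-assoc ∣ a ∣ 2 e)))) ,
    ℕP.≤-trans 2≤a (ℕP.≤-trans (ℕP.≤-reflexive (sym (ℕP.^-identityʳ ∣ a ∣))) (ℕP.^-monoʳ-≤ ∣ a ∣ {{ℕ.>-nonZero (ℕP.≤-trans (s≤s z≤n) 2≤a)}} (ℕP.≤-trans 1≤e (ℕP.m≤n*m e 2))))
    where
    pos-^ : ∀ m k → (+ m) ^ k ≡ + (m ℕ.^ k)
    pos-^ m zero = refl
    pos-^ m (suc k) = trans (cong (+ m *_) (pos-^ m k)) (sym (ℤP.pos-* m (m ℕ.^ k)))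
    sq : a ^ 2 ≡ + (∣ a ∣ ℕ.^ 2)
    sq with sq≥0 a
    ... | n , e′ , _ = trans (cong (a *_) (ℤP.*-identityʳ a)) (trans e′ (cong +_ (trans (sym (cong ∣_∣ e′)) (trans (ℤP.abs-* a a) (cong (∣ a ∣ ℕ.*_) (sym (ℕP.*-identityʳ ∣ a ∣)))))))

  -- If ℓ divides Y, the sum is 1 modulo ℓ. If ℓ² divides Y - 1, it is ℓ modulo ℓ², so just one
  -- factor ℓ splits off, and as the sum exceeds ℓ another prime remains.
  geo-prime : ∀ {ℓ} → Prime ℓ → ∀ Y k → geo Y ℓ ≡ + k → ℓ ℕ.< k → + ℓ ∣ℤ Y ⊎ + (ℓ ℕ.* ℓ) ∣ℤ Y - + 1 →
              ∃[ p ] (Prime p × ¬ p ≡ ℓ × + p ∣ℤ geo Y ℓ)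
  geo-prime {ℓ} pℓ Y k h ℓ<k (inj₁ ℓ∣Y) = other (primeDivisor k (ℕP.<-trans (prime>1 pℓ) ℓ<k))
    where
    unit : ∀ n → 1 ℕ.< n → + ℓ ∣ℤ geo Y n → + ℓ ∣ℤ + 1
    unit (suc n) _ g = ∣-comb (+ 1) (- geo Y n) g ℓ∣Y (l Y (geo Y n))
      where
      l : ∀ y g → + 1 ≡ + 1 * (+ 1 + y * g) + - g * y
      l = solve-∀
    other : ∃[ p ] (Prime p × p ℕD.∣ k) → ∃[ p ] (Prime p × ¬ p ≡ ℓ × + p ∣ℤ geo Y ℓ)
    other (p , pp , p∣k) = p , pp , (λ { refl → p∤1 pp (unit ℓ (prime>1 pℓ) p∣Ψ) }) , p∣Ψ
      where
      p∣Ψ : + p ∣ℤ geo Y ℓ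
      p∣Ψ = subst (+ p ∣ℤ_) (sym h) (ℕ-∣ {p} {+ k} p∣k)
  geo-prime {ℓ} pℓ Y k h ℓ<k (inj₂ Y≡1) = other (∣-ℕ {ℓ} {+ k} ℓ∣k)
    where
    Ψ≡ℓ : + (ℓ ℕ.* ℓ) ∣ℤ + k - + ℓ
    Ψ≡ℓ = subst (λ z → + (ℓ ℕ.* ℓ) ∣ℤ z - + ℓ) h (geo-cong1 Y ℓ Y≡1)
    ℓ∣k : + ℓ ∣ℤ + k
    ℓ∣k = ∣-comb (+ 1) (+ 1) (ℤD.∣-trans (ℕ-∣ {ℓ} {+ (ℓ ℕ.* ℓ)} (ℕD.m∣m*n ℓ)) Ψ≡ℓ) (ℤD.∣-refl {+ ℓ}) (l (+ k) (+ ℓ))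
      where
      l : ∀ a b → a ≡ + 1 * (a - b) + + 1 * b
      l = solve-∀
    other : ℓ ℕD.∣ k → ∃[ p ] (Prime p × ¬ p ≡ ℓ × + p ∣ℤ geo Y ℓ)
    other (ℕD.divides k′ e′) = pick (primeDivisor k′ (ℕP.*-cancelʳ-< ℓ 1 k′ (subst₂ ℕ._<_ (sym (ℕP.*-identityˡ ℓ)) e′ ℓ<k)))
      where
      ℓ∣1 : + ℓ ∣ℤ + k′ → + ℓ ∣ℤ + 1
      ℓ∣1 d = ∣-comb (+ 1) (- (+ 1)) d (cancel-p pℓ (subst₂ _∣ℤ_ (ℤP.pos-* ℓ ℓ) (trans (cong (λ z → + z - + ℓ) e′) (trans (cong (_- + ℓ) (ℤP.pos-* k′ ℓ)) (l (+ k′) (+ ℓ)))) Ψ≡ℓ)) (l′ (+ k′))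
        where
        l : ∀ k ℓ → k * ℓ - ℓ ≡ ℓ * (k - + 1)
        l = solve-∀
        l′ : ∀ k → + 1 ≡ + 1 * k + - (+ 1) * (k - + 1)
        l′ = solve-∀
      pick : ∃[ p ] (Prime p × p ℕD.∣ k′) → ∃[ p ] (Prime p × ¬ p ≡ ℓ × + p ∣ℤ geo Y ℓ)
      pick (p , pp , p∣k′) = p , pp , (λ { refl → p∤1 pp (ℓ∣1 (ℕ-∣ {ℓ} {+ k′} p∣k′)) }) ,
            subst (+ p ∣ℤ_) (sym h) (ℕ-∣ {p} {+ k} (ℕD.∣-trans p∣k′ (ℕD.divides ℓ (trans e′ (ℕP.*-comm k′ ℓ)))))

  geo-large : ∀ Y y → Y ≡ + y → 2 ℕ.≤ y → ∀ n → 2 ℕ.≤ n → ∃[ k ] (geo Y n ≡ + k × n ℕ.< k)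
  geo-large _ y refl 2≤y n 2≤n with geo-pos y n 2≤y
  ... | k , h , _ , lt = k , h , lt 2≤n

  -- The base a^(2e) is prepared for `geo-prime`: e = 1 if ℓ divides a, otherwise e satisfies a^e ≡
  -- 1 modulo ℓ², which works for ℓ = 2 too. Taking the ℓ^N-th power with N = T + 1 pushes the prime
  -- beyond T.
  prime-power-order : ∀ {ℓ} → Prime ℓ → ∀ T a → 2 ℕ.≤ ∣ a ∣ → ∃[ p ] (Prime p × T ℕ.< p × (∀ f → + p ∣ℤ a ^ f - + 1 → ℓ ℕ.^ 2 ℕD.∣ f))
  prime-power-order {ℓ} pℓ T a 2≤a = conclude (good (+ ℓ ℤD.∣? a))
    where
    N = suc T
    N≢0 : 1 ℕ.≤ ℓ ℕ.^ N
    N≢0 = 1≤^ N (ℕP.<⇒≤ (prime>1 pℓ))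
    Good : Set
    Good = ∃[ e ] ∃[ p ] (Prime p × ¬ p ≡ ℓ × + p ∣ℤ geo ((a ^ (2 ℕ.* e)) ^ (ℓ ℕ.^ N)) ℓ)
    Ψ-pos : ∀ e → 1 ℕ.≤ e → ∃[ k ] (geo ((a ^ (2 ℕ.* e)) ^ (ℓ ℕ.^ N)) ℓ ≡ + k × ℓ ℕ.< k)
    Ψ-pos e 1≤e = large (sq-pos a (e ℕ.* ℓ ℕ.^ N) 2≤a (ℕP.*-mono-≤ 1≤e N≢0))
      where
      large : ∃[ y ] (a ^ (2 ℕ.* (e ℕ.* ℓ ℕ.^ N)) ≡ + y × 2 ℕ.≤ y) → ∃[ k ] (geo ((a ^ (2 ℕ.* e)) ^ (ℓ ℕ.^ N)) ℓ ≡ + k × ℓ ℕ.< k)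
      large (y , h , 2≤y) = geo-large _ y (trans (ℤP.^-*-assoc a (2 ℕ.* e) (ℓ ℕ.^ N)) (trans (cong (a ^_) (ℕP.*-assoc 2 e (ℓ ℕ.^ N))) h)) 2≤y ℓ (prime>1 pℓ)
    candidate : ∀ e → 1 ℕ.≤ e → + ℓ ∣ℤ (a ^ (2 ℕ.* e)) ^ (ℓ ℕ.^ N) ⊎ + (ℓ ℕ.* ℓ) ∣ℤ (a ^ (2 ℕ.* e)) ^ (ℓ ℕ.^ N) - + 1 → Good
    candidate e 1≤e h = fromSize (Ψ-pos e 1≤e)
      where
      fromSize : ∃[ k ] (geo ((a ^ (2 ℕ.* e)) ^ (ℓ ℕ.^ N)) ℓ ≡ + k × ℓ ℕ.< k) → Good
      fromSize (k , hk , ℓ<k) = e , geo-prime pℓ _ k hk ℓ<k h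
    ∣-^ : ∀ {d x} M → 1 ℕ.≤ M → d ∣ℤ x → d ∣ℤ x ^ M
    ∣-^ {x = x} (suc M) _ = ∣*ʳ (x ^ M)
    good : Dec (+ ℓ ∣ℤ a) → Good
    good (yes ℓ∣a) = candidate 1 ℕP.≤-refl (inj₁ (∣-^ (ℓ ℕ.^ N) N≢0 (∣-^ 2 (s≤s z≤n) ℓ∣a)))
    good (no ℓ∤a) = fromOrder (order (ℓ ℕ.* ℓ) (ℕP.*-mono-≤ (ℕP.<⇒≤ (prime>1 pℓ)) (ℕP.<⇒≤ (prime>1 pℓ))) a
          (λ r pr d → subst (λ s → ¬ + s ∣ℤ a) (sym (prime∣prime pr pℓ ([ id , id ]′ (euclidsLemma ℓ ℓ pr d)))) ℓ∤a))
      where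
      fromOrder : ∃[ e ] (1 ℕ.≤ e × e ℕ.≤ ℓ ℕ.* ℓ × + (ℓ ℕ.* ℓ) ∣ℤ a ^ e - + 1) → Good
      fromOrder (e , 1≤e , _ , he) = candidate e 1≤e (inj₂ (pow-cong1 (a ^ (2 ℕ.* e)) (ℓ ℕ.^ N)
        (subst (λ n → + (ℓ ℕ.* ℓ) ∣ℤ a ^ n - + 1) (ℕP.*-comm e 2) (pow-cong1-* a e 2 he))))
    conclude : Good → ∃[ p ] (Prime p × T ℕ.< p × (∀ f → + p ∣ℤ a ^ f - + 1 → ℓ ℕ.^ 2 ℕD.∣ f))
    conclude (e , p , pp , p≢ℓ , d) = result (large-order pℓ a (a ^ (2 ℕ.* e)) (2 ℕ.* e) N refl pp p≢ℓ d)
      where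
      result : N ℕ.< p × (∀ f → + p ∣ℤ a ^ f - + 1 → ℓ ℕ.^ suc N ℕD.∣ f) × + p ∣ℤ (a ^ (2 ℕ.* e)) ^ (ℓ ℕ.^ suc N) - + 1 →
               ∃[ p ] (Prime p × T ℕ.< p × (∀ f → + p ∣ℤ a ^ f - + 1 → ℓ ℕ.^ 2 ℕD.∣ f))
      result (N<p , orders , _) = p , pp , ℕP.<-trans (ℕP.n<1+n T) N<p , λ f h → ℕD.∣-trans (ℕD.divides (ℓ ℕ.^ T) (l (ℓ ℕ.^ T) ℓ)) (orders f h)
        where
        l : ∀ x ℓ → ℓ ℕ.* (ℓ ℕ.* x) ≡ x ℕ.* (ℓ ℕ.* (ℓ ℕ.* 1))
        l = ℕRing.solve-∀

  prime[3] : Prime 3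
  prime[3] = Data.Nat.Primality.irreducible⇒prime λ {d} d∣3 → go d d∣3 (ℕD.∣⇒≤ d∣3)
    where
    go : ∀ d → d ℕD.∣ 3 → d ℕ.≤ 3 → d ≡ 1 ⊎ d ≡ 3
    go 0 h _ = contradiction (ℕD.0∣⇒≡0 h) λ ()
    go 1 _ _ = inj₁ refl
    go 2 (ℕD.divides (suc (suc zero)) ()) _
    go 3 _ _ = inj₂ refl
    go (suc (suc (suc (suc d)))) _ (s≤s (s≤s (s≤s ())))

  prime≢3 : ∀ x → 3 ℕ.< ∣ x ∣ → ¬ + 9 ∣ℤ x → ∃[ p ] (Prime p × ¬ p ≡ 3 × + p ∣ℤ x)
  prime≢3 x 3<x ∤9 with 3 ℕD.∣? ∣ x ∣
  ... | no 3∤ with primeDivisor (∣ x ∣) (ℕP.<-trans (s≤s (s≤s z≤n)) 3<x)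
  ...   | p , pp , p∣ = p , pp , (λ { refl → 3∤ p∣ }) , ℕ-∣ p∣
  prime≢3 x 3<x ∤9 | yes (ℕD.divides k e) with primeDivisor k (ℕP.*-cancelʳ-< 3 1 k (subst (3 ℕ.<_) e 3<x))
  ...   | p , pp , p∣k = p , pp , (λ { refl → ∤9 (ℕ-∣ (subst (9 ℕD.∣_) (sym e) (ℕD.*-pres-∣ p∣k (ℕD.∣-refl {3})))) }) , ℕ-∣ (ℕD.∣-trans p∣k (ℕD.divides 3 (trans e (ℕP.*-comm k 3))))

  -- With Y = a^(3^N), a prime other than 3 dividing Y² + Y + 1 gives a^(3^(N+1)) ≡ 1, an odd
  -- exponent. It exists because Y² + Y + 1 exceeds 3 and is never divisible by 9.
  odd-order : ∀ T a → 2 ℕ.≤ ∣ a ∣ → ∃[ p ] (Prime p × T ℕ.< p × ∃[ r ] (+ p ∣ℤ a ^ suc (r ℕ.+ r) - + 1))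
  odd-order T a 2≤a = conclude witness
    where
    N = suc T
    Y = a ^ (3 ℕ.^ N)
    2≤Y : 3 ℕ.≤ ∣ Y ∣
    2≤Y = ℕP.≤-trans (ℕP.≤-trans (n<2^n 2) (ℕP.^-monoʳ-≤ 2 (ℕP.≤-trans (s≤s (s≤s z≤n)) (ℕP.^-monoʳ-≤ 3 {1} {N} (s≤s z≤n)))))
            (subst ((2 ℕ.^ (3 ℕ.^ N)) ℕ.≤_) (sym (∣^∣ a (3 ℕ.^ N))) (ℕP.^-monoˡ-≤ (3 ℕ.^ N) 2≤a))
    Ψ = geo Y 3
    Ψ≡ : Ψ ≡ Y * Y + Y + + 1
    Ψ≡ = l Y
      where
      l : ∀ y → + 1 + y * (+ 1 + y * (+ 1 + y * + 0)) ≡ y * y + y + + 1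
      l = solve-∀
    large : 3 ℕ.< ∣ Ψ ∣
    large = ℕP.+-cancelʳ-< (∣ Y ∣ ℕ.+ 1) 3 (∣ Ψ ∣) (begin-strict
        3 ℕ.+ (∣ Y ∣ ℕ.+ 1) <⟨ bound (∣ Y ∣) 2≤Y ⟩
        ∣ Y ∣ ℕ.* ∣ Y ∣ ≡⟨ sym (ℤP.abs-* Y Y) ⟩
        ∣ Y * Y ∣ ≡⟨ cong ∣_∣ (trans (l (Y * Y) Y) (cong (λ z → z - (Y + + 1)) (sym Ψ≡))) ⟩
        ∣ Ψ - (Y + + 1) ∣ ≤⟨ ℤP.∣i-j∣≤∣i∣+∣j∣ Ψ (Y + + 1) ⟩
        ∣ Ψ ∣ ℕ.+ ∣ Y + + 1 ∣ ≤⟨ ℕP.+-monoʳ-≤ (∣ Ψ ∣) (ℤP.∣i+j∣≤∣i∣+∣j∣ Y (+ 1)) ⟩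
        ∣ Ψ ∣ ℕ.+ (∣ Y ∣ ℕ.+ 1) ∎)
      where
      open ℕP.≤-Reasoning
      l : ∀ a y → a ≡ (a + y + + 1) - (y + + 1)
      l = solve-∀
      bound : ∀ y → 3 ℕ.≤ y → 3 ℕ.+ (y ℕ.+ 1) ℕ.< y ℕ.* y
      bound y 3≤y = ℕP.<-≤-trans (ℕP.≤-trans (ℕP.≤-reflexive (l′ y)) (ℕP.≤-trans (ℕP.+-monoʳ-≤ y (ℕP.+-mono-≤ 3≤y (s≤s (s≤s z≤n)))) (ℕP.≤-reflexive (l″ y)))) (mono y 3≤y)
        where
        l′ : ∀ y → suc (3 ℕ.+ (y ℕ.+ 1)) ≡ y ℕ.+ (3 ℕ.+ 2)
        l′ = ℕRing.solve-∀
        l″ : ∀ y → y ℕ.+ (y ℕ.+ 2) ≡ 2 ℕ.* y ℕ.+ 2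
        l″ = ℕRing.solve-∀
        mono : ∀ y → 3 ℕ.≤ y → 2 ℕ.* y ℕ.+ 2 ℕ.≤ y ℕ.* y
        mono y h = ℕP.≤-trans (ℕP.+-monoʳ-≤ (2 ℕ.* y) (ℕP.≤-trans (s≤s (s≤s z≤n)) h)) (ℕP.≤-trans (ℕP.≤-reflexive (l‴ y)) (ℕP.*-monoˡ-≤ y h))
          where
          l‴ : ∀ y → 2 ℕ.* y ℕ.+ y ≡ 3 ℕ.* y
          l‴ = ℕRing.solve-∀
    not9 : ¬ + 9 ∣ℤ Ψ
    not9 d = cases (Y ℤDM.%ℕ 3) (ℤDM.n%ℕd<d Y 3) (ℤDM.a≡a%ℕn+[a/ℕn]*n Y 3)
      where
      k = Y ℤDM./ℕ 3
      3∣ : + 3 ∣ℤ Ψ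
      3∣ = ℤD.∣-trans (divides (+ 3) refl) d
      cases : ∀ r → r ℕ.< 3 → Y ≡ + r + k * + 3 → ⊥
      cases 0 _ e = p∤1 prime[3] (∣-comb (+ 1) (- (k + k * k * + 3)) 3∣ ℤD.∣-refl (trans (l k) (cong (λ z → + 1 * z + - (k + k * k * + 3) * + 3) (trans (cong (λ y → y * y + y + + 1) (sym e)) (sym Ψ≡)))))
        where
        l : ∀ k → + 1 ≡ + 1 * ((+ 0 + k * + 3) * (+ 0 + k * + 3) + (+ 0 + k * + 3) + + 1) + - (k + k * k * + 3) * + 3
        l = solve-∀
      cases 1 _ e = contradiction (∣-comb (+ 1) (- (k + k * k)) d ℤD.∣-refl (trans (l k) (cong (λ z → + 1 * z + - (k + k * k) * + 9) (trans (cong (λ y → y * y + y + + 1) (sym e)) (sym Ψ≡))))) 9∤3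
        where
        l : ∀ k → + 3 ≡ + 1 * ((+ 1 + k * + 3) * (+ 1 + k * + 3) + (+ 1 + k * + 3) + + 1) + - (k + k * k) * + 9
        l = solve-∀
        9∤3 : ¬ + 9 ∣ℤ + 3
        9∤3 h with ℕD.∣⇒≤ (∣-ℕ {9} {+ 3} h)
        ... | s≤s (s≤s (s≤s ()))
      cases 2 _ e = p∤1 prime[3] (∣-comb (+ 1) (- (+ 2 + k * + 5 + k * k * + 3)) 3∣ ℤD.∣-refl (trans (l k) (cong (λ z → + 1 * z + - (+ 2 + k * + 5 + k * k * + 3) * + 3) (trans (cong (λ y → y * y + y + + 1) (sym e)) (sym Ψ≡)))))
        where
        l : ∀ k → + 1 ≡ + 1 * ((+ 2 + k * + 3) * (+ 2 + k * + 3) + (+ 2 + k * + 3) + + 1) + - (+ 2 + k * + 5 + k * k * + 3) * + 3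
        l = solve-∀
      cases (suc (suc (suc r))) (s≤s (s≤s (s≤s ()))) _
    witness : ∃[ p ] (Prime p × ¬ p ≡ 3 × + p ∣ℤ Ψ)
    witness = prime≢3 Ψ large not9
    odd-3 : ∀ n → ∃[ r ] (3 ℕ.^ n ≡ suc (r ℕ.+ r))
    odd-3 zero = 0 , refl
    odd-3 (suc n) with odd-3 n
    ... | r , e = suc (r ℕ.+ r ℕ.+ r) , trans (cong (3 ℕ.*_) e) (l r)
      where
      l : ∀ r → 3 ℕ.* suc (r ℕ.+ r) ≡ suc (suc (r ℕ.+ r ℕ.+ r) ℕ.+ suc (r ℕ.+ r ℕ.+ r))
      l = ℕRing.solve-∀
    conclude : ∃[ p ] (Prime p × ¬ p ≡ 3 × + p ∣ℤ Ψ) → _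
    conclude (p , pp , p≢3 , d) with large-order prime[3] a a 1 N (sym (ℤP.*-identityʳ a)) pp p≢3 d
    ... | N<p , _ , one = p , pp , ℕP.<-trans (ℕP.n<1+n T) N<p , proj₁ (odd-3 (suc N)) , subst (λ k → + p ∣ℤ a ^ k - + 1) (proj₂ (odd-3 (suc N))) one

open Orders

-- Valuations and multiplicative dependence of natural numbers

module Valuation {ℓ : ℕ} (pℓ : Prime ℓ) where
  open Nat using (_*_; _+_; _^_)

  record Val (n v : ℕ) : Set where
    constructor val
    field
      part : ℕ
      factorised : n ≡ ℓ ^ v * part
      ℓ∤part : ¬ ℓ ℕD.∣ part

  val-exists : ∀ n → 1 ℕ.≤ n → ∃ (Val n)
  val-exists n = go n n ℕP.≤-refl
    where
    go : ∀ fuel n → n ℕ.≤ fuel → 1 ℕ.≤ n → ∃ (Val n)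
    go zero _ n≤ 1≤n = contradiction (ℕP.≤-trans 1≤n n≤) λ ()
    go (suc fuel) n n≤ 1≤n with ℓ ℕD.∣? n
    ... | no ℓ∤n = 0 , val n (sym (ℕP.+-identityʳ n)) ℓ∤n
    ... | yes (ℕD.divides n′ refl) with go fuel n′ (ℕP.≤-pred (ℕP.<-≤-trans (ℕP.m<m*n n′ ℓ {{ℕ.>-nonZero 1≤n′}} (prime>1 pℓ)) n≤)) 1≤n′
      where
      1≤n′ : 1 ℕ.≤ n′
      1≤n′ = ℕP.n≢0⇒n>0 λ { refl → contradiction 1≤n λ () }
    ...   | v , val n″ refl h = suc v , val n″ (l (ℓ ^ v) n″ ℓ) h
      where
      l : ∀ a b c → a * b * c ≡ c * a * b
      l = ℕRing.solve-∀

  val-* : ∀ {m n v w} → Val m v → Val n w → Val (m * n) (v + w)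
  val-* {v = v} {w} (val m′ refl hm) (val n′ refl hn) = val (m′ * n′)
    (trans (l (ℓ ^ v) m′ (ℓ ^ w) n′) (cong (_* (m′ * n′)) (sym (ℕP.^-distribˡ-+-* ℓ v w))))
    λ d → [ hm , hn ]′ (euclidsLemma m′ n′ pℓ d)
    where
    l : ∀ a b c d → a * b * (c * d) ≡ a * c * (b * d)
    l = ℕRing.solve-∀

  val-^ : ∀ {m v} → Val m v → ∀ k → Val (m ^ k) (k * v)
  val-^ h zero = val 1 refl λ d → ¬prime[1] (subst Prime (ℕD.∣1⇒≡1 d) pℓ)
  val-^ h (suc k) = val-* h (val-^ h k)

  val-unique : ∀ {n v w} → Val n v → Val n w → v ≡ w
  val-unique {v = zero} {zero} _ _ = refl
  val-unique {v = zero} {suc w} (val n′ e h) (val n″ e′ _) =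
    contradiction (ℕD.divides (ℓ ^ w * n″) (trans (sym (ℕP.+-identityʳ n′)) (trans (sym e) (trans e′ (l ℓ (ℓ ^ w) n″))))) h
    where
    l : ∀ a b c → a * b * c ≡ b * c * a
    l = ℕRing.solve-∀
  val-unique {v = suc v} {zero} h h′ = sym (val-unique {v = zero} {suc v} h′ h)
  val-unique {v = suc v} {suc w} (val n′ refl h) (val n″ e′ h′) =
    cong suc (val-unique (val n′ refl h) (val n″ (ℕP.*-cancelˡ-≡ _ _ ℓ {{prime⇒nonZero pℓ}} (trans (sym (ℕP.*-assoc ℓ (ℓ ^ v) n′)) (trans e′ (ℕP.*-assoc ℓ (ℓ ^ w) n″)))) h′))

  val-positive : ∀ {n v} → ℓ ℕD.∣ n → Val n v → 1 ℕ.≤ v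
  val-positive {v = zero} d (val n′ refl h) = contradiction (subst (ℓ ℕD.∣_) (ℕP.+-identityʳ n′) d) h
  val-positive {v = suc v} _ _ = s≤s z≤n

module NaturalPowers where
  open Nat using (_*_; _+_; _^_)

  ^-injectiveˡ : ∀ g {x y} → 1 ℕ.≤ g → x ^ g ≡ y ^ g → x ≡ y
  ^-injectiveˡ g {x} {y} 1≤g e with ℕP.<-cmp x y
  ... | tri< lt _ _ = contradiction e (ℕP.<⇒≢ (ℕP.^-monoˡ-< g {{ℕ.>-nonZero 1≤g}} lt))
  ... | tri≈ _ h _ = h
  ... | tri> _ _ gt = contradiction (sym e) (ℕP.<⇒≢ (ℕP.^-monoˡ-< g {{ℕ.>-nonZero 1≤g}} gt))

  coprime-^ : ∀ q {m n} → 1 ℕ.≤ m → Coprime m n → Coprime (m ^ q) (n ^ q)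
  coprime-^ q {m} {n} 1≤m cop {d} (d∣m , d∣n) with d ℕ.≟ 1
  ... | yes e = e
  ... | no d≢1 with primeDivisor d (ℕP.≤∧≢⇒< (ℕP.n≢0⇒n>0 λ { refl → ℕ.≢-nonZero⁻¹ (m ^ q) {{ℕP.m^n≢0 m q {{ℕ.>-nonZero 1≤m}}}} (ℕD.0∣⇒≡0 d∣m) }) (d≢1 ∘ sym))
  ...   | r , pr , r∣d = contradiction (subst Prime (cop (∣-pow⁻ℕ pr q (ℕD.∣-trans r∣d d∣m) , ∣-pow⁻ℕ pr q (ℕD.∣-trans r∣d d∣n))) pr) ¬prime[1]

  small-divisor : ∀ q {m P} → 1 ℕ.≤ m → 1 ℕ.≤ P → P ℕ.< 2 ^ q → m ^ q ℕD.∣ P → m ≡ 1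
  small-divisor q {m} 1≤m 1≤P P< d with m ℕ.≟ 1
  ... | yes e = e
  ... | no m≢1 = contradiction (ℕP.<-≤-trans P< (ℕP.≤-trans (ℕP.^-monoˡ-≤ q (ℕP.≤∧≢⇒< 1≤m (m≢1 ∘ sym))) (ℕD.∣⇒≤ {{ℕ.>-nonZero 1≤P}} d))) (ℕP.<-irrefl refl)

  -- Once common prime factors are cancelled, m^q divides P′ < 2^q, so m = 1, and likewise n = 1.
  equal-coefficients : ∀ q {P P′} → 1 ℕ.≤ P → 1 ℕ.≤ P′ → P ℕ.< 2 ^ q → P′ ℕ.< 2 ^ q →
                       ∀ m n → 1 ℕ.≤ m → 1 ℕ.≤ n → P * m ^ q ≡ P′ * n ^ q → P ≡ P′
  equal-coefficients q {P} {P′} 1≤P 1≤P′ P< P′< m n = go m m n ℕP.≤-refl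
    where
    coprime : ∀ m n → Coprime m n → 1 ℕ.≤ m → 1 ℕ.≤ n → P * m ^ q ≡ P′ * n ^ q → P ≡ P′
    coprime m n cop 1≤m 1≤n e = trans (sym (unit P m q m≡1)) (trans e (unit P′ n q n≡1))
      where
      unit : ∀ P m q → m ≡ 1 → P * m ^ q ≡ P
      unit P m q refl = trans (cong (P *_) (ℕP.^-zeroˡ q)) (ℕP.*-identityʳ P)
      m≡1 : m ≡ 1
      m≡1 = small-divisor q 1≤m 1≤P′ P′< (coprime-divisor (coprime-^ q 1≤m cop) (ℕD.divides P (trans (ℕP.*-comm (n ^ q) P′) (sym e))))
      n≡1 : n ≡ 1
      n≡1 = small-divisor q 1≤n 1≤P P< (coprime-divisor (coprime-^ q 1≤n (λ (x , y) → cop (y , x))) (ℕD.divides P′ (trans (ℕP.*-comm (m ^ q) P) e)))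
    factor : ∀ {r m} → 1 ℕ.≤ m → r ℕD.∣ m → ∃[ m′ ] (m ≡ m′ * r × 1 ℕ.≤ m′)
    factor 1≤m (ℕD.divides m′ refl) = m′ , refl , ℕP.n≢0⇒n>0 λ { refl → contradiction 1≤m λ () }
    go : ∀ fuel m n → m ℕ.≤ fuel → 1 ℕ.≤ m → 1 ℕ.≤ n → P * m ^ q ≡ P′ * n ^ q → P ≡ P′
    go zero m n m≤ 1≤m _ _ = contradiction (ℕP.≤-trans 1≤m m≤) λ ()
    go (suc fuel) m n m≤ 1≤m 1≤n e with gcd m n ℕ.≟ 1
    ... | yes g≡1 = coprime m n (Coprimality.gcd≡1⇒coprime g≡1) 1≤m 1≤n e
    ... | no g≢1 with primeDivisor (gcd m n) (ℕP.≤∧≢⇒< (ℕP.n≢0⇒n>0 λ z → ℕP.<⇒≢ 1≤m (sym (Data.Nat.GCD.gcd[m,n]≡0⇒m≡0 z))) (g≢1 ∘ sym))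
    ...   | r , pr , r∣g with factor 1≤m (ℕD.∣-trans r∣g (gcd[m,n]∣m m n)) | factor 1≤n (ℕD.∣-trans r∣g (gcd[m,n]∣n m n))
    ...     | m′ , refl , 1≤m′ | n′ , refl , 1≤n′ = go fuel m′ n′ (ℕP.≤-pred (ℕP.<-≤-trans (ℕP.m<m*n m′ r {{ℕ.>-nonZero 1≤m′}} (prime>1 pr)) m≤)) 1≤m′ 1≤n′
              (ℕP.*-cancelʳ-≡ _ _ (r ^ q) {{ℕP.m^n≢0 r q {{prime⇒nonZero pr}}}} (trans (sym (split P m′)) (trans e (split P′ n′))))
      where
      split : ∀ P m → P * (m * r) ^ q ≡ P * m ^ q * r ^ q
      split P m = trans (cong (P *_) (^-distribʳ-* q m r)) (sym (ℕP.*-assoc P (m ^ q) (r ^ q)))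

  -- Comparing valuations at a prime divisor of A eliminates the unknown powers of A.
  multiplicative-dependence : ∀ A B T → 2 ℕ.≤ A → 1 ℕ.≤ B → 1 ℕ.≤ T →
    (∀ j → ¬ ¬ (∃[ X ] ∃[ X′ ] ∃[ m ] ∃[ n ] (1 ℕ.≤ m × 1 ℕ.≤ n × T * A ^ X′ * m ^ (2 ^ suc j) ≡ B * A ^ X * n ^ (2 ^ suc j)))) →
    ¬ ¬ (∃[ i ] ∃[ j₁ ] ∃[ j₂ ] (1 ℕ.≤ i × B ^ i * A ^ j₁ ≡ T ^ i * A ^ j₂))
  multiplicative-dependence A B T 2≤A 1≤B 1≤T relation k with primeDivisor A 2≤A
  ... | ℓ , pℓ , ℓ∣A with Valuation.val-exists pℓ A (ℕP.<⇒≤ 2≤A) | Valuation.val-exists pℓ B 1≤B | Valuation.val-exists pℓ T 1≤T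
  ...   | α , vA | βb , vB | βt , vT = relation j λ (X , X′ , m , n , 1≤m , 1≤n , e) → k (α , βt , βb , val-positive ℓ∣A vA ,
            equal-coefficients q 1≤P 1≤P′ (small P (ℕP.m≤m+n P P′)) (small P′ (ℕP.m≤n+m P′ P)) _ _
              (1≤m*n (1≤^ (proj₁ (val-exists m 1≤m)) 1≤A) (1≤^ α 1≤n))
              (1≤m*n (1≤^ (proj₁ (val-exists n 1≤n)) 1≤A) (1≤^ α 1≤m))
              (sym (eliminate X X′ m n (proj₁ (val-exists m 1≤m)) (proj₁ (val-exists n 1≤n)) (proj₂ (val-exists m 1≤m)) (proj₂ (val-exists n 1≤n)) e)))
    where
    open Valuation pℓ
    1≤A : 1 ℕ.≤ A
    1≤A = ℕP.<⇒≤ 2≤A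
    1≤m*n : ∀ {m n} → 1 ℕ.≤ m → 1 ℕ.≤ n → 1 ℕ.≤ m * n
    1≤m*n = ℕP.*-mono-≤
    -- P and P′ involve only A, B, T and their valuations at ℓ, so j can be chosen after them, large
    -- enough to put both below 2^q.
    P P′ j q : ℕ
    P = B ^ α * A ^ βt
    P′ = T ^ α * A ^ βb
    j = P + P′
    q = 2 ^ suc j
    1≤P : 1 ℕ.≤ P
    1≤P = 1≤m*n (1≤^ α 1≤B) (1≤^ βt 1≤A)
    1≤P′ : 1 ℕ.≤ P′
    1≤P′ = 1≤m*n (1≤^ α 1≤T) (1≤^ βb 1≤A)
    small : ∀ x → x ℕ.≤ j → x ℕ.< 2 ^ q
    small x x≤j = ℕP.<-≤-trans (n<2^n x) (ℕP.^-monoʳ-≤ 2 (ℕP.≤-trans x≤j (ℕP.≤-trans (ℕP.n≤1+n j) (ℕP.<⇒≤ (n<2^n (suc j))))))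
    -- Raise the relation to the power α and trade A^(X′ α), A^(X α) for q-th powers by means of the
    -- equation between ℓ-valuations.
    eliminate : ∀ X X′ m n μ ν → Val m μ → Val n ν → T * A ^ X′ * m ^ q ≡ B * A ^ X * n ^ q →
                P′ * (A ^ ν * m ^ α) ^ q ≡ P * (A ^ μ * n ^ α) ^ q
    eliminate X X′ m n μ ν vm vn e = trans (cong (P′ *_) (expand ν m)) (trans
        (cancel (T ^ α) (B ^ α) (A ^ βb) (A ^ (q * ν)) (A ^ βt) (A ^ (X′ * α)) (A ^ (q * μ)) (A ^ (X * α)) (m ^ (q * α)) (n ^ (q * α)) raised balance)
        (sym (cong (P *_) (expand μ n))))
      where
      expand : ∀ ν m → (A ^ ν * m ^ α) ^ q ≡ A ^ (q * ν) * m ^ (q * α)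
      expand ν m = trans (^-distribʳ-* q (A ^ ν) (m ^ α)) (cong₂ _*_ (pow A ν) (pow m α))
        where
        pow : ∀ x ν → (x ^ ν) ^ q ≡ x ^ (q * ν)
        pow x ν = trans (ℕP.^-*-assoc x ν q) (cong (x ^_) (ℕP.*-comm ν q))
      side : ∀ T X m → (T * A ^ X * m ^ q) ^ α ≡ T ^ α * A ^ (X * α) * m ^ (q * α)
      side T X m = trans (^-distribʳ-* α (T * A ^ X) (m ^ q)) (cong₂ _*_ (trans (^-distribʳ-* α T (A ^ X)) (cong (T ^ α *_) (ℕP.^-*-assoc A X α))) (ℕP.^-*-assoc m q α))
      raised : T ^ α * A ^ (X′ * α) * m ^ (q * α) ≡ B ^ α * A ^ (X * α) * n ^ (q * α)
      raised = trans (sym (side T X′ m)) (trans (cong (_^ α) e) (side B X n))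
      exponents : βt + X′ * α + q * μ ≡ βb + X * α + q * ν
      exponents = val-unique (val-* (val-* vT (val-^ vA X′)) (val-^ vm q)) (subst (λ z → Val z (βb + X * α + q * ν)) (sym e) (val-* (val-* vB (val-^ vA X)) (val-^ vn q)))
      sum3 : ∀ x y z → A ^ (x + y + z) ≡ A ^ x * A ^ y * A ^ z
      sum3 x y z = trans (ℕP.^-distribˡ-+-* A (x + y) z) (cong (_* A ^ z) (ℕP.^-distribˡ-+-* A x y))
      balance : A ^ βt * A ^ (X′ * α) * A ^ (q * μ) ≡ A ^ βb * A ^ (X * α) * A ^ (q * ν)
      balance = trans (sym (sum3 βt (X′ * α) (q * μ))) (trans (cong (A ^_) exponents) (sum3 βb (X * α) (q * ν)))
      cancel : ∀ t b a1 a2 a3 a4 a5 a6 M N → t * a4 * M ≡ b * a6 * N → a3 * a4 * a5 ≡ a1 * a6 * a2 →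
               {{_ : ℕ.NonZero (a3 * a4 * a5)}} → t * a1 * (a2 * M) ≡ b * a3 * (a5 * N)
      cancel t b a1 a2 a3 a4 a5 a6 M N h h′ = ℕP.*-cancelʳ-≡ _ _ (a3 * a4 * a5)
        (trans (l₁ t a1 a2 M a3 a4 a5) (trans (cong (_* (a1 * a2 * a3 * a5)) h) (trans (l₂ b a1 a2 N a3 a5 a6) (cong (b * a3 * (a5 * N) *_) (sym h′)))))
        where
        l₁ : ∀ t a1 a2 M a3 a4 a5 → t * a1 * (a2 * M) * (a3 * a4 * a5) ≡ t * a4 * M * (a1 * a2 * a3 * a5)
        l₁ = ℕRing.solve-∀
        l₂ : ∀ b a1 a2 N a3 a5 a6 → b * a6 * N * (a1 * a2 * a3 * a5) ≡ b * a3 * (a5 * N) * (a1 * a6 * a2)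
        l₂ = ℕRing.solve-∀
      instance
        powers≢0 : ℕ.NonZero (A ^ βt * A ^ (X′ * α) * A ^ (q * μ))
        powers≢0 = ℕ.>-nonZero (1≤m*n (1≤m*n (1≤^ βt 1≤A) (1≤^ (X′ * α) 1≤A)) (1≤^ (q * μ) 1≤A))

  -- With one exponent zero, a prime dividing the difference of the exponents divides both, so roots
  -- can be extracted later.
  one-sided : ∀ A B T → 1 ℕ.≤ A → ∀ j₁ j₂ → B * A ^ j₁ ≡ T * A ^ j₂ →
              ∃[ k₁ ] ∃[ k₂ ] ((k₁ ≡ 0 ⊎ k₂ ≡ 0) × B * A ^ k₁ ≡ T * A ^ k₂)
  one-sided A B T 1≤A zero j₂ e = 0 , j₂ , inj₁ refl , e
  one-sided A B T 1≤A (suc j₁) zero e = suc j₁ , 0 , inj₂ refl , e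
  one-sided A B T 1≤A (suc j₁) (suc j₂) e = one-sided A B T 1≤A j₁ j₂
    (ℕP.*-cancelˡ-≡ _ _ A {{ℕ.>-nonZero 1≤A}} (trans (l A B (A ^ j₁)) (trans e (sym (l A T (A ^ j₂))))))
    where
    l : ∀ a b c → a * (b * c) ≡ b * (a * c)
    l = ℕRing.solve-∀

open NaturalPowers

module IntegerPowers where
  open I using (_+_; _*_; _-_; _^_)

  1≤abs : ∀ {x} → ¬ x ≡ + 0 → 1 ℕ.≤ ∣ x ∣
  1≤abs x≢0 = ℕP.n≢0⇒n>0 (x≢0 ∘ ℤP.∣i∣≡0⇒i≡0)

  abs-eq : ∀ x y → ∣ x ∣ ≡ ∣ y ∣ → x ≡ y ⊎ x ≡ - y
  abs-eq x y e with ±-abs x | ±-abs y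
  ... | inj₁ h | inj₁ h′ = inj₁ (trans h (trans (cong +_ e) (sym h′)))
  ... | inj₁ h | inj₂ h′ = inj₂ (trans h (trans (cong +_ e) (trans (sym (ℤP.neg-involutive _)) (cong -_ (sym h′)))))
  ... | inj₂ h | inj₁ h′ = inj₂ (trans h (trans (cong (λ z → - + z) e) (cong -_ (sym h′))))
  ... | inj₂ h | inj₂ h′ = inj₁ (trans h (trans (cong (λ z → - + z) e) (sym h′)))

  ^-cong-∣ : ∀ {d} x y n → d ∣ℤ x - y → d ∣ℤ x ^ n - y ^ n
  ^-cong-∣ x y zero h = ∣0
  ^-cong-∣ x y (suc n) h = ∣-comb (x ^ n) y h (^-cong-∣ x y n h) (l x y (x ^ n) (y ^ n))
    where
    l : ∀ x y u v → x * u - y * v ≡ u * (x - y) + y * (u - v)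
    l = solve-∀

  exponent-difference : ∀ {p} → Prime p → ∀ {a} → ¬ + p ∣ℤ a → ∀ {d} → (∀ f → + p ∣ℤ a ^ f - + 1 → d ℕD.∣ f) →
                        ∀ x y → + p ∣ℤ a ^ x - a ^ y → + d ∣ℤ + x - + y
  exponent-difference pp nd orders zero zero h = ∣0
  exponent-difference pp nd {d} orders (suc x) zero h = subst (+ d ∣ℤ_) (sym (ℤP.+-identityʳ (+ suc x))) (ℕ-∣ {d} {+ suc x} (orders (suc x) h))
  exponent-difference pp {a} nd {d} orders zero (suc y) h = subst (+ d ∣ℤ_) (sym (ℤP.+-identityˡ (- + suc y))) (ℤD.∣m⇒∣-m {+ d} {+ suc y} (ℕ-∣ {d} {+ suc y} (orders (suc y) (∣-by (- (+ 1)) h (l (a ^ suc y))))))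
    where
    l : ∀ x → x - + 1 ≡ - (+ 1) * (+ 1 - x)
    l = solve-∀
  exponent-difference {p} pp {a} nd {d} orders (suc x) (suc y) h =
    subst (+ d ∣ℤ_) (l (+ x) (+ y)) (exponent-difference pp nd orders x y
      ([ (λ z → contradiction z nd) , id ]′ (euclid pp a (a ^ x - a ^ y) (subst (+ p ∣ℤ_) (l′ a (a ^ x) (a ^ y)) h))))
    where
    l : ∀ x y → x - y ≡ (+ 1 + x) - (+ 1 + y)
    l = solve-∀
    l′ : ∀ a x y → a * x - a * y ≡ a * (x - y)
    l′ = solve-∀

  -- The factor 2 will come from squaring away a sign. For ℓ = 2 it uses up one power of ℓ, which is
  -- why orders divisible by ℓ² are sought.
  halve : ∀ {ℓ} → Prime ℓ → ∀ x → + (ℓ ℕ.^ 2) ∣ℤ + 2 * x → + ℓ ∣ℤ x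
  halve {ℓ} pℓ x h with euclid pℓ (+ 2) x (ℤD.∣-trans (ℕ-∣ {ℓ} {+ (ℓ ℕ.^ 2)} (ℕD.m∣m*n (ℓ ℕ.* 1))) h)
  ... | inj₂ d = d
  ... | inj₁ d with prime∣prime pℓ prime[2] (∣-ℕ {ℓ} {+ 2} d)
  ...   | refl = cancel-p prime[2] h

  one-sided-factor : ∀ ℓ j₁ j₂ → j₁ ≡ 0 ⊎ j₂ ≡ 0 → + ℓ ∣ℤ + j₁ - + j₂ →
                     ∃[ j₁′ ] ∃[ j₂′ ] ((j₁′ ≡ 0 ⊎ j₂′ ≡ 0) × j₁ ≡ j₁′ ℕ.* ℓ × j₂ ≡ j₂′ ℕ.* ℓ)
  one-sided-factor ℓ j₁ j₂ (inj₁ refl) d = factor (∣-ℕ {ℓ} {x = - (+ j₂)} (subst (+ ℓ ∣ℤ_) (ℤP.+-identityˡ (- (+ j₂))) d))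
    where
    factor : ℓ ℕD.∣ ∣ - (+ j₂) ∣ → ∃[ j₁′ ] ∃[ j₂′ ] ((j₁′ ≡ 0 ⊎ j₂′ ≡ 0) × 0 ≡ j₁′ ℕ.* ℓ × j₂ ≡ j₂′ ℕ.* ℓ)
    factor (ℕD.divides j₂′ e) = 0 , j₂′ , inj₁ refl , refl , trans (sym (ℤP.∣-i∣≡∣i∣ (+ j₂))) e
  one-sided-factor ℓ j₁ j₂ (inj₂ refl) d = factor (∣-ℕ {ℓ} {x = + j₁} (subst (+ ℓ ∣ℤ_) (ℤP.+-identityʳ (+ j₁)) d))
    where
    factor : ℓ ℕD.∣ j₁ → ∃[ j₁′ ] ∃[ j₂′ ] ((j₁′ ≡ 0 ⊎ j₂′ ≡ 0) × j₁ ≡ j₁′ ℕ.* ℓ × 0 ≡ j₂′ ℕ.* ℓ)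
    factor (ℕD.divides j₁′ e) = j₁′ , 0 , inj₂ refl , e , refl

open IntegerPowers

-- From a multiplicative relation to a power of a

module RankOne (a b t : ℤ) (2≤a : 2 ℕ.≤ ∣ a ∣) (b≢0 : ¬ b ≡ + 0) (t≢0 : ¬ t ≡ + 0) (S₀ : ℕ)
               (H : ∀ p → Prime p → S₀ ℕ.< p → ∃[ m ] (+ p ∣ℤ t ℤ.* a ℤ.^ m ℤ.- b)) where
  open I using (_+_; _*_; _-_; _^_)

  a≢0 : ¬ a ≡ + 0
  a≢0 refl = contradiction 2≤a λ ()

  T₀ : ℕ
  T₀ = S₀ ℕ.+ (∣ t ∣ ℕ.+ (∣ a ∣))

  module LargePrime {p} (pp : Prime p) (T₀<p : T₀ ℕ.< p) where
    p∤t : ¬ + p ∣ℤ t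
    p∤t = ∤-< t≢0 (ℕP.≤-<-trans (ℕP.≤-trans (ℕP.m≤m+n (∣ t ∣) (∣ a ∣)) (ℕP.m≤n+m (∣ t ∣ ℕ.+ (∣ a ∣)) S₀)) T₀<p)
    p∤a : ¬ + p ∣ℤ a
    p∤a = ∤-< a≢0 (ℕP.≤-<-trans (ℕP.≤-trans (ℕP.m≤n+m (∣ a ∣) (∣ t ∣)) (ℕP.m≤n+m (∣ t ∣ ℕ.+ (∣ a ∣)) S₀)) T₀<p)
    m : ℕ
    m = proj₁ (H p pp (ℕP.≤-<-trans (ℕP.m≤m+n S₀ _) T₀<p))
    b≡ta^m : + p ∣ℤ t * a ^ m - b
    b≡ta^m = proj₂ (H p pp (ℕP.≤-<-trans (ℕP.m≤m+n S₀ _) T₀<p))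

  abs-term : ∀ x i j → ∣ x ^ i * a ^ j ∣ ≡ ∣ x ∣ ℕ.^ i ℕ.* (∣ a ∣) ℕ.^ j
  abs-term x i j = trans (ℤP.abs-* (x ^ i) (a ^ j)) (cong₂ ℕ._*_ (∣^∣ x i) (∣^∣ a j))

  -- Substituting b ≡ t a^m gives a^(m i + j₁) ≡ ± a^j₂ modulo p. Squaring removes the sign, the
  -- order of a yields ℓ² ∣ 2 (m i + j₁ - j₂), and m i drops out because ℓ ∣ i.
  divides-exponents : ∀ {ℓ} → Prime ℓ → ∀ i j₁ j₂ → ℓ ℕD.∣ i → (∣ b ∣) ℕ.^ i ℕ.* (∣ a ∣) ℕ.^ j₁ ≡ (∣ t ∣) ℕ.^ i ℕ.* (∣ a ∣) ℕ.^ j₂ →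
                      + ℓ ∣ℤ + j₁ - + j₂
  divides-exponents {ℓ} pℓ i j₁ j₂ ℓ∣i e = fromPrime (prime-power-order pℓ T₀ a 2≤a)
    where
    fromPrime : ∃[ p ] (Prime p × T₀ ℕ.< p × (∀ f → + p ∣ℤ a ^ f - + 1 → ℓ ℕ.^ 2 ℕD.∣ f)) → + ℓ ∣ℤ + j₁ - + j₂
    fromPrime (p , pp , T₀<p , orders) = ∣-comb (+ 1) (- + m) ℓ∣k (ℕ-∣ {ℓ} {+ i} ℓ∣i) (trans (l₄ (+ m) (+ i) (+ j₁) (+ j₂))
        (cong (λ z → + 1 * (z + + j₁ - + j₂) + - + m * + i) (sym (ℤP.pos-* m i))))
      where
      open LargePrime pp T₀<p
      k : ℕ
      k = m ℕ.* i ℕ.+ j₁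
      s x y : ℤ
      s = t ^ i
      x = b ^ i * a ^ j₁
      y = s * a ^ j₂
      squares : x * x ≡ y * y
      squares = [ (λ h → cong (λ z → z * z) h) , (λ h → trans (cong (λ z → z * z) h) (l y)) ]′ (abs-eq x y (trans (abs-term b i j₁) (trans e (sym (abs-term t i j₂)))))
        where
        l : ∀ y → - y * - y ≡ y * y
        l = solve-∀
      x≡ : + p ∣ℤ s * a ^ k - x
      x≡ = ∣-by (a ^ j₁) (^-cong-∣ (t * a ^ m) b i b≡ta^m)
             (trans (cong (λ z → s * z - x) (trans (ℤP.^-distribˡ-+-* a (m ℕ.* i) j₁) (cong (_* a ^ j₁) (sym (ℤP.^-*-assoc a m i)))))
               (trans (l s ((a ^ m) ^ i) (a ^ j₁) (b ^ i)) (cong (λ z → a ^ j₁ * (z - b ^ i)) (sym (^-distribʳ-*ℤ i t (a ^ m))))))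
        where
        l : ∀ s u v w → s * (u * v) - w * v ≡ v * (s * u - w)
        l = solve-∀
      p∣ : + p ∣ℤ a ^ (k ℕ.+ k) - a ^ (j₂ ℕ.+ j₂)
      p∣ = [ (λ z → contradiction z (∤-prod pp (∤-pow pp i p∤t) (∤-pow pp i p∤t))) , id ]′
             (euclid pp (s * s) _ (∣-by (s * a ^ k + x) x≡ (trans (cong (s * s *_) (cong₂ _-_ (ℤP.^-distribˡ-+-* a k k) (ℤP.^-distribˡ-+-* a j₂ j₂)))
               (trans (l s (a ^ k) (a ^ j₂)) (trans (cong (λ z → s * a ^ k * (s * a ^ k) - z) (sym squares)) (l′ (s * a ^ k) x))))))
        where
        l : ∀ s u w → s * s * (u * u - w * w) ≡ s * u * (s * u) - s * w * (s * w)
        l = solve-∀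
        l′ : ∀ u x → u * u - x * x ≡ (u + x) * (u - x)
        l′ = solve-∀
      ℓ∣k : + ℓ ∣ℤ + (m ℕ.* i) + + j₁ - + j₂
      ℓ∣k = halve pℓ (+ (m ℕ.* i) + + j₁ - + j₂) (subst (+ (ℓ ℕ.^ 2) ∣ℤ_) (l (+ (m ℕ.* i)) (+ j₁) (+ j₂)) (exponent-difference pp p∤a orders (k ℕ.+ k) (j₂ ℕ.+ j₂) p∣))
        where
        l : ∀ m j j′ → m + j + (m + j) - (j′ + j′) ≡ + 2 * (m + j - j′)
        l = solve-∀
      l₄ : ∀ m i j j′ → j - j′ ≡ + 1 * (m * i + j - j′) + - m * i
      l₄ = solve-∀

  Dependence : ℕ → Set
  Dependence i = ∃[ j₁ ] ∃[ j₂ ] ((j₁ ≡ 0 ⊎ j₂ ≡ 0) × (∣ b ∣) ℕ.^ i ℕ.* (∣ a ∣) ℕ.^ j₁ ≡ (∣ t ∣) ℕ.^ i ℕ.* (∣ a ∣) ℕ.^ j₂)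

  extract-root : ∀ {ℓ} → Prime ℓ → ∀ i → Dependence (i ℕ.* ℓ) → Dependence i
  extract-root {ℓ} pℓ i (j₁ , j₂ , h , e) = root (one-sided-factor ℓ j₁ j₂ h (divides-exponents pℓ (i ℕ.* ℓ) j₁ j₂ (ℕD.divides i refl) e))
    where
    power : ∀ x j j′ → j ≡ j′ ℕ.* ℓ → (x ℕ.^ i ℕ.* (∣ a ∣) ℕ.^ j′) ℕ.^ ℓ ≡ x ℕ.^ (i ℕ.* ℓ) ℕ.* (∣ a ∣) ℕ.^ j
    power x j j′ refl = trans (^-distribʳ-* ℓ (x ℕ.^ i) ((∣ a ∣) ℕ.^ j′)) (cong₂ ℕ._*_ (ℕP.^-*-assoc x i ℓ) (ℕP.^-*-assoc ∣ a ∣ j′ ℓ))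
    root : ∃[ j₁′ ] ∃[ j₂′ ] ((j₁′ ≡ 0 ⊎ j₂′ ≡ 0) × j₁ ≡ j₁′ ℕ.* ℓ × j₂ ≡ j₂′ ℕ.* ℓ) → Dependence i
    root (j₁′ , j₂′ , h′ , e₁ , e₂) = j₁′ , j₂′ , h′ ,
      ^-injectiveˡ ℓ (ℕP.<⇒≤ (prime>1 pℓ)) (trans (power ∣ b ∣ j₁ j₁′ e₁) (trans e (sym (power ∣ t ∣ j₂ j₂′ e₂))))

  extract-all-roots : ∀ fuel i → i ℕ.≤ fuel → 1 ℕ.≤ i → Dependence i → Dependence 1
  extract-all-roots zero i i≤ 1≤i _ = contradiction (ℕP.≤-trans 1≤i i≤) λ ()
  extract-all-roots (suc fuel) i i≤ 1≤i D with i ℕ.≟ 1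
  ... | yes i≡1 = subst Dependence i≡1 D
  ... | no i≢1 with primeDivisor i (ℕP.≤∧≢⇒< 1≤i (i≢1 ∘ sym))
  ...   | ℓ , pℓ , ℕD.divides i′ e = extract-all-roots fuel i′
            (ℕP.≤-pred (ℕP.<-≤-trans (ℕP.m<m*n i′ ℓ {{ℕ.>-nonZero 1≤i′}} (prime>1 pℓ)) (subst (ℕ._≤ suc fuel) e i≤))) 1≤i′
            (extract-root pℓ i′ (subst Dependence e D))
    where
    1≤i′ : 1 ℕ.≤ i′
    1≤i′ = ℕP.n≢0⇒n>0 λ z → contradiction (trans e (cong (ℕ._* ℓ) z)) (ℕP.<⇒≢ 1≤i ∘ sym)

  -- Modulo a prime at which a has odd order, −1 is not a power of a.
  sign : ∀ k₁ k₂ → ¬ b * a ^ k₁ ≡ - (t * a ^ k₂)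
  sign k₁ k₂ e = fromPrime (odd-order (T₀ ℕ.+ 2) a 2≤a)
    where
    fromPrime : ¬ (∃[ p ] (Prime p × T₀ ℕ.+ 2 ℕ.< p × ∃[ r ] (+ p ∣ℤ a ^ suc (r ℕ.+ r) - + 1)))
    fromPrime (p , pp , lt , r , one) = ∤-< {p} {+ 2} (λ ()) (ℕP.≤-<-trans (ℕP.m≤n+m 2 T₀) lt)
        (∣-comb (- (+ 1)) (+ 1) (pow1 x) (∣-comb (- (+ 1)) (+ 1) (pow1 y) sum (l₂ (w ^ O) (u ^ O))) (l₃ (u ^ O)))
      where
      open LargePrime pp (ℕP.≤-<-trans (ℕP.m≤m+n T₀ 2) lt)
      O x y : ℕ
      O = suc (r ℕ.+ r)
      x = m ℕ.+ k₁
      y = k₂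
      u w : ℤ
      u = a ^ x
      w = a ^ y
      pow1 : ∀ n → + p ∣ℤ (a ^ n) ^ O - + 1
      pow1 n = subst (λ z → + p ∣ℤ z - + 1) (trans (cong (a ^_) (ℕP.*-comm O n)) (sym (ℤP.^-*-assoc a n O))) (pow-cong1-* a O n one)
      u≡-w : + p ∣ℤ u - - w
      u≡-w = [ (λ z → contradiction z p∤t) , id ]′ (euclid pp t (u - - w)
        (∣-by (a ^ k₁) b≡ta^m (trans (cong (λ z → t * (z - - w)) (ℤP.^-distribˡ-+-* a m k₁)) (trans (l t (a ^ m) (a ^ k₁) w)
          (trans (cong (λ z → t * a ^ m * a ^ k₁ - z) (sym e)) (l′ (t * a ^ m) (a ^ k₁) b))))))
        where
        l : ∀ t m k w → t * (m * k - - w) ≡ t * m * k - - (t * w)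
        l = solve-∀
        l′ : ∀ u k b → u * k - b * k ≡ k * (u - b)
        l′ = solve-∀
      odd-neg : ∀ w r → (- w) ^ suc (r ℕ.+ r) ≡ - (w ^ suc (r ℕ.+ r))
      odd-neg w zero = l w
        where
        l : ∀ w → - w * + 1 ≡ - (w * + 1)
        l = solve-∀
      odd-neg w (suc r) = subst (λ n → (- w) ^ suc n ≡ - (w ^ suc n)) (sym (cong suc (ℕP.+-suc r r)))
          (trans (cong (λ z → - w * (- w * z)) (odd-neg w r)) (l w (w ^ suc (r ℕ.+ r))))
        where
        l : ∀ w v → - w * (- w * - v) ≡ - (w * (w * v))
        l = solve-∀
      sum : + p ∣ℤ u ^ O + w ^ O
      sum = subst (+ p ∣ℤ_) (trans (cong (λ z → u ^ O - z) (odd-neg w r)) (l (u ^ O) (w ^ O))) (^-cong-∣ u (- w) O u≡-w)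
        where
        l : ∀ u w → u - - w ≡ u + w
        l = solve-∀
      l₂ : ∀ w u → u + + 1 ≡ - (+ 1) * (w - + 1) + + 1 * (u + w)
      l₂ = solve-∀
      l₃ : ∀ u → + 2 ≡ - (+ 1) * (u - + 1) + + 1 * (u + + 1)
      l₃ = solve-∀

  power-ratio : ¬ ¬ (∃[ k ] (b ≡ t * a ^ k ⊎ t ≡ b * a ^ k))
  power-ratio k = multiplicative-dependence (∣ a ∣) (∣ b ∣) (∣ t ∣) 2≤a (1≤abs b≢0) (1≤abs t≢0) (GlobalRelation.relation a b t a≢0 b≢0 t≢0 S₀ H)
      λ (i , j₁ , j₂ , 1≤i , e) → k (conclude (extract-all-roots i i ℕP.≤-refl 1≤i (one-sided (∣ a ∣) ((∣ b ∣) ℕ.^ i) ((∣ t ∣) ℕ.^ i) (1≤abs a≢0) j₁ j₂ e)))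
    where
    abs : ∀ x k → ∣ x * a ^ k ∣ ≡ (∣ x ∣) ℕ.^ 1 ℕ.* (∣ a ∣) ℕ.^ k
    abs x k = trans (ℤP.abs-* x (a ^ k)) (cong₂ ℕ._*_ (sym (ℕP.*-identityʳ ∣ x ∣)) (∣^∣ a k))
    oneSided : ∀ k₁ k₂ → k₁ ≡ 0 ⊎ k₂ ≡ 0 → b * a ^ k₁ ≡ t * a ^ k₂ → ∃[ k ] (b ≡ t * a ^ k ⊎ t ≡ b * a ^ k)
    oneSided k₁ k₂ (inj₁ refl) eq = k₂ , inj₁ (trans (sym (ℤP.*-identityʳ b)) eq)
    oneSided k₁ k₂ (inj₂ refl) eq = k₁ , inj₂ (trans (sym (ℤP.*-identityʳ t)) (sym eq))
    conclude : Dependence 1 → ∃[ k ] (b ≡ t * a ^ k ⊎ t ≡ b * a ^ k)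
    conclude (k₁ , k₂ , h , e) = oneSided k₁ k₂ h
      ([ id , (λ z → contradiction z (sign k₁ k₂)) ]′ (abs-eq (b * a ^ k₁) (t * a ^ k₂) (trans (abs b k₁) (trans e (sym (abs t k₂))))))

-- Orbits of linear polynomials and the resulting equations

module Iterates (a b : ℤ) where
  open I using (_+_; _*_; _-_; _^_)

  t : ℤ
  t = a + b - + 1

  orbit : ℕ → ℤ
  orbit m = iter (lin a b) m (+ 1)

  orbit-geo : ∀ m → orbit m ≡ + 1 + t * geo a m
  orbit-geo zero = sym (cong (λ z → + 1 + z) (ℤP.*-zeroʳ t))
  orbit-geo (suc m) = trans (cong (λ z → a * z + b) (orbit-geo m)) (l a b (geo a m))
    where
    l : ∀ a b g → a * (+ 1 + (a + b - + 1) * g) + b ≡ + 1 + (a + b - + 1) * (+ 1 + a * g)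
    l = solve-∀

  orbit-power : ∀ m → (a - + 1) * orbit m ≡ t * a ^ m - b
  orbit-power m = trans (cong ((a - + 1) *_) (orbit-geo m)) (trans (l a b (geo a m)) (trans (cong (λ z → t * (z + + 1) - b) (geo-≡ a m)) (l′ t b (a ^ m))))
    where
    l : ∀ a b g → (a - + 1) * (+ 1 + (a + b - + 1) * g) ≡ (a + b - + 1) * ((a - + 1) * g + + 1) - b
    l = solve-∀
    l′ : ∀ t b y → t * (y - + 1 + + 1) - b ≡ t * y - b
    l′ = solve-∀

module PrimeProducts where
  open Nat using (_*_; _+_; _^_)

  ∈A? : ∀ p {k} (q : Fin k → ℕ) → Dec (p ∈A q)
  ∈A? p q = FinP.any? λ i → q i ℕ.≟ p

  family-bound : ∀ {k} (q : Fin k → ℕ) → ∃[ S ] (∀ i → q i ℕ.≤ S)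
  family-bound {zero} q = 0 , λ ()
  family-bound {suc k} q with family-bound (λ i → q (suc i))
  ... | S , h = q zero + S , λ { zero → ℕP.m≤m+n (q zero) S ; (suc i) → ℕP.≤-trans (h i) (ℕP.m≤n+m S (q zero)) }

  prodPow-prime : ∀ {k} (q : Fin k → ℕ) → (∀ i → Prime (q i)) → ∀ s {p} → Prime p → p ℕD.∣ prodPow q s → p ∈A q
  prodPow-prime {zero} q pq s pp d = contradiction (subst Prime (ℕD.∣1⇒≡1 d) pp) ¬prime[1]
  prodPow-prime {suc k} q pq s pp d with euclidsLemma (q zero ^ s zero) (prodPow (λ i → q (suc i)) (λ i → s (suc i))) pp d
  ... | inj₁ d₀ = zero , sym (prime∣prime pp (pq zero) (∣-pow⁻ℕ pp (s zero) d₀))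
  ... | inj₂ d₁ with prodPow-prime (λ i → q (suc i)) (λ i → pq (suc i)) (λ i → s (suc i)) pp d₁
  ...   | i , e = suc i , e

  prodPow-surjective : ∀ {k} (q : Fin k → ℕ) → (∀ i → Prime (q i)) → ∀ n → 1 ℕ.≤ n → (∀ p → Prime p → p ℕD.∣ n → p ∈A q) → ∃[ s ] (n ≡ prodPow q s)
  prodPow-surjective {zero} q pq n 1≤n h with n ℕ.≟ 1
  ... | yes e = (λ ()) , e
  ... | no n≢1 with primeDivisor n (ℕP.≤∧≢⇒< 1≤n (n≢1 ∘ sym))
  ...   | p , pp , p∣n with h p pp p∣n
  ...     | () , _
  prodPow-surjective {suc k} q pq n 1≤n h with Valuation.val-exists (pq zero) n 1≤n
  ... | v , Valuation.val n′ e q₀∤n′ with prodPow-surjective (λ i → q (suc i)) (λ i → pq (suc i)) n′ (ℕP.n≢0⇒n>0 λ { refl → q₀∤n′ (q zero ℕD.∣0) })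
        (λ p pp d → tail pp d (h p pp (ℕD.∣-trans d (ℕD.divides (q zero ^ v) e))))
    where
    tail : ∀ {p} → Prime p → p ℕD.∣ n′ → p ∈A q → p ∈A (λ i → q (suc i))
    tail pp d (zero , refl) = contradiction d q₀∤n′
    tail pp d (suc i , e) = i , e
  ...   | s , e′ = (λ { zero → v ; (suc i) → s i }) , trans e (cong (q zero ^ v *_) e′)

  prodPow-trivial : ∀ {k} (q s : Fin k → ℕ) → sumFin s ≡ 0 → prodPow q s ≡ 1
  prodPow-trivial {zero} q s e = refl
  prodPow-trivial {suc k} q s e = cong₂ _*_ (cong (q zero ^_) (ℕP.m+n≡0⇒m≡0 (s zero) e)) (prodPow-trivial (λ i → q (suc i)) (λ i → s (suc i)) (ℕP.m+n≡0⇒n≡0 (s zero) e))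

open PrimeProducts

module Units where
  open I using (_+_; _*_; _-_; _^_)

  abs-one : ∀ x → ∣ x ∣ ≡ 1 → x ≡ + 1 ⊎ x ≡ - (+ 1)
  abs-one x e = [ (λ h → inj₁ (trans h (cong +_ e))) , (λ h → inj₂ (trans h (cong (λ n → - (+ n)) e))) ]′ (±-abs x)

  factors-of-unit : ∀ x y {u} → ∣ u ∣ ≡ 1 → x * y ≡ u → (x ≡ + 1 × y ≡ u) ⊎ (x ≡ - (+ 1) × y ≡ - u)
  factors-of-unit x y {u} h e with abs-one x (ℕP.m*n≡1⇒m≡1 ∣ x ∣ ∣ y ∣ (trans (sym (ℤP.abs-* x y)) (trans (cong ∣_∣ e) h)))
  ... | inj₁ refl = inj₁ (refl , trans (sym (ℤP.*-identityˡ y)) e)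
  ... | inj₂ refl = inj₂ (refl , trans (l y) (cong -_ e))
    where
    l : ∀ y → y ≡ - (- (+ 1) * y)
    l = solve-∀

  -- Removing the first term gives a · geo a (k - 1) = -2, hence |a| = 2; for a = 2 the sum is not
  -- negative.
  geo≡-1 : ∀ a k → 2 ℕ.≤ ∣ a ∣ → geo a k ≡ - (+ 1) → a ≡ - (+ 2)
  geo≡-1 a (suc k) 2≤a e = cases (±-abs a)
    where
    product≡ : a * geo a k ≡ - (+ 2)
    product≡ = trans (l (a * geo a k)) (cong (λ z → z - + 1) e)
      where
      l : ∀ x → x ≡ + 1 + x - + 1
      l = solve-∀
    abs≡2 : ∣ a ∣ ≡ 2
    abs≡2 = ℕP.≤-antisym (ℕD.∣⇒≤ (ℕD.divides (∣ geo a k ∣) (trans (sym (cong ∣_∣ product≡)) (trans (ℤP.abs-* a (geo a k)) (ℕP.*-comm ∣ a ∣ ∣ geo a k ∣))))) 2≤a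
    positive : ∃[ g ] (geo (+ 2) k ≡ + g × k ℕ.≤ g × (2 ℕ.≤ k → k ℕ.< g)) → ¬ + 2 * geo (+ 2) k ≡ - (+ 2)
    positive (g , h , _) e′ with trans (ℤP.pos-* 2 g) (trans (cong (+ 2 *_) (sym h)) e′)
    ... | ()
    cases : a ≡ + ∣ a ∣ ⊎ a ≡ - + ∣ a ∣ → a ≡ - (+ 2)
    cases (inj₂ h) = trans h (cong (λ n → - (+ n)) abs≡2)
    cases (inj₁ h) = contradiction (subst (λ x → x * geo x k ≡ - (+ 2)) (trans h (cong +_ abs≡2)) product≡) (positive (geo-pos 2 k ℕP.≤-refl))

  -- t = b a^k forces b (1 + a + ⋯ + a^(k-1)) = 1, and b = t a^k forces t (1 + a + ⋯ + a^(k-1)) = -1.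
  exponential-equation : ∀ a b k → 2 ℕ.≤ ∣ a ∣ → b ≡ (a + b - + 1) * a ^ k ⊎ a + b - + 1 ≡ b * a ^ k →
                         b ≡ - a ⊎ b ≡ + 1 ⊎ (a ≡ - (+ 2) × b ≡ - (+ 1)) ⊎ (a ≡ - (+ 2) × b ≡ + 4)
  exponential-equation a b k 2≤a = [ forT , forB ]′
    where
    a-1≢0 : ¬ a - + 1 ≡ + 0
    a-1≢0 e = contradiction (subst (λ x → 2 ℕ.≤ ∣ x ∣) (trans (l a) (cong (λ z → z + + 1) e)) 2≤a) λ { (s≤s ()) }
      where
      l : ∀ a → a ≡ a - + 1 + + 1
      l = solve-∀
    zero-factor : ∀ x → (a - + 1) * x ≡ + 0 → x ≡ + 0
    zero-factor x e = [ (λ h → contradiction h a-1≢0) , id ]′ (ℤP.i*j≡0⇒i≡0∨j≡0 (a - + 1) e)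
    t g : ℤ
    t = a + b - + 1
    g = geo a k
    b≡ : b ≡ t + + 1 - a
    b≡ = l a b
      where
      l : ∀ a b → b ≡ a + b - + 1 + + 1 - a
      l = solve-∀
    forT : b ≡ t * a ^ k → _
    forT e = [ (λ (t≡1 , g≡-1) → inj₂ (inj₂ (inj₂ (geo≡-1 a k 2≤a g≡-1 , trans b≡ (cong₂ (λ u v → u + + 1 - v) t≡1 (geo≡-1 a k 2≤a g≡-1))))))
             , (λ (t≡-1 , _) → inj₁ (trans b≡ (trans (cong (λ u → u + + 1 - a) t≡-1) (ℤP.+-identityˡ (- a))))) ]′ (factors-of-unit t g refl tg≡-1)
      where
      l : ∀ a b g → (a - + 1) * ((a + b - + 1) * g + + 1) ≡ (a + b - + 1) * ((a - + 1) * g) + (a - + 1)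
      l = solve-∀
      l′ : ∀ a b y → (a + b - + 1) * (y - + 1) + (a - + 1) ≡ (a + b - + 1) * y - b
      l′ = solve-∀
      l″ : ∀ x → x ≡ x + + 1 - + 1
      l″ = solve-∀
      tg≡-1 : t * g ≡ - (+ 1)
      tg≡-1 = trans (l″ (t * g)) (cong (λ z → z - + 1) (zero-factor (t * g + + 1) (trans (l a b g) (trans (cong (λ z → t * z + (a - + 1)) (geo-≡ a k))
        (trans (l′ a b (a ^ k)) (trans (cong (λ z → z - b) (sym e)) (ℤP.+-inverseʳ b)))))))
    forB : t ≡ b * a ^ k → _
    forB e = [ (λ (b≡1 , _) → inj₂ (inj₁ b≡1)) , (λ (b≡-1 , g≡-1) → inj₂ (inj₂ (inj₁ (geo≡-1 a k 2≤a g≡-1 , b≡-1)))) ]′ (factors-of-unit b g refl bg≡1)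
      where
      l : ∀ a b g → (a - + 1) * (b * g - + 1) ≡ b * ((a - + 1) * g) - (a - + 1)
      l = solve-∀
      l′ : ∀ a b y → b * (y - + 1) - (a - + 1) ≡ b * y - (a + b - + 1)
      l′ = solve-∀
      l″ : ∀ x → x ≡ x - + 1 + + 1
      l″ = solve-∀
      bg≡1 : b * g ≡ + 1
      bg≡1 = trans (l″ (b * g)) (cong (λ z → z + + 1) (zero-factor (b * g - + 1) (trans (l a b g) (trans (cong (λ z → b * z - (a - + 1)) (geo-≡ a k))
        (trans (l′ a b (a ^ k)) (trans (cong (λ z → z - t) (sym e)) (ℤP.+-inverseʳ t)))))))

-- Necessity of the five forms

module Necessity {k : ℕ} (q : Fin k → ℕ) (pq : ∀ i → Prime (q i)) (a b : ℤ) (a≢0 : ¬ a ≡ + 0) (nil : WLN (lin a b) (+ 1) q) where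
  open I using (_+_; _*_; _-_; _^_)
  open Iterates a b

  nilpotent : ∀ p → Prime p → ¬ p ∈A q → ∃[ m ] (+ p ∣ℤ + 1 + t * geo a m)
  nilpotent p pp p∉A with nil p pp p∉A
  ... | m , _ , d = m , subst (+ p ∣ℤ_) (orbit-geo m) (ℕ-∣ d)

  S₀ : ℕ
  S₀ = proj₁ (family-bound q)

  large∉A : ∀ {p} → S₀ ℕ.< p → ¬ p ∈A q
  large∉A lt (i , refl) = ℕP.<⇒≱ lt (proj₂ (family-bound q) i)

  -- Modulo a prime dividing t every iterate equals 1 and never vanishes.
  divisor∈A : ∀ p → Prime p → + p ∣ℤ t → p ∈A q
  divisor∈A p pp p∣t = decidable-stable (∈A? p q) λ p∉A → let m , d = nilpotent p pp p∉A in
    p∤1 pp (∣-comb (+ 1) (- geo a m) d p∣t (l t (geo a m)))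
    where
    l : ∀ t g → + 1 ≡ + 1 * (+ 1 + t * g) + - g * t
    l = solve-∀

  t≢0 : ¬ t ≡ + 0
  t≢0 t≡0 with primeAbove S₀
  ... | p , pp , lt = large∉A lt (divisor∈A p pp (subst (+ p ∣ℤ_) (sym t≡0) ∣0))

  ±prodPow : ∀ x → x ≡ t → ∃[ s ] (x ≡ + prodPow q s ⊎ x ≡ - (+ prodPow q s))
  ±prodPow x refl = signed (prodPow-surjective q pq (∣ t ∣) (ℕP.n≢0⇒n>0 (t≢0 ∘ ℤP.∣i∣≡0⇒i≡0)) (λ p pp d → divisor∈A p pp (ℕ-∣ {p} {t} d)))
    where
    signed : ∃[ s ] (∣ t ∣ ≡ prodPow q s) → ∃[ s ] (t ≡ + prodPow q s ⊎ t ≡ - (+ prodPow q s))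
    signed (s , e) = s , [ (λ h → inj₁ (trans h (cong +_ e))) , (λ h → inj₂ (trans h (cong (λ n → - (+ n)) e))) ]′ (±-abs t)

  Forms : Set
  Forms = (a ≡ + 1 × ∃[ s ] (b ≡ + prodPow q s ⊎ b ≡ - (+ prodPow q s)))
          ⊎ (b ≡ - a)
          ⊎ (b ≡ + 1 × ∃[ s ] (1 ℕ.≤ sumFin s × (a ≡ + prodPow q s ⊎ a ≡ - (+ prodPow q s))))
          ⊎ (a ≡ - (+ 2) × b ≡ - (+ 1) × 2 ∈A q)
          ⊎ (a ≡ - (+ 2) × b ≡ + 4)

  translation : a ≡ + 1 → Forms
  translation a≡1 = inj₁ (a≡1 , ±prodPow b (trans (l b) (cong (λ z → z + b - + 1) (sym a≡1))))
    where
    l : ∀ b → b ≡ + 1 + b - + 1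
    l = solve-∀

  -- For a = -1 the orbit alternates between 1 and b - 1, so a prime larger than |b - 1| forces b =
  -- 1.
  reflection : a ≡ - (+ 1) → b ≡ - a
  reflection a≡-1 with primeAbove (S₀ ℕ.+ (∣ b - + 1 ∣))
  ... | p , pp , lt with nilpotent p pp (large∉A (ℕP.≤-<-trans (ℕP.m≤m+n S₀ _) lt))
  ...   | m , d = trans (ℤP.i-j≡0⇒i≡j b (+ 1) (decidable-stable (b - + 1 ℤ.≟ + 0) λ ne → ∤-< ne (ℕP.≤-<-trans (ℕP.m≤n+m (∣ b - + 1 ∣) S₀) lt) p∣b-1)) (sym (cong -_ a≡-1))
    where
    geo-alternates : ∀ m → geo (- (+ 1)) m ≡ + 0 ⊎ geo (- (+ 1)) m ≡ + 1
    geo-alternates zero = inj₁ refl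
    geo-alternates (suc m) = [ (λ h → inj₂ (cong (λ z → + 1 + - (+ 1) * z) h)) , (λ h → inj₁ (cong (λ z → + 1 + - (+ 1) * z) h)) ]′ (geo-alternates m)
    d′ : + p ∣ℤ + 1 + (- (+ 1) + b - + 1) * geo (- (+ 1)) m
    d′ = subst (λ x → + p ∣ℤ + 1 + (x + b - + 1) * geo x m) a≡-1 d
    p∣b-1 : + p ∣ℤ b - + 1
    p∣b-1 = [ (λ h → contradiction (subst (+ p ∣ℤ_) (trans (cong (λ z → + 1 + (- (+ 1) + b - + 1) * z) h) (l₀ b)) d′) (p∤1 pp))
            , (λ h → subst (+ p ∣ℤ_) (trans (cong (λ z → + 1 + (- (+ 1) + b - + 1) * z) h) (l₁ b)) d′) ]′ (geo-alternates m)
      where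
      l₀ : ∀ b → + 1 + (- (+ 1) + b - + 1) * + 0 ≡ + 1
      l₀ = solve-∀
      l₁ : ∀ b → + 1 + (- (+ 1) + b - + 1) * + 1 ≡ b - + 1
      l₁ = solve-∀

  module Expanding (2≤a : 2 ℕ.≤ ∣ a ∣) where
    hypothesis : ∀ p → Prime p → S₀ ℕ.< p → ∃[ m ] (+ p ∣ℤ t * a ^ m - b)
    hypothesis p pp lt with nilpotent p pp (large∉A lt)
    ... | m , d = m , subst (+ p ∣ℤ_) (trans (cong ((a - + 1) *_) (sym (orbit-geo m))) (orbit-power m)) (∣*ˡ (a - + 1) d)

    b≢0 : ¬ b ≡ + 0
    b≢0 b≡0 = fromPrime (primeAbove (S₀ ℕ.+ ((∣ t ∣) ℕ.+ (∣ a ∣))))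
      where
      fromPrime : ¬ (∃[ p ] (Prime p × S₀ ℕ.+ ((∣ t ∣) ℕ.+ (∣ a ∣)) ℕ.< p))
      fromPrime (p , pp , lt) = fromOrbit (hypothesis p pp (ℕP.≤-<-trans (ℕP.m≤m+n S₀ _) lt))
        where
        p∤t : ¬ + p ∣ℤ t
        p∤t = ∤-< t≢0 (ℕP.≤-<-trans (ℕP.≤-trans (ℕP.m≤m+n (∣ t ∣) (∣ a ∣)) (ℕP.m≤n+m ((∣ t ∣) ℕ.+ (∣ a ∣)) S₀)) lt)
        p∤a : ¬ + p ∣ℤ a
        p∤a = ∤-< a≢0 (ℕP.≤-<-trans (ℕP.≤-trans (ℕP.m≤n+m (∣ a ∣) (∣ t ∣)) (ℕP.m≤n+m ((∣ t ∣) ℕ.+ (∣ a ∣)) S₀)) lt)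
        fromOrbit : ¬ (∃[ m ] (+ p ∣ℤ t * a ^ m - b))
        fromOrbit (m , d) = ∤-prod pp p∤t (∤-pow pp m p∤a) (subst (+ p ∣ℤ_) (trans (cong (λ z → t * a ^ m - z) b≡0) (ℤP.+-identityʳ (t * a ^ m))) d)

    -- The alternatives are equalities of integers and thus decidable, which removes the double
    -- negation carried along so far.
    classified : b ≡ - a ⊎ b ≡ + 1 ⊎ (a ≡ - (+ 2) × b ≡ - (+ 1)) ⊎ (a ≡ - (+ 2) × b ≡ + 4)
    classified = decidable-stable
      ((b ℤ.≟ - a) ⊎-dec ((b ℤ.≟ + 1) ⊎-dec (((a ℤ.≟ - (+ 2)) ×-dec (b ℤ.≟ - (+ 1))) ⊎-dec ((a ℤ.≟ - (+ 2)) ×-dec (b ℤ.≟ + 4)))))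
      λ no → RankOne.power-ratio a b t 2≤a b≢0 t≢0 S₀ hypothesis λ (n , h) → no (Units.exponential-equation a b n 2≤a h)

    unit-translation : b ≡ + 1 → Forms
    unit-translation b≡1 with ±prodPow a (trans (l a) (cong (λ z → a + z - + 1) (sym b≡1)))
      where
      l : ∀ a → a ≡ a + + 1 - + 1
      l = solve-∀
    -- All exponents zero would mean a = ±1, against |a| ≥ 2.
    ... | s , h = inj₂ (inj₂ (inj₁ (b≡1 , s , ℕP.n≢0⇒n>0 (λ e → ℕP.<-irrefl (trans (sym (prodPow-trivial q s e)) (sym (size h))) 2≤a) , h)))
      where
      size : a ≡ + prodPow q s ⊎ a ≡ - (+ prodPow q s) → ∣ a ∣ ≡ prodPow q s
      size (inj₁ e) = cong ∣_∣ e
      size (inj₂ e) = trans (cong ∣_∣ e) (ℤP.∣-i∣≡∣i∣ (+ prodPow q s))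

    forms : Forms
    forms = cases classified
      where
      cases : b ≡ - a ⊎ b ≡ + 1 ⊎ (a ≡ - (+ 2) × b ≡ - (+ 1)) ⊎ (a ≡ - (+ 2) × b ≡ + 4) → Forms
      cases (inj₁ h) = inj₂ (inj₁ h)
      cases (inj₂ (inj₁ h)) = unit-translation h
      cases (inj₂ (inj₂ (inj₁ (h , h′)))) = inj₂ (inj₂ (inj₂ (inj₁ (h , h′ , divisor∈A 2 prime[2]
        (subst (+ 2 ∣ℤ_) (sym (cong₂ (λ x y → x + y - + 1) h h′)) (divides (- (+ 2)) refl))))))
      cases (inj₂ (inj₂ (inj₂ h))) = inj₂ (inj₂ (inj₂ (inj₂ h)))

  forms : Forms
  forms with ∣ a ∣ ℕ.≟ 1
  ... | yes e = [ translation , (λ h → inj₂ (inj₁ (reflection h))) ]′ (Units.abs-one a e)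
  ... | no ne = Expanding.forms (ℕP.≤∧≢⇒< (ℕP.n≢0⇒n>0 (a≢0 ∘ ℤP.∣i∣≡0⇒i≡0)) (ne ∘ sym))

-- Sufficiency of the five forms

module Sufficiency {k : ℕ} (q : Fin k → ℕ) (pq : ∀ i → Prime (q i)) (a b : ℤ) where
  open I using (_+_; _*_; _-_; _^_)
  open Iterates a b

  ∤±prodPow : ∀ {p x} → Prime p → ¬ p ∈A q → ∀ s → x ≡ + prodPow q s ⊎ x ≡ - (+ prodPow q s) → ¬ + p ∣ℤ x
  ∤±prodPow pp p∉A s (inj₁ refl) d = p∉A (prodPow-prime q pq s pp (∣-ℕ d))
  ∤±prodPow {p} pp p∉A s (inj₂ refl) d = p∉A (prodPow-prime q pq s pp (subst (p ℕD.∣_) (ℤP.∣-i∣≡∣i∣ (+ prodPow q s)) (∣-ℕ {p} {x = - (+ prodPow q s)} d)))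

  reached : ∀ {p} m → + p ∣ℤ + 1 + t * geo a (suc m) → ∃[ m ] (1 ℕ.≤ m × p ℕD.∣ ∣ orbit m ∣)
  reached {p} m d = suc m , s≤s z≤n , ∣-ℕ (subst (+ p ∣ℤ_) (sym (orbit-geo (suc m))) d)

  -- The sum vanishes at multiples of p if a ≡ 1 and at multiples of an exponent e with a^e ≡ 1
  -- otherwise. Arbitrarily late zeros are needed since some first terms are split off later.
  vanishing-sum : ∀ {p} → Prime p → ¬ + p ∣ℤ a → ∀ r → ∃[ n ] (+ p ∣ℤ geo a (suc (r ℕ.+ n)))
  vanishing-sum {p} pp p∤a r with + p ℤD.∣? a - + 1
  ... | yes d = proj₁ large , subst (λ n → + p ∣ℤ geo a n) (proj₂ large) (∣-comb (+ 1) (+ 1) (geo-cong1 a (suc r ℕ.* p) d) (ℕ-∣ {p} {+ (suc r ℕ.* p)} (ℕD.divides (suc r) refl)) (l (geo a (suc r ℕ.* p)) (+ (suc r ℕ.* p))))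
    where
    l : ∀ g n → g ≡ + 1 * (g - n) + + 1 * n
    l = solve-∀
    large : ∃[ n ] (suc r ℕ.* p ≡ suc (r ℕ.+ n))
    large = suc r ℕ.* p ℕ.∸ suc r , sym (ℕP.m+[n∸m]≡n {suc r} (ℕP.m≤m*n (suc r) p {{prime⇒nonZero pp}}))
  ... | no nd with prime-order pp a p∤a
  ...   | e , 1≤e , _ , h = proj₁ large , subst (λ n → + p ∣ℤ geo a n) (proj₂ large)
            ([ (λ z → contradiction z nd) , id ]′ (euclid pp (a - + 1) (geo a (e ℕ.* suc r)) (subst (+ p ∣ℤ_) (sym (geo-≡ a (e ℕ.* suc r))) (pow-cong1-* a e (suc r) h))))
    where
    large : ∃[ n ] (e ℕ.* suc r ≡ suc (r ℕ.+ n))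
    large = e ℕ.* suc r ℕ.∸ suc r , sym (ℕP.m+[n∸m]≡n {suc r} (ℕP.m≤n*m (suc r) e {{ℕ.>-nonZero 1≤e}}))

  translation : a ≡ + 1 → ∃[ s ] (b ≡ + prodPow q s ⊎ b ≡ - (+ prodPow q s)) → WLN (lin a b) (+ 1) q
  translation refl (s , h) p pp p∉A with inverse pp b (∤±prodPow pp p∉A s h)
  ... | y , d = reached m′ (∣-comb (+ 1) b d p∣ (trans (cong (λ z → + 1 + (+ 1 + b - + 1) * z) (geo-one (suc m′))) (l b y (+ suc m′))))
    where
    instance
      p≢0 : ℕ.NonZero p
      p≢0 = prime⇒nonZero pp
    r = (- y) ℤDM.%ℕ p
    -- The number of steps is r + p rather than r, to be positive; `m′` is its predecessor.
    m′ = r ℕ.+ ℕ.pred p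
    geo-one : ∀ n → geo (+ 1) n ≡ + n
    geo-one zero = refl
    geo-one (suc n) = cong (λ z → + 1 + z) (trans (ℤP.*-identityˡ _) (geo-one n))
    p∣ : + p ∣ℤ y + + suc m′
    p∣ = divides (+ 1 - (- y) ℤDM./ℕ p) (trans (cong (λ n → y + + n) (trans (sym (ℕP.+-suc r (ℕ.pred p))) (cong (r ℕ.+_) (ℕP.suc-pred p))))
           (trans (l′ y (+ r) (+ p)) (trans (cong (λ z → - z + + r + + p) (ℤDM.a≡a%ℕn+[a/ℕn]*n (- y) p)) (l″ (+ r) ((- y) ℤDM./ℕ p) (+ p)))))
      where
      l′ : ∀ y r p → y + (r + p) ≡ - (- y) + r + p
      l′ = solve-∀
      l″ : ∀ r k p → - (r + k * p) + r + p ≡ (+ 1 - k) * p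
      l″ = solve-∀
    l : ∀ b y m → + 1 + (+ 1 + b - + 1) * m ≡ + 1 * (+ 1 - b * y) + b * (y + m)
    l = solve-∀

  fixes-root : b ≡ - a → WLN (lin a b) (+ 1) q
  fixes-root refl p pp _ = 1 , s≤s z≤n , ∣-ℕ {p} (subst (+ p ∣ℤ_) (l a) ∣0)
    where
    l : ∀ a → + 0 ≡ a * + 1 + - a
    l = solve-∀

  -- Here t = a, so the orbit 1 + a (1 + a + ⋯) is itself a geometric sum with one more term.
  unit-translation : b ≡ + 1 → ∃[ s ] (a ≡ + prodPow q s ⊎ a ≡ - (+ prodPow q s)) → WLN (lin a b) (+ 1) q
  unit-translation refl (s , h) p pp p∉A with vanishing-sum pp (∤±prodPow pp p∉A s h) 1
  ... | n , d = reached n (subst (+ p ∣ℤ_) (l a (geo a (suc n))) d)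
    where
    l : ∀ a g → + 1 + a * g ≡ + 1 + (a + + 1 - + 1) * g
    l = solve-∀

  -- Here t = -4, and 1 - 4 g = -(1 - 2 + 4 g): the orbit is minus a geometric sum with two more
  -- terms.
  negative-doubling : a ≡ - (+ 2) → b ≡ - (+ 1) → 2 ∈A q → WLN (lin a b) (+ 1) q
  negative-doubling refl refl 2∈A p pp p∉A with vanishing-sum pp p∤a 2
    where
    p∤a : ¬ + p ∣ℤ - (+ 2)
    p∤a d = p∉A (subst (_∈A q) (sym (prime∣prime pp prime[2] (∣-ℕ d))) 2∈A)
  ... | n , d = reached n (∣-by (- (+ 1)) d (l (geo (- (+ 2)) (suc n))))
    where
    l : ∀ g → + 1 + (- (+ 2) + - (+ 1) - + 1) * g ≡ - (+ 1) * (+ 1 + - (+ 2) * (+ 1 + - (+ 2) * g))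
    l = solve-∀

  -- The orbit is 1, 2, 0.
  two-steps : a ≡ - (+ 2) → b ≡ + 4 → WLN (lin a b) (+ 1) q
  two-steps refl refl p pp _ = 2 , s≤s z≤n , p ℕD.∣0

theorem3 : (k : ℕ) (q : Fin k → ℕ) → (∀ i → Prime (q i)) → (∀ i j → q i ≡ q j → i ≡ j) →
    (a b : ℤ) → ¬ (a ≡ + 0) →
    (WLN (lin a b) (+ 1) q ⇔
    ( (a ≡ + 1 × ∃[ s ] (b ≡ + prodPow q s ⊎ b ≡ - (+ prodPow q s)))
    ⊎ (b ≡ - a)
    ⊎ (b ≡ + 1 × ∃[ s ] (1 ℕ.≤ sumFin s × (a ≡ + prodPow q s ⊎ a ≡ - (+ prodPow q s))))
    ⊎ (a ≡ - (+ 2) × b ≡ - (+ 1) × 2 ∈A q)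
    ⊎ (a ≡ - (+ 2) × b ≡ + 4) ))
theorem3 k q pq _ a b a≢0 = mk⇔ (Necessity.forms q pq a b a≢0) λ
  { (inj₁ (a≡1 , h)) → translation a≡1 h
  ; (inj₂ (inj₁ b≡-a)) → fixes-root b≡-a
  ; (inj₂ (inj₂ (inj₁ (b≡1 , s , _ , h)))) → unit-translation b≡1 (s , h)
  ; (inj₂ (inj₂ (inj₂ (inj₁ (a≡-2 , b≡-1 , 2∈A))))) → negative-doubling a≡-2 b≡-1 2∈A
  ; (inj₂ (inj₂ (inj₂ (inj₂ (a≡-2 , b≡4))))) → two-steps a≡-2 b≡4 }
  where open Sufficiency q pq a b
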